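{- Let $G$ be a 3-edge-connected near-bipartite cubic graph which is not isomorphic to $K_4$. Then $G$ has a matching $M$ with $|M|\geq |V(G)|/2-3$ such that every edge of $M$ is removable in $G$.
   Context: All graphs are finite, simple and undirected. A connected graph is matching covered if every edge lies in some perfect matching. An edge $e$ of a matching covered graph $G$ is removable if $G-e$ is matching covered. A non-bipartite matching covered graph $G$ is near-bipartite if it has two edges $e,f$ such that $G-\{e,f\}$ is bipartite and matching covered. -}

module Defs where

open import Data.Bool using (Bool; true; false; _∧_; not; if_then_else_)
open import Data.Nat using (ℕ; zero; suc; _+_; _*_; _≤_)
open import Data.Fin using (Fin; toℕ; _≟_)
open import Data.Fin.Properties using ()
open import Data.Product using (Σ; ∃; ∃-syntax; _×_; _,_)
open import Data.Sum using (_⊎_)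
open import Data.List using (List; map)
open import Data.Nat.ListAction using (sum)
open import Data.List.Base using (allFin)
open import Relation.Nullary using (¬_; ⌊_⌋)
open import Relation.Binary.PropositionalEquality using (_≡_; _≢_)
open import Function.Bundles using (_↔_; Inverse)

Adj : ℕ → Set
Adj n = Fin n → Fin n → Bool

record SimpleGraph (n : ℕ) : Set where
  field
    adj   : Adj n
    sym   : ∀ u v → adj u v ≡ adj v u
    irrfl : ∀ v → adj v v ≡ false
open SimpleGraph public

count : ∀ {n} → (Fin n → Bool) → ℕ
count {n} p = sum (map (λ x → if p x then 1 else 0) (allFin n))

deg : ∀ {n} → Adj n → Fin n → ℕ
deg A v = count (A v)

-- number of (undirected) edges of a symmetric, loopless adjacency relation:
-- each edge {x,y} is counted once, via its ordered pair with toℕ x < toℕ y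
_<ᵇF_ : ∀ {n} → Fin n → Fin n → Bool
x <ᵇF y = Data.Nat._<ᵇ_ (toℕ x) (toℕ y)

edgeCount : ∀ {n} → Adj n → ℕ
edgeCount {n} A = sum (map (λ x → count (λ y → A x y ∧ (x <ᵇF y))) (allFin n))

data Reach {n} (A : Adj n) : Fin n → Fin n → Set where
  here : ∀ {u} → Reach A u u
  step : ∀ {u v w} → A u v ≡ true → Reach A v w → Reach A u w

Connected : ∀ {n} → Adj n → Set
Connected A = ∀ u v → Reach A u v

samePair : ∀ {n} → Fin n → Fin n → Fin n → Fin n → Bool
samePair x y u v =
  (⌊ x ≟ u ⌋ ∧ ⌊ y ≟ v ⌋) Data.Bool.∨ (⌊ x ≟ v ⌋ ∧ ⌊ y ≟ u ⌋)

deleteEdge : ∀ {n} → Adj n → Fin n → Fin n → Adj n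
deleteEdge A u v x y = A x y ∧ not (samePair x y u v)

SubRel : ∀ {n} → Adj n → Adj n → Set
SubRel A M = (∀ x y → M x y ≡ M y x) × (∀ x y → M x y ≡ true → A x y ≡ true)

IsMatching : ∀ {n} → Adj n → Adj n → Set
IsMatching A M = SubRel A M × (∀ v → deg M v ≤ 1)

IsPerfectMatching : ∀ {n} → Adj n → Adj n → Set
IsPerfectMatching A M = SubRel A M × (∀ v → deg M v ≡ 1)

MatchingCovered : ∀ {n} → Adj n → Set
MatchingCovered A =
  Connected A ×
  (∀ u v → A u v ≡ true → Σ (Adj _) λ M → (IsPerfectMatching A M × M u v ≡ true))

Bipartite : ∀ {n} → Adj n → Set
Bipartite {n} A = Σ (Fin n → Bool) λ c → (∀ x y → A x y ≡ true → c x ≢ c y)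

Removable : ∀ {n} → Adj n → Fin n → Fin n → Set
Removable A u v = MatchingCovered (deleteEdge A u v)

NearBipartite : ∀ {n} → Adj n → Set
NearBipartite A =
  MatchingCovered A × ¬ Bipartite A ×
  ∃[ u₁ ] ∃[ v₁ ] ∃[ u₂ ] ∃[ v₂ ]
    (A u₁ v₁ ≡ true × A u₂ v₂ ≡ true × samePair u₁ v₁ u₂ v₂ ≡ false ×
     Bipartite (deleteEdge (deleteEdge A u₁ v₁) u₂ v₂) ×
     MatchingCovered (deleteEdge (deleteEdge A u₁ v₁) u₂ v₂))

Cubic : ∀ {n} → Adj n → Set
Cubic A = ∀ v → deg A v ≡ 3

-- 3-edge-connected: G - F is connected for every set F of at most 2 edges
-- (F = {e,f}, with e = f allowed giving |F| = 1; connectivity of G itself,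
-- i.e. F = ∅, is required explicitly)
ThreeEdgeConnected : ∀ {n} → Adj n → Set
ThreeEdgeConnected A =
  Connected A ×
  (∀ u₁ v₁ u₂ v₂ → A u₁ v₁ ≡ true → A u₂ v₂ ≡ true →
     Connected (deleteEdge (deleteEdge A u₁ v₁) u₂ v₂))

K4 : Adj 4
K4 x y = not ⌊ x ≟ y ⌋

Isomorphic : ∀ {n m} → Adj n → Adj m → Set
Isomorphic {n} {m} A B =
  Σ (Fin n ↔ Fin m) λ φ → (∀ x y → A x y ≡ B (Inverse.to φ x) (Inverse.to φ y))

{-# OPTIONS --safe #-}
module Submission where

-- Deleting a₁a₂ and b₁b₂ leaves a bipartite graph with colour classes A ∋ a₁, a₂ and B ∋ b₁, b₂ of equal size.
-- For a set X of vertices let out X be the number of edges from A ∩ X to B ∖ X. Since the graph is cubic and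
-- 3-edge-connected, out X is bounded below in terms of |A ∩ X| − |B ∩ X|; all cut arguments are uncrossings of this
-- bound. The 3-edge-cuts separating a₁a₂ from b₁b₂ (the special sets) form a chain. Let N be a matching that crosses no
-- special set. If an edge st of N is not removable, then Hall's theorem, applied once to the perfect matchings avoiding
-- a₁a₂ and b₁b₂ and once to those containing both, yields a set Z with |A ∩ Z| = |B ∩ Z| which only st leaves from A
-- to B and which N enters at most once.
-- Let L be the least and H the greatest special set. The matching N covers H ∖ L; it covers L except for b₁, b₂ and the
-- end s of the single edge that leaves L from A to B, and is chosen there to cross no 4-edge-cut of L separating b₁ from b₂;
-- symmetrically outside H. Counting the edges of N between Z and the rest of L, of H ∖ L, or of the complement of H
-- excludes every such Z, and only six vertices remain uncovered.

open import Defs hiding (sym)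
import Data.Bool as Bool
open import Data.Bool using (Bool; true; false; T; _∧_; _∨_; not; if_then_else_)
open import Data.Bool.Properties using (T-∧; ∧-comm; ∧-assoc; ∨-comm; ∨-identityʳ; ∧-identityʳ; ∧-zeroʳ; not-involutive)
open import Data.Empty using (⊥; ⊥-elim)
open import Data.Fin using (Fin; zero; suc; toℕ; #_; _≟_)
open import Data.Fin.Properties using (any?; all?; toℕ-injective)
open import Data.Fin.Subset.Properties using (anySubset?)
open import Data.List using (List; []; _∷_; map; tabulate; allFin)
open import Data.List.Properties using (map-tabulate)
import Data.Nat as Nat
open import Data.Nat using (ℕ; zero; suc; _+_; _*_; _≤_; _<_; _≤ᵇ_; _<ᵇ_; z≤n; s≤s)
open import Data.Nat.ListAction using (sum)
open import Data.Nat.Properties hiding (_≟_)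
open import Data.Nat.Tactic.RingSolver using (solve-∀)
open import Data.Product using (Σ; ∃; _×_; _,_; proj₁; proj₂)
open import Data.Sum using (_⊎_; inj₁; inj₂; [_,_]′)
import Data.Vec as Vec
open import Data.Vec using (Vec; []; _∷_; lookup)
open import Data.Vec.Properties using (lookup∘tabulate)
open import Function using (_∘_; id)
open import Function.Bundles using (Equivalence)
open import Relation.Binary.PropositionalEquality hiding (J)
open import Relation.Nullary using (Dec; yes; no; ¬_; ⌊_⌋; contradiction)
open import Relation.Nullary.Decidable using (True; map′; ¬?; _×-dec_; _→-dec_)

-- The cut of X has 2 `out X` + 2 `α X` - 2 `β X` + 3 (|B ∩ X| - |A ∩ X|) edges, where `α` says that
-- X meets {a₁, a₂} and `β` that it contains {b₁, b₂}. Hence a special set is left by one edge of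
-- `E` and entered by two, and every set Z is a 4-edge-cut. A perfect matching through a₁a₂ and b₁b₂
-- must use the one edge that leaves a special set, so that edge is never removable; this is why N
-- must not cross special sets. Counting edges of N does not exclude a set Z that runs through an
-- end of the chain and separates b₁ from b₂; such sets must be taken care of when N is chosen.
-- Leaving s, b₁, b₂ uncovered makes L, and each 4-edge-cut of L in question, contain equally many
-- remaining vertices of A and of B, so Hall's theorem can be applied between nested cuts. Each end
-- costs three vertices, and six uncovered vertices are the 3 edges lost in the bound.

-- Linear arithmetic over ℕ

infixl 7 _:+_
infixl 8 _:*_
infix 6 _⊠_⩽_∵_ _⊠_≐_∵_

data Expr (k : ℕ) : Set where
  con  : ℕ → Expr k
  var  : Fin k → Expr k
  _:+_ : Expr k → Expr k → Expr k
  _:*_ : ℕ → Expr k → Expr k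

infix 9 ‵_
‵_ : ∀ m {k} {m<k : True (m Nat.<? k)} → Expr k
‵_ m {m<k = m<k} = var (#_ m {m<n = m<k})

⟦_⟧ : ∀ {k} → Expr k → Vec ℕ k → ℕ
⟦ con c ⟧ ρ = c
⟦ var i ⟧ ρ = lookup ρ i
⟦ s :+ t ⟧ ρ = ⟦ s ⟧ ρ + ⟦ t ⟧ ρ
⟦ c :* t ⟧ ρ = c * ⟦ t ⟧ ρ

dot : ∀ {k} → Vec ℕ k → Vec ℕ k → ℕ
dot [] [] = 0
dot (a ∷ u) (x ∷ ρ) = a * x + dot u ρ

zeroV : ∀ {k} → Vec ℕ k
zeroV {zero} = []
zeroV {suc k} = 0 ∷ zeroV

unitV : ∀ {k} → Fin k → Vec ℕ k
unitV zero = 1 ∷ zeroV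
unitV (suc i) = 0 ∷ unitV i

infixl 6 _⊕_
_⊕_ : ∀ {k} → Vec ℕ k → Vec ℕ k → Vec ℕ k
[] ⊕ [] = []
(a ∷ u) ⊕ (b ∷ v) = a + b ∷ u ⊕ v

scale : ∀ {k} → ℕ → Vec ℕ k → Vec ℕ k
scale c [] = []
scale c (a ∷ u) = c * a ∷ scale c u

dot-zero : ∀ {k} (ρ : Vec ℕ k) → dot zeroV ρ ≡ 0
dot-zero [] = refl
dot-zero (x ∷ ρ) = dot-zero ρ

dot-unit : ∀ {k} (i : Fin k) ρ → dot (unitV i) ρ ≡ lookup ρ i
dot-unit zero (x ∷ ρ) = trans (cong (x + 0 +_) (dot-zero ρ)) (trans (+-identityʳ _) (+-identityʳ x))
dot-unit (suc i) (x ∷ ρ) = dot-unit i ρ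

dot-⊕ : ∀ {k} (u v ρ : Vec ℕ k) → dot (u ⊕ v) ρ ≡ dot u ρ + dot v ρ
dot-⊕ [] [] [] = refl
dot-⊕ (a ∷ u) (b ∷ v) (x ∷ ρ) = trans (cong ((a + b) * x +_) (dot-⊕ u v ρ)) (lemma a b x _ _)
  where
  lemma : ∀ a b x p q → (a + b) * x + (p + q) ≡ a * x + p + (b * x + q)
  lemma = solve-∀

dot-scale : ∀ {k} c (u ρ : Vec ℕ k) → dot (scale c u) ρ ≡ c * dot u ρ
dot-scale c [] [] = sym (*-zeroʳ c)
dot-scale c (a ∷ u) (x ∷ ρ) = trans (cong (c * a * x +_) (dot-scale c u ρ)) (lemma c a x _)
  where
  lemma : ∀ c a x p → c * a * x + c * p ≡ c * (a * x + p)
  lemma = solve-∀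

norm : ∀ {k} → Expr k → Vec ℕ (suc k)
norm (con c) = c ∷ zeroV
norm (var i) = unitV (suc i)
norm (s :+ t) = norm s ⊕ norm t
norm (c :* t) = scale c (norm t)

norm-sound : ∀ {k} (t : Expr k) ρ → dot (norm t) (1 ∷ ρ) ≡ ⟦ t ⟧ ρ
norm-sound (con c) ρ = trans (cong (c * 1 +_) (dot-zero ρ)) (trans (+-identityʳ _) (*-identityʳ c))
norm-sound (var i) ρ = dot-unit i ρ
norm-sound (s :+ t) ρ = trans (dot-⊕ (norm s) (norm t) _) (cong₂ _+_ (norm-sound s ρ) (norm-sound t ρ))
norm-sound (c :* t) ρ = trans (dot-scale c (norm t) _) (cong (c *_) (norm-sound t ρ))

record Hyp {k} (ρ : Vec ℕ k) : Set where
  constructor _⊠_⩽_∵_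
  field
    weight  : ℕ
    lhs rhs : Expr k
    holds   : ⟦ lhs ⟧ ρ ≤ ⟦ rhs ⟧ ρ

record Eqn {k} (ρ : Vec ℕ k) : Set where
  constructor _⊠_≐_∵_
  field
    weight  : ℕ
    lhs rhs : Expr k
    holds   : ⟦ lhs ⟧ ρ ≡ ⟦ rhs ⟧ ρ

total : ∀ {k} {ρ : Vec ℕ k} → (Hyp ρ → Expr k) → List (Hyp ρ) → Vec ℕ (suc k)
total side [] = zeroV
total side (h ∷ hs) = scale (Hyp.weight h) (norm (side h)) ⊕ total side hs

total-≤ : ∀ {k} {ρ : Vec ℕ k} (hs : List (Hyp ρ)) →
          dot (total Hyp.lhs hs) (1 ∷ ρ) ≤ dot (total Hyp.rhs hs) (1 ∷ ρ)
total-≤ [] = ≤-refl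
total-≤ {ρ = ρ} (h@(w ⊠ l ⩽ r ∵ p) ∷ hs)
  rewrite dot-⊕ (scale w (norm l)) (total Hyp.lhs hs) (1 ∷ ρ)
        | dot-⊕ (scale w (norm r)) (total Hyp.rhs hs) (1 ∷ ρ)
        | dot-scale w (norm l) (1 ∷ ρ) | dot-scale w (norm r) (1 ∷ ρ)
        | norm-sound l ρ | norm-sound r ρ
  = +-mono-≤ (*-monoʳ-≤ w p) (total-≤ hs)

dominates : ∀ {k} → Vec ℕ k → Vec ℕ k → Bool
dominates [] [] = true
dominates (a ∷ u) (b ∷ v) = (b ≤ᵇ a) ∧ dominates u v

dominates-sound : ∀ {k} (u v ρ : Vec ℕ k) → T (dominates u v) → dot v ρ ≤ dot u ρ
dominates-sound [] [] [] _ = z≤n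
dominates-sound (a ∷ u) (b ∷ v) (x ∷ ρ) t with Equivalence.to (T-∧ {b ≤ᵇ a}) t
... | p , q = +-mono-≤ (*-monoˡ-≤ x (≤ᵇ⇒≤ b a p)) (dominates-sound u v ρ q)

-- The head of each vector is the constant term, evaluated at 1. Strictness there and domination in
-- the other coefficients suffice because the variables range over natural numbers.
refuted : ∀ {k} → Vec ℕ (suc k) → Vec ℕ (suc k) → Bool
refuted (a ∷ u) (b ∷ v) = (b <ᵇ a) ∧ dominates u v

refuted-sound : ∀ {k} (u v : Vec ℕ (suc k)) ρ → T (refuted u v) → dot v (1 ∷ ρ) < dot u (1 ∷ ρ)
refuted-sound (a ∷ u) (b ∷ v) ρ t with Equivalence.to (T-∧ {b <ᵇ a}) t
... | p , q = +-mono-<-≤ (*-monoˡ-< 1 (<ᵇ⇒< b a p)) (dominates-sound u v ρ q)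

abstract
  -- A Farkas certificate: the weighted sum of the hypotheses reads L ≤ R with L > R coefficientwise.
  farkas : ∀ {k} (ρ : Vec ℕ k) (hs : List (Hyp ρ)) →
           {T (refuted (total Hyp.lhs hs) (total Hyp.rhs hs))} → ⊥
  farkas ρ hs {t} = <⇒≱ (refuted-sound (total Hyp.lhs hs) (total Hyp.rhs hs) ρ t) (total-≤ hs)

forwards backwards : ∀ {k} {ρ : Vec ℕ k} → Eqn ρ → Hyp ρ
forwards (w ⊠ l ≐ r ∵ p) = w ⊠ l ⩽ r ∵ ≤-reflexive p
backwards (w ⊠ l ≐ r ∵ p) = w ⊠ r ⩽ l ∵ ≤-reflexive (sym p)

-- The equations with the given weights sum up to w · r ≡ w · l.
equate : ∀ {k} (ρ : Vec ℕ k) (w : ℕ) (l r : Expr k) (es : List (Eqn ρ)) →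
         {∀ neg → T (refuted (total Hyp.lhs ((w ⊠ con 1 :+ r ⩽ l ∵ neg) ∷ map forwards es))
                             (total Hyp.rhs ((w ⊠ con 1 :+ r ⩽ l ∵ neg) ∷ map forwards es)))} →
         {∀ neg → T (refuted (total Hyp.lhs ((w ⊠ con 1 :+ l ⩽ r ∵ neg) ∷ map backwards es))
                             (total Hyp.rhs ((w ⊠ con 1 :+ l ⩽ r ∵ neg) ∷ map backwards es)))} →
         ⟦ l ⟧ ρ ≡ ⟦ r ⟧ ρ
equate ρ w l r es {t} {u} = ≤-antisym
  (≮⇒≥ λ neg → farkas ρ ((w ⊠ con 1 :+ r ⩽ l ∵ neg) ∷ map forwards es) {t neg})
  (≮⇒≥ λ neg → farkas ρ ((w ⊠ con 1 :+ l ⩽ r ∵ neg) ∷ map backwards es) {u neg})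

-- Exhaustive checks over Booleans

allᵇ : ∀ k → (Vec Bool k → Bool) → Bool
allᵇ zero f = f []
allᵇ (suc k) f = allᵇ k (f ∘ (true ∷_)) ∧ allᵇ k (f ∘ (false ∷_))

allᵇ-sound : ∀ k f → T (allᵇ k f) → ∀ v → T (f v)
allᵇ-sound zero f t [] = t
allᵇ-sound (suc k) f t (b ∷ v) with Equivalence.to (T-∧ {allᵇ k (f ∘ (true ∷_))}) t
allᵇ-sound (suc k) f t (true ∷ v) | p , q = allᵇ-sound k _ p v
allᵇ-sound (suc k) f t (false ∷ v) | p , q = allᵇ-sound k _ q v

-- Sums over Fin n

-- Written like `count`, so that `deg` and `edgeCount` unfold to sums of this form by computation.
∑ : ∀ {n} → (Fin n → ℕ) → ℕ
∑ {n} f = sum (map f (allFin n))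

∑-tail : ∀ {n} (f : Fin (suc n) → ℕ) → sum (map f (tabulate suc)) ≡ ∑ (f ∘ suc)
∑-tail f = cong sum (trans (map-tabulate suc f) (sym (map-tabulate id (f ∘ suc))))

∑-suc : ∀ {n} (f : Fin (suc n) → ℕ) → ∑ f ≡ f zero + ∑ (f ∘ suc)
∑-suc f = cong (f zero +_) (∑-tail f)

∑-mono : ∀ {n} {f g : Fin n → ℕ} → (∀ x → f x ≤ g x) → ∑ f ≤ ∑ g
∑-mono {zero} h = z≤n
∑-mono {suc n} {f} {g} h rewrite ∑-suc f | ∑-suc g = +-mono-≤ (h zero) (∑-mono (h ∘ suc))

∑-cong : ∀ {n} {f g : Fin n → ℕ} → (∀ x → f x ≡ g x) → ∑ f ≡ ∑ g
∑-cong h = ≤-antisym (∑-mono (≤-reflexive ∘ h)) (∑-mono (≤-reflexive ∘ sym ∘ h))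

∑-+ : ∀ {n} (f g : Fin n → ℕ) → ∑ (λ x → f x + g x) ≡ ∑ f + ∑ g
∑-+ {zero} f g = refl
∑-+ {suc n} f g
  rewrite ∑-suc (λ x → f x + g x) | ∑-suc f | ∑-suc g | ∑-+ (f ∘ suc) (g ∘ suc)
  = lemma (f zero) (g zero) _ _
  where
  lemma : ∀ a b p q → a + b + (p + q) ≡ a + p + (b + q)
  lemma = solve-∀

∑-* : ∀ {n} c (f : Fin n → ℕ) → ∑ (λ x → c * f x) ≡ c * ∑ f
∑-* {zero} c f = sym (*-zeroʳ c)
∑-* {suc n} c f rewrite ∑-suc (λ x → c * f x) | ∑-suc f | ∑-* c (f ∘ suc) = sym (*-distribˡ-+ c (f zero) _)

∑-0 : ∀ {n} → ∑ {n} (λ _ → 0) ≡ 0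
∑-0 {zero} = refl
∑-0 {suc n} = trans (∑-suc {n} (λ _ → 0)) (∑-0 {n})

∑-swap : ∀ {m n} (f : Fin m → Fin n → ℕ) → ∑ (λ x → ∑ (f x)) ≡ ∑ (λ y → ∑ (λ x → f x y))
∑-swap {zero} {n} f = sym (∑-0 {n})
∑-swap {suc m} f
  rewrite ∑-suc (λ x → ∑ (f x)) | ∑-swap (f ∘ suc)
  = trans (sym (∑-+ (f zero) (λ y → ∑ (λ x → f (suc x) y)))) (∑-cong (λ y → sym (∑-suc (λ x → f x y))))

∑-term : ∀ {n} (f : Fin n → ℕ) x → f x ≤ ∑ f
∑-term f zero rewrite ∑-suc f = m≤m+n _ _
∑-term f (suc x) rewrite ∑-suc f = ≤-trans (∑-term (f ∘ suc) x) (m≤n+m _ _)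

∑-positive : ∀ {n} (f : Fin n → ℕ) → 1 ≤ ∑ f → Σ (Fin n) λ x → 1 ≤ f x
∑-positive {suc n} f h with f zero in eq
... | suc k = zero , subst (1 ≤_) (sym eq) (s≤s z≤n)
... | zero with ∑-positive (f ∘ suc) (subst (1 ≤_) (∑-tail f) h)
...   | x , p = suc x , p

⟪_⟫ : Bool → ℕ
⟪ b ⟫ = if b then 1 else 0

∑-δ : ∀ {n} a (f : Fin n → ℕ) → ∑ (λ x → ⟪ ⌊ x ≟ a ⌋ ⟫ * f x) ≡ f a
∑-δ {suc n} a f = trans (∑-suc (λ x → ⟪ ⌊ x ≟ a ⌋ ⟫ * f x)) (aux a)
  where
  aux : ∀ a → ⟪ ⌊ zero ≟ a ⌋ ⟫ * f zero + ∑ (λ x → ⟪ ⌊ suc x ≟ a ⌋ ⟫ * f (suc x)) ≡ f a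
  aux zero = trans (cong₂ _+_ (+-identityʳ (f zero)) (∑-0 {n})) (+-identityʳ _)
  aux (suc a) = trans (∑-cong (λ x → cong (λ b → ⟪ b ⟫ * f (suc x)) (≟-suc x a))) (∑-δ a (f ∘ suc))
    where
    ≟-suc : ∀ (x a : Fin n) → ⌊ suc x ≟ suc a ⌋ ≡ ⌊ x ≟ a ⌋
    ≟-suc x a with x ≟ a
    ... | yes _ = refl
    ... | no _ = refl

-- Vertex sets

VSet : ℕ → Set
VSet n = Fin n → Bool

infixr 7 _∩_ _∖_
infixr 6 _∪_
infix 4 _⊆_ _∈_ _∉_

_∩_ _∪_ _∖_ : ∀ {n} → VSet n → VSet n → VSet n
(X ∩ Y) x = X x ∧ Y x
(X ∪ Y) x = X x ∨ Y x
(X ∖ Y) x = X x ∧ not (Y x)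

∁ : ∀ {n} → VSet n → VSet n
∁ X x = not (X x)

∅ V : ∀ {n} → VSet n
∅ _ = false
V _ = true

⁅_⁆ : ∀ {n} → Fin n → VSet n
⁅ a ⁆ x = ⌊ x ≟ a ⌋

_∈_ _∉_ : ∀ {n} → Fin n → VSet n → Set
x ∈ X = X x ≡ true
x ∉ X = X x ≡ false

_⊆_ : ∀ {n} → VSet n → VSet n → Set
X ⊆ Y = ∀ x → x ∈ X → x ∈ Y

true≢false : ∀ {b} → b ≡ true → b ≡ false → ⊥
true≢false refl ()

∧-true : ∀ {a b} → a ∧ b ≡ true → a ≡ true × b ≡ true
∧-true {true} {true} _ = refl , refl

∧ˡ : ∀ {a b} → a ∧ b ≡ true → a ≡ true
∧ˡ = proj₁ ∘ ∧-true

∧ʳ : ∀ {a b} → a ∧ b ≡ true → b ≡ true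
∧ʳ {a} = proj₂ ∘ ∧-true {a}

∧-intro : ∀ {a b} → a ≡ true → b ≡ true → a ∧ b ≡ true
∧-intro refl refl = refl

∧-false : ∀ {a b} → a ∧ b ≡ false → a ≡ true → b ≡ false
∧-false p refl = p

∨-true : ∀ {a b} → a ∨ b ≡ true → a ≡ true ⊎ b ≡ true
∨-true {true} _ = inj₁ refl
∨-true {false} p = inj₂ p

∨-introˡ : ∀ {a b} → a ≡ true → a ∨ b ≡ true
∨-introˡ refl = refl

∨-introʳ : ∀ {a b} → b ≡ true → a ∨ b ≡ true
∨-introʳ {true} refl = refl
∨-introʳ {false} refl = refl

not-true : ∀ {a} → not a ≡ true → a ≡ false
not-true {false} _ = refl

not-intro : ∀ {a} → a ≡ false → not a ≡ true
not-intro refl = refl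

¬true : ∀ {b} → ¬ (b ≡ true) → b ≡ false
¬true {true} p = ⊥-elim (p refl)
¬true {false} _ = refl

bool : ∀ b → b ≡ true ⊎ b ≡ false
bool true = inj₁ refl
bool false = inj₂ refl

⌊≟⌋-true : ∀ {n} {x y : Fin n} → ⌊ x ≟ y ⌋ ≡ true → x ≡ y
⌊≟⌋-true {x = x} {y} p with x ≟ y
... | yes q = q

⌊≟⌋-refl : ∀ {n} (x : Fin n) → ⌊ x ≟ x ⌋ ≡ true
⌊≟⌋-refl x with x ≟ x
... | yes _ = refl
... | no ¬p = ⊥-elim (¬p refl)

⌊≟⌋-false : ∀ {n} {x y : Fin n} → x ≢ y → ⌊ x ≟ y ⌋ ≡ false
⌊≟⌋-false {x = x} {y} ¬p with x ≟ y
... | yes q = ⊥-elim (¬p q)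
... | no _ = refl

⟪⟫-mono : ∀ {a b} → (a ≡ true → b ≡ true) → ⟪ a ⟫ ≤ ⟪ b ⟫
⟪⟫-mono {true} h rewrite h refl = ≤-refl
⟪⟫-mono {false} h = z≤n

⟪⟫-positive : ∀ {a} → 1 ≤ ⟪ a ⟫ → a ≡ true
⟪⟫-positive {true} _ = refl

⟪⟫≤1 : ∀ a → ⟪ a ⟫ ≤ 1
⟪⟫≤1 true = ≤-refl
⟪⟫≤1 false = z≤n

-- Sets are functions without extensionality: P has to respect pointwise equality before a search
-- over Boolean vectors can decide it.
∃set? : ∀ {n} {P : VSet n → Set} → (∀ {X Y} → X ≗ Y → P X → P Y) → (∀ X → Dec (P X)) → Dec (∃ P)
∃set? resp P? = map′ (λ (v , p) → lookup v , p)
                     (λ (X , p) → Vec.tabulate X , resp (sym ∘ lookup∘tabulate X) p)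
                     (anySubset? (λ v → P? (lookup v)))

infix 4 _⊆?_
_⊆?_ : ∀ {n} (X Y : VSet n) → Dec (X ⊆ Y)
X ⊆? Y = all? (λ x → (X x Bool.≟ true) →-dec (Y x Bool.≟ true))

-- Counting in boolean combinations of sets

at : ∀ {n k} → Vec (VSet n) k → Fin n → Vec Bool k
at [] x = []
at (X ∷ Xs) x = X x ∷ at Xs x

cnt : ∀ {n} → (Fin n → Bool) → VSet n → ℕ
cnt p X = ∑ λ x → ⟪ p x ∧ X x ⟫

flow : ∀ {n} → Adj n → VSet n → VSet n → ℕ
flow R P Q = ∑ λ x → ∑ λ y → ⟪ R x y ∧ (P x ∧ Q y) ⟫

-- The recursion ends at the last term instead of 0, so that the inequalities read off below carry
-- no trailing summand 0.
sumOf : ∀ {m} → (Fin (suc m) → ℕ) → ℕ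
sumOf {zero} f = f zero
sumOf {suc m} f = f zero + sumOf (f ∘ suc)

sumOf-∑ : ∀ {n m} (f : Fin (suc m) → Fin n → ℕ) → sumOf (λ i → ∑ (f i)) ≡ ∑ (λ x → sumOf (λ i → f i x))
sumOf-∑ {m = zero} f = refl
sumOf-∑ {m = suc m} f = trans (cong (∑ (f zero) +_) (sumOf-∑ (f ∘ suc))) (sym (∑-+ (f zero) _))

sumOf-0 : ∀ m → sumOf {m} (λ _ → 0) ≡ 0
sumOf-0 zero = refl
sumOf-0 (suc m) = sumOf-0 m

module _ {k p q : ℕ} (l : Vec Bool k → Vec Bool (suc p)) (r : Vec Bool k → Vec Bool (suc q)) where

  cnt-check : Bool
  cnt-check = allᵇ k (λ v → sumOf (λ i → ⟪ lookup (l v) i ⟫) ≤ᵇ sumOf (λ i → ⟪ lookup (r v) i ⟫))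

  -- An inequality between numbers of elements of boolean combinations of Xs, verified on the atoms.
  cnt-≤ : ∀ {n} (c : Fin n → Bool) (Xs : Vec (VSet n) k) → {T cnt-check} →
          sumOf (λ i → cnt c (λ x → lookup (l (at Xs x)) i)) ≤ sumOf (λ i → cnt c (λ x → lookup (r (at Xs x)) i))
  cnt-≤ c Xs {t}
    rewrite sumOf-∑ (λ i x → ⟪ c x ∧ lookup (l (at Xs x)) i ⟫)
          | sumOf-∑ (λ i x → ⟪ c x ∧ lookup (r (at Xs x)) i ⟫)
    = ∑-mono pointwise
    where
    pointwise : ∀ x → sumOf (λ i → ⟪ c x ∧ lookup (l (at Xs x)) i ⟫) ≤ sumOf (λ i → ⟪ c x ∧ lookup (r (at Xs x)) i ⟫)
    pointwise x with c x
    ... | true = ≤ᵇ⇒≤ _ _ (allᵇ-sound k _ t (at Xs x))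
    ... | false = ≤-trans (≤-reflexive (sumOf-0 p)) z≤n

cnt-≡ : ∀ {k p q} (l : Vec Bool k → Vec Bool (suc p)) (r : Vec Bool k → Vec Bool (suc q)) {n} (c : Fin n → Bool)
        (Xs : Vec (VSet n) k) → {T (cnt-check l r)} → {T (cnt-check r l)} →
        sumOf (λ i → cnt c (λ x → lookup (l (at Xs x)) i)) ≡ sumOf (λ i → cnt c (λ x → lookup (r (at Xs x)) i))
cnt-≡ l r c Xs {t} {u} = ≤-antisym (cnt-≤ l r c Xs {t}) (cnt-≤ r l c Xs {u})

module _ {k p q : ℕ} (l : Vec Bool k → Vec (Bool × Bool) (suc p)) (r : Vec Bool k → Vec (Bool × Bool) (suc q)) where

  pair : ∀ {m} → Vec (Bool × Bool) m → Vec (Bool × Bool) m → Fin m → Bool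
  pair u v i = proj₁ (lookup u i) ∧ proj₂ (lookup v i)

  -- A pair of vertices enters a flow only through the atoms of the two ends. Comparing both sides
  -- on all pairs of atoms therefore proves submodularity and every other uncrossing inequality by
  -- computation.
  flow-check : Bool
  flow-check = allᵇ k (λ u → allᵇ k (λ v →
    sumOf (λ i → ⟪ pair (l u) (l v) i ⟫) ≤ᵇ sumOf (λ i → ⟪ pair (r u) (r v) i ⟫)))

  flow-≤ : ∀ {n} (R : Adj n) (Xs : Vec (VSet n) k) → {T flow-check} →
           sumOf (λ i → flow R (λ x → proj₁ (lookup (l (at Xs x)) i)) (λ x → proj₂ (lookup (l (at Xs x)) i)))
         ≤ sumOf (λ i → flow R (λ x → proj₁ (lookup (r (at Xs x)) i)) (λ x → proj₂ (lookup (r (at Xs x)) i)))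
  flow-≤ R Xs {t}
    rewrite sumOf-∑ (λ i x → ∑ λ y → ⟪ R x y ∧ pair (l (at Xs x)) (l (at Xs y)) i ⟫)
          | sumOf-∑ (λ i x → ∑ λ y → ⟪ R x y ∧ pair (r (at Xs x)) (r (at Xs y)) i ⟫)
    = ∑-mono λ x → subst₂ _≤_ (sym (sumOf-∑ (λ i y → ⟪ R x y ∧ pair (l (at Xs x)) (l (at Xs y)) i ⟫)))
                              (sym (sumOf-∑ (λ i y → ⟪ R x y ∧ pair (r (at Xs x)) (r (at Xs y)) i ⟫)))
                              (∑-mono (pointwise x))
    where
    pointwise : ∀ x y → sumOf (λ i → ⟪ R x y ∧ pair (l (at Xs x)) (l (at Xs y)) i ⟫)
                      ≤ sumOf (λ i → ⟪ R x y ∧ pair (r (at Xs x)) (r (at Xs y)) i ⟫)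
    pointwise x y with R x y
    ... | true = ≤ᵇ⇒≤ _ _ (allᵇ-sound k _ (allᵇ-sound k _ t (at Xs x)) (at Xs y))
    ... | false = ≤-trans (≤-reflexive (sumOf-0 p)) z≤n

cnt-cong : ∀ {n} (c : Fin n → Bool) {X Y : VSet n} → X ≗ Y → cnt c X ≡ cnt c Y
cnt-cong c h = ∑-cong (λ x → cong (λ b → ⟪ c x ∧ b ⟫) (h x))

flow-cong : ∀ {n} (R : Adj n) {P P′ Q Q′ : VSet n} → P ≗ P′ → Q ≗ Q′ → flow R P Q ≡ flow R P′ Q′
flow-cong R h k = ∑-cong (λ x → ∑-cong (λ y → cong₂ (λ a b → ⟪ R x y ∧ (a ∧ b) ⟫) (h x) (k y)))

cnt-⁅⁆ : ∀ {n} (X : VSet n) a → cnt X ⁅ a ⁆ ≡ ⟪ X a ⟫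
cnt-⁅⁆ X a = trans (∑-cong (λ x → lemma (X x) ⌊ x ≟ a ⌋)) (∑-δ a (λ x → ⟪ X x ⟫))
  where
  lemma : ∀ p q → ⟪ p ∧ q ⟫ ≡ ⟪ q ⟫ * ⟪ p ⟫
  lemma true true = refl
  lemma true false = refl
  lemma false true = refl
  lemma false false = refl

flow-term : ∀ {n} (R : Adj n) {P Q : VSet n} {x y} → R x y ≡ true → x ∈ P → y ∈ Q → 1 ≤ flow R P Q
flow-term R {P} {Q} {x} {y} r p q =
  ≤-trans (≤-trans (≤-reflexive (sym (cong ⟪_⟫ (∧-intro r (∧-intro p q)))))
                   (∑-term (λ y → ⟪ R x y ∧ (P x ∧ Q y) ⟫) y))
          (∑-term (λ x → ∑ λ y → ⟪ R x y ∧ (P x ∧ Q y) ⟫) x)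

flow-witness : ∀ {n} (R : Adj n) {P Q : VSet n} → 1 ≤ flow R P Q → ∃ λ x → ∃ λ y → R x y ≡ true × x ∈ P × y ∈ Q
flow-witness R {P} {Q} h with ∑-positive (λ x → ∑ λ y → ⟪ R x y ∧ (P x ∧ Q y) ⟫) h
... | x , h′ with ∑-positive (λ y → ⟪ R x y ∧ (P x ∧ Q y) ⟫) h′
...   | y , h″ with ∧-true (⟪⟫-positive h″)
...     | r , pq with ∧-true pq
...       | p , q = x , y , r , p , q

flow-0 : ∀ {n} (R : Adj n) {P Q : VSet n} → (∀ x y → R x y ≡ true → x ∈ P → y ∈ Q → ⊥) → flow R P Q ≡ 0
flow-0 R {P} {Q} h with flow R P Q in eq
... | zero = refl
... | suc k with flow-witness R {P} {Q} (subst (1 ≤_) (sym eq) (s≤s z≤n))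
...   | x , y , r , p , q = ⊥-elim (h x y r p q)

cnt-witness : ∀ {n} (c : Fin n → Bool) {X : VSet n} → 1 ≤ cnt c X → ∃ λ x → c x ≡ true × x ∈ X
cnt-witness c {X} h with ∑-positive (λ x → ⟪ c x ∧ X x ⟫) h
... | x , h′ = x , ∧-true (⟪⟫-positive h′)

∑-mono-< : ∀ {n} {f g : Fin n → ℕ} → (∀ x → f x ≤ g x) → ∀ x → f x < g x → ∑ f < ∑ g
∑-mono-< {f = f} {g} h zero p rewrite ∑-suc f | ∑-suc g = +-mono-<-≤ p (∑-mono (h ∘ suc))
∑-mono-< {f = f} {g} h (suc x) p rewrite ∑-suc f | ∑-suc g = +-mono-≤-< (h zero) (∑-mono-< (h ∘ suc) x p)

∑-≤-tight : ∀ {n} {f g : Fin n → ℕ} → (∀ x → f x ≤ g x) → ∑ f ≡ ∑ g → ∀ x → f x ≡ g x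
∑-≤-tight h eq x with m≤n⇒m<n∨m≡n (h x)
... | inj₁ p = ⊥-elim (<⇒≢ (∑-mono-< h x p) eq)
... | inj₂ q = q

∑-unique : ∀ {n} (f : Fin n → Bool) → (∀ x y → f x ≡ true → f y ≡ true → x ≡ y) → ∑ (λ x → ⟪ f x ⟫) ≤ 1
∑-unique {n} f u with any? (λ x → f x Bool.≟ true)
... | yes (a , p) = ≤-trans (∑-mono bound) (≤-reflexive (∑-δ a (λ _ → 1)))
  where
  bound : ∀ x → ⟪ f x ⟫ ≤ ⟪ ⌊ x ≟ a ⌋ ⟫ * 1
  bound x = subst (⟪ f x ⟫ ≤_) (sym (*-identityʳ _))
                  (⟪⟫-mono (λ q → subst (λ y → ⌊ x ≟ y ⌋ ≡ true) (u x a q p) (⌊≟⌋-refl x)))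
... | no ¬p = ≤-trans (∑-mono (λ x → ⟪⟫-mono {b = false} (λ q → ⊥-elim (¬p (x , q))))) (≤-trans (≤-reflexive (∑-0 {n})) z≤n)

flow-mono : ∀ {n} {R S : Adj n} {P P′ Q Q′ : VSet n} → (∀ x y → R x y ≡ true → S x y ≡ true) →
            P ⊆ P′ → Q ⊆ Q′ → flow R P Q ≤ flow S P′ Q′
flow-mono {R = R} {S} {P} {P′} {Q} {Q′} h p q = ∑-mono λ x → ∑-mono λ y → ⟪⟫-mono (λ r → imply x y (∧-true {R x y} r))
  where
  imply : ∀ x y → R x y ≡ true × P x ∧ Q y ≡ true → S x y ∧ (P′ x ∧ Q′ y) ≡ true
  imply x y (r , s) = ∧-intro (h x y r) (∧-intro (p x (∧ˡ {P x} s)) (q y (∧ʳ {P x} s)))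

flow-≤1 : ∀ {n} (R : Adj n) {P Q : VSet n} s t → (∀ x y → R x y ≡ true → x ∈ P → y ∈ Q → x ≡ s × y ≡ t) → flow R P Q ≤ 1
flow-≤1 R {P} {Q} s t h = ≤-trans (∑-mono λ x → ∑-mono λ y → bound x y)
  (≤-reflexive (trans (∑-cong (λ x → trans (∑-* ⟪ ⁅ s ⁆ x ⟫ (λ y → ⟪ ⁅ t ⁆ y ⟫ * 1)) (cong (⟪ ⁅ s ⁆ x ⟫ *_) (∑-δ t (λ _ → 1)))))
                      (∑-δ s (λ _ → 1))))
  where
  bound : ∀ x y → ⟪ R x y ∧ (P x ∧ Q y) ⟫ ≤ ⟪ ⁅ s ⁆ x ⟫ * (⟪ ⁅ t ⁆ y ⟫ * 1)
  bound x y with R x y in r | P x in p | Q y in q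
  ... | false | _ | _ = z≤n
  ... | true | false | _ = z≤n
  ... | true | true | false = z≤n
  ... | true | true | true with h x y r p q
  ...   | refl , refl rewrite ⌊≟⌋-refl x | ⌊≟⌋-refl y = ≤-refl

cnt-∁ : ∀ {n} (c : Fin n → Bool) (X : VSet n) → cnt c (∁ X) + cnt c X ≡ cnt c V
cnt-∁ c X = cnt-≡ {1} (λ { (x ∷ []) → not x ∷ x ∷ [] }) (λ { (x ∷ []) → true ∷ [] }) c (X ∷ [])

-- Hall's theorem

-- N is directed from A to B and perfect between them. Rows and columns are given as indicator sums,
-- so that the numbers of matched vertices and of crossing edges of N can be compared by summation.
record Matching {n} (R : Adj n) (A B : VSet n) (N : Adj n) : Set where
  field
    edge : ∀ x y → N x y ≡ true → R x y ≡ true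
    left : ∀ x y → N x y ≡ true → x ∈ A
    right : ∀ x y → N x y ≡ true → y ∈ B
    row  : ∀ x → ∑ (λ y → ⟪ N x y ⟫) ≡ ⟪ A x ⟫
    col  : ∀ y → ∑ (λ x → ⟪ N x y ⟫) ≡ ⟪ B y ⟫

Closed : ∀ {n} → Adj n → VSet n → Set
Closed R X = ∀ x y → R x y ≡ true → x ∈ X → y ∈ X

remove : ∀ {n} → Adj n → Fin n → Fin n → Adj n
remove R a b x y = R x y ∧ not (⁅ a ⁆ x ∧ ⁅ b ⁆ y)

remove-⊆ : ∀ {n} (R : Adj n) {a b x y} → remove R a b x y ≡ true → R x y ≡ true
remove-⊆ R p = (∧ˡ p)

remove-keep : ∀ {n} (R : Adj n) {a b x y} → R x y ≡ true → (x ≡ a → y ≡ b → ⊥) → remove R a b x y ≡ true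
remove-keep R {a} {b} {x} {y} r h = ∧-intro r (not-intro (¬true λ p →
  h (⌊≟⌋-true (∧ˡ {⁅ a ⁆ x} p)) (⌊≟⌋-true (∧ʳ {⁅ a ⁆ x} p))))

remove-gone : ∀ {n} (R : Adj n) a b → remove R a b a b ≡ false
remove-gone R a b = ¬true λ p → true≢false
  (∧-intro (⌊≟⌋-refl a) (⌊≟⌋-refl b)) (not-true (∧ʳ {R a b} p))

module _ {n} (A B : VSet n) (disjoint : ∀ x → x ∈ A → x ∈ B → ⊥) where

  private

    -- Hall's condition. A closed X contains all neighbours of A ∩ X, so a single vertex set carries
    -- both sides of the inequality, and violators can be intersected and united.
    Good : Adj n → Set
    Good R = ∀ X → Closed R X → cnt A X ≤ cnt B X

    Bad : Adj n → VSet n → Set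
    Bad R X = Closed R X × cnt B X < cnt A X

    bad? : ∀ R → Dec (∃ (Bad R))
    bad? R = ∃set? (λ {X} {Y} h (c , l) → (λ x y r p → trans (sym (h y)) (c x y r (trans (h x) p))) ,
                                          subst₂ _<_ (cnt-cong B h) (cnt-cong A h) l)
                   (λ X → all? (λ x → all? (λ y → (R x y Bool.≟ true) →-dec ((X x Bool.≟ true) →-dec (X y Bool.≟ true))))
                          ×-dec (cnt B X Nat.<? cnt A X))

    ¬bad⇒good : ∀ R → ¬ ∃ (Bad R) → Good R
    ¬bad⇒good R h X c = ≮⇒≥ λ l → h (X , c , l)

    size : Adj n → ℕ
    size R = ∑ λ x → ∑ λ y → ⟪ R x y ⟫

    size-remove : ∀ R {a b} → R a b ≡ true → size (remove R a b) < size R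
    size-remove R {a} {b} r =
      ∑-mono-< (λ x → ∑-mono (λ y → le x y)) a
        (∑-mono-< (le a) b (subst₂ _<_ (sym (cong ⟪_⟫ (remove-gone R a b))) (sym (cong ⟪_⟫ r)) (s≤s z≤n)))
      where
      le : ∀ x y → ⟪ remove R a b x y ⟫ ≤ ⟪ R x y ⟫
      le x y = ⟪⟫-mono (remove-⊆ R)

    singleton≤ : ∀ (C : VSet n) {a} → a ∈ C → cnt C ⁅ a ⁆ ≡ 1
    singleton≤ C {a} p = trans (cnt-⁅⁆ C a) (cong ⟪_⟫ p)

    singleton≡0 : ∀ (C : VSet n) {a} → (a ∈ C → ⊥) → cnt C ⁅ a ⁆ ≡ 0
    singleton≡0 C {a} p = trans (cnt-⁅⁆ C a) (cong ⟪_⟫ (¬true p))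

    split : ∀ (C X : VSet n) a → a ∈ X → cnt C X ≡ cnt C (X ∖ ⁅ a ⁆) + cnt C ⁅ a ⁆
    split C X a p = trans (cnt-cong C eq) (≤-antisym
      (cnt-≤ {2} (λ { (x ∷ s ∷ []) → (x ∨ s) ∷ [] }) (λ { (x ∷ s ∷ []) → x ∧ not s ∷ s ∷ [] }) C (X ∷ ⁅ a ⁆ ∷ []))
      (cnt-≤ {2} (λ { (x ∷ s ∷ []) → x ∧ not s ∷ s ∷ [] }) (λ { (x ∷ s ∷ []) → (x ∨ s) ∷ [] }) C (X ∷ ⁅ a ⁆ ∷ [])))
      where
      eq : X ≗ (X ∪ ⁅ a ⁆)
      eq x with X x in q | ⁅ a ⁆ x in e
      ... | true | _ = refl
      ... | false | false = refl
      ... | false | true = ⊥-elim (true≢false (subst (_∈ X) (sym (⌊≟⌋-true e)) p) q)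

    modular : ∀ (C X Y : VSet n) → cnt C (X ∩ Y) + cnt C (X ∪ Y) ≡ cnt C X + cnt C Y
    modular C X Y = ≤-antisym
      (cnt-≤ {2} (λ { (x ∷ y ∷ []) → x ∧ y ∷ (x ∨ y) ∷ [] }) (λ { (x ∷ y ∷ []) → x ∷ y ∷ [] }) C (X ∷ Y ∷ []))
      (cnt-≤ {2} (λ { (x ∷ y ∷ []) → x ∷ y ∷ [] }) (λ { (x ∷ y ∷ []) → x ∧ y ∷ (x ∨ y) ∷ [] }) C (X ∷ Y ∷ []))

    module _ (|A|≡|B| : cnt A V ≡ cnt B V) where

      Sub : Adj n → Set
      Sub R = ∀ x y → R x y ≡ true → x ∈ A × y ∈ B

      -- A vertex of A without a neighbour would violate the condition as a singleton, and a vertex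
      -- y of B without one through the closed set of all vertices but y. Since A and B have equal
      -- size, the column bounds must all be tight.
      done : ∀ R → Sub R → Good R →
             (∀ x y₁ y₂ → R x y₁ ≡ true → R x y₂ ≡ true → y₁ ≡ y₂) → Matching R A B R
      done R sub good unique = record
        { edge = λ _ _ p → p ; left = λ x y p → proj₁ (sub x y p) ; right = λ x y p → proj₂ (sub x y p)
        ; row = row ; col = λ y → sym (∑-≤-tight col≥ sums y) }
        where
        row : ∀ x → ∑ (λ y → ⟪ R x y ⟫) ≡ ⟪ A x ⟫
        row x with bool (A x)
        ... | inj₂ q rewrite q = trans (∑-cong (λ y → cong ⟪_⟫ (¬true (λ p → true≢false (proj₁ (sub x y p)) q)))) (∑-0 {n})
        ... | inj₁ q rewrite q = ≤-antisym (∑-unique (R x) (unique x)) (≮⇒≥ λ l → contradiction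
                (good ⁅ x ⁆ λ u y r s → ⊥-elim (<⇒≱ l (≤-trans
                  (≤-reflexive (sym (cong ⟪_⟫ (subst (λ z → R z y ≡ true) (⌊≟⌋-true s) r)))) (∑-term (λ y → ⟪ R x y ⟫) y))))
                (<⇒≱ (subst₂ _<_ (sym (singleton≡0 B (disjoint x q))) (sym (singleton≤ A q)) (s≤s z≤n))))

        col≥ : ∀ y → ⟪ B y ⟫ ≤ ∑ (λ x → ⟪ R x y ⟫)
        col≥ y with bool (B y)
        ... | inj₂ q rewrite q = z≤n
        ... | inj₁ q rewrite q = ≮⇒≥ λ l →
          let
            outside : VSet n
            outside = V ∖ ⁅ y ⁆
            closed : Closed R outside
            closed x z r _ = not-intro (¬true λ p → <⇒≱ l (≤-trans
              (≤-reflexive (sym (cong ⟪_⟫ (subst (λ z → R x z ≡ true) (⌊≟⌋-true p) r)))) (∑-term (λ x → ⟪ R x y ⟫) x)))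
          in (farkas (cnt A V ∷ cnt B V ∷ cnt A outside ∷ cnt B outside ∷ cnt A ⁅ y ⁆ ∷ cnt B ⁅ y ⁆ ∷ [])
            ( 1 ⊠ ‵ 1 ⩽ ‵ 0 ∵ ≤-reflexive (sym |A|≡|B|)
            ∷ 1 ⊠ ‵ 0 ⩽ ‵ 2 :+ ‵ 4 ∵ ≤-reflexive (split A V y refl)
            ∷ 1 ⊠ ‵ 3 :+ ‵ 5 ⩽ ‵ 1 ∵ ≤-reflexive (sym (split B V y refl))
            ∷ 1 ⊠ con 1 ⩽ ‵ 5 ∵ ≤-reflexive (sym (singleton≤ B q))
            ∷ 1 ⊠ ‵ 4 ⩽ con 0 ∵ ≤-reflexive (singleton≡0 A (λ p → disjoint y p q))
            ∷ 1 ⊠ ‵ 2 ⩽ ‵ 3 ∵ good outside closed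
            ∷ []))

        sums : ∑ (λ y → ⟪ B y ⟫) ≡ ∑ (λ y → ∑ (λ x → ⟪ R x y ⟫))
        sums = trans (sym (trans (sym (size-V A)) (trans |A|≡|B| (size-V B))))
                      (trans (sym (∑-cong row)) (∑-swap (λ x y → ⟪ R x y ⟫)))
          where
          size-V : ∀ C → cnt C V ≡ ∑ (λ x → ⟪ C x ⟫)
          size-V C = ∑-cong (λ x → cong ⟪_⟫ (Bool-∧ (C x)))
            where
            Bool-∧ : ∀ b → b ∧ true ≡ b
            Bool-∧ true = refl
            Bool-∧ false = refl

      -- Rado: if x has two neighbours, the edge to one of them can be dropped without violating Hall's condition.
      rado : ∀ k R → size R < k → Sub R → Good R → ∃ λ N → Matching R A B N
      rado (suc k) R (s≤s s) sub good
        with any? (λ x → any? λ y₁ → any? λ y₂ → (R x y₁ Bool.≟ true) ×-dec (R x y₂ Bool.≟ true) ×-dec ¬? (y₁ ≟ y₂))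
      ... | no none = R , done R sub good λ x y₁ y₂ p q → decide x y₁ y₂ p q (y₁ ≟ y₂)
        where
        decide : ∀ x y₁ y₂ → R x y₁ ≡ true → R x y₂ ≡ true → Dec (y₁ ≡ y₂) → y₁ ≡ y₂
        decide x y₁ y₂ p q (yes e) = e
        decide x y₁ y₂ p q (no ne) = ⊥-elim (none (x , y₁ , y₂ , p , q , ne))
      ... | yes (a , b₁ , b₂ , r₁ , r₂ , b₁≢b₂) with bad? (remove R a b₁) | bad? (remove R a b₂)
      ...   | no ok | _ = continue (rado k (remove R a b₁) (≤-trans (size-remove R r₁) s)
                                  (λ x y p → sub x y (remove-⊆ R p)) (¬bad⇒good _ ok))
        where
        continue : (∃ λ N → Matching (remove R a b₁) A B N) → ∃ λ N → Matching R A B N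
        continue (N , m) = N , record { Matching m ; edge = λ x y p → remove-⊆ R (Matching.edge m x y p) }
      ...   | yes _ | no ok = continue (rado k (remove R a b₂) (≤-trans (size-remove R r₂) s)
                                  (λ x y p → sub x y (remove-⊆ R p)) (¬bad⇒good _ ok))
        where
        continue : (∃ λ N → Matching (remove R a b₂) A B N) → ∃ λ N → Matching R A B N
        continue (N , m) = N , record { Matching m ; edge = λ x y p → remove-⊆ R (Matching.edge m x y p) }
      ...   | yes (X₁ , c₁ , l₁) | yes (X₂ , c₂ , l₂) = ⊥-elim
        (farkas (cnt A X₁ ∷ cnt B X₁ ∷ cnt A X₂ ∷ cnt B X₂ ∷ cnt A (X₁ ∪ X₂) ∷ cnt B (X₁ ∪ X₂) ∷ cnt A (X₁ ∩ X₂)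
            ∷ cnt B (X₁ ∩ X₂) ∷ cnt A core ∷ cnt B core ∷ cnt A ⁅ a ⁆ ∷ cnt B ⁅ a ⁆ ∷ [])
          ( 1 ⊠ con 1 :+ ‵ 1 ⩽ ‵ 0 ∵ l₁
          ∷ 1 ⊠ con 1 :+ ‵ 3 ⩽ ‵ 2 ∵ l₂
          ∷ 1 ⊠ ‵ 0 :+ ‵ 2 ⩽ ‵ 6 :+ ‵ 4 ∵ ≤-reflexive (sym (modular A X₁ X₂))
          ∷ 1 ⊠ ‵ 7 :+ ‵ 5 ⩽ ‵ 1 :+ ‵ 3 ∵ ≤-reflexive (modular B X₁ X₂)
          ∷ 1 ⊠ ‵ 6 ⩽ ‵ 8 :+ ‵ 10 ∵ ≤-reflexive (split A (X₁ ∩ X₂) a (∧-intro a∈X₁ a∈X₂))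
          ∷ 1 ⊠ ‵ 9 :+ ‵ 11 ⩽ ‵ 7 ∵ ≤-reflexive (sym (split B (X₁ ∩ X₂) a (∧-intro a∈X₁ a∈X₂)))
          ∷ 1 ⊠ ‵ 10 ⩽ con 1 ∵ ≤-reflexive (singleton≤ A a∈A)
          ∷ 1 ⊠ ‵ 8 ⩽ ‵ 9 ∵ good core core-closed
          ∷ 1 ⊠ ‵ 4 ⩽ ‵ 5 ∵ good (X₁ ∪ X₂) ∪-closed
          ∷ []))
        where
        a∈A : a ∈ A
        a∈A = proj₁ (sub a b₁ r₁)

        keep₁ : ∀ {x y} → R x y ≡ true → (x ≡ a → y ≡ b₁ → ⊥) → x ∈ X₁ → y ∈ X₁
        keep₁ r h p = c₁ _ _ (remove-keep R r h) p

        keep₂ : ∀ {x y} → R x y ≡ true → (x ≡ a → y ≡ b₂ → ⊥) → x ∈ X₂ → y ∈ X₂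
        keep₂ r h p = c₂ _ _ (remove-keep R r h) p

        a∈X₁ : a ∈ X₁
        a∈X₁ with bool (X₁ a)
        ... | inj₁ p = p
        ... | inj₂ q = ⊥-elim (<⇒≱ l₁ (good X₁ λ x y r p → keep₁ r (λ e _ → true≢false (subst (_∈ X₁) e p) q) p))

        a∈X₂ : a ∈ X₂
        a∈X₂ with bool (X₂ a)
        ... | inj₁ p = p
        ... | inj₂ q = ⊥-elim (<⇒≱ l₂ (good X₂ λ x y r p → keep₂ r (λ e _ → true≢false (subst (_∈ X₂) e p) q) p))

        b₂∈X₁ : b₂ ∈ X₁
        b₂∈X₁ = keep₁ r₂ (λ _ e → b₁≢b₂ (sym e)) a∈X₁

        b₁∈X₂ : b₁ ∈ X₂
        b₁∈X₂ = keep₂ r₁ (λ _ e → b₁≢b₂ e) a∈X₂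

        ∪-closed : Closed R (X₁ ∪ X₂)
        ∪-closed x y r p with x ≟ a | y ≟ b₁ | y ≟ b₂ | ∨-true {X₁ x} p
        ... | _ | yes refl | _ | _ = ∨-introʳ b₁∈X₂
        ... | _ | _ | yes refl | _ = ∨-introˡ b₂∈X₁
        ... | _ | no y≢b₁ | _ | inj₁ q = ∨-introˡ (keep₁ r (λ _ → y≢b₁) q)
        ... | _ | _ | no y≢b₂ | inj₂ q = ∨-introʳ (keep₂ r (λ _ → y≢b₂) q)

        -- The vertex a is dropped because its edges to b₁ and b₂ are the only ones that may leave
        -- the intersection. This costs one vertex of A, while the two violators together have a
        -- surplus of two.
        core : VSet n
        core = (X₁ ∩ X₂) ∖ ⁅ a ⁆

        core-closed : Closed R core
        core-closed x y r p with ∧-true {X₁ x ∧ X₂ x} p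
        ... | q , ¬a with ∧-true {X₁ x} q
        ...   | q₁ , q₂ = ∧-intro (∧-intro (keep₁ r x≢a q₁) (keep₂ r x≢a q₂))
                            (not-intro (¬true λ e → disjoint y (subst (_∈ A) (sym (⌊≟⌋-true e)) a∈A) (proj₂ (sub x y r))))
          where
          x≢a : ∀ {P : Set} → x ≡ a → P → ⊥
          x≢a refl _ = true≢false (⌊≟⌋-refl a) (not-true ¬a)

  hall : (R : Adj n) → cnt A V ≡ cnt B V → (∀ x y → R x y ≡ true → x ∈ A × y ∈ B) →
         (∃ λ N → Matching R A B N) ⊎ (∃ λ X → Closed R X × cnt B X < cnt A X)
  hall R eq sub with bad? R
  ... | yes b = inj₂ b
  ... | no ok = inj₁ (rado eq (suc (size R)) R ≤-refl sub (¬bad⇒good R ok))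

-- The setup: two colour classes and one special edge in each

record Shape (n : ℕ) : Set where
  field
    edge        : Adj n
    A B         : VSet n
    a₁ a₂ b₁ b₂ : Fin n

-- By eta for records `flip (flip σ)` is σ itself, so a result obtained for the exchanged classes
-- can be mirrored back without transport along the shape.
flip : ∀ {n} → Shape n → Shape n
flip σ = record { edge = edge ; A = B ; B = A ; a₁ = b₁ ; a₂ = b₂ ; b₁ = a₁ ; b₂ = a₂ }
  where open Shape σ

module Counts {n} (σ : Shape n) where
  open Shape σ

  E : Adj n
  E x y = edge x y ∧ (A x ∧ B y)

  nA nB out back α β εa εb : VSet n → ℕ
  nA = cnt A
  nB = cnt B
  out X = flow E X (∁ X)
  back X = flow E (∁ X) X
  α X = ⟪ X a₁ ∨ X a₂ ⟫
  β X = ⟪ X b₁ ∧ X b₂ ⟫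
  εa X = ⟪ X a₁ ⟫ + ⟪ X a₂ ⟫
  εb X = ⟪ X b₁ ⟫ + ⟪ X b₂ ⟫

-- A cubic 3-edge-connected graph which becomes bipartite, with classes A and B of equal size,
-- when the edge a₁a₂ inside A and the edge b₁b₂ inside B are deleted.
record Setup (n : ℕ) : Set where
  field
    shape     : Shape n
  open Shape shape public
  field
    edge-sym  : ∀ x y → edge x y ≡ edge y x
    cubic     : ∀ v → deg edge v ≡ 3
    B≡∁A      : ∀ x → B x ≡ not (A x)
    a₁∈A      : a₁ ∈ A
    a₂∈A      : a₂ ∈ A
    b₁∈B      : b₁ ∈ B
    b₂∈B      : b₂ ∈ B
    a₁≢a₂     : a₁ ≢ a₂
    b₁≢b₂     : b₁ ≢ b₂
    a₁a₂      : edge a₁ a₂ ≡ true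
    b₁b₂      : edge b₁ b₂ ≡ true
    A-edges   : ∀ x y → edge x y ≡ true → x ∈ A → y ∈ A → (x ≡ a₁ × y ≡ a₂) ⊎ (x ≡ a₂ × y ≡ a₁)
    B-edges   : ∀ x y → edge x y ≡ true → x ∈ B → y ∈ B → (x ≡ b₁ × y ≡ b₂) ⊎ (x ≡ b₂ × y ≡ b₁)
    balanced  : cnt A V ≡ cnt B V
    cut≥3     : ∀ X x y → x ∈ X → y ∉ X → 3 ≤ flow edge X (∁ X)

mirror : ∀ {n} → Setup n → Setup n
mirror S = record
  { shape = flip shape ; edge-sym = edge-sym ; cubic = cubic
  ; B≡∁A = λ x → trans (sym (not-involutive (A x))) (cong not (sym (B≡∁A x)))
  ; a₁∈A = b₁∈B ; a₂∈A = b₂∈B ; b₁∈B = a₁∈A ; b₂∈B = a₂∈A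
  ; a₁≢a₂ = b₁≢b₂ ; b₁≢b₂ = a₁≢a₂ ; a₁a₂ = b₁b₂ ; b₁b₂ = a₁a₂ ; A-edges = B-edges ; B-edges = A-edges
  ; balanced = sym balanced ; cut≥3 = cut≥3 }
  where
  open Setup S

-- Degree counts and the size of a cut

flow-single : ∀ {n} (R : Adj n) {u v} → u ≢ v →
              (∀ x y → R x y ≡ (⁅ u ⁆ x ∧ ⁅ v ⁆ y) ∨ (⁅ v ⁆ x ∧ ⁅ u ⁆ y)) →
              ∀ P Q → flow R P Q ≡ ⟪ P u ∧ Q v ⟫ + ⟪ P v ∧ Q u ⟫
flow-single R {u} {v} u≢v h P Q = begin
  flow R P Q
    ≡⟨ ∑-cong (λ x → ∑-cong (λ y → pointwise x y)) ⟩
  ∑ (λ x → ∑ (λ y → term u v x y + term v u x y))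
    ≡⟨ ∑-cong (λ x → ∑-+ (term u v x) (term v u x)) ⟩
  ∑ (λ x → ∑ (term u v x) + ∑ (term v u x))
    ≡⟨ ∑-+ (λ x → ∑ (term u v x)) (λ x → ∑ (term v u x)) ⟩
  ∑ (λ x → ∑ (term u v x)) + ∑ (λ x → ∑ (term v u x))
    ≡⟨ cong₂ _+_ (value u v) (value v u) ⟩
  ⟪ P u ∧ Q v ⟫ + ⟪ P v ∧ Q u ⟫ ∎
  where
  open ≡-Reasoning
  term : ∀ u v x y → ℕ
  term u v x y = ⟪ ⁅ u ⁆ x ⟫ * (⟪ ⁅ v ⁆ y ⟫ * ⟪ P x ∧ Q y ⟫)

  value : ∀ u v → ∑ (λ x → ∑ (term u v x)) ≡ ⟪ P u ∧ Q v ⟫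
  value u v = trans (∑-cong (λ x → trans (∑-* ⟪ ⁅ u ⁆ x ⟫ (λ y → ⟪ ⁅ v ⁆ y ⟫ * ⟪ P x ∧ Q y ⟫))
                                         (cong (⟪ ⁅ u ⁆ x ⟫ *_) (∑-δ v (λ y → ⟪ P x ∧ Q y ⟫)))))
                    (∑-δ u (λ x → ⟪ P x ∧ Q v ⟫))

  identity : ∀ p q r s t → (p ≡ true → r ≡ true → ⊥) →
             ⟪ ((p ∧ q) ∨ (r ∧ s)) ∧ t ⟫ ≡ ⟪ p ⟫ * (⟪ q ⟫ * ⟪ t ⟫) + ⟪ r ⟫ * (⟪ s ⟫ * ⟪ t ⟫)
  identity true q true s t h = ⊥-elim (h refl refl)
  identity false q false s t h = refl
  identity true true false s true h = refl
  identity true true false s false h = refl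
  identity true false false s t h = refl
  identity false q true true true h = refl
  identity false q true true false h = refl
  identity false q true false t h = refl

  pointwise : ∀ x y → ⟪ R x y ∧ (P x ∧ Q y) ⟫ ≡ term u v x y + term v u x y
  pointwise x y = trans (cong (λ b → ⟪ b ∧ (P x ∧ Q y) ⟫) (h x y))
    (identity (⁅ u ⁆ x) (⁅ v ⁆ y) (⁅ v ⁆ x) (⁅ u ⁆ y) _
      (λ p q → u≢v (trans (sym (⌊≟⌋-true p)) (⌊≟⌋-true q))))

flow-transpose : ∀ {n} {R S : Adj n} → (∀ x y → R x y ≡ S y x) → ∀ P Q → flow R P Q ≡ flow S Q P
flow-transpose {R = R} {S} h P Q =
  trans (∑-swap (λ x y → ⟪ R x y ∧ (P x ∧ Q y) ⟫)) (∑-cong λ y → ∑-cong λ x → pointwise x y)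
  where
  pointwise : ∀ x y → ⟪ R x y ∧ (P x ∧ Q y) ⟫ ≡ ⟪ S y x ∧ (Q y ∧ P x) ⟫
  pointwise x y rewrite h x y | ∧-comm (P x) (Q y) = refl

degree-sum : ∀ {n} (R : Adj n) {k} → (∀ v → deg R v ≡ k) → ∀ C X → flow R (C ∩ X) V ≡ k * cnt C X
degree-sum {n} R {k} regular C X = trans (∑-cong row) (∑-* k (λ x → ⟪ C x ∧ X x ⟫))
  where
  row : ∀ x → ∑ (λ y → ⟪ R x y ∧ ((C x ∧ X x) ∧ true) ⟫) ≡ k * ⟪ C x ∧ X x ⟫
  row x with C x ∧ X x
  ... | true = trans (∑-cong (λ y → cong ⟪_⟫ (∧-identityʳ (R x y)))) (trans (regular x) (sym (*-identityʳ k)))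
  ... | false = trans (∑-cong (λ y → cong ⟪_⟫ (∧-zeroʳ (R x y)))) (trans (∑-0 {n}) (sym (*-zeroʳ k)))

module Basics {n} (S : Setup n) where
  open Setup S public
  open Counts shape public

  A-B : ∀ {x} → x ∈ A → x ∈ B → ⊥
  A-B {x} p q = true≢false p (not-true (trans (sym (B≡∁A x)) q))

  private

    AA BB E⁻ : Adj n
    AA x y = edge x y ∧ (A x ∧ A y)
    BB x y = edge x y ∧ (B x ∧ B y)
    E⁻ x y = edge x y ∧ (B x ∧ A y)

    ≡-Bool : ∀ {p q : Bool} → (p ≡ true → q ≡ true) → (q ≡ true → p ≡ true) → p ≡ q
    ≡-Bool {true} f g = sym (f refl)
    ≡-Bool {false} {true} f g = g refl
    ≡-Bool {false} {false} f g = refl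

    single : ∀ (C : VSet n) u v → u ∈ C → v ∈ C → edge u v ≡ true →
             (∀ x y → edge x y ≡ true → x ∈ C → y ∈ C → (x ≡ u × y ≡ v) ⊎ (x ≡ v × y ≡ u)) →
             ∀ x y → edge x y ∧ (C x ∧ C y) ≡ (⁅ u ⁆ x ∧ ⁅ v ⁆ y) ∨ (⁅ v ⁆ x ∧ ⁅ u ⁆ y)
    single C u v p q uv h x y = ≡-Bool to from
      where
      to : edge x y ∧ (C x ∧ C y) ≡ true → (⁅ u ⁆ x ∧ ⁅ v ⁆ y) ∨ (⁅ v ⁆ x ∧ ⁅ u ⁆ y) ≡ true
      to r with ∧-true {edge x y} r
      ... | s , t with h x y s (∧ˡ {C x} t) (∧ʳ {C x} t)
      ...   | inj₁ (refl , refl) = ∨-introˡ (∧-intro (⌊≟⌋-refl x) (⌊≟⌋-refl y))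
      ...   | inj₂ (refl , refl) = ∨-introʳ (∧-intro (⌊≟⌋-refl x) (⌊≟⌋-refl y))
      from : (⁅ u ⁆ x ∧ ⁅ v ⁆ y) ∨ (⁅ v ⁆ x ∧ ⁅ u ⁆ y) ≡ true → edge x y ∧ (C x ∧ C y) ≡ true
      from r with ∨-true {⁅ u ⁆ x ∧ ⁅ v ⁆ y} r
      ... | inj₁ s rewrite ⌊≟⌋-true {x = x} (∧ˡ {⁅ u ⁆ x} s) | ⌊≟⌋-true {x = y} (∧ʳ {⁅ u ⁆ x} s)
        = ∧-intro uv (∧-intro p q)
      ... | inj₂ s rewrite ⌊≟⌋-true {x = x} (∧ˡ {⁅ v ⁆ x} s) | ⌊≟⌋-true {x = y} (∧ʳ {⁅ v ⁆ x} s)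
        = ∧-intro (trans (edge-sym v u) uv) (∧-intro q p)

    flow-AA : ∀ P Q → flow AA P Q ≡ ⟪ P a₁ ∧ Q a₂ ⟫ + ⟪ P a₂ ∧ Q a₁ ⟫
    flow-AA = flow-single AA a₁≢a₂ (single A a₁ a₂ a₁∈A a₂∈A a₁a₂ A-edges)

    flow-BB : ∀ P Q → flow BB P Q ≡ ⟪ P b₁ ∧ Q b₂ ⟫ + ⟪ P b₂ ∧ Q b₁ ⟫
    flow-BB = flow-single BB b₁≢b₂ (single B b₁ b₂ b₁∈B b₂∈B b₁b₂ B-edges)

    flow-E⁻ : ∀ P Q → flow E⁻ P Q ≡ flow E Q P
    flow-E⁻ = flow-transpose λ x y → cong₂ _∧_ (edge-sym x y) (∧-comm (B x) (A y))

    flow-+ : ∀ (R S : Adj n) P Q → ∑ (λ x → ∑ λ y → ⟪ R x y ∧ (P x ∧ Q y) ⟫ + ⟪ S x y ∧ (P x ∧ Q y) ⟫) ≡ flow R P Q + flow S P Q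
    flow-+ R S P Q = trans (∑-cong (λ x → ∑-+ (λ y → ⟪ R x y ∧ (P x ∧ Q y) ⟫) (λ y → ⟪ S x y ∧ (P x ∧ Q y) ⟫)))
                           (∑-+ (λ x → ∑ λ y → ⟪ R x y ∧ (P x ∧ Q y) ⟫) (λ x → ∑ λ y → ⟪ S x y ∧ (P x ∧ Q y) ⟫))

    A-half : ∀ X → 3 * nA X ≡ (⟪ X a₁ ∧ true ⟫ + ⟪ X a₂ ∧ true ⟫) + flow E X V
    A-half X = trans (sym (degree-sum edge cubic A X)) (trans (∑-cong (λ x → ∑-cong (λ y → pointwise x y)))
                 (trans (flow-+ AA E X V) (cong (_+ flow E X V) (flow-AA X V))))
      where
      identity : ∀ e p q x → ⟪ e ∧ ((p ∧ x) ∧ true) ⟫ ≡ ⟪ (e ∧ (p ∧ q)) ∧ (x ∧ true) ⟫ + ⟪ (e ∧ (p ∧ not q)) ∧ (x ∧ true) ⟫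
      identity false p q x = refl
      identity true false q x = refl
      identity true true true true = refl
      identity true true true false = refl
      identity true true false true = refl
      identity true true false false = refl
      pointwise : ∀ x y → ⟪ edge x y ∧ ((A x ∧ X x) ∧ true) ⟫ ≡ ⟪ AA x y ∧ (X x ∧ true) ⟫ + ⟪ E x y ∧ (X x ∧ true) ⟫
      pointwise x y rewrite B≡∁A y = identity (edge x y) (A x) (A y) (X x)

    B-half : ∀ X → 3 * nB X ≡ (⟪ X b₁ ∧ true ⟫ + ⟪ X b₂ ∧ true ⟫) + flow E V X
    B-half X = trans (sym (degree-sum edge cubic B X)) (trans (∑-cong (λ x → ∑-cong (λ y → pointwise x y)))
                 (trans (flow-+ BB E⁻ X V) (cong₂ _+_ (flow-BB X V) (flow-E⁻ X V))))
      where
      identity : ∀ e p q x → ⟪ e ∧ ((p ∧ x) ∧ true) ⟫ ≡ ⟪ (e ∧ (p ∧ not q)) ∧ (x ∧ true) ⟫ + ⟪ (e ∧ (p ∧ q)) ∧ (x ∧ true) ⟫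
      identity false p q x = refl
      identity true false q x = refl
      identity true true true true = refl
      identity true true true false = refl
      identity true true false true = refl
      identity true true false false = refl
      pointwise : ∀ x y → ⟪ edge x y ∧ ((B x ∧ X x) ∧ true) ⟫ ≡ ⟪ BB x y ∧ (X x ∧ true) ⟫ + ⟪ E⁻ x y ∧ (X x ∧ true) ⟫
      pointwise x y rewrite B≡∁A y = identity (edge x y) (B x) (A y) (X x)

    cut : ∀ X → flow edge X (∁ X) ≡ (flow AA X (∁ X) + out X) + (flow BB X (∁ X) + back X)
    cut X = trans (∑-cong (λ x → ∑-cong (λ y → pointwise x y))) (trans (∑-cong (λ x →
              ∑-+ (λ y → ⟪ AA x y ∧ (X x ∧ not (X y)) ⟫ + ⟪ E x y ∧ (X x ∧ not (X y)) ⟫)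
                  (λ y → ⟪ BB x y ∧ (X x ∧ not (X y)) ⟫ + ⟪ E⁻ x y ∧ (X x ∧ not (X y)) ⟫)))
            (trans (∑-+ (λ x → ∑ λ y → ⟪ AA x y ∧ (X x ∧ not (X y)) ⟫ + ⟪ E x y ∧ (X x ∧ not (X y)) ⟫)
                        (λ x → ∑ λ y → ⟪ BB x y ∧ (X x ∧ not (X y)) ⟫ + ⟪ E⁻ x y ∧ (X x ∧ not (X y)) ⟫))
            (cong₂ _+_ (flow-+ AA E X (∁ X)) (trans (flow-+ BB E⁻ X (∁ X)) (cong (flow BB X (∁ X) +_) (flow-E⁻ X (∁ X)))))))
      where
      identity : ∀ e p q t → ⟪ e ∧ t ⟫ ≡ (⟪ (e ∧ (p ∧ q)) ∧ t ⟫ + ⟪ (e ∧ (p ∧ not q)) ∧ t ⟫)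
                                       + (⟪ (e ∧ (not p ∧ not q)) ∧ t ⟫ + ⟪ (e ∧ (not p ∧ q)) ∧ t ⟫)
      identity false p q t = refl
      identity true true true true = refl
      identity true true true false = refl
      identity true true false true = refl
      identity true true false false = refl
      identity true false true true = refl
      identity true false true false = refl
      identity true false false true = refl
      identity true false false false = refl
      pointwise : ∀ x y → ⟪ edge x y ∧ (X x ∧ not (X y)) ⟫
                        ≡ (⟪ AA x y ∧ (X x ∧ not (X y)) ⟫ + ⟪ E x y ∧ (X x ∧ not (X y)) ⟫)
                        + (⟪ BB x y ∧ (X x ∧ not (X y)) ⟫ + ⟪ E⁻ x y ∧ (X x ∧ not (X y)) ⟫)
      pointwise x y rewrite B≡∁A x | B≡∁A y = identity (edge x y) (A x) (A y) _

    split-out : ∀ X → flow E X V ≡ flow E X X + out X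
    split-out X = ≤-antisym
      (flow-≤ {1} (λ { (x ∷ []) → (x , true) ∷ [] }) (λ { (x ∷ []) → (x , x) ∷ (x , not x) ∷ [] }) E (X ∷ []))
      (flow-≤ {1} (λ { (x ∷ []) → (x , x) ∷ (x , not x) ∷ [] }) (λ { (x ∷ []) → (x , true) ∷ [] }) E (X ∷ []))

    split-back : ∀ X → flow E V X ≡ flow E X X + back X
    split-back X = ≤-antisym
      (flow-≤ {1} (λ { (x ∷ []) → (true , x) ∷ [] }) (λ { (x ∷ []) → (x , x) ∷ (not x , x) ∷ [] }) E (X ∷ []))
      (flow-≤ {1} (λ { (x ∷ []) → (x , x) ∷ (not x , x) ∷ [] }) (λ { (x ∷ []) → (true , x) ∷ [] }) E (X ∷ []))

    ∧-true-≡ : ∀ p q → ⟪ p ∧ true ⟫ + ⟪ q ∧ true ⟫ ≡ ⟪ p ⟫ + ⟪ q ⟫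
    ∧-true-≡ p q = cong₂ (λ p q → ⟪ p ⟫ + ⟪ q ⟫) (∧-identityʳ p) (∧-identityʳ q)

    -- Eliminating `back X` from the size of the cut adds `εa X` and subtracts `εb X`. Together with
    -- the contributions of a₁a₂ and b₁b₂ to the cut this leaves 2 `α X` and -2 `β X`, which is why
    -- `α` is a disjunction and `β` a conjunction.
    either : ∀ p q → (⟪ p ∧ not q ⟫ + ⟪ q ∧ not p ⟫) + (⟪ p ⟫ + ⟪ q ⟫) ≡ 2 * ⟪ p ∨ q ⟫
    either true true = refl
    either true false = refl
    either false true = refl
    either false false = refl

    both : ∀ p q → (⟪ p ∧ not q ⟫ + ⟪ q ∧ not p ⟫) + 2 * ⟪ p ∧ q ⟫ ≡ ⟪ p ⟫ + ⟪ q ⟫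
    both true true = refl
    both true false = refl
    both false true = refl
    both false false = refl

  -- The degrees in A ∩ X add up to 3 `nA X` and those in B ∩ X to 3 `nB X`; the edges of `E` inside
  -- X cancel. The terms `εa` and `εb` stand for a₁a₂ and b₁b₂, which `E` does not contain.
  balance : ∀ X → out X + 3 * nB X + εa X ≡ back X + 3 * nA X + εb X
  balance X = equate (out X ∷ back X ∷ nA X ∷ nB X ∷ εa X ∷ εb X ∷ ⟪ X a₁ ∧ true ⟫ + ⟪ X a₂ ∧ true ⟫
      ∷ ⟪ X b₁ ∧ true ⟫ + ⟪ X b₂ ∧ true ⟫ ∷ flow E X V ∷ flow E V X ∷ flow E X X
      ∷ []) 1 (‵ 0 :+ 3 :* (‵ 3) :+ ‵ 4) (‵ 1 :+ 3 :* (‵ 2) :+ ‵ 5)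
    ( 1 ⊠ ‵ 6 :+ ‵ 8 ≐ 3 :* (‵ 2) ∵ sym (A-half X)
    ∷ 1 ⊠ 3 :* (‵ 3) ≐ ‵ 7 :+ ‵ 9 ∵ B-half X
    ∷ 1 ⊠ ‵ 10 :+ ‵ 0 ≐ ‵ 8 ∵ sym (split-out X)
    ∷ 1 ⊠ ‵ 9 ≐ ‵ 10 :+ ‵ 1 ∵ split-back X
    ∷ 1 ⊠ ‵ 4 ≐ ‵ 6 ∵ sym (∧-true-≡ (X a₁) (X a₂))
    ∷ 1 ⊠ ‵ 7 ≐ ‵ 5 ∵ ∧-true-≡ (X b₁) (X b₂)
    ∷ [])

  -- 3-edge-connectivity in directed form: twice the edges of E leaving X, plus corrections for a₁a₂ and b₁b₂,
  -- is the size of the cut of X plus 3 (nA X − nB X).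
  star : ∀ X {x y} → x ∈ X → y ∉ X → 3 + 3 * nA X + 2 * β X ≤ 2 * out X + 2 * α X + 3 * nB X
  star X {x} {y} p q =
    (≮⇒≥ λ neg → farkas (out X ∷ back X ∷ nA X ∷ nB X ∷ εa X ∷ εb X ∷ α X ∷ β X ∷ flow edge X (∁ X)
        ∷ flow AA X (∁ X) ∷ flow BB X (∁ X) ∷ ⟪ X a₁ ∧ not (X a₂) ⟫ + ⟪ X a₂ ∧ not (X a₁) ⟫
        ∷ ⟪ X b₁ ∧ not (X b₂) ⟫ + ⟪ X b₂ ∧ not (X b₁) ⟫ ∷ [])
      ( 1 ⊠ con 3 ⩽ ‵ 8 ∵ cut≥3 X x y p q
      ∷ 1 ⊠ ‵ 8 ⩽ ‵ 9 :+ ‵ 0 :+ (‵ 10 :+ ‵ 1) ∵ ≤-reflexive (cut X)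
      ∷ 1 ⊠ ‵ 9 ⩽ ‵ 11 ∵ ≤-reflexive (flow-AA X (∁ X))
      ∷ 1 ⊠ ‵ 10 ⩽ ‵ 12 ∵ ≤-reflexive (flow-BB X (∁ X))
      ∷ 1 ⊠ ‵ 11 :+ ‵ 4 ⩽ 2 :* (‵ 6) ∵ ≤-reflexive (either (X a₁) (X a₂))
      ∷ 1 ⊠ ‵ 12 :+ 2 :* (‵ 7) ⩽ ‵ 5 ∵ ≤-reflexive (both (X b₁) (X b₂))
      ∷ 1 ⊠ ‵ 1 :+ 3 :* (‵ 2) :+ ‵ 5 ⩽ ‵ 0 :+ 3 :* (‵ 3) :+ ‵ 4 ∵ ≤-reflexive (sym (balance X))
      ∷ 1 ⊠ con 1 :+ (2 :* (‵ 0) :+ 2 :* (‵ 6) :+ 3 :* (‵ 3)) ⩽ con 3 :+ 3 :* (‵ 2) :+ 2 :* (‵ 7) ∵ neg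
      ∷ []))

-- Perfect matchings assembled from matchings between the classes

infixl 8 _⊖_ _⊞_
_⊖_ _⊞_ : ∀ {n} → VSet n → Fin n → VSet n
X ⊖ a = X ∖ ⁅ a ⁆
X ⊞ a = X ∪ ⁅ a ⁆

∈-⊖ : ∀ {n} {X : VSet n} {a x} → x ∈ X → x ≢ a → x ∈ X ⊖ a
∈-⊖ p x≢a = ∧-intro p (not-intro (⌊≟⌋-false x≢a))

⊖-⊆ : ∀ {n} {X : VSet n} {a} x → x ∈ X ⊖ a → x ∈ X
⊖-⊆ x p = (∧ˡ p)

⊖-≢ : ∀ {n} {X : VSet n} {a x} → x ∈ X ⊖ a → x ≢ a
⊖-≢ {X = X} {a} {x} p refl = true≢false (⌊≟⌋-refl x) (not-true (∧ʳ {X x} p))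

∉-⊖ : ∀ {n} (X : VSet n) a → a ∉ X ⊖ a
∉-⊖ X a = ¬true λ p → ⊖-≢ {X = X} {a = a} p refl

⊞-last : ∀ {n} (X : VSet n) a → a ∈ X ⊞ a
⊞-last X a = ∨-introʳ (⌊≟⌋-refl a)

⊞-cases : ∀ {n} {X : VSet n} {a x} → x ∈ X ⊞ a → x ∈ X ⊎ x ≡ a
⊞-cases {X = X} {a} {x} p with ∨-true {X x} p
... | inj₁ q = inj₁ q
... | inj₂ q = inj₂ (⌊≟⌋-true q)

∉-⊞ : ∀ {n} {X : VSet n} {a x} → x ∉ X → x ≢ a → x ∉ X ⊞ a
∉-⊞ {X = X} p x≢a = ¬true λ q → [ (λ r → true≢false r p) , x≢a ]′ (⊞-cases {X = X} q)

cnt-⊞ : ∀ {n} (C X : VSet n) a → a ∉ X → cnt C (X ⊞ a) ≡ cnt C X + ⟪ C a ⟫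
cnt-⊞ {n} C X a a∉X = trans (≤-antisym
    (cnt-≤ {2} (λ { (x ∷ s ∷ []) → (x ∨ s) ∷ [] }) (λ { (x ∷ s ∷ []) → x ∷ s ∷ [] }) C (X ∷ ⁅ a ⁆ ∷ []))
    (≤-trans (cnt-≤ {2} (λ { (x ∷ s ∷ []) → x ∷ s ∷ [] }) (λ { (x ∷ s ∷ []) → (x ∨ s) ∷ (x ∧ s) ∷ [] }) C (X ∷ ⁅ a ⁆ ∷ []))
             (≤-reflexive (trans (cong (cnt C (X ⊞ a) +_) empty) (+-identityʳ _)))))
  (cong (cnt C X +_) (cnt-⁅⁆ C a))
  where
  empty : cnt C (X ∩ ⁅ a ⁆) ≡ 0
  empty = trans (∑-cong λ x → cong ⟪_⟫ (¬true λ p → no-common x (∧ʳ {C x} p))) (∑-0 {n})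
    where
    no-common : ∀ x → x ∈ X ∩ ⁅ a ⁆ → ⊥
    no-common x p = true≢false (subst (_∈ X) (⌊≟⌋-true (∧ʳ {X x} p)) (∧ˡ {X x} p)) a∉X

cnt-⊖ : ∀ {n} (C X : VSet n) a → a ∈ X → cnt C X ≡ cnt C (X ⊖ a) + ⟪ C a ⟫
cnt-⊖ C X a a∈X = trans (cnt-cong C (λ x → restore x)) (cnt-⊞ C (X ⊖ a) a (∉-⊖ X a))
  where
  restore : X ≗ (X ⊖ a) ⊞ a
  restore x with bool (X x) | x ≟ a
  ... | inj₁ p | yes _ rewrite p = refl
  ... | inj₁ p | no _ rewrite p = refl
  ... | inj₂ p | no _ rewrite p = refl
  ... | inj₂ p | yes refl = ⊥-elim (true≢false a∈X p)

Matching-⊆ : ∀ {n} {R S N : Adj n} {A B : VSet n} → (∀ x y → R x y ≡ true → S x y ≡ true) →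
             Matching R A B N → Matching S A B N
Matching-⊆ h m = record { Matching m ; edge = λ x y p → h x y (Matching.edge m x y p) }

symmetrise : ∀ {n} → Adj n → Adj n
symmetrise N x y = N x y ∨ N y x

⟪⟫-∨ : ∀ a b → (a ≡ true → b ≡ true → ⊥) → ⟪ a ∨ b ⟫ ≡ ⟪ a ⟫ + ⟪ b ⟫
⟪⟫-∨ true true h = ⊥-elim (h refl refl)
⟪⟫-∨ true false h = refl
⟪⟫-∨ false b h = refl

deg-∨ : ∀ {n} (M N : Adj n) v → (∀ u → M v u ≡ true → N v u ≡ true → ⊥) →
        deg (λ x y → M x y ∨ N x y) v ≡ deg M v + deg N v
deg-∨ M N v h = trans (∑-cong (λ u → ⟪⟫-∨ (M v u) (N v u) (h u))) (∑-+ (λ u → ⟪ M v u ⟫) (λ u → ⟪ N v u ⟫))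

deg-symmetrise : ∀ {n} {R : Adj n} {A B : VSet n} {N : Adj n} → (∀ x → x ∈ A → x ∈ B → ⊥) →
                 Matching R A B N → ∀ v → deg (symmetrise N) v ≡ ⟪ A v ⟫ + ⟪ B v ⟫
deg-symmetrise {N = N} disjoint m v =
  trans (deg-∨ N (λ x y → N y x) v (λ u p q → disjoint v (left v u p) (right u v q))) (cong₂ _+_ (row v) (col v))
  where open Matching m

deg-samePair : ∀ {n} {a b : Fin n} → a ≢ b → ∀ v → deg (λ x y → samePair x y a b) v ≡ ⟪ ⁅ a ⁆ v ⟫ + ⟪ ⁅ b ⁆ v ⟫
deg-samePair {n} {a = a} {b} a≢b v =
  trans (deg-∨ (λ x y → ⁅ a ⁆ x ∧ ⁅ b ⁆ y) (λ x y → ⁅ b ⁆ x ∧ ⁅ a ⁆ y) v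
          (λ u p q → a≢b (trans (sym (⌊≟⌋-true (∧ˡ {⁅ a ⁆ v} p))) (⌊≟⌋-true (∧ˡ {⁅ b ⁆ v} q)))))
        (cong₂ _+_ (half a b) (half b a))
  where
  half : ∀ a b → ∑ (λ u → ⟪ ⁅ a ⁆ v ∧ ⁅ b ⁆ u ⟫) ≡ ⟪ ⁅ a ⁆ v ⟫
  half a b with ⁅ a ⁆ v
  ... | true = trans (∑-cong (λ u → sym (*-identityʳ ⟪ ⁅ b ⁆ u ⟫))) (∑-δ b (λ _ → 1))
  ... | false = ∑-0 {n}

Matching-insert : ∀ {n} {R : Adj n} {A B : VSet n} {N : Adj n} {x y} → R x y ≡ true → x ∈ A → y ∈ B →
                  Matching R (A ⊖ x) (B ⊖ y) N →
                  Matching R A B (λ u v → N u v ∨ (⁅ x ⁆ u ∧ ⁅ y ⁆ v))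
Matching-insert {n} {R} {A} {B} {N} {x} {y} r x∈A y∈B m = record
  { edge = λ u v p → [ edge u v , (λ q → subst₂ (λ u v → R u v ≡ true) (sym (is-x q)) (sym (is-y q)) r) ]′ (∨-true p)
  ; left = λ u v p → [ (λ q → ⊖-⊆ {X = A} {a = x} u (left u v q)) , (λ q → subst (_∈ A) (sym (is-x q)) x∈A) ]′ (∨-true p)
  ; right = λ u v p → [ (λ q → ⊖-⊆ {X = B} {a = y} v (right u v q)) , (λ q → subst (_∈ B) (sym (is-y q)) y∈B) ]′ (∨-true p)
  ; row = λ u → trans (∑-cong (λ v → ⟪⟫-∨ (N u v) _ (fresh u v))) (trans (∑-+ (λ v → ⟪ N u v ⟫) (λ v → ⟪ ⁅ x ⁆ u ∧ ⁅ y ⁆ v ⟫))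
      (trans (cong₂ _+_ (row u) (half (⁅ x ⁆ u) y)) (add A x x∈A u)))
  ; col = λ v → trans (∑-cong (λ u → ⟪⟫-∨ (N u v) _ (fresh u v))) (trans (∑-+ (λ u → ⟪ N u v ⟫) (λ u → ⟪ ⁅ x ⁆ u ∧ ⁅ y ⁆ v ⟫))
      (trans (cong₂ _+_ (col v) (trans (∑-cong (λ u → cong ⟪_⟫ (∧-comm (⁅ x ⁆ u) (⁅ y ⁆ v)))) (half (⁅ y ⁆ v) x))) (add B y y∈B v)))
  }
  where
  open Matching m
  is-x : ∀ {u v} → ⁅ x ⁆ u ∧ ⁅ y ⁆ v ≡ true → u ≡ x
  is-x {u} q = ⌊≟⌋-true (∧ˡ {⁅ x ⁆ u} q)
  is-y : ∀ {u v} → ⁅ x ⁆ u ∧ ⁅ y ⁆ v ≡ true → v ≡ y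
  is-y {u} q = ⌊≟⌋-true (∧ʳ {⁅ x ⁆ u} q)
  fresh : ∀ u v → N u v ≡ true → ⁅ x ⁆ u ∧ ⁅ y ⁆ v ≡ true → ⊥
  fresh u v p q = ⊖-≢ {X = A} {a = x} (left u v p) (is-x q)
  half : ∀ b y → ∑ (λ v → ⟪ b ∧ ⁅ y ⁆ v ⟫) ≡ ⟪ b ⟫
  half true y = trans (∑-cong (λ u → sym (*-identityʳ ⟪ ⁅ y ⁆ u ⟫))) (∑-δ y (λ _ → 1))
  half false y = ∑-0 {n}
  add : ∀ C a → a ∈ C → ∀ u → ⟪ (C ⊖ a) u ⟫ + ⟪ ⁅ a ⁆ u ⟫ ≡ ⟪ C u ⟫
  add C a a∈C u with u ≟ a
  ... | yes refl rewrite a∈C = refl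
  ... | no _ = trans (+-identityʳ _) (cong ⟪_⟫ (∧-identityʳ (C u)))

module Perfect {n} (S : Setup n) where
  open Basics S

  terminals-free : VSet n
  terminals-free = V ⊖ a₁ ⊖ a₂ ⊖ b₁ ⊖ b₂

  A-≢-B : ∀ {x y} → x ∈ A → y ∈ B → x ≢ y
  A-≢-B p q refl = A-B p q

  E-edge : ∀ {x y} → E x y ≡ true → edge x y ≡ true
  E-edge p = (∧ˡ p)

  E-A : ∀ {x y} → E x y ≡ true → x ∈ A
  E-A {x} {y} p = (∧ˡ {A x} (∧ʳ {edge x y} p))

  E-B : ∀ {x y} → E x y ≡ true → y ∈ B
  E-B {x} {y} p = (∧ʳ {A x} (∧ʳ {edge x y} p))

  B-∉A : ∀ {x} → x ∈ B → x ∉ A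
  B-∉A {x} p = not-true (trans (sym (B≡∁A x)) p)

  A-∉B : ∀ {x} → x ∈ A → x ∉ B
  A-∉B p = ¬true λ q → A-B p q

  -- Hall's theorem for the subgraph induced on K. Edges to vertices outside K are disregarded, so
  -- the violator is closed only relative to K; those who use it add the excluded vertices of B by
  -- hand.
  hall-on : (R : Adj n) → (∀ x y → R x y ≡ true → E x y ≡ true) → ∀ K → nA K ≡ nB K →
            (∃ λ N → Matching R (A ∩ K) (B ∩ K) N) ⊎
            (∃ λ X → X ⊆ K × (∀ x y → R x y ≡ true → x ∈ X → y ∈ K → y ∈ X) × nB X < nA X)
  hall-on R R⊆E K eq with hall (A ∩ K) (B ∩ K)
      (λ x p q → A-B (∧ˡ {A x} p) (∧ˡ {B x} q))
      (λ x y → R x y ∧ ((A ∩ K) x ∧ (B ∩ K) y))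
      (trans (size A) (trans eq (sym (size B))))
      (λ x y p → ∧-true {(A ∩ K) x} (∧ʳ {R x y} p))
    where
    size : ∀ C → cnt (C ∩ K) V ≡ cnt C K
    size C = ∑-cong λ x → cong ⟪_⟫ (∧-identityʳ (C x ∧ K x))
  ... | inj₁ (N , m) = inj₁ (N , Matching-⊆ (λ x y p → (∧ˡ p)) m)
  ... | inj₂ (X , closed , l) = inj₂ (K ∩ X , (λ x p → (∧ˡ {K x} p)) , closed′ , subst₂ _<_ (assoc B) (assoc A) l)
    where
    assoc : ∀ C → cnt (C ∩ K) X ≡ cnt C (K ∩ X)
    assoc C = ∑-cong λ x → cong ⟪_⟫ (∧-assoc (C x) (K x) (X x))
    closed′ : ∀ x y → R x y ≡ true → x ∈ K ∩ X → y ∈ K → y ∈ K ∩ X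
    closed′ x y r p q with ∧-true {K x} p
    ... | x∈K , x∈X = ∧-intro q (closed x y
          (∧-intro r (∧-intro (∧-intro (E-A (R⊆E x y r)) x∈K) (∧-intro (E-B (R⊆E x y r)) q))) x∈X)

  module Deleted {s t} (st : E s t ≡ true) where

    R G-st : Adj n
    R = remove E s t
    G-st = deleteEdge edge s t

    R⊆E : ∀ x y → R x y ≡ true → E x y ≡ true
    R⊆E x y = remove-⊆ E

    s∈A : s ∈ A
    s∈A = E-A st

    t∈B : t ∈ B
    t∈B = E-B st

    keep : ∀ {u v} → edge u v ≡ true → samePair u v s t ≡ false → G-st u v ≡ true
    keep p q = ∧-intro p (not-intro q)

    samePair-flip : ∀ u v → samePair u v s t ≡ samePair v u s t
    samePair-flip u v = trans (∨-comm (⁅ s ⁆ u ∧ ⁅ t ⁆ v) (⁅ t ⁆ u ∧ ⁅ s ⁆ v))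
                              (cong₂ _∨_ (∧-comm (⁅ t ⁆ u) (⁅ s ⁆ v)) (∧-comm (⁅ s ⁆ u) (⁅ t ⁆ v)))

    R-kept : ∀ {x y} → R x y ≡ true → G-st x y ≡ true
    R-kept {x} {y} r = keep (E-edge (R⊆E x y r)) (¬true λ p → [ forward , backward ]′ (∨-true {⁅ s ⁆ x ∧ ⁅ t ⁆ y} p))
      where
      forward : ⁅ s ⁆ x ∧ ⁅ t ⁆ y ≡ true → ⊥
      forward q = true≢false q (not-true (∧ʳ {E x y} r))
      backward : ⁅ t ⁆ x ∧ ⁅ s ⁆ y ≡ true → ⊥
      backward q = A-B (subst (_∈ A) (⌊≟⌋-true (∧ˡ {⁅ t ⁆ x} q)) (E-A (R⊆E x y r))) t∈B

    symmetrise-⊆ : ∀ {A′ B′ N} → Matching R A′ B′ N → ∀ x y → symmetrise N x y ≡ true → G-st x y ≡ true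
    symmetrise-⊆ {N = N} m x y p with ∨-true {N x y} p
    ... | inj₁ q = R-kept (Matching.edge m x y q)
    ... | inj₂ q with ∧-true {edge y x} (R-kept (Matching.edge m y x q))
    ...   | u , v = keep (trans (edge-sym x y) u) (trans (samePair-flip x y) (not-true v))

    PMThrough : Fin n → Fin n → Set
    PMThrough u v = Σ (Adj n) λ M → IsPerfectMatching G-st M × M u v ≡ true

    PMThrough-flip : ∀ {u v} → PMThrough u v → PMThrough v u
    PMThrough-flip {u} {v} (M , ((symm , sub) , d) , p) = M , ((symm , sub) , d) , trans (symm v u) p

    ⟪A⟫+⟪B⟫ : ∀ v → ⟪ A v ⟫ + ⟪ B v ⟫ ≡ 1
    ⟪A⟫+⟪B⟫ v rewrite B≡∁A v with A v
    ... | true = refl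
    ... | false = refl

    -- As A and B have equal size, a perfect matching contains both of a₁a₂ and b₁b₂ or neither.
    -- This is the construction for neither; the following module, which matches all vertices but
    -- the four ends, handles both.
    perfect₀ : ∀ {N x y} → Matching R A B N → N x y ≡ true → PMThrough x y
    perfect₀ {N} {x} {y} m p = symmetrise N ,
      (((λ u v → ∨-comm (N u v) (N v u)) , symmetrise-⊆ m) ,
       (λ v → trans (deg-symmetrise (λ x p q → A-B p q) m v) (⟪A⟫+⟪B⟫ v))) , ∨-introˡ p

    module _ {N : Adj n} (m : Matching R (A ∩ terminals-free) (B ∩ terminals-free) N) where

      private
        e f ef M : Adj n
        e u v = samePair u v a₁ a₂
        f u v = samePair u v b₁ b₂
        ef u v = e u v ∨ f u v
        M u v = symmetrise N u v ∨ ef u v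

        pair-sym : ∀ {a b : Fin n} u v → samePair u v a b ≡ samePair v u a b
        pair-sym {a} {b} u v = trans (∨-comm (⁅ a ⁆ u ∧ ⁅ b ⁆ v) (⁅ b ⁆ u ∧ ⁅ a ⁆ v))
                                     (cong₂ _∨_ (∧-comm (⁅ b ⁆ u) (⁅ a ⁆ v)) (∧-comm (⁅ a ⁆ u) (⁅ b ⁆ v)))

        pair-cases : ∀ {a b : Fin n} u v → samePair u v a b ≡ true → (u ≡ a × v ≡ b) ⊎ (u ≡ b × v ≡ a)
        pair-cases {a} {b} u v p with ∨-true {⁅ a ⁆ u ∧ ⁅ b ⁆ v} p
        ... | inj₁ q = inj₁ (⌊≟⌋-true (∧ˡ {⁅ a ⁆ u} q) , ⌊≟⌋-true (∧ʳ {⁅ a ⁆ u} q))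
        ... | inj₂ q = inj₂ (⌊≟⌋-true (∧ˡ {⁅ b ⁆ u} q) , ⌊≟⌋-true (∧ʳ {⁅ b ⁆ u} q))

        pair-end : ∀ {a b : Fin n} {C : VSet n} u v → a ∈ C → b ∈ C → samePair u v a b ≡ true → u ∈ C × v ∈ C
        pair-end u v p q r with pair-cases u v r
        ... | inj₁ (refl , refl) = p , q
        ... | inj₂ (refl , refl) = q , p

        e-kept : ∀ u v → e u v ≡ true → G-st u v ≡ true
        e-kept u v p = keep is-edge (¬true λ q → t∉ (pair-cases u v q))
          where
          is-edge : edge u v ≡ true
          is-edge with pair-cases u v p
          ... | inj₁ (refl , refl) = a₁a₂
          ... | inj₂ (refl , refl) = trans (edge-sym u v) a₁a₂
          t∉ : (u ≡ s × v ≡ t) ⊎ (u ≡ t × v ≡ s) → ⊥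
          t∉ (inj₁ (_ , refl)) = A-B (proj₂ (pair-end {C = A} u v a₁∈A a₂∈A p)) t∈B
          t∉ (inj₂ (refl , _)) = A-B (proj₁ (pair-end {C = A} u v a₁∈A a₂∈A p)) t∈B

        f-kept : ∀ u v → f u v ≡ true → G-st u v ≡ true
        f-kept u v p = keep is-edge (¬true λ q → s∉ (pair-cases u v q))
          where
          is-edge : edge u v ≡ true
          is-edge with pair-cases u v p
          ... | inj₁ (refl , refl) = b₁b₂
          ... | inj₂ (refl , refl) = trans (edge-sym u v) b₁b₂
          s∉ : (u ≡ s × v ≡ t) ⊎ (u ≡ t × v ≡ s) → ⊥
          s∉ (inj₁ (refl , _)) = A-B s∈A (proj₁ (pair-end {C = B} u v b₁∈B b₂∈B p))
          s∉ (inj₂ (_ , refl)) = A-B s∈A (proj₂ (pair-end {C = B} u v b₁∈B b₂∈B p))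

        at-terminal : ∀ {u v} → ef u v ≡ true → u ∈ terminals-free → ⊥
        at-terminal {u} {v} p q with ∨-true {e u v} p
        ... | inj₁ r = [ (λ w → ⊖-≢ {X = V} {a = a₁} u-a₁ (proj₁ w)) , (λ w → ⊖-≢ {X = V ⊖ a₁} {a = a₂} u-a₂ (proj₁ w)) ]′ (pair-cases u v r)
          where
          u-a₂ = ⊖-⊆ {X = V ⊖ a₁ ⊖ a₂} {a = b₁} u (⊖-⊆ {X = V ⊖ a₁ ⊖ a₂ ⊖ b₁} {a = b₂} u q)
          u-a₁ = ⊖-⊆ {X = V ⊖ a₁} {a = a₂} u u-a₂
        ... | inj₂ r = [ (λ w → ⊖-≢ {X = V ⊖ a₁ ⊖ a₂} {a = b₁} (⊖-⊆ {X = V ⊖ a₁ ⊖ a₂ ⊖ b₁} {a = b₂} u q) (proj₁ w))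
                       , (λ w → ⊖-≢ {X = V ⊖ a₁ ⊖ a₂ ⊖ b₁} {a = b₂} q (proj₁ w)) ]′ (pair-cases u v r)

        in-free : ∀ {u v} → symmetrise N u v ≡ true → u ∈ terminals-free
        in-free {u} {v} p with ∨-true {N u v} p
        ... | inj₁ q = (∧ʳ {A u} (Matching.left m u v q))
        ... | inj₂ q = (∧ʳ {B u} (Matching.right m v u q))

        degree : ∀ v → deg M v ≡ 1
        degree v = trans (deg-∨ (symmetrise N) ef v (λ u p q → at-terminal {v} {u} q (in-free p)))
          (trans (cong₂ _+_ (deg-symmetrise (λ x p q → A-B (∧ˡ {A x} p) (∧ˡ {B x} q)) m v)
            (trans (deg-∨ e f v (λ u p q → A-B (proj₁ (pair-end {C = A} v u a₁∈A a₂∈A p)) (proj₁ (pair-end {C = B} v u b₁∈B b₂∈B q))))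
                   (cong₂ _+_ (deg-samePair a₁≢a₂ v) (deg-samePair b₁≢b₂ v))))
            count-ends)
          where
          count-ends : (⟪ (A ∩ terminals-free) v ⟫ + ⟪ (B ∩ terminals-free) v ⟫)
                     + ((⟪ ⁅ a₁ ⁆ v ⟫ + ⟪ ⁅ a₂ ⁆ v ⟫) + (⟪ ⁅ b₁ ⁆ v ⟫ + ⟪ ⁅ b₂ ⁆ v ⟫)) ≡ 1
          count-ends with v ≟ a₁ | v ≟ a₂ | v ≟ b₁ | v ≟ b₂
          ... | yes refl | yes q | _ | _ = ⊥-elim (a₁≢a₂ q)
          ... | yes refl | _ | yes q | _ = ⊥-elim (A-≢-B a₁∈A b₁∈B q)
          ... | yes refl | _ | _ | yes q = ⊥-elim (A-≢-B a₁∈A b₂∈B q)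
          ... | _ | yes refl | yes q | _ = ⊥-elim (A-≢-B a₂∈A b₁∈B q)
          ... | _ | yes refl | _ | yes q = ⊥-elim (A-≢-B a₂∈A b₂∈B q)
          ... | _ | _ | yes refl | yes q = ⊥-elim (b₁≢b₂ q)
          ... | yes _ | no _ | no _ | no _ rewrite ∧-zeroʳ (A v) | ∧-zeroʳ (B v) = refl
          ... | no _ | yes _ | no _ | no _ rewrite ∧-zeroʳ (A v) | ∧-zeroʳ (B v) = refl
          ... | no _ | no _ | yes _ | no _ rewrite ∧-zeroʳ (A v) | ∧-zeroʳ (B v) = refl
          ... | no _ | no _ | no _ | yes _ rewrite ∧-zeroʳ (A v) | ∧-zeroʳ (B v) = refl
          ... | no _ | no _ | no _ | no _ rewrite ∧-identityʳ (A v) | ∧-identityʳ (B v) = trans (+-identityʳ _) (⟪A⟫+⟪B⟫ v)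

        is-pm : IsPerfectMatching G-st M
        is-pm = ((λ u v → cong₂ _∨_ (∨-comm (N u v) (N v u)) (cong₂ _∨_ (pair-sym {a₁} u v) (pair-sym {b₁} u v)))
                , λ u v p → [ symmetrise-⊆ m u v , (λ q → [ e-kept u v , f-kept u v ]′ (∨-true {e u v} q)) ]′ (∨-true {symmetrise N u v} p))
              , degree

      perfect₂ : ∀ {x y} → N x y ≡ true → PMThrough x y
      perfect₂ p = M , is-pm , ∨-introˡ (∨-introˡ p)

      perfect-e : PMThrough a₁ a₂
      perfect-e = M , is-pm , ∨-introʳ {symmetrise N a₁ a₂} (∨-introˡ (∨-introˡ (∧-intro (⌊≟⌋-refl a₁) (⌊≟⌋-refl a₂))))

      perfect-f : PMThrough b₁ b₂
      perfect-f = M , is-pm , ∨-introʳ {symmetrise N b₁ b₂} (∨-introʳ {e b₁ b₂} (∨-introˡ (∧-intro (⌊≟⌋-refl b₁) (⌊≟⌋-refl b₂))))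

-- Special sets and obstructions

-- A 3-edge-cut separating a₁a₂ from b₁b₂, given by its side that contains b₁b₂
record Special {n} (σ : Shape n) (X : VSet n) : Set where
  open Shape σ
  open Counts σ
  field
    a₁∉    : a₁ ∉ X
    a₂∉    : a₂ ∉ X
    b₁∈    : b₁ ∈ X
    b₂∈    : b₂ ∈ X
    excess : nB X ≡ 1 + nA X
    out≡1  : out X ≡ 1

NonCrossing : ∀ {n} → Shape n → Adj n → Set
NonCrossing σ N = ∀ X → Special σ X → ∀ x y → N x y ≡ true → X x ≡ X y

Within : ∀ {n} → Setup n → Adj n → Set
Within S N = ∀ x y → N x y ≡ true → Counts.E (Setup.shape S) x y ≡ true

-- The shape of a violator of Hall's condition when all perfect matchings through some edge entering Z use the edge st.
record Obstruction {n} (σ : Shape n) (s t : Fin n) (Z : VSet n) : Set where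
  open Shape σ
  open Counts σ
  field
    nA≡nB    : nA Z ≡ nB Z
    only     : ∀ x y → E x y ≡ true → x ∈ Z → y ∉ Z → x ≡ s × y ≡ t
    s∈       : s ∈ Z
    t∉       : t ∉ Z
    out≡1    : out Z ≡ 1
    meets-a  : Z a₁ ∨ Z a₂ ≡ true
    misses-b : Z b₁ ∧ Z b₂ ≡ false

-- The edges entering Z are that edge, the special edge of a special set below Z unless Z meets b₁b₂,
-- and the special edge of a special set above Z if Z contains a₁a₂; so N, crossing no special set, enters Z at most once.
record Dependence {n} (σ : Shape n) (N : Adj n) (Z : VSet n) : Set where
  open Shape σ
  open Counts σ
  field
    N-back        : flow N (∁ Z) Z ≤ 1
    special-below : Z b₁ ∨ Z b₂ ≡ false → ∃ λ C → Special σ C × (∀ x → x ∈ C → x ∉ Z) × 1 ≤ flow E C Z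
    special-above : Z a₁ ∧ Z a₂ ≡ true → ∃ λ C → Special σ C × (∀ x → x ∉ C → x ∈ Z) × 1 ≤ flow E (∁ Z) (∁ C)

-- Symmetry under exchange of the classes

transpose : ∀ {n} → Adj n → Adj n
transpose N x y = N y x

not² : ∀ {n} (X : VSet n) → X ≗ ∁ (∁ X)
not² X x = sym (not-involutive (X x))

not-false : ∀ {a} → not a ≡ false → a ≡ true
not-false {true} _ = refl

de-morgan-∧ : ∀ a b → a ∧ b ≡ false → not a ∨ not b ≡ true
de-morgan-∧ true false _ = refl
de-morgan-∧ false b _ = refl

de-morgan-∨ : ∀ a b → a ∨ b ≡ true → not a ∧ not b ≡ false
de-morgan-∨ true b _ = refl
de-morgan-∨ false true _ = refl

∨-false : ∀ {a b} → a ∨ b ≡ false → a ≡ false × b ≡ false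
∨-false {false} {false} _ = refl , refl

∨-false-intro : ∀ {a b} → a ≡ false → b ≡ false → a ∨ b ≡ false
∨-false-intro refl refl = refl

module Mirror {n} (S : Setup n) where
  open Basics S

  private
    module M = Counts (flip shape)

  mirror-E : ∀ x y → M.E x y ≡ E y x
  mirror-E x y = cong₂ _∧_ (edge-sym x y) (∧-comm (B x) (A y))

  mirror-flow : ∀ P Q → flow M.E P Q ≡ flow E Q P
  mirror-flow = flow-transpose mirror-E

  ∁-excess : ∀ {X k} → nB X ≡ k + nA X → nA (∁ X) ≡ k + nB (∁ X)
  ∁-excess {X} {k} h = +-cancelʳ-≡ (nA X) _ _ (begin
    nA (∁ X) + nA X       ≡⟨ cnt-∁ A X ⟩
    cnt A V               ≡⟨ balanced ⟩
    cnt B V               ≡⟨ cnt-∁ B X ⟨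
    nB (∁ X) + nB X       ≡⟨ cong (nB (∁ X) +_) h ⟩
    nB (∁ X) + (k + nA X) ≡⟨ +-assoc (nB (∁ X)) k (nA X) ⟨
    nB (∁ X) + k + nA X   ≡⟨ cong (_+ nA X) (+-comm (nB (∁ X)) k) ⟩
    k + nB (∁ X) + nA X   ∎)
    where open ≡-Reasoning

  -- Exchanging the classes reverses `E`, and complementation reverses the side of the cut; the two
  -- reversals cancel.
  mirror-out : ∀ X → M.out (∁ X) ≡ out X
  mirror-out X = trans (mirror-flow (∁ X) (∁ (∁ X))) (flow-cong E (sym ∘ not² X) (λ _ → refl))

  mirror-special : ∀ {X} → Special shape X → Special (flip shape) (∁ X)
  mirror-special {X} sp = record
    { a₁∉ = cong not b₁∈ ; a₂∉ = cong not b₂∈ ; b₁∈ = cong not a₁∉ ; b₂∈ = cong not a₂∉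
    ; excess = ∁-excess excess ; out≡1 = trans (mirror-out X) out≡1 }
    where open Special sp

  mirror-obstruction : ∀ {s t Z} → Obstruction shape s t Z → Obstruction (flip shape) t s (∁ Z)
  mirror-obstruction {s} {t} {Z} ob = record
    { nA≡nB = sym (∁-excess {k = 0} (sym nA≡nB))
    ; only = λ x y e p q → swap (only y x (trans (sym (mirror-E x y)) e) (not-false q) (not-true p))
    ; s∈ = not-intro t∉ ; t∉ = cong not s∈
    ; out≡1 = trans (mirror-out Z) out≡1
    ; meets-a = de-morgan-∧ (Z b₁) (Z b₂) misses-b
    ; misses-b = de-morgan-∨ (Z a₁) (Z a₂) meets-a }
    where
    open Obstruction ob
    swap : ∀ {P Q : Set} → P × Q → Q × P
    swap (p , q) = q , p

  mirror-noncrossing : ∀ {N} → NonCrossing (flip shape) (transpose N) → NonCrossing shape N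
  mirror-noncrossing h X sp x y p = trans (not² X x) (trans (cong not (sym (h (∁ X) (mirror-special sp) y x p))) (sym (not² X y)))

-- Complementation turns a special set disjoint from Z into one whose complement lies in the new
-- set, so `special-below` and `special-above` trade places.
mirror-dependence : ∀ {n} (S : Setup n) {N Z} → let open Setup S in
                    Dependence shape N Z → Dependence (flip shape) (transpose N) (∁ Z)
mirror-dependence S {N} {Z} dep = record
  { N-back = subst (_≤ 1) (trans (flow-cong N (λ _ → refl) (not² Z))
                                 (flow-transpose {R = N} {transpose N} (λ _ _ → refl) (∁ Z) (∁ (∁ Z)))) N-back
  ; special-below = λ h → below (special-above (both-in h))
  ; special-above = λ h → above (special-below (both-out h)) }
  where
  open Dependence dep
  open Basics S
  open Mirror S
  module M = Counts (flip shape)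

  both-in : not (Z a₁) ∨ not (Z a₂) ≡ false → Z a₁ ∧ Z a₂ ≡ true
  both-in h = ∧-intro (not-false (proj₁ (∨-false {not (Z a₁)} h))) (not-false (proj₂ (∨-false {not (Z a₁)} h)))

  both-out : not (Z b₁) ∧ not (Z b₂) ≡ true → Z b₁ ∨ Z b₂ ≡ false
  both-out h = ∨-false-intro (not-true (∧ˡ {not (Z b₁)} h)) (not-true (∧ʳ {not (Z b₁)} h))

  below : (∃ λ C → Special shape C × (∀ x → x ∉ C → x ∈ Z) × 1 ≤ flow E (∁ Z) (∁ C)) →
          ∃ λ C → Special (flip shape) C × (∀ x → x ∈ C → x ∉ ∁ Z) × 1 ≤ flow M.E C (∁ Z)
  below (C , sp , h , k) = ∁ C , mirror-special sp , (λ x p → cong not (h x (not-true p))) ,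
                           subst (1 ≤_) (sym (mirror-flow (∁ C) (∁ Z))) k

  above : (∃ λ C → Special shape C × (∀ x → x ∈ C → x ∉ Z) × 1 ≤ flow E C Z) →
          ∃ λ C → Special (flip shape) C × (∀ x → x ∉ C → x ∈ ∁ Z) × 1 ≤ flow M.E (∁ (∁ Z)) (∁ C)
  above (C , sp , h , k) = ∁ C , mirror-special sp , (λ x p → not-intro (h x (not-false p))) ,
                           subst (1 ≤_) (trans (flow-cong E (not² C) (not² Z)) (sym (mirror-flow (∁ (∁ Z)) (∁ (∁ C))))) k

-- Violators of Hall's condition

module Facts {n} (S : Setup n) where
  open Perfect S
  open Basics S

  α≡0 : ∀ {X} → a₁ ∉ X → a₂ ∉ X → α X ≡ 0
  α≡0 p q = cong₂ (λ a b → ⟪ a ∨ b ⟫) p q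

  β≡1 : ∀ {X} → b₁ ∈ X → b₂ ∈ X → β X ≡ 1
  β≡1 p q = cong₂ (λ a b → ⟪ a ∧ b ⟫) p q

  Only : Fin n → Fin n → VSet n → Set
  Only s t X = ∀ x y → E x y ≡ true → x ∈ X → y ∉ X → x ≡ s × y ≡ t

  only-out : ∀ {s t X} → Only s t X → out X ≤ 1
  only-out {s} {t} only = flow-≤1 E s t λ x y e p q → only x y e p (not-true q)

  -- A special set is left by only one edge, which no special-avoiding relation may use.
  ¬special-only : ∀ {N s t X} → NonCrossing shape N → N s t ≡ true → Only s t X →
                  a₁ ∉ X → a₂ ∉ X → b₁ ∈ X → b₂ ∈ X → nB X ≤ 1 + nA X → ⊥
  ¬special-only {N} {s} {t} {X} nc st only a₁∉ a₂∉ b₁∈ b₂∈ small = crossing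
    (flow-witness E {X} {∁ X} (≤-reflexive (sym out≡1)))
    where
    out≡1 : out X ≡ 1
    out≡1 = ≤-antisym (only-out {X = X} only)
      -- The negated goal is the last entry of the certificate, here and below; its weight is the
      -- factor by which the goal is scaled. Integrality enters because the negation is a strict
      -- inequality between naturals: 1 ≤ 2 `out X` already gives `out X` ≥ 1.
      (≮⇒≥ λ neg → farkas (out X ∷ nA X ∷ nB X ∷ α X ∷ β X ∷ [])
        ( 1 ⊠ con 3 :+ 3 :* (‵ 1) :+ 2 :* (‵ 4) ⩽ 2 :* (‵ 0) :+ 2 :* (‵ 3) :+ 3 :* (‵ 2) ∵ star X b₁∈ a₁∉
        ∷ 2 ⊠ ‵ 3 ⩽ con 0 ∵ ≤-reflexive (α≡0 {X} a₁∉ a₂∉)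
        ∷ 2 ⊠ con 1 ⩽ ‵ 4 ∵ ≤-reflexive (sym (β≡1 {X} b₁∈ b₂∈))
        ∷ 3 ⊠ ‵ 2 ⩽ con 1 :+ ‵ 1 ∵ small
        ∷ 2 ⊠ con 1 :+ ‵ 0 ⩽ con 1 ∵ neg
        ∷ []))
    excess : nB X ≡ 1 + nA X
    excess = ≤-antisym small
      (≮⇒≥ λ neg → farkas (out X ∷ nA X ∷ nB X ∷ α X ∷ β X ∷ [])
        ( 1 ⊠ con 3 :+ 3 :* (‵ 1) :+ 2 :* (‵ 4) ⩽ 2 :* (‵ 0) :+ 2 :* (‵ 3) :+ 3 :* (‵ 2) ∵ star X b₁∈ a₁∉
        ∷ 2 ⊠ ‵ 3 ⩽ con 0 ∵ ≤-reflexive (α≡0 {X} a₁∉ a₂∉)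
        ∷ 2 ⊠ con 1 ⩽ ‵ 4 ∵ ≤-reflexive (sym (β≡1 {X} b₁∈ b₂∈))
        ∷ 2 ⊠ ‵ 0 ⩽ con 1 ∵ ≤-reflexive out≡1
        ∷ 3 ⊠ con 1 :+ ‵ 2 ⩽ con 1 :+ ‵ 1 ∵ neg
        ∷ []))
    crossing : (∃ λ x → ∃ λ y → E x y ≡ true × x ∈ X × y ∈ ∁ X) → ⊥
    crossing (x , y , e , p , q) with only x y e p (not-true q)
    ... | refl , refl = true≢false (trans (sym (nc X sp x y st)) p) (not-true q)
      where
      sp : Special shape X
      sp = record { a₁∉ = a₁∉ ; a₂∉ = a₂∉ ; b₁∈ = b₁∈ ; b₂∈ = b₂∈ ; excess = excess ; out≡1 = out≡1 }

  ⟪a⟫ : ∀ {a} → a ∈ A → ⟪ A a ⟫ ≡ 1 × ⟪ B a ⟫ ≡ 0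
  ⟪a⟫ p = cong ⟪_⟫ p , cong ⟪_⟫ (A-∉B p)

  ⟪b⟫ : ∀ {b} → b ∈ B → ⟪ A b ⟫ ≡ 0 × ⟪ B b ⟫ ≡ 1
  ⟪b⟫ p = cong ⟪_⟫ (B-∉A p) , cong ⟪_⟫ p

  nA-⊖a : ∀ {X a} → a ∈ A → a ∈ X → nA X ≡ 1 + nA (X ⊖ a)
  nA-⊖a {X} {a} p q = trans (cnt-⊖ A X a q) (trans (cong (nA (X ⊖ a) +_) (proj₁ (⟪a⟫ p))) (+-comm _ 1))

  nB-⊖a : ∀ {X a} → a ∈ A → a ∈ X → nB X ≡ nB (X ⊖ a)
  nB-⊖a {X} {a} p q = trans (cnt-⊖ B X a q) (trans (cong (nB (X ⊖ a) +_) (proj₂ (⟪a⟫ p))) (+-identityʳ _))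

  nA-⊖b : ∀ {X b} → b ∈ B → b ∈ X → nA X ≡ nA (X ⊖ b)
  nA-⊖b {X} {b} p q = trans (cnt-⊖ A X b q) (trans (cong (nA (X ⊖ b) +_) (proj₁ (⟪b⟫ p))) (+-identityʳ _))

  nB-⊖b : ∀ {X b} → b ∈ B → b ∈ X → nB X ≡ 1 + nB (X ⊖ b)
  nB-⊖b {X} {b} p q = trans (cnt-⊖ B X b q) (trans (cong (nB (X ⊖ b) +_) (proj₂ (⟪b⟫ p))) (+-comm _ 1))

  nA-⊞b : ∀ {X b} → b ∈ B → b ∉ X → nA (X ⊞ b) ≡ nA X
  nA-⊞b {X} {b} p q = trans (cnt-⊞ A X b q) (trans (cong (nA X +_) (proj₁ (⟪b⟫ p))) (+-identityʳ _))

  nB-⊞b : ∀ {X b} → b ∈ B → b ∉ X → nB (X ⊞ b) ≡ 1 + nB X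
  nB-⊞b {X} {b} p q = trans (cnt-⊞ B X b q) (trans (cong (nB X +_) (proj₂ (⟪b⟫ p))) (+-comm _ 1))

  free-∈ : ∀ {x} → x ≢ a₁ → x ≢ a₂ → x ≢ b₁ → x ≢ b₂ → x ∈ terminals-free
  free-∈ {x} p q r u = ∈-⊖ {X = V ⊖ a₁ ⊖ a₂ ⊖ b₁} (∈-⊖ {X = V ⊖ a₁ ⊖ a₂} (∈-⊖ {X = V ⊖ a₁} (∈-⊖ {X = V} {x = x} refl p) q) r) u

  free-≢ : ∀ {x} → x ∈ terminals-free → x ≢ a₁ × x ≢ a₂ × x ≢ b₁ × x ≢ b₂
  free-≢ {x} p = ⊖-≢ {X = V} {a = a₁} in₁ , ⊖-≢ {X = V ⊖ a₁} {a = a₂} in₂ , ⊖-≢ {X = V ⊖ a₁ ⊖ a₂} {a = b₁} in₃ , ⊖-≢ {X = V ⊖ a₁ ⊖ a₂ ⊖ b₁} {a = b₂} p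
    where
    in₃ = ⊖-⊆ {X = V ⊖ a₁ ⊖ a₂ ⊖ b₁} {a = b₂} x p
    in₂ = ⊖-⊆ {X = V ⊖ a₁ ⊖ a₂} {a = b₁} x in₃
    in₁ = ⊖-⊆ {X = V ⊖ a₁} {a = a₂} x in₂

  free-sizes : (cnt A V ≡ 2 + nA terminals-free) × (cnt B V ≡ 2 + nB terminals-free)
  free-sizes =
      trans (nA-⊖a {V} a₁∈A refl) (trans (cong suc (nA-⊖a {V ⊖ a₁} a₂∈A a₂∈)) (cong (2 +_)
        (trans (nA-⊖b {V ⊖ a₁ ⊖ a₂} b₁∈B b₁∈) (nA-⊖b {V ⊖ a₁ ⊖ a₂ ⊖ b₁} b₂∈B b₂∈))))
    , trans (nB-⊖a {V} a₁∈A refl) (trans (nB-⊖a {V ⊖ a₁} a₂∈A a₂∈)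
        (trans (nB-⊖b {V ⊖ a₁ ⊖ a₂} b₁∈B b₁∈) (cong suc (nB-⊖b {V ⊖ a₁ ⊖ a₂ ⊖ b₁} b₂∈B b₂∈))))
    where
    a₂∈ : a₂ ∈ V ⊖ a₁
    a₂∈ = ∈-⊖ {X = V} {x = a₂} refl (a₁≢a₂ ∘ sym)
    b₁∈ : b₁ ∈ V ⊖ a₁ ⊖ a₂
    b₁∈ = ∈-⊖ {X = V ⊖ a₁} (∈-⊖ {X = V} {x = b₁} refl (A-≢-B a₁∈A b₁∈B ∘ sym)) (A-≢-B a₂∈A b₁∈B ∘ sym)
    b₂∈ : b₂ ∈ V ⊖ a₁ ⊖ a₂ ⊖ b₁
    b₂∈ = ∈-⊖ {X = V ⊖ a₁ ⊖ a₂} (∈-⊖ {X = V ⊖ a₁} (∈-⊖ {X = V} {x = b₂} refl (A-≢-B a₁∈A b₂∈B ∘ sym))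
                (A-≢-B a₂∈A b₂∈B ∘ sym)) (b₁≢b₂ ∘ sym)

  free-balanced : nA terminals-free ≡ nB terminals-free
  free-balanced = suc-injective (suc-injective (trans (sym (proj₁ free-sizes)) (trans balanced (proj₂ free-sizes))))

Matching-cong : ∀ {n} {R N : Adj n} {A A′ B B′ : VSet n} → A ≗ A′ → B ≗ B′ → Matching R A B N → Matching R A′ B′ N
Matching-cong h k m = record
  { edge = edge ; left = λ x y p → trans (sym (h x)) (left x y p) ; right = λ x y p → trans (sym (k y)) (right x y p)
  ; row = λ x → trans (row x) (cong ⟪_⟫ (h x)) ; col = λ y → trans (col y) (cong ⟪_⟫ (k y)) }
  where open Matching m

module Structure {n} (S : Setup n) {N : Adj n} (N⊆E : Within S N) (noncrossing : NonCrossing (Setup.shape S) N)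
  {s t : Fin n} (st∈N : N s t ≡ true) where

  open Perfect S
  open Basics S
  open Facts S
  open Deleted (N⊆E s t st∈N)

  private
    st : E s t ≡ true
    st = N⊆E s t st∈N

  -- An edge of `E` other than st survives in `R`, and relative closedness of the violator X then
  -- keeps its end inside Y.
  violator-only : ∀ {X K Y} → (∀ x → x ∈ Y → x ∈ A → x ∈ X) → X ⊆ Y → (∀ y → y ∈ B → y ∉ Y → y ∈ K) →
                  (∀ x y → R x y ≡ true → x ∈ X → y ∈ K → y ∈ X) → Only s t Y
  violator-only {Y = Y} small big outside closed x y e p q with x ≟ s | y ≟ t
  ... | yes refl | yes refl = refl , refl
  ... | no x≢s | _ = ⊥-elim (true≢false (big y (closed x y (remove-keep E e (λ h _ → x≢s h))
                       (small x p (E-A e)) (outside y (E-B e) q))) q)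
  ... | yes _ | no y≢t = ⊥-elim (true≢false (big y (closed x y (remove-keep E e (λ _ h → y≢t h))
                       (small x p (E-A e)) (outside y (E-B e) q))) q)

  A-⊖⊖ : ∀ K {x y} → y ∈ B → (A ∩ (K ⊖ x ⊖ y)) ≗ (A ∩ K) ⊖ x
  A-⊖⊖ K {x} {y} y∈B v with v ≟ y
  ... | no _ = trans (cong (A v ∧_) (∧-identityʳ _)) (sym (∧-assoc (A v) (K v) (not (⁅ x ⁆ v))))
  ... | yes refl rewrite B-∉A y∈B = refl

  B-⊖⊖ : ∀ K {x y} → x ∈ A → (B ∩ (K ⊖ x ⊖ y)) ≗ (B ∩ K) ⊖ y
  B-⊖⊖ K {x} {y} x∈A v with v ≟ x
  ... | no _ = trans (cong (λ b → B v ∧ (b ∧ not (⁅ y ⁆ v))) (∧-identityʳ (K v))) (sym (∧-assoc (B v) (K v) (not (⁅ y ⁆ v))))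
  ... | yes refl rewrite A-∉B x∈A = refl

  through : ∀ K {x y M} → R x y ≡ true → x ∈ K → y ∈ K → Matching R (A ∩ (K ⊖ x ⊖ y)) (B ∩ (K ⊖ x ⊖ y)) M →
            Matching R (A ∩ K) (B ∩ K) (λ u v → M u v ∨ (⁅ x ⁆ u ∧ ⁅ y ⁆ v))
  through K r p q m = Matching-insert r (∧-intro (E-A (R⊆E _ _ r)) p) (∧-intro (E-B (R⊆E _ _ r)) q)
    (Matching-cong (A-⊖⊖ K (E-B (R⊆E _ _ r))) (B-⊖⊖ K (E-A (R⊆E _ _ r))) m)

  ⊖⊖-sizes : ∀ K {x y} → x ∈ A → y ∈ B → x ∈ K → y ∈ K → (nA K ≡ 1 + nA (K ⊖ x ⊖ y)) × (nB K ≡ 1 + nB (K ⊖ x ⊖ y))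
  ⊖⊖-sizes K {x} {y} x∈A y∈B x∈K y∈K =
      trans (nA-⊖a {K} x∈A x∈K) (cong suc (nA-⊖b {K ⊖ x} y∈B y∈K⊖x))
    , trans (nB-⊖a {K} x∈A x∈K) (nB-⊖b {K ⊖ x} y∈B y∈K⊖x)
    where
    y∈K⊖x : y ∈ K ⊖ x
    y∈K⊖x = ∈-⊖ {X = K} y∈K (λ h → A-≢-B x∈A y∈B (sym h))

  ⊖⊖-≢ : ∀ (K : VSet n) x y v → v ∈ K ⊖ x ⊖ y → v ∈ K × v ≢ x × v ≢ y
  ⊖⊖-≢ K x y v p = ⊖-⊆ {X = K} {a = x} v q , ⊖-≢ {X = K} {a = x} q , ⊖-≢ {X = K ⊖ x} {a = y} p
    where
    q : v ∈ K ⊖ x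
    q = ⊖-⊆ {X = K ⊖ x} {a = y} v p

  ⊞-≢A : ∀ {X a v} → v ∈ X ⊞ a → v ∈ A → a ∈ B → v ∈ X
  ⊞-≢A {X} p v∈A a∈B = [ id , (λ h → ⊥-elim (A-≢-B v∈A a∈B h)) ]′ (⊞-cases {X = X} p)

  ∉⊞ : ∀ {X : VSet n} {a v} → v ∉ X ⊞ a → v ∉ X × v ≢ a
  ∉⊞ {X} {a} {v} p = ¬true (λ q → true≢false {(X ⊞ a) v} (∨-introˡ q) p) , λ { refl → true≢false (⊞-last X a) p }

  HallViolator : VSet n → VSet n → Set
  HallViolator K X = X ⊆ K × (∀ x y → R x y ≡ true → x ∈ X → y ∈ K → y ∈ X) × nB X < nA X

  -- The excluded vertex y is put back, so that edges ending in y do not leave the set; this uses up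
  -- the surplus of the violator. With at most one leaving edge, `star` then forces equality of the
  -- two classes, meeting a₁a₂, and not containing b₁b₂.
  first-obstruction : ∀ {x y X} → x ∈ A → y ∈ B → HallViolator (V ⊖ x ⊖ y) X →
                      Obstruction shape s t (X ⊞ y) × x ∉ X ⊞ y × y ∈ X ⊞ y
  first-obstruction {x} {y} {X} x∈A y∈B (X⊆K , closed , l) = ob , x∉Z , ⊞-last X y
    where
    Z : VSet n
    Z = X ⊞ y

    y∉X : y ∉ X
    y∉X = ¬true λ p → proj₂ (proj₂ (⊖⊖-≢ V x y y (X⊆K y p))) refl

    x∉Z : x ∉ Z
    x∉Z = ∉-⊞ {X = X} (¬true λ p → proj₁ (proj₂ (⊖⊖-≢ V x y x (X⊆K x p))) refl) (A-≢-B x∈A y∈B)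

    only : Only s t Z
    only = violator-only (λ v p v∈A → ⊞-≢A {X} p v∈A y∈B) (λ v p → ∨-introˡ p)
      (λ v v∈B p → ∈-⊖ {X = V ⊖ x} (∈-⊖ {X = V} {x = v} refl (λ h → A-≢-B x∈A v∈B (sym h))) (proj₂ (∉⊞ {X} p))) closed

    nB≤nA : nB Z ≤ nA Z
    nB≤nA = subst₂ _≤_ (sym (nB-⊞b {X} y∈B y∉X)) (sym (nA-⊞b {X} y∈B y∉X)) l

    bound : 3 + 3 * nA Z + 2 * β Z ≤ 2 * out Z + 2 * α Z + 3 * nB Z
    bound = star Z (⊞-last X y) x∉Z

    α≤1 : α Z ≤ 1
    α≤1 = ⟪⟫≤1 (Z a₁ ∨ Z a₂)

    nA≡nB : nA Z ≡ nB Z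
    nA≡nB = ≤-antisym
      (≮⇒≥ λ neg → farkas (nA Z ∷ nB Z ∷ out Z ∷ α Z ∷ β Z ∷ [])
        ( 1 ⊠ con 3 :+ 3 :* (‵ 0) :+ 2 :* (‵ 4) ⩽ 2 :* (‵ 2) :+ 2 :* (‵ 3) :+ 3 :* (‵ 1) ∵ bound
        ∷ 2 ⊠ ‵ 3 ⩽ con 1 ∵ α≤1
        ∷ 2 ⊠ ‵ 2 ⩽ con 1 ∵ only-out {X = Z} only
        ∷ 3 ⊠ con 1 :+ ‵ 1 ⩽ ‵ 0 ∵ neg
        ∷ [])) nB≤nA

    out≡1 : out Z ≡ 1
    out≡1 = ≤-antisym (only-out {X = Z} only)
      (≮⇒≥ λ neg → farkas (nA Z ∷ nB Z ∷ out Z ∷ α Z ∷ β Z ∷ [])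
        ( 1 ⊠ con 3 :+ 3 :* (‵ 0) :+ 2 :* (‵ 4) ⩽ 2 :* (‵ 2) :+ 2 :* (‵ 3) :+ 3 :* (‵ 1) ∵ bound
        ∷ 2 ⊠ ‵ 3 ⩽ con 1 ∵ α≤1
        ∷ 3 ⊠ ‵ 1 ⩽ ‵ 0 ∵ ≤-reflexive (sym nA≡nB)
        ∷ 2 ⊠ con 1 :+ ‵ 2 ⩽ con 1 ∵ neg
        ∷ []))

    crosses : s ∈ Z × t ∉ Z
    crosses = crossing (flow-witness E {Z} {∁ Z} (≤-reflexive (sym out≡1)))
      where
      crossing : (∃ λ u → ∃ λ v → E u v ≡ true × u ∈ Z × v ∈ ∁ Z) → s ∈ Z × t ∉ Z
      crossing (u , v , e , p , q) with only u v e p (not-true q)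
      ... | refl , refl = p , not-true q

    meets : Z a₁ ∨ Z a₂ ≡ true
    meets = ⟪⟫-positive
      (≮⇒≥ λ neg → farkas (nA Z ∷ nB Z ∷ out Z ∷ α Z ∷ β Z ∷ [])
        ( 1 ⊠ con 3 :+ 3 :* (‵ 0) :+ 2 :* (‵ 4) ⩽ 2 :* (‵ 2) :+ 2 :* (‵ 3) :+ 3 :* (‵ 1) ∵ bound
        ∷ 2 ⊠ ‵ 2 ⩽ con 1 ∵ ≤-reflexive out≡1
        ∷ 3 ⊠ ‵ 1 ⩽ ‵ 0 ∵ ≤-reflexive (sym nA≡nB)
        ∷ 2 ⊠ con 1 :+ ‵ 3 ⩽ con 1 ∵ neg
        ∷ []))

    misses : Z b₁ ∧ Z b₂ ≡ false
    misses = ¬true λ h → (farkas (nA Z ∷ nB Z ∷ out Z ∷ α Z ∷ β Z ∷ [])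
      ( 1 ⊠ con 3 :+ 3 :* (‵ 0) :+ 2 :* (‵ 4) ⩽ 2 :* (‵ 2) :+ 2 :* (‵ 3) :+ 3 :* (‵ 1) ∵ bound
      ∷ 2 ⊠ ‵ 2 ⩽ con 1 ∵ ≤-reflexive out≡1
      ∷ 2 ⊠ ‵ 3 ⩽ con 1 ∵ α≤1
      ∷ 3 ⊠ ‵ 1 ⩽ ‵ 0 ∵ ≤-reflexive (sym nA≡nB)
      ∷ 2 ⊠ con 1 ⩽ ‵ 4 ∵ ≤-reflexive (sym (cong ⟪_⟫ h))
      ∷ []))

    ob : Obstruction shape s t Z
    ob = record { nA≡nB = nA≡nB ; only = only ; s∈ = proj₁ crosses ; t∉ = proj₂ crosses ; out≡1 = out≡1
                ; meets-a = meets ; misses-b = misses }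

  obstruction : ∀ {x y} → R x y ≡ true → PMThrough x y ⊎ ∃ λ Z → Obstruction shape s t Z × x ∉ Z × y ∈ Z
  obstruction {x} {y} r = cases (hall-on R R⊆E (V ⊖ x ⊖ y)
      (suc-injective (trans (sym (proj₁ sizes)) (trans balanced (proj₂ sizes)))))
    where
    x∈A = E-A (R⊆E x y r)
    y∈B = E-B (R⊆E x y r)
    sizes = ⊖⊖-sizes V x∈A y∈B refl refl

    cases : (∃ λ M → Matching R (A ∩ (V ⊖ x ⊖ y)) (B ∩ (V ⊖ x ⊖ y)) M) ⊎ ∃ (HallViolator (V ⊖ x ⊖ y)) →
            PMThrough x y ⊎ ∃ λ Z → Obstruction shape s t Z × x ∉ Z × y ∈ Z
    cases (inj₁ (M , m)) = inj₁ (perfect₀ (Matching-cong (λ v → ∧-identityʳ (A v)) (λ v → ∧-identityʳ (B v))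
      (through V r refl refl m)) (∨-introʳ {M x y} (∧-intro (⌊≟⌋-refl x) (⌊≟⌋-refl y))))
    cases (inj₂ (X , v)) = inj₂ (X ⊞ y , first-obstruction x∈A y∈B v)

  -- A perfect matching through a₁a₂ and b₁b₂: a violator of Hall's condition would be special.
  terminal-matching : ∃ λ M → Matching R (A ∩ terminals-free) (B ∩ terminals-free) M
  terminal-matching with hall-on R R⊆E terminals-free free-balanced
  ... | inj₁ m = m
  ... | inj₂ (X , X⊆K , closed , l) = ⊥-elim (¬special-only {X = Y} noncrossing st∈N only
          (∉Y a₁∈A λ p → proj₁ (free-≢ (X⊆K a₁ p)) refl) (∉Y a₂∈A λ p → proj₁ (proj₂ (free-≢ (X⊆K a₂ p))) refl)
          (∨-introˡ (⊞-last X b₁)) (⊞-last (X ⊞ b₁) b₂) small)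
    where
    Y : VSet n
    Y = X ⊞ b₁ ⊞ b₂

    ∉Y : ∀ {v} → v ∈ A → (v ∈ X → ⊥) → v ∉ Y
    ∉Y v∈A h = ∉-⊞ {X = X ⊞ b₁} (∉-⊞ {X = X} (¬true h) (A-≢-B v∈A b₁∈B)) (A-≢-B v∈A b₂∈B)

    b₁∉X : b₁ ∉ X
    b₁∉X = ¬true λ p → proj₁ (proj₂ (proj₂ (free-≢ (X⊆K b₁ p)))) refl

    b₂∉ : b₂ ∉ X ⊞ b₁
    b₂∉ = ∉-⊞ {X = X} (¬true λ p → proj₂ (proj₂ (proj₂ (free-≢ (X⊆K b₂ p)))) refl) (b₁≢b₂ ∘ sym)

    only : Only s t Y
    only = violator-only (λ v p v∈A → ⊞-≢A {X} (⊞-≢A {X ⊞ b₁} p v∈A b₂∈B) v∈A b₁∈B) (λ v p → ∨-introˡ (∨-introˡ p))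
      (λ v v∈B p → free-∈ (A-≢-B a₁∈A v∈B ∘ sym) (A-≢-B a₂∈A v∈B ∘ sym)
        (proj₂ (∉⊞ {X} (proj₁ (∉⊞ {X ⊞ b₁} p)))) (proj₂ (∉⊞ {X ⊞ b₁} p))) closed

    small : nB Y ≤ 1 + nA Y
    small = (≮⇒≥ λ neg → farkas (nB Y ∷ nA Y ∷ nB (X ⊞ b₁) ∷ nA (X ⊞ b₁) ∷ nB X ∷ nA X ∷ [])
      ( 1 ⊠ ‵ 0 ⩽ con 1 :+ ‵ 2 ∵ ≤-reflexive (nB-⊞b {X ⊞ b₁} b₂∈B b₂∉)
      ∷ 1 ⊠ ‵ 2 ⩽ con 1 :+ ‵ 4 ∵ ≤-reflexive (nB-⊞b {X} b₁∈B b₁∉X)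
      ∷ 1 ⊠ ‵ 3 ⩽ ‵ 1 ∵ ≤-reflexive (sym (nA-⊞b {X ⊞ b₁} b₂∈B b₂∉))
      ∷ 1 ⊠ ‵ 5 ⩽ ‵ 3 ∵ ≤-reflexive (sym (nA-⊞b {X} b₁∈B b₁∉X))
      ∷ 1 ⊠ con 1 :+ ‵ 4 ⩽ ‵ 5 ∵ l
      ∷ 1 ⊠ con 1 :+ (con 1 :+ ‵ 1) ⩽ ‵ 0 ∵ neg
      ∷ []))

  -- The violator for perfect matchings through a₁a₂, b₁b₂ and xy, enlarged by the excluded vertices
  -- b₁, b₂, y of B. Three added vertices against a surplus of at least one of A bound the excess by
  -- 2; an excess below 2 would make the set special and st the edge leaving it.
  record Second (x y : Fin n) (Y : VSet n) : Set where
    field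
      only   : Only s t Y
      a₁∉    : a₁ ∉ Y
      a₂∉    : a₂ ∉ Y
      b₁∈    : b₁ ∈ Y
      b₂∈    : b₂ ∈ Y
      x∉     : x ∉ Y
      y∈     : y ∈ Y
      excess : nB Y ≡ 2 + nA Y

  second-obstruction : ∀ {x y} → R x y ≡ true → x ≢ a₁ → x ≢ a₂ → y ≢ b₁ → y ≢ b₂ → PMThrough x y ⊎ ∃ (Second x y)
  second-obstruction {x} {y} r x≢a₁ x≢a₂ y≢b₁ y≢b₂
    with hall-on R R⊆E (terminals-free ⊖ x ⊖ y)
      (suc-injective (trans (sym (proj₁ sizes)) (trans free-balanced (proj₂ sizes))))
    where
    x∈A = E-A (R⊆E x y r)
    y∈B = E-B (R⊆E x y r)
    sizes = ⊖⊖-sizes terminals-free x∈A y∈B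
      (free-∈ x≢a₁ x≢a₂ (A-≢-B x∈A b₁∈B) (A-≢-B x∈A b₂∈B))
      (free-∈ (A-≢-B a₁∈A y∈B ∘ sym) (A-≢-B a₂∈A y∈B ∘ sym) y≢b₁ y≢b₂)
  ... | inj₁ (M , m) = inj₁ (perfect₂ (through terminals-free r
          (free-∈ x≢a₁ x≢a₂ (A-≢-B x∈A b₁∈B) (A-≢-B x∈A b₂∈B))
          (free-∈ (A-≢-B a₁∈A y∈B ∘ sym) (A-≢-B a₂∈A y∈B ∘ sym) y≢b₁ y≢b₂) m)
          (∨-introʳ {M x y} (∧-intro (⌊≟⌋-refl x) (⌊≟⌋-refl y))))
    where
    x∈A = E-A (R⊆E x y r)
    y∈B = E-B (R⊆E x y r)
  ... | inj₂ (X , X⊆K , closed , l) = inj₂ (Y , record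
          { only = only ; a₁∉ = a₁∉ ; a₂∉ = a₂∉ ; b₁∈ = b₁∈ ; b₂∈ = b₂∈
          ; x∉ = ∉Y x∈A (λ p → proj₁ (proj₂ (⊖⊖-≢ terminals-free x y x (X⊆K x p))) refl) ; y∈ = ⊞-last (X ⊞ b₁ ⊞ b₂) y
          ; excess = ≤-antisym small (≰⇒> λ h → ¬special-only {X = Y} noncrossing st∈N only a₁∉ a₂∉ b₁∈ b₂∈ h) })
    where
    x∈A = E-A (R⊆E x y r)
    y∈B = E-B (R⊆E x y r)

    Y : VSet n
    Y = X ⊞ b₁ ⊞ b₂ ⊞ y

    X-free : ∀ {v} → v ∈ X → v ≢ a₁ × v ≢ a₂ × v ≢ b₁ × v ≢ b₂
    X-free {v} p = free-≢ (proj₁ (⊖⊖-≢ terminals-free x y v (X⊆K v p)))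

    ∉Y : ∀ {v} → v ∈ A → (v ∈ X → ⊥) → v ∉ Y
    ∉Y v∈A h = ∉-⊞ {X = X ⊞ b₁ ⊞ b₂} (∉-⊞ {X = X ⊞ b₁} (∉-⊞ {X = X} (¬true h) (A-≢-B v∈A b₁∈B)) (A-≢-B v∈A b₂∈B)) (A-≢-B v∈A y∈B)

    a₁∉ : a₁ ∉ Y
    a₁∉ = ∉Y a₁∈A (λ p → proj₁ (X-free p) refl)

    a₂∉ : a₂ ∉ Y
    a₂∉ = ∉Y a₂∈A (λ p → proj₁ (proj₂ (X-free p)) refl)

    b₁∈ : b₁ ∈ Y
    b₁∈ = ∨-introˡ (∨-introˡ (⊞-last X b₁))

    b₂∈ : b₂ ∈ Y
    b₂∈ = ∨-introˡ (⊞-last (X ⊞ b₁) b₂)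

    b₁∉X : b₁ ∉ X
    b₁∉X = ¬true λ p → proj₁ (proj₂ (proj₂ (X-free p))) refl

    b₂∉ : b₂ ∉ X ⊞ b₁
    b₂∉ = ∉-⊞ {X = X} (¬true λ p → proj₂ (proj₂ (proj₂ (X-free p))) refl) (b₁≢b₂ ∘ sym)

    y∉ : y ∉ X ⊞ b₁ ⊞ b₂
    y∉ = ∉-⊞ {X = X ⊞ b₁} (∉-⊞ {X = X} (¬true λ p → proj₂ (proj₂ (⊖⊖-≢ terminals-free x y y (X⊆K y p))) refl) y≢b₁) y≢b₂

    only : Only s t Y
    only = violator-only
      (λ v p v∈A → ⊞-≢A {X} (⊞-≢A {X ⊞ b₁} (⊞-≢A {X ⊞ b₁ ⊞ b₂} p v∈A y∈B) v∈A b₂∈B) v∈A b₁∈B)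
      (λ v p → ∨-introˡ (∨-introˡ (∨-introˡ p)))
      (λ v v∈B p → ∈-⊖ {X = terminals-free ⊖ x} (∈-⊖ {X = terminals-free}
        (free-∈ (A-≢-B a₁∈A v∈B ∘ sym) (A-≢-B a₂∈A v∈B ∘ sym)
          (proj₂ (∉⊞ {X} (proj₁ (∉⊞ {X ⊞ b₁} (proj₁ (∉⊞ {X ⊞ b₁ ⊞ b₂} p))))))
          (proj₂ (∉⊞ {X ⊞ b₁} (proj₁ (∉⊞ {X ⊞ b₁ ⊞ b₂} p)))))
        (A-≢-B x∈A v∈B ∘ sym)) (proj₂ (∉⊞ {X ⊞ b₁ ⊞ b₂} p))) closed

    small : nB Y ≤ 2 + nA Y
    small = (≮⇒≥ λ neg → farkas (nB Y ∷ nA Y ∷ nB (X ⊞ b₁ ⊞ b₂) ∷ nA (X ⊞ b₁ ⊞ b₂) ∷ nB (X ⊞ b₁) ∷ nA (X ⊞ b₁)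
        ∷ nB X ∷ nA X ∷ [])
      ( 1 ⊠ ‵ 0 ⩽ con 1 :+ ‵ 2 ∵ ≤-reflexive (nB-⊞b {X ⊞ b₁ ⊞ b₂} y∈B y∉)
      ∷ 1 ⊠ ‵ 2 ⩽ con 1 :+ ‵ 4 ∵ ≤-reflexive (nB-⊞b {X ⊞ b₁} b₂∈B b₂∉)
      ∷ 1 ⊠ ‵ 4 ⩽ con 1 :+ ‵ 6 ∵ ≤-reflexive (nB-⊞b {X} b₁∈B b₁∉X)
      ∷ 1 ⊠ ‵ 3 ⩽ ‵ 1 ∵ ≤-reflexive (sym (nA-⊞b {X ⊞ b₁ ⊞ b₂} y∈B y∉))
      ∷ 1 ⊠ ‵ 5 ⩽ ‵ 3 ∵ ≤-reflexive (sym (nA-⊞b {X ⊞ b₁} b₂∈B b₂∉))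
      ∷ 1 ⊠ ‵ 7 ⩽ ‵ 5 ∵ ≤-reflexive (sym (nA-⊞b {X} b₁∈B b₁∉X))
      ∷ 1 ⊠ con 1 :+ ‵ 6 ⩽ ‵ 7 ∵ l
      ∷ 1 ⊠ con 1 :+ (con 2 :+ ‵ 1) ⩽ ‵ 0 ∵ neg
      ∷ []))

-- The edges that enter an obstruction

∨-positive : ∀ {p q} → p ∨ q ≡ true → 1 ≤ ⟪ p ⟫ + ⟪ q ⟫
∨-positive {true} _ = s≤s z≤n
∨-positive {false} {true} _ = s≤s z≤n

∨-zero : ∀ {p q} → p ∨ q ≡ false → ⟪ p ⟫ + ⟪ q ⟫ ≡ 0
∨-zero {false} {false} _ = refl

∨-case : ∀ {p q} → p ∨ q ≡ true → p ≡ false → q ≡ true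
∨-case h refl = h

∨-case′ : ∀ {p q} → p ∨ q ≡ true → q ≡ false → p ≡ true
∨-case′ {true} h refl = refl

module Dependent {n} (S : Setup n) {N : Adj n} (N⊆E : Within S N) (noncrossing : NonCrossing (Setup.shape S) N)
  {s t : Fin n} {Z : VSet n} (ob : Obstruction (Setup.shape S) s t Z) where

  open Perfect S
  open Basics S
  open Facts S
  open Obstruction ob

  -- `balance` for a set with equal classes and one leaving edge. All later contradictions exhibit
  -- more entering edges than this equation permits.
  back-count : 1 + εa Z ≡ back Z + εb Z
  back-count = equate (nA Z ∷ nB Z ∷ out Z ∷ back Z ∷ εa Z ∷ εb Z ∷ []) 1 (con 1 :+ ‵ 4) (‵ 3 :+ ‵ 5)
    ( 1 ⊠ ‵ 2 :+ 3 :* (‵ 1) :+ ‵ 4 ≐ ‵ 3 :+ 3 :* (‵ 0) :+ ‵ 5 ∵ balance Z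
    ∷ 3 ⊠ ‵ 0 ≐ ‵ 1 ∵ nA≡nB
    ∷ 1 ⊠ con 1 ≐ ‵ 2 ∵ sym out≡1
    ∷ [])

  N≤E : ∀ P Q → flow N P Q ≤ flow E P Q
  N≤E P Q = flow-mono {R = N} {S = E} {P = P} {P′ = P} {Q = Q} {Q′ = Q} N⊆E (λ _ p → p) (λ _ q → q)

  -- When the edge xy entering Z meets a₁a₂, the role of the second Hall violator is played by ∁ Z ⊖ x.
  module Touching {x y} (x-end : x ≡ a₁ ⊎ x ≡ a₂) (x∉Z : x ∉ Z) (y∈Z : y ∈ Z) (xy : E x y ≡ true) where

    εa≡1 : εa Z ≡ 1
    εa≡1 = [ (λ { refl → cong₂ (λ p q → ⟪ p ⟫ + ⟪ q ⟫) x∉Z (∨-case meets-a x∉Z) })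
           , (λ { refl → cong₂ (λ p q → ⟪ p ⟫ + ⟪ q ⟫) (∨-case′ meets-a x∉Z) x∉Z }) ]′ x-end

    not-both-a : Z a₁ ∧ Z a₂ ≡ true → ⊥
    not-both-a h = [ (λ { refl → true≢false (∧ˡ {Z a₁} h) x∉Z })
                   , (λ { refl → true≢false (∧ʳ {Z a₁} h) x∉Z }) ]′ x-end

    with-b : Z b₁ ∨ Z b₂ ≡ true → Dependence shape N Z
    with-b h = record
      { N-back = ≤-trans (N≤E (∁ Z) Z)
          (≮⇒≥ λ neg → farkas (back Z ∷ εa Z ∷ εb Z ∷ [])
            ( 1 ⊠ ‵ 0 :+ ‵ 2 ⩽ con 1 :+ ‵ 1 ∵ ≤-reflexive (sym back-count)
            ∷ 1 ⊠ ‵ 1 ⩽ con 1 ∵ ≤-reflexive εa≡1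
            ∷ 1 ⊠ con 1 ⩽ ‵ 2 ∵ ∨-positive {Z b₁} h
            ∷ 1 ⊠ con 1 :+ con 1 ⩽ ‵ 0 ∵ neg
            ∷ []))
      ; special-below = λ p → ⊥-elim (true≢false h p)
      ; special-above = ⊥-elim ∘ not-both-a }

    module _ (h : Z b₁ ∨ Z b₂ ≡ false) where

      C D : VSet n
      C = ∁ Z ⊖ x
      D = ⁅ x ⁆ ∖ Z

      x∈A : x ∈ A
      x∈A = E-A xy

      a∉C : ∀ {a} → (x ≢ a → a ∈ Z) → a ∉ C
      a∉C {a} f = ¬true λ p → true≢false (f (λ e → ⊖-≢ {X = ∁ Z} {a = x} {x = a} p (sym e))) (not-true (⊖-⊆ {X = ∁ Z} {a = x} a p))

      a₁∉C : a₁ ∉ C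
      a₁∉C = a∉C λ x≢a₁ → [ (λ e → ⊥-elim (x≢a₁ e)) , (λ { refl → ∨-case′ meets-a x∉Z }) ]′ x-end

      a₂∉C : a₂ ∉ C
      a₂∉C = a∉C λ x≢a₂ → [ (λ { refl → ∨-case meets-a x∉Z }) , (λ e → ⊥-elim (x≢a₂ e)) ]′ x-end

      b₁∈C : b₁ ∈ C
      b₁∈C = ∈-⊖ {X = ∁ Z} (not-intro (proj₁ (∨-false {Z b₁} h))) (A-≢-B x∈A b₁∈B ∘ sym)

      b₂∈C : b₂ ∈ C
      b₂∈C = ∈-⊖ {X = ∁ Z} (not-intro (proj₂ (∨-false {Z b₁} h))) (A-≢-B x∈A b₂∈B ∘ sym)

      excess : nB C ≡ 1 + nA C
      excess = trans (sym (nB-⊖a {∁ Z} x∈A (not-intro x∉Z)))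
        (trans (sym (Mirror.∁-excess S {Z} {0} (sym nA≡nB))) (nA-⊖a {∁ Z} x∈A (not-intro x∉Z)))

      -- Outside C there are only Z and x, and x lies in A, so no edge of `E` ends there.
      out-C : out C ≤ flow E C Z
      out-C = ≤-trans (flow-≤ {2} (λ { (z ∷ e ∷ []) → (not z ∧ not e , not (not z ∧ not e)) ∷ [] })
                                  (λ { (z ∷ e ∷ []) → (not z ∧ not e , z) ∷ (not z ∧ not e , e) ∷ [] }) E (Z ∷ ⁅ x ⁆ ∷ []))
        (≤-reflexive (trans (cong (flow E C Z +_) (flow-0 E {C} {⁅ x ⁆} λ u v e _ q →
          A-B (subst (_∈ A) (sym (⌊≟⌋-true q)) x∈A) (E-B e))) (+-identityʳ _)))

      entering : flow E C Z + flow E D Z ≤ back Z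
      entering = flow-≤ {2} (λ { (z ∷ e ∷ []) → (not z ∧ not e , z) ∷ (e ∧ not z , z) ∷ [] })
                            (λ { (z ∷ e ∷ []) → (not z , z) ∷ [] }) E (Z ∷ ⁅ x ⁆ ∷ [])

      N-entering : flow N (∁ Z) Z ≤ flow N C Z + flow N D Z
      N-entering = flow-≤ {2} (λ { (z ∷ e ∷ []) → (not z , z) ∷ [] })
                              (λ { (z ∷ e ∷ []) → (not z ∧ not e , z) ∷ (e ∧ not z , z) ∷ [] }) N (Z ∷ ⁅ x ⁆ ∷ [])

      out-C≥1 : 1 ≤ out C
      out-C≥1 = (≮⇒≥ λ neg → farkas (nA C ∷ nB C ∷ out C ∷ α C ∷ β C ∷ [])
        ( 1 ⊠ con 3 :+ 3 :* (‵ 0) :+ 2 :* (‵ 4) ⩽ 2 :* (‵ 2) :+ 2 :* (‵ 3) :+ 3 :* (‵ 1) ∵ star C b₁∈C a₁∉C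
        ∷ 2 ⊠ ‵ 3 ⩽ con 0 ∵ ≤-reflexive (α≡0 {C} a₁∉C a₂∉C)
        ∷ 2 ⊠ con 1 ⩽ ‵ 4 ∵ ≤-reflexive (sym (β≡1 {C} b₁∈C b₂∈C))
        ∷ 3 ⊠ ‵ 1 ⩽ con 1 :+ ‵ 0 ∵ ≤-reflexive excess
        ∷ 2 ⊠ con 1 :+ ‵ 2 ⩽ con 1 ∵ neg
        ∷ []))

      D-edge : 1 ≤ flow E D Z
      D-edge = flow-term E {D} {Z} xy (∧-intro (⌊≟⌋-refl x) (not-intro x∉Z)) y∈Z

      out-C≤1 : out C ≤ 1
      out-C≤1 = (≮⇒≥ λ neg → farkas (out C ∷ flow E C Z ∷ flow E D Z ∷ back Z ∷ εa Z ∷ εb Z ∷ [])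
        ( 1 ⊠ ‵ 0 ⩽ ‵ 1 ∵ out-C
        ∷ 1 ⊠ ‵ 1 :+ ‵ 2 ⩽ ‵ 3 ∵ entering
        ∷ 1 ⊠ con 1 ⩽ ‵ 2 ∵ D-edge
        ∷ 1 ⊠ ‵ 4 ⩽ con 1 ∵ ≤-reflexive εa≡1
        ∷ 1 ⊠ ‵ 3 :+ ‵ 5 ⩽ con 1 :+ ‵ 4 ∵ ≤-reflexive (sym back-count)
        ∷ 1 ⊠ con 1 :+ con 1 ⩽ ‵ 0 ∵ neg
        ∷ []))

      D-edge≤1 : flow E D Z ≤ 1
      D-edge≤1 = (≮⇒≥ λ neg → farkas (out C ∷ flow E C Z ∷ flow E D Z ∷ back Z ∷ εa Z ∷ εb Z ∷ [])
        ( 1 ⊠ ‵ 0 ⩽ ‵ 1 ∵ out-C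
        ∷ 1 ⊠ ‵ 1 :+ ‵ 2 ⩽ ‵ 3 ∵ entering
        ∷ 1 ⊠ con 1 ⩽ ‵ 0 ∵ out-C≥1
        ∷ 1 ⊠ ‵ 4 ⩽ con 1 ∵ ≤-reflexive εa≡1
        ∷ 1 ⊠ ‵ 3 :+ ‵ 5 ⩽ con 1 :+ ‵ 4 ∵ ≤-reflexive (sym back-count)
        ∷ 1 ⊠ con 1 :+ con 1 ⩽ ‵ 2 ∵ neg
        ∷ []))

      -- Since Z misses b₁ and b₂ and contains only one of a₁, a₂, exactly two edges enter it. One
      -- of them is xy; `star` needs the other one to leave C.
      C-special : Special shape C
      C-special = record { a₁∉ = a₁∉C ; a₂∉ = a₂∉C ; b₁∈ = b₁∈C ; b₂∈ = b₂∈C ; excess = excess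
                         ; out≡1 = ≤-antisym out-C≤1 out-C≥1 }

      C-Z : ∀ v → v ∈ C → v ∉ Z
      C-Z v p = not-true (⊖-⊆ {X = ∁ Z} {a = x} v p)

      without-b : Dependence shape N Z
      without-b = record
        { N-back = ≤-trans N-entering (+-mono-≤
            (≤-reflexive (flow-0 N {C} {Z} λ u v r p q → true≢false q (C-Z v (trans (sym (noncrossing C C-special u v r)) p))))
            (≤-trans (N≤E D Z) D-edge≤1))
        ; special-below = λ _ → C , C-special , C-Z , ≤-trans out-C≥1 out-C
        ; special-above = ⊥-elim ∘ not-both-a }

    touching : Dependence shape N Z
    touching = [ with-b , without-b ]′ (bool (Z b₁ ∨ Z b₂))

  -- Uncrossing Z with the second violator Y. By `star` both the intersection I and the union have
  -- more vertices of B than of A, and the two excesses add up to 2, so each is 1. Then `out C` ≥ 1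
  -- - `εb Z`, `back D` ≥ `εa Z` - 1 and at least one edge runs from O to I, whereas these three
  -- numbers add up to at most `back Z` = 1 + `εa Z` - `εb Z`. Hence all three bounds are tight.
  module Crossing {x y Y} (Y-only : Only s t Y) (a₁∉Y : a₁ ∉ Y) (a₂∉Y : a₂ ∉ Y) (b₁∈Y : b₁ ∈ Y) (b₂∈Y : b₂ ∈ Y)
    (Y-excess : nB Y ≡ 2 + nA Y) (x∉Z : x ∉ Z) (y∈Z : y ∈ Z) (x∉Y : x ∉ Y) (y∈Y : y ∈ Y) (xy : E x y ≡ true) where

    I C D O : VSet n
    I = Z ∩ Y
    C = Y ∖ Z
    D = Z ∖ Y
    O x = not (Z x ∨ Y x)

    I-only : Only s t I
    I-only u v e p q with bool (Z v)
    ... | inj₁ r = Y-only u v e (∧ʳ {Z u} p) (∧-false q r)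
    ... | inj₂ r = only u v e (∧ˡ {Z u} p) r

    U-only : Only s t (Z ∪ Y)
    U-only u v e p q with ∨-true {Z u} p
    ... | inj₁ r = only u v e r (proj₁ (∨-false {Z v} q))
    ... | inj₂ r = Y-only u v e r (proj₂ (∨-false {Z v} q))

    modular : ∀ c → cnt c I + cnt c (Z ∪ Y) ≡ cnt c Z + cnt c Y
    modular c = cnt-≡ {2} (λ { (z ∷ y ∷ []) → z ∧ y ∷ (z ∨ y) ∷ [] }) (λ { (z ∷ y ∷ []) → z ∷ y ∷ [] }) c (Z ∷ Y ∷ [])

    split-Y : ∀ c → cnt c Y ≡ cnt c I + cnt c C
    split-Y c = cnt-≡ {2} (λ { (z ∷ y ∷ []) → y ∷ [] }) (λ { (z ∷ y ∷ []) → z ∧ y ∷ y ∧ not z ∷ [] }) c (Z ∷ Y ∷ [])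

    split-Z : ∀ c → cnt c Z ≡ cnt c I + cnt c D
    split-Z c = cnt-≡ {2} (λ { (z ∷ y ∷ []) → z ∷ [] }) (λ { (z ∷ y ∷ []) → z ∧ y ∷ z ∧ not y ∷ [] }) c (Z ∷ Y ∷ [])

    I-deficit : 1 + nA I ≤ nB I
    I-deficit = (≮⇒≥ λ neg → farkas (nA I ∷ nB I ∷ out I ∷ α I ∷ β I ∷ [])
      ( 1 ⊠ con 3 :+ 3 :* (‵ 0) :+ 2 :* (‵ 4) ⩽ 2 :* (‵ 2) :+ 2 :* (‵ 3) :+ 3 :* (‵ 1)
            ∵ star I (∧-intro y∈Z y∈Y) (¬true λ p → true≢false (∧ˡ {Z x} p) x∉Z)
      ∷ 2 ⊠ ‵ 2 ⩽ con 1 ∵ only-out {X = I} I-only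
      ∷ 2 ⊠ ‵ 3 ⩽ con 0
            ∵ ≤-reflexive (α≡0 {I} (¬true λ p → true≢false (∧ʳ {Z a₁} p) a₁∉Y) (¬true λ p → true≢false (∧ʳ {Z a₂} p) a₂∉Y))
      ∷ 3 ⊠ con 1 :+ ‵ 1 ⩽ con 1 :+ ‵ 0 ∵ neg
      ∷ []))

    U-deficit : 1 + nA (Z ∪ Y) ≤ nB (Z ∪ Y)
    U-deficit = (≮⇒≥ λ neg → farkas (nA (Z ∪ Y) ∷ nB (Z ∪ Y) ∷ out (Z ∪ Y) ∷ α (Z ∪ Y) ∷ β (Z ∪ Y) ∷ [])
      ( 1 ⊠ con 3 :+ 3 :* (‵ 0) :+ 2 :* (‵ 4) ⩽ 2 :* (‵ 2) :+ 2 :* (‵ 3) :+ 3 :* (‵ 1)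
            ∵ star (Z ∪ Y) {y} {x} (∨-introˡ y∈Z) (∨-false-intro x∉Z x∉Y)
      ∷ 2 ⊠ ‵ 2 ⩽ con 1 ∵ only-out {X = Z ∪ Y} U-only
      ∷ 2 ⊠ ‵ 3 ⩽ con 1 ∵ ⟪⟫≤1 ((Z ∪ Y) a₁ ∨ (Z ∪ Y) a₂)
      ∷ 2 ⊠ con 1 ⩽ ‵ 4 ∵ ≤-reflexive (sym (β≡1 {Z ∪ Y} (∨-introʳ b₁∈Y) (∨-introʳ b₂∈Y)))
      ∷ 3 ⊠ con 1 :+ ‵ 1 ⩽ con 1 :+ ‵ 0 ∵ neg
      ∷ []))

    I-excess : nB I ≡ 1 + nA I
    I-excess = ≤-antisym
      (≮⇒≥ λ neg → farkas (nA I ∷ nB I ∷ nA (Z ∪ Y) ∷ nB (Z ∪ Y) ∷ nA Z ∷ nB Z ∷ nA Y ∷ nB Y ∷ [])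
        ( 1 ⊠ con 1 :+ ‵ 2 ⩽ ‵ 3 ∵ U-deficit
        ∷ 1 ⊠ ‵ 5 ⩽ ‵ 4 ∵ ≤-reflexive (sym nA≡nB)
        ∷ 1 ⊠ ‵ 7 ⩽ con 2 :+ ‵ 6 ∵ ≤-reflexive Y-excess
        ∷ 1 ⊠ ‵ 4 :+ ‵ 6 ⩽ ‵ 0 :+ ‵ 2 ∵ ≤-reflexive (sym (modular A))
        ∷ 1 ⊠ ‵ 1 :+ ‵ 3 ⩽ ‵ 5 :+ ‵ 7 ∵ ≤-reflexive (modular B)
        ∷ 1 ⊠ con 1 :+ (con 1 :+ ‵ 0) ⩽ ‵ 1 ∵ neg
        ∷ [])) I-deficit

    C-excess : nB C ≡ 1 + nA C
    C-excess = equate (nA I ∷ nB I ∷ nA Y ∷ nB Y ∷ nA C ∷ nB C ∷ []) 1 (‵ 5) (con 1 :+ ‵ 4)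
      ( 1 ⊠ con 1 :+ ‵ 0 ≐ ‵ 1 ∵ sym I-excess
      ∷ 1 ⊠ ‵ 3 ≐ con 2 :+ ‵ 2 ∵ Y-excess
      ∷ 1 ⊠ ‵ 2 ≐ ‵ 0 :+ ‵ 4 ∵ split-Y A
      ∷ 1 ⊠ ‵ 1 :+ ‵ 5 ≐ ‵ 3 ∵ sym (split-Y B)
      ∷ [])

    D-excess : nA D ≡ 1 + nB D
    D-excess = equate (nA I ∷ nB I ∷ nA Z ∷ nB Z ∷ nA D ∷ nB D ∷ []) 1 (‵ 4) (con 1 :+ ‵ 5)
      ( 1 ⊠ ‵ 1 ≐ con 1 :+ ‵ 0 ∵ I-excess
      ∷ 1 ⊠ ‵ 2 ≐ ‵ 3 ∵ nA≡nB
      ∷ 1 ⊠ ‵ 0 :+ ‵ 4 ≐ ‵ 2 ∵ sym (split-Z A)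
      ∷ 1 ⊠ ‵ 3 ≐ ‵ 1 :+ ‵ 5 ∵ split-Z B
      ∷ [])

    C-∉Z : ∀ v → v ∈ C → v ∉ Z
    C-∉Z v p = not-true (∧ʳ {Y v} p)

    C-O : flow E C O ≡ 0
    C-O = flow-0 E {C} {O} λ u v e p q → escape u v e p (proj₂ (∨-false {Z v} (not-true q)))
      where
      escape : ∀ u v → E u v ≡ true → u ∈ C → v ∉ Y → ⊥
      escape u v e p q with Y-only u v e (∧ˡ {Y u} p) q
      ... | refl , _ = true≢false s∈ (C-∉Z u p)

    Y-D : flow E Y D ≡ 0
    Y-D = flow-0 E {Y} {D} escape
      where
      escape : ∀ u v → E u v ≡ true → u ∈ Y → v ∈ D → ⊥
      escape u v e p q with Y-only u v e p (not-true (∧ʳ {Z v} q))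
      ... | _ , refl = true≢false (∧ˡ {Z v} q) t∉

    O-I : 1 ≤ flow E O I
    O-I = flow-term E {O} {I} xy (not-intro (∨-false-intro x∉Z x∉Y)) (∧-intro y∈Z y∈Y)

    -- The two extra flows on the right vanish: the only edge leaving Y is st, which neither starts
    -- outside Z nor ends in Z.
    cells : out C + (back D + flow E O I) ≤ back Z + (flow E C O + flow E Y D)
    cells = flow-≤ {2}
      (λ { (z ∷ y ∷ []) → (y ∧ not z , not (y ∧ not z)) ∷ (not (z ∧ not y) , z ∧ not y) ∷ (not (z ∨ y) , z ∧ y) ∷ [] })
      (λ { (z ∷ y ∷ []) → (not z , z) ∷ (y ∧ not z , not (z ∨ y)) ∷ (y , z ∧ not y) ∷ [] }) E (Z ∷ Y ∷ [])

    N-cells : flow N (∁ Z) Z ≤ flow N C I + (flow N O D + (flow N O I + flow N Y D))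
    N-cells = flow-≤ {2} (λ { (z ∷ y ∷ []) → (not z , z) ∷ [] })
      (λ { (z ∷ y ∷ []) → (y ∧ not z , z ∧ y) ∷ (not (z ∨ y) , z ∧ not y) ∷ (not (z ∨ y) , z ∧ y) ∷ (y , z ∧ not y) ∷ [] })
      N (Z ∷ Y ∷ [])

    b-cases : ∀ p q → p ∧ q ≡ false → 1 ≤ ⟪ not p ∧ not q ⟫ + (⟪ p ⟫ + ⟪ q ⟫)
    b-cases true false _ = s≤s z≤n
    b-cases false true _ = s≤s z≤n
    b-cases false false _ = s≤s z≤n

    β-C : 1 ≤ β C + εb Z
    β-C rewrite b₁∈Y | b₂∈Y = b-cases (Z b₁) (Z b₂) misses-b

    α-C : α C ≡ 0
    α-C = α≡0 {C} (cong (_∧ not (Z a₁)) a₁∉Y) (cong (_∧ not (Z a₂)) a₂∉Y)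

    C-element : ∃ λ v → v ∈ B × v ∈ C
    C-element = cnt-witness B {C} (subst (1 ≤_) (sym C-excess) (s≤s z≤n))

    D-element : ∃ λ v → v ∈ A × v ∈ D
    D-element = cnt-witness A {D} (subst (1 ≤_) (sym D-excess) (s≤s z≤n))

    out-C≥ : 1 ≤ out C + εb Z
    out-C≥ = (≮⇒≥ λ neg → farkas (nA C ∷ nB C ∷ out C ∷ α C ∷ β C ∷ εb Z ∷ [])
      ( 1 ⊠ con 3 :+ 3 :* (‵ 0) :+ 2 :* (‵ 4) ⩽ 2 :* (‵ 2) :+ 2 :* (‵ 3) :+ 3 :* (‵ 1)
            ∵ star C (proj₂ (proj₂ C-element)) (¬true λ p → true≢false s∈ (C-∉Z s p))
      ∷ 2 ⊠ ‵ 3 ⩽ con 0 ∵ ≤-reflexive α-C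
      ∷ 3 ⊠ ‵ 1 ⩽ con 1 :+ ‵ 0 ∵ ≤-reflexive C-excess
      ∷ 2 ⊠ con 1 ⩽ ‵ 4 :+ ‵ 5 ∵ β-C
      ∷ 2 ⊠ con 1 :+ (‵ 2 :+ ‵ 5) ⩽ con 1 ∵ neg
      ∷ []))

    εa-D : εa D ≡ εa Z
    εa-D = cong₂ (λ p q → ⟪ p ⟫ + ⟪ q ⟫) (in-Z a₁∉Y) (in-Z a₂∉Y)
      where
      in-Z : ∀ {v} → v ∉ Y → D v ≡ Z v
      in-Z {v} p = trans (cong (λ b → Z v ∧ not b) p) (∧-identityʳ (Z v))

    εb-D : εb D ≡ 0
    εb-D = cong₂ (λ p q → ⟪ p ⟫ + ⟪ q ⟫) (∉D b₁∈Y) (∉D b₂∈Y)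
      where
      ∉D : ∀ {v} → v ∈ Y → v ∉ D
      ∉D {v} p = trans (cong (λ b → Z v ∧ not b) p) (∧-zeroʳ (Z v))

    back-D≥ : εa Z ≤ 1 + back D
    back-D≥ = (≮⇒≥ λ neg → farkas (nA D ∷ nB D ∷ out D ∷ back D ∷ α D ∷ β D ∷ εa Z ∷ εa D ∷ εb D ∷ [])
      ( 1 ⊠ con 3 :+ 3 :* (‵ 0) :+ 2 :* (‵ 5) ⩽ 2 :* (‵ 2) :+ 2 :* (‵ 4) :+ 3 :* (‵ 1)
            ∵ star D (proj₂ (proj₂ D-element)) (¬true λ p → true≢false (∧ˡ {Z t} p) t∉)
      ∷ 2 ⊠ ‵ 4 ⩽ con 1 ∵ ⟪⟫≤1 (D a₁ ∨ D a₂)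
      ∷ 3 ⊠ ‵ 0 ⩽ con 1 :+ ‵ 1 ∵ ≤-reflexive D-excess
      ∷ 2 ⊠ ‵ 2 :+ 3 :* (‵ 1) :+ ‵ 7 ⩽ ‵ 3 :+ 3 :* (‵ 0) :+ ‵ 8 ∵ ≤-reflexive (balance D)
      ∷ 2 ⊠ ‵ 6 ⩽ ‵ 7 ∵ ≤-reflexive (sym εa-D)
      ∷ 2 ⊠ ‵ 8 ⩽ con 0 ∵ ≤-reflexive εb-D
      ∷ 2 ⊠ con 1 :+ (con 1 :+ ‵ 3) ⩽ ‵ 6 ∵ neg
      ∷ []))

    out-C≤ : out C + εb Z ≤ 1
    out-C≤ = (≮⇒≥ λ neg → farkas (out C ∷ εb Z ∷ back D ∷ flow E O I ∷ back Z ∷ flow E C O ∷ flow E Y D ∷ εa Z ∷ [])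
      ( 1 ⊠ ‵ 0 :+ (‵ 2 :+ ‵ 3) ⩽ ‵ 4 :+ (‵ 5 :+ ‵ 6) ∵ cells
      ∷ 1 ⊠ ‵ 5 ⩽ con 0 ∵ ≤-reflexive C-O
      ∷ 1 ⊠ ‵ 6 ⩽ con 0 ∵ ≤-reflexive Y-D
      ∷ 1 ⊠ con 1 ⩽ ‵ 3 ∵ O-I
      ∷ 1 ⊠ ‵ 4 :+ ‵ 1 ⩽ con 1 :+ ‵ 7 ∵ ≤-reflexive (sym back-count)
      ∷ 1 ⊠ ‵ 7 ⩽ con 1 :+ ‵ 2 ∵ back-D≥
      ∷ 1 ⊠ con 1 :+ con 1 ⩽ ‵ 0 :+ ‵ 1 ∵ neg
      ∷ []))

    back-D≤ : 1 + back D ≤ εa Z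
    back-D≤ = (≮⇒≥ λ neg → farkas (out C ∷ εb Z ∷ back D ∷ flow E O I ∷ back Z ∷ flow E C O ∷ flow E Y D ∷ εa Z ∷ [])
      ( 1 ⊠ ‵ 0 :+ (‵ 2 :+ ‵ 3) ⩽ ‵ 4 :+ (‵ 5 :+ ‵ 6) ∵ cells
      ∷ 1 ⊠ ‵ 5 ⩽ con 0 ∵ ≤-reflexive C-O
      ∷ 1 ⊠ ‵ 6 ⩽ con 0 ∵ ≤-reflexive Y-D
      ∷ 1 ⊠ con 1 ⩽ ‵ 3 ∵ O-I
      ∷ 1 ⊠ ‵ 4 :+ ‵ 1 ⩽ con 1 :+ ‵ 7 ∵ ≤-reflexive (sym back-count)
      ∷ 1 ⊠ con 1 ⩽ ‵ 0 :+ ‵ 1 ∵ out-C≥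
      ∷ 1 ⊠ con 1 :+ ‵ 7 ⩽ con 1 :+ ‵ 2 ∵ neg
      ∷ []))

    O-I≤1 : flow E O I ≤ 1
    O-I≤1 = (≮⇒≥ λ neg → farkas (out C ∷ εb Z ∷ back D ∷ flow E O I ∷ back Z ∷ flow E C O ∷ flow E Y D ∷ εa Z ∷ [])
      ( 1 ⊠ ‵ 0 :+ (‵ 2 :+ ‵ 3) ⩽ ‵ 4 :+ (‵ 5 :+ ‵ 6) ∵ cells
      ∷ 1 ⊠ ‵ 5 ⩽ con 0 ∵ ≤-reflexive C-O
      ∷ 1 ⊠ ‵ 6 ⩽ con 0 ∵ ≤-reflexive Y-D
      ∷ 1 ⊠ ‵ 4 :+ ‵ 1 ⩽ con 1 :+ ‵ 7 ∵ ≤-reflexive (sym back-count)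
      ∷ 1 ⊠ con 1 ⩽ ‵ 0 :+ ‵ 1 ∵ out-C≥
      ∷ 1 ⊠ ‵ 7 ⩽ con 1 :+ ‵ 2 ∵ back-D≥
      ∷ 1 ⊠ con 1 :+ con 1 ⩽ ‵ 3 ∵ neg
      ∷ []))

    C-special : Z b₁ ∨ Z b₂ ≡ false → Special shape C
    C-special h = record
      { a₁∉ = cong (_∧ not (Z a₁)) a₁∉Y ; a₂∉ = cong (_∧ not (Z a₂)) a₂∉Y
      ; b₁∈ = ∧-intro b₁∈Y (not-intro (proj₁ (∨-false {Z b₁} h))) ; b₂∈ = ∧-intro b₂∈Y (not-intro (proj₂ (∨-false {Z b₁} h)))
      ; excess = C-excess
      ; out≡1 = trans (sym (+-identityʳ _)) (subst (λ e → out C + e ≡ 1) (∨-zero {Z b₁} h) (≤-antisym out-C≤ out-C≥)) }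

    D-special : Z a₁ ∧ Z a₂ ≡ true → Special shape (∁ D)
    D-special h = record
      { a₁∉ = cong not (∧-intro (∧ˡ {Z a₁} h) (not-intro a₁∉Y))
      ; a₂∉ = cong not (∧-intro (∧ʳ {Z a₁} h) (not-intro a₂∉Y))
      ; b₁∈ = not-intro (trans (cong (λ b → Z b₁ ∧ not b) b₁∈Y) (∧-zeroʳ (Z b₁)))
      ; b₂∈ = not-intro (trans (cong (λ b → Z b₂ ∧ not b) b₂∈Y) (∧-zeroʳ (Z b₂)))
      ; excess = Mirror.∁-excess (mirror S) {D} {1} D-excess
      ; out≡1 = trans (flow-cong E {∁ D} (λ _ → refl) (sym ∘ not² D)) (suc-injective (trans (≤-antisym back-D≤ back-D≥) two)) }
      where
      two : εa Z ≡ 2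
      two = cong₂ (λ p q → ⟪ p ⟫ + ⟪ q ⟫) (∧ˡ {Z a₁} h) (∧ʳ {Z a₁} h)

    -- Either Z contains one of b₁, b₂, and the tight bound leaves no edge going out of C, or C is
    -- special and N does not cross it. The analogous alternative for D is in `N-D`.
    N-C : flow N C I ≡ 0
    N-C = [ (λ h → n≤0⇒n≡0 (≤-trans (N≤E C I) (≤-trans C-I
              (≮⇒≥ λ neg → farkas (out C ∷ εb Z ∷ [])
                ( 1 ⊠ ‵ 0 :+ ‵ 1 ⩽ con 1 ∵ out-C≤
                ∷ 1 ⊠ con 1 ⩽ ‵ 1 ∵ ∨-positive {Z b₁} h
                ∷ 1 ⊠ con 1 :+ con 0 ⩽ ‵ 0 ∵ neg
                ∷ [])))))
          , (λ h → flow-0 N {C} {I} λ u v r p q → true≢false (∧ˡ {Z v} q)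
                     (C-∉Z v (trans (sym (noncrossing C (C-special h) u v r)) p))) ]′ (bool (Z b₁ ∨ Z b₂))
      where
      C-I : flow E C I ≤ out C
      C-I = flow-mono {R = E} {S = E} {P = C} {P′ = C} {Q = I} {Q′ = ∁ C} (λ _ _ e → e) (λ _ p → p) λ v q →
              not-intro (¬true λ p → true≢false (∧ˡ {Z v} q) (C-∉Z v p))

    one-a : ∀ p q → p ∧ q ≡ false → ⟪ p ⟫ + ⟪ q ⟫ ≤ 1
    one-a true false _ = s≤s z≤n
    one-a false true _ = s≤s z≤n
    one-a false false _ = z≤n

    N-D : flow N O D ≡ 0
    N-D = [ (λ h → flow-0 N {O} {D} λ u v r p q → true≢false
              (trans (sym (noncrossing (∁ D) (D-special h) u v r)) (not-intro (O-∉D u p))) (cong not q))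
          , (λ h → n≤0⇒n≡0 (≤-trans (N≤E O D) (≤-trans O-D
              (≮⇒≥ λ neg → farkas (back D ∷ εa Z ∷ [])
                ( 1 ⊠ con 1 :+ ‵ 0 ⩽ ‵ 1 ∵ back-D≤
                ∷ 1 ⊠ ‵ 1 ⩽ con 1 ∵ one-a (Z a₁) (Z a₂) h
                ∷ 1 ⊠ con 1 :+ con 0 ⩽ ‵ 0 ∵ neg
                ∷ []))))) ]′ (bool (Z a₁ ∧ Z a₂))
      where
      O-∉D : ∀ v → v ∈ O → v ∉ D
      O-∉D v p = ¬true λ q → true≢false (∧ˡ {Z v} q) (proj₁ (∨-false {Z v} (not-true p)))

      O-D : flow E O D ≤ back D
      O-D = flow-mono {R = E} {S = E} {P = O} {P′ = ∁ D} {Q = D} {Q′ = D} (λ _ _ e → e) (λ v p → not-intro (O-∉D v p)) (λ _ q → q)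

    crossing : Dependence shape N Z
    crossing = record
      { N-back = (≮⇒≥ λ neg → farkas (flow N (∁ Z) Z ∷ flow N C I ∷ flow N O D ∷ flow N O I ∷ flow N Y D
          ∷ flow E O I ∷ flow E Y D ∷ [])
        ( 1 ⊠ ‵ 0 ⩽ ‵ 1 :+ (‵ 2 :+ (‵ 3 :+ ‵ 4)) ∵ N-cells
        ∷ 1 ⊠ ‵ 1 ⩽ con 0 ∵ ≤-reflexive N-C
        ∷ 1 ⊠ ‵ 2 ⩽ con 0 ∵ ≤-reflexive N-D
        ∷ 1 ⊠ ‵ 3 ⩽ ‵ 5 ∵ N≤E O I
        ∷ 1 ⊠ ‵ 5 ⩽ con 1 ∵ O-I≤1
        ∷ 1 ⊠ ‵ 4 ⩽ ‵ 6 ∵ N≤E Y D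
        ∷ 1 ⊠ ‵ 6 ⩽ con 0 ∵ ≤-reflexive Y-D
        ∷ 1 ⊠ con 1 :+ con 1 ⩽ ‵ 0 ∵ neg
        ∷ []))
      ; special-below = λ h → C , C-special h , C-∉Z , ≤-trans (≤-reflexive (sym (Special.out≡1 (C-special h)))) C-Z
      ; special-above = λ h → ∁ D , D-special h , (λ v p → (∧ˡ {Z v} (not-false p)))
                            , subst (1 ≤_) (flow-cong E {∁ Z} (λ _ → refl) (not² D)) (Z-D h) }
      where
      C-Z : out C ≤ flow E C Z
      C-Z = ≤-trans (flow-≤ {2} (λ { (z ∷ y ∷ []) → (y ∧ not z , not (y ∧ not z)) ∷ [] })
                                (λ { (z ∷ y ∷ []) → (y ∧ not z , z) ∷ (y ∧ not z , not (z ∨ y)) ∷ [] }) E (Z ∷ Y ∷ []))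
                    (≤-reflexive (trans (cong (flow E C Z +_) C-O) (+-identityʳ _)))

      Z-D : Z a₁ ∧ Z a₂ ≡ true → 1 ≤ flow E (∁ Z) D
      Z-D h = (≮⇒≥ λ neg → farkas (flow E (∁ Z) D ∷ flow E Y D ∷ back D ∷ flow E (∁ D) (∁ (∁ D)) ∷ [])
        ( 1 ⊠ ‵ 2 ⩽ ‵ 0 :+ ‵ 1
              ∵ flow-≤ {2} (λ { (z ∷ y ∷ []) → (not (z ∧ not y) , z ∧ not y) ∷ [] }) (λ { (z ∷ y ∷ []) → (not z , z ∧ not y) ∷ (y , z ∧ not y) ∷ [] }) E (Z ∷ Y ∷ [])
        ∷ 1 ⊠ ‵ 1 ⩽ con 0 ∵ ≤-reflexive Y-D
        ∷ 1 ⊠ con 1 ⩽ ‵ 3 ∵ ≤-reflexive (sym (Special.out≡1 (D-special h)))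
        ∷ 1 ⊠ ‵ 3 ⩽ ‵ 2 ∵ ≤-reflexive (sym (flow-cong E {∁ D} (λ _ → refl) (not² D)))
        ∷ 1 ⊠ con 1 :+ ‵ 0 ⩽ con 1 ∵ neg
        ∷ []))

-- From violators to removability

-- An edge of a relation crossing no special set is removable unless Hall's condition yields a set Z of this kind.
module Removal {n} (S : Setup n) {N : Adj n} (N⊆E : Within S N) (noncrossing : NonCrossing (Setup.shape S) N)
  {s t : Fin n} (st∈N : N s t ≡ true)
  (refute : ∀ Z → Obstruction (Setup.shape S) s t Z → Dependence (Setup.shape S) N Z → ⊥) where

  open Perfect S
  open Basics S
  open Facts S
  open Deleted (N⊆E s t st∈N)
  open Structure S N⊆E noncrossing st∈N

  private
    -- The case of an edge ending in b₁ or b₂ is `touching` for the exchanged classes and the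
    -- complement of Z. Complementing twice returns Z only pointwise, hence the transport.
    touching-b : ∀ {x y Z} → Obstruction shape s t Z → y ≡ b₁ ⊎ y ≡ b₂ → x ∉ Z → y ∈ Z → E x y ≡ true → Dependence shape N Z
    touching-b {x} {y} {Z} ob y-end x∉Z y∈Z xy = from-mirror
      (Dependent.Touching.touching (mirror S) {transpose N}
        (λ u v p → trans (Mirror.mirror-E S u v) (N⊆E v u p))
        (λ X sp u v p → Mirror.mirror-noncrossing (mirror S) {transpose N} noncrossing X sp u v p)
        (Mirror.mirror-obstruction S ob) y-end (cong not y∈Z) (not-intro x∉Z) (trans (Mirror.mirror-E S y x) xy))
      where
      from-mirror : Dependence (flip shape) (transpose N) (∁ Z) → Dependence shape N Z
      from-mirror dep = transport (mirror-dependence (mirror S) dep)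
        where
        transport : Dependence shape N (∁ (∁ Z)) → Dependence shape N Z
        transport dep = record
          { N-back = subst (_≤ 1) (flow-cong N (λ v → sym (not² (∁ Z) v)) (λ v → sym (not² Z v))) N-back
          ; special-below = λ h → below (special-below (trans (cong₂ _∨_ (sym (not² Z b₁)) (sym (not² Z b₂))) h))
          ; special-above = λ h → above (special-above (trans (cong₂ _∧_ (sym (not² Z a₁)) (sym (not² Z a₂))) h)) }
          where
          open Dependence dep
          below : (∃ λ C → Special shape C × (∀ x → x ∈ C → x ∉ ∁ (∁ Z)) × 1 ≤ flow E C (∁ (∁ Z))) →
                  ∃ λ C → Special shape C × (∀ x → x ∈ C → x ∉ Z) × 1 ≤ flow E C Z
          below (C , sp , h , k) = C , sp , (λ x p → trans (not² Z x) (h x p)) ,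
                                   subst (1 ≤_) (flow-cong E {C} (λ _ → refl) (λ v → sym (not² Z v))) k
          above : (∃ λ C → Special shape C × (∀ x → x ∉ C → x ∈ ∁ (∁ Z)) × 1 ≤ flow E (∁ (∁ (∁ Z))) (∁ C)) →
                  ∃ λ C → Special shape C × (∀ x → x ∉ C → x ∈ Z) × 1 ≤ flow E (∁ Z) (∁ C)
          above (C , sp , h , k) = C , sp , (λ x p → trans (not² Z x) (h x p)) ,
                                   subst (1 ≤_) (flow-cong E {Q = ∁ C} (λ v → sym (not² (∁ Z) v)) (λ _ → refl)) k

  through-E : ∀ {x y} → R x y ≡ true → PMThrough x y
  through-E {x} {y} r = [ id , blocked ]′ (obstruction r)
    where
    xy : E x y ≡ true
    xy = R⊆E x y r

    blocked : (∃ λ Z → Obstruction shape s t Z × x ∉ Z × y ∈ Z) → PMThrough x y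
    blocked (Z , ob , x∉Z , y∈Z) = decide (x ≟ a₁) (x ≟ a₂) (y ≟ b₁) (y ≟ b₂)
      where
      second : ∃ (Second x y) → PMThrough x y
      second (Y , sec) = ⊥-elim (refute Z ob (Dependent.Crossing.crossing S N⊆E noncrossing ob
                           only a₁∉ a₂∉ b₁∈ b₂∈ excess x∉Z y∈Z x∉ y∈ xy))
        where open Second sec

      decide : Dec (x ≡ a₁) → Dec (x ≡ a₂) → Dec (y ≡ b₁) → Dec (y ≡ b₂) → PMThrough x y
      -- No perfect matching through xy contains a₁a₂ if x is an end of it, and likewise for y and
      -- b₁b₂; only the last clause has a second violator at its disposal.
      decide (yes p) _ _ _ = ⊥-elim (refute Z ob (Dependent.Touching.touching S N⊆E noncrossing ob (inj₁ p) x∉Z y∈Z xy))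
      decide _ (yes p) _ _ = ⊥-elim (refute Z ob (Dependent.Touching.touching S N⊆E noncrossing ob (inj₂ p) x∉Z y∈Z xy))
      decide _ _ (yes p) _ = ⊥-elim (refute Z ob (touching-b ob (inj₁ p) x∉Z y∈Z xy))
      decide _ _ _ (yes p) = ⊥-elim (refute Z ob (touching-b ob (inj₂ p) x∉Z y∈Z xy))
      decide (no p) (no q) (no u) (no v) = [ id , second ]′ (second-obstruction r p q u v)

  every-edge : ∀ u v → G-st u v ≡ true → PMThrough u v
  every-edge u v p = sides (bool (A u)) (bool (A v))
    where
    uv : edge u v ≡ true
    uv = (∧ˡ p)

    kept : samePair u v s t ≡ false
    kept = not-true (∧ʳ {edge u v} p)

    to-B : ∀ {x} → x ∉ A → x ∈ B
    to-B {x} q = trans (B≡∁A x) (not-intro q)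

    sides : u ∈ A ⊎ u ∉ A → v ∈ A ⊎ v ∉ A → PMThrough u v
    sides (inj₁ q) (inj₁ r) = [ (λ { (refl , refl) → perfect-e (proj₂ terminal-matching) })
                              , (λ { (refl , refl) → PMThrough-flip (perfect-e (proj₂ terminal-matching)) }) ]′ (A-edges u v uv q r)
    sides (inj₂ q) (inj₂ r) = [ (λ { (refl , refl) → perfect-f (proj₂ terminal-matching) })
                              , (λ { (refl , refl) → PMThrough-flip (perfect-f (proj₂ terminal-matching)) }) ]′ (B-edges u v uv (to-B q) (to-B r))
    sides (inj₁ q) (inj₂ r) = through-E (∧-intro (∧-intro uv (∧-intro q (to-B r)))
      (not-intro (¬true λ w → true≢false (∨-introˡ w) kept)))
    sides (inj₂ q) (inj₁ r) = PMThrough-flip (through-E (∧-intro (∧-intro (trans (edge-sym v u) uv) (∧-intro r (to-B q)))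
      (not-intro (¬true λ w → true≢false (∨-introˡ w) (trans (sym (samePair-flip u v)) kept)))))

-- Matchings that cross no member of a lattice

Matching-join : ∀ {n} {R : Adj n} {A A₁ A₂ B B₁ B₂ : VSet n} {N₁ N₂ : Adj n} →
                (∀ x → A x ≡ A₁ x ∨ A₂ x) → (∀ x → B x ≡ B₁ x ∨ B₂ x) →
                (∀ x → x ∈ A₁ → x ∈ A₂ → ⊥) → (∀ x → x ∈ B₁ → x ∈ B₂ → ⊥) →
                Matching R A₁ B₁ N₁ → Matching R A₂ B₂ N₂ → Matching R A B (λ x y → N₁ x y ∨ N₂ x y)
Matching-join {A = A} {A₁} {A₂} {B} {B₁} {B₂} {N₁} {N₂} a b disjA disjB m₁ m₂ = record
  { edge = λ x y p → [ M₁.edge x y , M₂.edge x y ]′ (∨-true p)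
  ; left = λ x y p → trans (a x) ([ (λ q → ∨-introˡ (M₁.left x y q)) , (λ q → ∨-introʳ (M₂.left x y q)) ]′ (∨-true p))
  ; right = λ x y p → trans (b y) ([ (λ q → ∨-introˡ (M₁.right x y q)) , (λ q → ∨-introʳ (M₂.right x y q)) ]′ (∨-true p))
  ; row = λ x → trans (∑-cong (λ y → ⟪⟫-∨ (N₁ x y) (N₂ x y) (λ p q → disjA x (M₁.left x y p) (M₂.left x y q))))
      (trans (∑-+ (λ y → ⟪ N₁ x y ⟫) (λ y → ⟪ N₂ x y ⟫)) (trans (cong₂ _+_ (M₁.row x) (M₂.row x))
        (trans (sym (⟪⟫-∨ (A₁ x) (A₂ x) (disjA x))) (cong ⟪_⟫ (sym (a x))))))
  ; col = λ y → trans (∑-cong (λ x → ⟪⟫-∨ (N₁ x y) (N₂ x y) (λ p q → disjA x (M₁.left x y p) (M₂.left x y q))))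
      (trans (∑-+ (λ x → ⟪ N₁ x y ⟫) (λ x → ⟪ N₂ x y ⟫)) (trans (cong₂ _+_ (M₁.col y) (M₂.col y))
        (trans (sym (⟪⟫-∨ (B₁ y) (B₂ y) (disjB y))) (cong ⟪_⟫ (sym (b y)))))) }
  where
  module M₁ = Matching m₁
  module M₂ = Matching m₂

cnt-< : ∀ {n} (c : Fin n → Bool) {X Y : VSet n} {y} → X ⊆ Y → c y ≡ true → y ∈ Y → y ∉ X → cnt c X < cnt c Y
cnt-< c {X} {Y} {y} h cy p q = ∑-mono-< (λ x → ⟪⟫-mono (λ r → ∧-intro (∧ˡ {c x} r) (h x (∧ʳ {c x} r)))) y
  (subst₂ _<_ (sym (cong ⟪_⟫ (trans (cong (c y ∧_) q) (∧-zeroʳ (c y))))) (sym (cong ⟪_⟫ (∧-intro cy p))) (s≤s z≤n))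

cnt-cong-on : ∀ {n} (c : Fin n → Bool) {X Y : VSet n} → (∀ x → c x ≡ true → X x ≡ Y x) → cnt c X ≡ cnt c Y
cnt-cong-on c {X} {Y} h = ∑-cong pointwise
  where
  pointwise : ∀ x → ⟪ c x ∧ X x ⟫ ≡ ⟪ c x ∧ Y x ⟫
  pointwise x with c x in eq
  ... | true = cong ⟪_⟫ (h x eq)
  ... | false = refl

cnt-0 : ∀ {n} (c : Fin n → Bool) {X : VSet n} → (∀ x → c x ≡ true → x ∈ X → ⊥) → cnt c X ≡ 0
cnt-0 {n} c {X} h = trans (cnt-cong-on c {X} {∅} (λ x p → ¬true (h x p)))
                          (trans (∑-cong (λ x → cong ⟪_⟫ (∧-zeroʳ (c x)))) (∑-0 {n}))

cnt-⊎ : ∀ {n} (c : Fin n → Bool) {X Y : VSet n} → (∀ x → x ∈ X → x ∈ Y → ⊥) → cnt c (X ∪ Y) ≡ cnt c X + cnt c Y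
cnt-⊎ c {X} {Y} h = trans (sym (trans (cong (_+ cnt c (X ∪ Y)) (cnt-0 c {X ∩ Y} λ x _ p → h x (∧ˡ {X x} p) (∧ʳ {X x} p))) refl))
  (cnt-≡ {2} (λ { (x ∷ y ∷ []) → x ∧ y ∷ (x ∨ y) ∷ [] }) (λ { (x ∷ y ∷ []) → x ∷ y ∷ [] }) c (X ∷ Y ∷ []))

cnt-⊆ : ∀ {n} (c : Fin n → Bool) {X Y : VSet n} → X ⊆ Y → cnt c Y ≡ cnt c X + cnt c (Y ∖ X)
cnt-⊆ c {X} {Y} h = trans (cnt-cong c recover) (cnt-⊎ c {X} {Y ∖ X} λ x p q → true≢false p (not-true (∧ʳ {Y x} q)))
  where
  recover : Y ≗ X ∪ (Y ∖ X)
  recover x with bool (X x)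
  ... | inj₁ p = trans (h x p) (sym (∨-introˡ p))
  ... | inj₂ q rewrite q = sym (∧-identityʳ (Y x))

cnt-point : ∀ {n} (c : Fin n → Bool) (X : VSet n) a → cnt c (X ∩ ⁅ a ⁆) ≡ ⟪ c a ∧ X a ⟫
cnt-point c X a = trans (∑-cong (λ x → lemma (c x) (X x) (⁅ a ⁆ x))) (∑-δ a (λ x → ⟪ c x ∧ X x ⟫))
  where
  lemma : ∀ p q r → ⟪ p ∧ (q ∧ r) ⟫ ≡ ⟪ r ⟫ * ⟪ p ∧ q ⟫
  lemma true true true = refl
  lemma true true false = refl
  lemma true false true = refl
  lemma true false false = refl
  lemma false q true = refl
  lemma false q false = refl

flow-⊎ : ∀ {n} (R : Adj n) {P P₁ P₂ Q Q₁ Q₂ : VSet n} →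
         (∀ x y → R x y ≡ true → x ∈ P → y ∈ Q → (x ∈ P₁ × y ∈ Q₁) ⊎ (x ∈ P₂ × y ∈ Q₂)) →
         flow R P Q ≤ flow R P₁ Q₁ + flow R P₂ Q₂
flow-⊎ R {P} {P₁} {P₂} {Q} {Q₁} {Q₂} h = ≤-trans
  (∑-mono λ x → ≤-trans (∑-mono λ y → pointwise x y) (≤-reflexive (∑-+ (λ y → ⟪ R x y ∧ (P₁ x ∧ Q₁ y) ⟫) (λ y → ⟪ R x y ∧ (P₂ x ∧ Q₂ y) ⟫))))
  (≤-reflexive (∑-+ (λ x → ∑ λ y → ⟪ R x y ∧ (P₁ x ∧ Q₁ y) ⟫) (λ x → ∑ λ y → ⟪ R x y ∧ (P₂ x ∧ Q₂ y) ⟫)))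
  where
  pointwise : ∀ x y → ⟪ R x y ∧ (P x ∧ Q y) ⟫ ≤ ⟪ R x y ∧ (P₁ x ∧ Q₁ y) ⟫ + ⟪ R x y ∧ (P₂ x ∧ Q₂ y) ⟫
  pointwise x y with bool (R x y) | bool (P x) | bool (Q y)
  ... | inj₂ r | _ | _ rewrite r = z≤n
  ... | inj₁ r | inj₂ p | _ rewrite r | p = z≤n
  ... | inj₁ r | inj₁ p | inj₂ q rewrite r | p | q = z≤n
  ... | inj₁ r | inj₁ p | inj₁ q = ≤-trans (⟪⟫≤1 _)
    ([ (λ u → ≤-trans (≤-reflexive (sym (cong ⟪_⟫ (∧-intro r (∧-intro (proj₁ u) (proj₂ u)))))) (m≤m+n _ _))
     , (λ u → ≤-trans (≤-reflexive (sym (cong ⟪_⟫ (∧-intro r (∧-intro (proj₁ u) (proj₂ u)))))) (m≤n+m _ _)) ]′ (h x y r p q))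

Avoids : ∀ {n} → Adj n → VSet n → Set
Avoids N F = ∀ x y → N x y ≡ true → F x ≡ F y

-- A lattice of sets such that every interval carries a perfect matching (apart from the vertices outside K):
-- then the matching can be chosen so that no edge leaves any member of the lattice.
module Lattice {n} (R : Adj n) (A B K : VSet n) (𝓕 : VSet n → Set)
  (resp : ∀ {X Y} → X ≗ Y → 𝓕 X → 𝓕 Y) (𝓕? : ∀ X → Dec (𝓕 X))
  (∩-closed : ∀ {X Y} → 𝓕 X → 𝓕 Y → 𝓕 (X ∩ Y)) (∪-closed : ∀ {X Y} → 𝓕 X → 𝓕 Y → 𝓕 (X ∪ Y))
  (fill : ∀ {L U v} → 𝓕 L → 𝓕 U → L ⊆ U → v ∈ U → v ∉ L →
          ∃ λ N → Matching R (A ∩ ((U ∖ L) ∩ K)) (B ∩ ((U ∖ L) ∩ K)) N) where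

  private

    Between : VSet n → VSet n → VSet n → Set
    Between L U F = 𝓕 F × L ⊆ F × F ⊆ U × (∃ λ x → x ∈ F × x ∉ L) × (∃ λ y → y ∈ U × y ∉ F)

    between? : ∀ (L U : VSet n) → Dec (∃ (Between L U))
    between? L U = ∃set?
      (λ h (f , lf , fu , (x , p , q) , (y , r , w)) →
         resp h f , (λ v i → trans (sym (h v)) (lf v i)) , (λ v i → fu v (trans (h v) i)) ,
         (x , trans (sym (h x)) p , q) , (y , r , trans (sym (h y)) w))
      (λ F → 𝓕? F ×-dec (L ⊆? F) ×-dec (F ⊆? U) ×-dec any? (λ x → (F x Bool.≟ true) ×-dec (L x Bool.≟ false))
             ×-dec any? (λ y → (U y Bool.≟ true) ×-dec (F y Bool.≟ false)))

    cells : ∀ {L F U : VSet n} → L ⊆ F → F ⊆ U → ∀ x → (U ∖ L) x ≡ (F ∖ L) x ∨ (U ∖ F) x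
    cells {L} {F} {U} lf fu x with bool (L x) | bool (F x)
    ... | inj₁ l | _ rewrite l | lf x l = trans (∧-zeroʳ (U x)) (sym (∧-zeroʳ (U x)))
    ... | inj₂ l | inj₁ f rewrite l | f | fu x f = refl
    ... | inj₂ l | inj₂ f rewrite l | f = refl

    spread : ∀ c k x y → c ∧ ((x ∨ y) ∧ k) ≡ (c ∧ (x ∧ k)) ∨ (c ∧ (y ∧ k))
    spread false k x y = refl
    spread true true true y = refl
    spread true true false y = refl
    spread true false true y = sym (∧-zeroʳ y)
    spread true false false y = refl

    -- Recursion on the number of vertices of U outside L. A member strictly between L and U splits
    -- the interval into two shorter ones, whose matchings are joined; if there is none, any
    -- matching supplied by `fill` will do.
    search : ∀ k (L U : VSet n) {v : Fin n} → cnt V (U ∖ L) < k → 𝓕 L → 𝓕 U → L ⊆ U → v ∈ U → v ∉ L →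
             ∃ λ N → Matching R (A ∩ ((U ∖ L) ∩ K)) (B ∩ ((U ∖ L) ∩ K)) N × (∀ F → 𝓕 F → Avoids N F)
    search (suc k) L U {v} (s≤s size) l u L⊆U v∈U v∉L = decide (between? L U)
      where
      Result = ∃ λ N → Matching R (A ∩ ((U ∖ L) ∩ K)) (B ∩ ((U ∖ L) ∩ K)) N × (∀ F → 𝓕 F → Avoids N F)

      decide : Dec (∃ (Between L U)) → Result
      decide (yes (F , f , L⊆F , F⊆U , (x , x∈F , x∉L) , (y , y∈U , y∉F))) = join
        (search k L F (≤-trans (cnt-< V {F ∖ L} {U ∖ L} {y} smaller₁ refl (∧-intro y∈U (not-intro y∉L)) (cong (_∧ not (L y)) y∉F)) size)
                l f L⊆F x∈F x∉L)
        (search k F U (≤-trans (cnt-< V {U ∖ F} {U ∖ L} {x} smaller₂ refl (∧-intro (F⊆U x x∈F) (not-intro x∉L))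
                                 (trans (cong (λ b → U x ∧ not b) x∈F) (∧-zeroʳ (U x)))) size)
                f u F⊆U y∈U y∉F)
        where
        y∉L : y ∉ L
        y∉L = ¬true λ p → true≢false (L⊆F y p) y∉F

        smaller₁ : (F ∖ L) ⊆ (U ∖ L)
        smaller₁ w p = ∧-intro (F⊆U w (∧ˡ {F w} p)) (∧ʳ {F w} p)

        smaller₂ : (U ∖ F) ⊆ (U ∖ L)
        smaller₂ w p = ∧-intro (∧ˡ {U w} p) (not-intro (¬true λ q → true≢false (L⊆F w q) (not-true (∧ʳ {U w} p))))

        apart : ∀ C w → w ∈ C ∩ ((F ∖ L) ∩ K) → w ∈ C ∩ ((U ∖ F) ∩ K) → ⊥
        apart C w p q = true≢false
          (∧ˡ {F w} (∧ˡ {F w ∧ not (L w)} (∧ʳ {C w} p)))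
          (not-true (∧ʳ {U w} (∧ˡ {U w ∧ not (F w)} (∧ʳ {C w} q))))

        whole : ∀ C w → (C ∩ ((U ∖ L) ∩ K)) w ≡ (C ∩ ((F ∖ L) ∩ K)) w ∨ (C ∩ ((U ∖ F) ∩ K)) w
        whole C w = trans (cong (λ b → C w ∧ (b ∧ K w)) (cells L⊆F F⊆U w)) (spread (C w) (K w) ((F ∖ L) w) ((U ∖ F) w))

        join : (∃ λ N → Matching R (A ∩ ((F ∖ L) ∩ K)) (B ∩ ((F ∖ L) ∩ K)) N × (∀ F → 𝓕 F → Avoids N F)) →
               (∃ λ N → Matching R (A ∩ ((U ∖ F) ∩ K)) (B ∩ ((U ∖ F) ∩ K)) N × (∀ F → 𝓕 F → Avoids N F)) → Result
        join (N₁ , m₁ , avoid₁) (N₂ , m₂ , avoid₂) = (λ x y → N₁ x y ∨ N₂ x y) ,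
          Matching-join (whole A) (whole B) (apart A) (apart B) m₁ m₂ ,
          λ G g x y p → [ avoid₁ G g x y , avoid₂ G g x y ]′ (∨-true p)
      decide (no none) = uncrossed (fill l u L⊆U v∈U v∉L)
        where
        uncrossed : (∃ λ N → Matching R (A ∩ ((U ∖ L) ∩ K)) (B ∩ ((U ∖ L) ∩ K)) N) → Result
        uncrossed (N , m) = N , m , avoid
          where
          inside : ∀ C w → w ∈ C ∩ ((U ∖ L) ∩ K) → w ∈ U × w ∉ L
          inside C w p with ∧-true {U w} (∧ˡ {U w ∧ not (L w)} (∧ʳ {C w} p))
          ... | q , r = q , not-true r

          separated : ∀ F → 𝓕 F → ∀ x y → x ∈ U × x ∉ L → y ∈ U × y ∉ L → x ∈ F → y ∉ F → ⊥
          -- A member that separates two vertices of the interval is pushed into it by uniting with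
          -- L and intersecting with U; the result would lie strictly between L and U.
          separated F f x y (x∈U , x∉L) (y∈U , y∉L) x∈F y∉F = none ((F ∪ L) ∩ U ,
            ∩-closed (∪-closed f l) u , (λ w p → ∧-intro (∨-introʳ p) (L⊆U w p)) , (λ w p → (∧ʳ {F w ∨ L w} p)) ,
            (x , ∧-intro (∨-introˡ x∈F) x∈U , x∉L) , (y , y∈U , cong (_∧ U y) (∨-false-intro y∉F y∉L)))

          avoid : ∀ F → 𝓕 F → Avoids N F
          avoid F f x y p with bool (F x) | bool (F y)
          ... | inj₁ q | inj₁ r = trans q (sym r)
          ... | inj₂ q | inj₂ r = trans q (sym r)
          ... | inj₁ q | inj₂ r = ⊥-elim (separated F f x y (inside A x (Matching.left m x y p)) (inside B y (Matching.right m x y p)) q r)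
          ... | inj₂ q | inj₁ r = ⊥-elim (separated F f y x (inside B y (Matching.right m x y p)) (inside A x (Matching.left m x y p)) r q)

  lattice-matching : ∀ {L U v} → 𝓕 L → 𝓕 U → L ⊆ U → v ∈ U → v ∉ L →
                     ∃ λ N → Matching R (A ∩ ((U ∖ L) ∩ K)) (B ∩ ((U ∖ L) ∩ K)) N × (∀ F → 𝓕 F → Avoids N F)
  lattice-matching {L} {U} = search (suc (cnt V (U ∖ L))) L U ≤-refl

module Intervals {n} (S : Setup n) where
  open Perfect S
  open Facts S
  open Basics S

  rout : VSet n → VSet n → ℕ
  rout X̂ Q = flow E Q (X̂ ∖ Q)

  -- A violator of Hall's condition for the interval from L to U, enlarged by L and by the excluded vertices W of B
  record Blocked (X̂ L U W : VSet n) : Set where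
    field
      Y X    : VSet n
      L⊆Y    : L ⊆ Y
      Y⊆U    : Y ⊆ U
      W⊆Y    : W ⊆ Y
      Y∩A⊆   : ∀ v → v ∈ A → v ∈ Y → v ∈ L ⊎ v ∈ X
      nA-Y   : nA Y ≡ nA L + nA X
      nB-Y   : nB Y ≡ nB L + (nB X + nB W)
      nB<nA  : nB X < nA X
      out-Y  : rout X̂ Y ≤ rout X̂ L + rout X̂ U
      nonempty : ∃ λ v → v ∈ Y

  -- Hall's theorem between two nested sets. An edge leaving the enlarged violator starts in L, or
  -- starts in X and then by relative closedness ends beyond U; it is charged to `rout X̂ L` or to
  -- `rout X̂ U`, so the violator has few leaving edges.
  interval : ∀ X̂ K L U W → L ⊆ U → W ⊆ (U ∖ L) → W ⊆ B → (∀ v → v ∈ B → v ∈ U → v ∉ L → v ∉ W → v ∈ K) →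
             (∀ v → v ∈ W → v ∉ K) → nA ((U ∖ L) ∩ K) ≡ nB ((U ∖ L) ∩ K) →
             (∀ (b : Blocked X̂ L U W) → Blocked.X b ⊆ K → ⊥) →
             ∃ λ N → Matching E (A ∩ ((U ∖ L) ∩ K)) (B ∩ ((U ∖ L) ∩ K)) N
  interval X̂ K L U W L⊆U W⊆T W⊆B rest W∉K equal refute =
    [ id , (λ v → ⊥-elim (refute (blocked v) (λ w p → (∧ʳ {(U ∖ L) w} (proj₁ (proj₂ v) w p))))) ]′
    (hall-on E (λ _ _ e → e) ((U ∖ L) ∩ K) equal)
    where
    blocked : (∃ λ X → X ⊆ (U ∖ L) ∩ K × (∀ x y → E x y ≡ true → x ∈ X → y ∈ (U ∖ L) ∩ K → y ∈ X) × nB X < nA X) →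
              Blocked X̂ L U W
    blocked (X , X⊆ , closed , l) = record
      { Y = Y ; X = X ; L⊆Y = λ v p → ∨-introˡ p
      ; Y⊆U = λ v p → [ L⊆U v , (λ q → [ (λ r → proj₁ (X-T v r)) , (λ r → (∧ˡ {U v} (W⊆T v r))) ]′ (∨-true {X v} q)) ]′ (∨-true {L v} p)
      ; W⊆Y = λ v p → ∨-introʳ {L v} (∨-introʳ {X v} p)
      ; Y∩A⊆ = A-part
      ; nA-Y = trans (size A) (cong (nA L +_) (trans (cong (nA X +_) (cnt-0 A λ v p q → A-B p (W⊆B v q))) (+-identityʳ _)))
      ; nB-Y = size B
      ; nB<nA = l
      ; out-Y = flow-⊎ E leaving
      ; nonempty = a-vertex (cnt-witness A {X} (≤-trans (s≤s z≤n) l)) }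
      where
      Y : VSet n
      Y = L ∪ (X ∪ W)

      X-T : ∀ v → v ∈ X → v ∈ U × v ∉ L
      X-T v p with ∧-true {U v} (∧ˡ {U v ∧ not (L v)} (X⊆ v p))
      ... | q , r = q , not-true r

      a-vertex : (∃ λ v → v ∈ A × v ∈ X) → ∃ λ v → v ∈ Y
      a-vertex (v , _ , p) = v , ∨-introʳ {L v} (∨-introˡ p)

      A-part : ∀ v → v ∈ A → v ∈ Y → v ∈ L ⊎ v ∈ X
      A-part v a p = [ inj₁ , (λ q → [ inj₂ , (λ r → ⊥-elim (A-B a (W⊆B v r))) ]′ (∨-true {X v} q)) ]′ (∨-true {L v} p)

      size : ∀ c → cnt c Y ≡ cnt c L + (cnt c X + cnt c W)
      size c = trans
        (cnt-⊎ c {L} {X ∪ W} λ v p q → [ (λ r → true≢false p (proj₂ (X-T v r)))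
                                       , (λ r → true≢false p (not-true (∧ʳ {U v} (W⊆T v r)))) ]′ (∨-true {X v} q))
        (cong (cnt c L +_) (cnt-⊎ c {X} {W} λ v p q → true≢false (∧ʳ {(U ∖ L) v} (X⊆ v p)) (W∉K v q)))

      leaving : ∀ x y → E x y ≡ true → x ∈ Y → y ∈ X̂ ∖ Y → (x ∈ L × y ∈ X̂ ∖ L) ⊎ (x ∈ U × y ∈ X̂ ∖ U)
      leaving x y e p q with ∧-true {X̂ y} q
      ... | y∈X̂ , y∉Y′ with ∨-false {L y} (not-true y∉Y′)
      ...   | y∉L , y∉XW with ∨-false {X y} y∉XW
      ...     | y∉X , y∉W = [ (λ x∈L → inj₁ (x∈L , ∧-intro y∈X̂ (not-intro y∉L)))
                            , (λ x∈X → inj₂ (proj₁ (X-T x x∈X) , ∧-intro y∈X̂ (not-intro (¬true λ y∈U →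
                                true≢false (closed x y e x∈X (∧-intro (∧-intro y∈U (not-intro y∉L)) (rest y (E-B e) y∈U y∉L y∉W))) y∉X)))) ]′
                            (A-part x (E-A e) p)

-- Matching an end of the chain

⟪⟫-split : ∀ {a b} → (a ≡ true → b ≡ true) → ⟪ b ∧ not a ⟫ + ⟪ a ⟫ ≡ ⟪ b ⟫
⟪⟫-split {true} h rewrite h refl = refl
⟪⟫-split {false} {true} h = refl
⟪⟫-split {false} {false} h = refl

≡-by-⇔ : ∀ {a b : Bool} → (a ≡ true → b ≡ true) → (b ≡ true → a ≡ true) → a ≡ b
≡-by-⇔ {true} f g = sym (f refl)
≡-by-⇔ {false} {true} f g = g refl
≡-by-⇔ {false} {false} f g = refl

-- The edges of N inside Z are counted once from A and once from B and cancel; so entering and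
-- leaving edges of N differ by the difference of the covered vertices.
matching-balance : ∀ {n} {R : Adj n} {A B : VSet n} {N : Adj n} → Matching R A B N → ∀ Z →
                   cnt A Z + flow N (∁ Z) Z ≡ cnt B Z + flow N Z (∁ Z)
matching-balance {R = R} {A} {B} {N} m Z = equate (cnt A Z ∷ cnt B Z ∷ flow N (∁ Z) Z ∷ flow N Z (∁ Z) ∷ flow N Z Z
    ∷ flow N Z V ∷ flow N V Z ∷ []) 1 (‵ 0 :+ ‵ 2) (‵ 1 :+ ‵ 3)
  ( 1 ⊠ ‵ 0 ≐ ‵ 5 ∵ rows
  ∷ 1 ⊠ ‵ 6 ≐ ‵ 1 ∵ sym cols
  ∷ 1 ⊠ ‵ 5 ≐ ‵ 4 :+ ‵ 3 ∵ outer
  ∷ 1 ⊠ ‵ 4 :+ ‵ 2 ≐ ‵ 6 ∵ sym inner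
  ∷ [])
  where
  open Matching m

  mult : ∀ {b} z r → r ≡ ⟪ b ⟫ → ⟪ b ∧ z ⟫ ≡ ⟪ z ⟫ * r
  mult {true} true r refl = refl
  mult {true} false r refl = refl
  mult {false} true r refl = refl
  mult {false} false r refl = refl

  term : ∀ z e → ⟪ z ⟫ * ⟪ e ⟫ ≡ ⟪ e ∧ (z ∧ true) ⟫
  term true true = refl
  term true false = refl
  term false true = refl
  term false false = refl

  rows : cnt A Z ≡ flow N Z V
  rows = ∑-cong λ x → trans (mult (Z x) _ (row x)) (trans (sym (∑-* ⟪ Z x ⟫ (λ y → ⟪ N x y ⟫))) (∑-cong λ y → term (Z x) (N x y)))

  cols : cnt B Z ≡ flow N V Z
  cols = trans
    (∑-cong λ y → trans (mult (Z y) _ (col y)) (trans (sym (∑-* ⟪ Z y ⟫ (λ x → ⟪ N x y ⟫))) (∑-cong λ x → term (Z y) (N x y))))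
    (sym (flow-transpose {R = N} {λ y x → N x y} (λ _ _ → refl) V Z))

  outer : flow N Z V ≡ flow N Z Z + flow N Z (∁ Z)
  outer = ≤-antisym
    (flow-≤ {1} (λ { (z ∷ []) → (z , true) ∷ [] }) (λ { (z ∷ []) → (z , z) ∷ (z , not z) ∷ [] }) N (Z ∷ []))
    (flow-≤ {1} (λ { (z ∷ []) → (z , z) ∷ (z , not z) ∷ [] }) (λ { (z ∷ []) → (z , true) ∷ [] }) N (Z ∷ []))

  inner : flow N V Z ≡ flow N Z Z + flow N (∁ Z) Z
  inner = ≤-antisym
    (flow-≤ {1} (λ { (z ∷ []) → (true , z) ∷ [] }) (λ { (z ∷ []) → (z , z) ∷ (not z , z) ∷ [] }) N (Z ∷ []))
    (flow-≤ {1} (λ { (z ∷ []) → (z , z) ∷ (not z , z) ∷ [] }) (λ { (z ∷ []) → (true , z) ∷ [] }) N (Z ∷ []))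

avoids-if-no-flow : ∀ {n} (N : Adj n) (Z : VSet n) → flow N Z (∁ Z) ≡ 0 → flow N (∁ Z) Z ≡ 0 → Avoids N Z
avoids-if-no-flow N Z h k x y p = ≡-by-⇔
  (λ q → [ id , (λ r → ⊥-elim (absurd h (flow-term N {Z} {∁ Z} p q (not-intro r)))) ]′ (bool (Z y)))
  (λ q → [ id , (λ r → ⊥-elim (absurd k (flow-term N {∁ Z} {Z} p (not-intro r) q))) ]′ (bool (Z x)))
  where
  absurd : ∀ {m} → m ≡ 0 → 1 ≤ m → ⊥
  absurd refl ()

-- The b₁b₂-side X̂ of the part of the graph beyond all 3-edge-cuts separating a₁a₂ from b₁b₂;
-- the only way from A ∩ X̂ out of X̂ is through s.
record End {n} (S : Setup n) (X̂ : VSet n) (s p q : Fin n) : Set where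
  open Basics S
  open Intervals S
  field
    s∈A     : s ∈ A
    p∈B     : p ∈ B
    q∈B     : q ∈ B
    p≢q     : p ≢ q
    s∈      : s ∈ X̂
    p∈      : p ∈ X̂
    q∈      : q ∈ X̂
    excess  : nB X̂ ≡ 1 + nA X̂
    star°   : ∀ Q {v} → Q ⊆ X̂ → v ∈ Q →
              3 + 3 * nA Q + 2 * ⟪ Q p ∧ Q q ⟫ ≤ 2 * (rout X̂ Q + ⟪ Q s ⟫) + 3 * nB Q
    bal°    : ∀ Q → Q ⊆ X̂ →
              3 * nA Q + (⟪ Q p ⟫ + ⟪ Q q ⟫) + flow E (X̂ ∖ Q) Q ≤ rout X̂ Q + ⟪ Q s ⟫ + 3 * nB Q

End-swap : ∀ {n} {S : Setup n} {X̂ s p q} → End S X̂ s p q → End S X̂ s q p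
End-swap {S = S} {X̂} {s} {p} {q} e = record
  { s∈A = s∈A ; p∈B = q∈B ; q∈B = p∈B ; p≢q = p≢q ∘ sym ; s∈ = s∈ ; p∈ = q∈ ; q∈ = p∈ ; excess = excess
  ; star° = λ Q h k → subst (λ b → 3 + 3 * nA Q + 2 * ⟪ b ⟫ ≤ 2 * (rout X̂ Q + ⟪ Q s ⟫) + 3 * nB Q) (∧-comm (Q p) (Q q)) (star° Q h k)
  ; bal° = λ Q h → subst (λ b → 3 * nA Q + b + flow E (X̂ ∖ Q) Q ≤ rout X̂ Q + ⟪ Q s ⟫ + 3 * nB Q) (+-comm ⟪ Q p ⟫ ⟪ Q q ⟫) (bal° Q h) }
  where
  open End e
  open Basics S
  open Intervals S

-- The 4-edge-cuts inside X̂ that separate p from q and have s on the side of p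
record Tight {n} (S : Setup n) (X̂ : VSet n) (s p q : Fin n) (Q : VSet n) : Set where
  open Basics S
  open Intervals S
  field
    Q⊆     : Q ⊆ X̂
    s∈     : s ∈ Q
    p∈     : p ∈ Q
    q∉     : q ∉ Q
    nA≡nB  : nA Q ≡ nB Q
    rout≡1 : rout X̂ Q ≡ 1

inner-vertices : ∀ {n} → Fin n → Fin n → Fin n → VSet n
inner-vertices s p q x = not (⁅ s ⁆ x) ∧ (not (⁅ p ⁆ x) ∧ not (⁅ q ⁆ x))

module EndMatching {n} (S : Setup n) {X̂ : VSet n} {s p q : Fin n} (end : End S X̂ s p q) where
  open Perfect S
  open Facts S
  open Basics S
  open Intervals S
  open End end

  K : VSet n
  K = inner-vertices s p q

  K-split : ∀ {v} → v ∈ K → v ≢ s × v ≢ p × v ≢ q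
  K-split {v} k with ∧-true {not (⁅ s ⁆ v)} k
  ... | a , r with ∧-true {not (⁅ p ⁆ v)} r
  ...   | b , c = unequal a , unequal b , unequal c
    where
    unequal : ∀ {w} → not (⁅ w ⁆ v) ≡ true → v ≢ w
    unequal h refl = true≢false (⌊≟⌋-refl v) (not-true h)

  K-intro : ∀ {v} → v ≢ s → v ≢ p → v ≢ q → v ∈ K
  K-intro a b c = ∧-intro (not-intro (⌊≟⌋-false a)) (∧-intro (not-intro (⌊≟⌋-false b)) (not-intro (⌊≟⌋-false c)))

  PQ : VSet n
  PQ = ⁅ p ⁆ ∪ ⁅ q ⁆

  PQ⊆B : ∀ v → v ∈ PQ → v ∈ B
  PQ⊆B v h = [ (λ r → subst (_∈ B) (sym (⌊≟⌋-true r)) p∈B) , (λ r → subst (_∈ B) (sym (⌊≟⌋-true r)) q∈B) ]′ (∨-true h)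

  PQ∉K : ∀ v → v ∈ PQ → v ∉ K
  PQ∉K v h = ¬true λ k → [ (λ r → proj₁ (proj₂ (K-split {v} k)) (⌊≟⌋-true r)) , (λ r → proj₂ (proj₂ (K-split {v} k)) (⌊≟⌋-true r)) ]′ (∨-true {⁅ p ⁆ v} h)

  nA-K : ∀ T → nA T ≡ nA (T ∩ K) + ⟪ T s ⟫
  nA-K T = trans (cnt-≡ {2} (λ { (t ∷ e ∷ []) → t ∷ [] }) (λ { (t ∷ e ∷ []) → t ∧ not e ∷ t ∧ e ∷ [] }) A (T ∷ ⁅ s ⁆ ∷ []))
    (cong₂ _+_ (cnt-cong-on A {T ∖ ⁅ s ⁆} {T ∩ K} λ v a → cong (T v ∧_) (same v a))
               (trans (cnt-point A T s) (cong (λ b → ⟪ b ∧ T s ⟫) s∈A)))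
    where
    same : ∀ v → v ∈ A → not (⁅ s ⁆ v) ≡ K v
    same v a = sym (trans (cong (not (⁅ s ⁆ v) ∧_) (cong₂ (λ x y → not x ∧ not y) (⌊≟⌋-false (A-≢-B a p∈B)) (⌊≟⌋-false (A-≢-B a q∈B))))
                          (∧-identityʳ _))

  nB-K : ∀ T → nB T ≡ nB (T ∩ K) + nB (T ∩ PQ)
  nB-K T = trans (cnt-≡ {2} (λ { (t ∷ e ∷ []) → t ∷ [] }) (λ { (t ∷ e ∷ []) → t ∧ not e ∷ t ∧ e ∷ [] }) B (T ∷ PQ ∷ []))
    (cong (_+ nB (T ∩ PQ)) (cnt-cong-on B {T ∖ PQ} {T ∩ K} λ v b → cong (T v ∧_) (same v b)))
    where
    de-morgan : ∀ x y → not (x ∨ y) ≡ not x ∧ not y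
    de-morgan true y = refl
    de-morgan false y = refl
    same : ∀ v → v ∈ B → not (PQ v) ≡ K v
    same v b = trans (de-morgan (⁅ p ⁆ v) (⁅ q ⁆ v)) (cong (λ z → not z ∧ (not (⁅ p ⁆ v) ∧ not (⁅ q ⁆ v))) (sym (⌊≟⌋-false (A-≢-B s∈A b ∘ sym))))

  nB-PQ : ∀ T → nB (T ∩ PQ) ≡ ⟪ T p ⟫ + ⟪ T q ⟫
  nB-PQ T = trans
    (cnt-≡ {3} (λ { (t ∷ e ∷ f ∷ []) → t ∧ (e ∨ f) ∷ [] }) (λ { (t ∷ e ∷ f ∷ []) → t ∧ e ∷ (t ∧ not e) ∧ f ∷ [] }) B (T ∷ ⁅ p ⁆ ∷ ⁅ q ⁆ ∷ []))
    (cong₂ _+_ (trans (cnt-point B T p) (cong (λ b → ⟪ b ∧ T p ⟫) p∈B))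
               (trans (cnt-point B (T ∖ ⁅ p ⁆) q) (cong₂ (λ b c → ⟪ b ∧ c ⟫) q∈B
                 (trans (cong (λ b → T q ∧ not b) (⌊≟⌋-false (p≢q ∘ sym))) (∧-identityʳ (T q))))))

  rout-submodular : ∀ P Q → rout X̂ (P ∩ Q) + rout X̂ (P ∪ Q) ≤ rout X̂ P + rout X̂ Q
  rout-submodular P Q = flow-≤ {3}
    (λ { (x ∷ u ∷ v ∷ []) → (u ∧ v , x ∧ not (u ∧ v)) ∷ (u ∨ v , x ∧ not (u ∨ v)) ∷ [] })
    (λ { (x ∷ u ∷ v ∷ []) → (u , x ∧ not u) ∷ (v , x ∧ not v) ∷ [] }) E (X̂ ∷ P ∷ Q ∷ [])

  modular : ∀ (c P Q : VSet n) → cnt c (P ∩ Q) + cnt c (P ∪ Q) ≡ cnt c P + cnt c Q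
  modular c P Q = cnt-≡ {2} (λ { (x ∷ y ∷ []) → x ∧ y ∷ (x ∨ y) ∷ [] }) (λ { (x ∷ y ∷ []) → x ∷ y ∷ [] }) c (P ∷ Q ∷ [])

  -- By submodularity at most two edges leave the intersection and the union together. `bal°` then
  -- excludes a surplus of A in either set, so both are balanced because P and Q are; `star°` gives
  -- each of them a leaving edge, hence exactly one.
  tight-pair : ∀ {P Q} → Tight S X̂ s p q P → Tight S X̂ s p q Q → Tight S X̂ s p q (P ∩ Q) × Tight S X̂ s p q (P ∪ Q)
  tight-pair {P} {Q} t u =
      record { Q⊆ = I⊆ ; s∈ = ∧-intro T.s∈ U.s∈ ; p∈ = ∧-intro T.p∈ U.p∈ ; q∉ = cong (_∧ Q q) T.q∉
             ; nA≡nB = ≤-antisym aI≤bI bI≤aI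
             ; rout≡1 = ≤-antisym (upper oI≥ oU≥ (rout-submodular P Q)) oI≥ }
    , record { Q⊆ = U⊆ ; s∈ = ∨-introˡ T.s∈ ; p∈ = ∨-introˡ T.p∈ ; q∉ = ∨-false-intro T.q∉ U.q∉
             ; nA≡nB = ≤-antisym aU≤bU bU≤aU
             ; rout≡1 = ≤-antisym (upper oU≥ oI≥ (≤-trans (≤-reflexive (+-comm (rout X̂ (P ∪ Q)) (rout X̂ (P ∩ Q)))) (rout-submodular P Q))) oU≥ }
    where
    module T = Tight t
    module U = Tight u

    I⊆ : (P ∩ Q) ⊆ X̂
    I⊆ v h = T.Q⊆ v (∧ˡ {P v} h)

    U⊆ : (P ∪ Q) ⊆ X̂
    U⊆ v h = [ T.Q⊆ v , U.Q⊆ v ]′ (∨-true h)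

    upper : ∀ {x y} → 1 ≤ x → 1 ≤ y → x + y ≤ rout X̂ P + rout X̂ Q → x ≤ 1
    upper {x} {y} h k l = (≮⇒≥ λ neg → farkas (x ∷ y ∷ rout X̂ P ∷ rout X̂ Q ∷ [])
      ( 1 ⊠ con 1 ⩽ ‵ 1 ∵ k
      ∷ 1 ⊠ ‵ 0 :+ ‵ 1 ⩽ ‵ 2 :+ ‵ 3 ∵ l
      ∷ 1 ⊠ ‵ 2 ⩽ con 1 ∵ ≤-reflexive T.rout≡1
      ∷ 1 ⊠ ‵ 3 ⩽ con 1 ∵ ≤-reflexive U.rout≡1
      ∷ 1 ⊠ con 1 :+ con 1 ⩽ ‵ 0 ∵ neg
      ∷ []))

    aU≤bU : nA (P ∪ Q) ≤ nB (P ∪ Q)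
    aU≤bU = (≮⇒≥ λ neg → farkas (nA (P ∪ Q) ∷ nB (P ∪ Q) ∷ rout X̂ (P ∩ Q) ∷ rout X̂ (P ∪ Q) ∷ rout X̂ P
        ∷ rout X̂ Q ∷ ⟪ (P ∪ Q) p ⟫ ∷ ⟪ (P ∪ Q) q ⟫ ∷ ⟪ (P ∪ Q) s ⟫ ∷ flow E (X̂ ∖ (P ∪ Q)) (P ∪ Q) ∷ [])
      ( 1 ⊠ 3 :* (‵ 0) :+ (‵ 6 :+ ‵ 7) :+ ‵ 9 ⩽ ‵ 3 :+ ‵ 8 :+ 3 :* (‵ 1) ∵ bal° (P ∪ Q) U⊆
      ∷ 1 ⊠ ‵ 2 :+ ‵ 3 ⩽ ‵ 4 :+ ‵ 5 ∵ rout-submodular P Q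
      ∷ 1 ⊠ ‵ 4 ⩽ con 1 ∵ ≤-reflexive T.rout≡1
      ∷ 1 ⊠ ‵ 5 ⩽ con 1 ∵ ≤-reflexive U.rout≡1
      ∷ 1 ⊠ con 1 ⩽ ‵ 6 ∵ ≤-reflexive (sym (cong ⟪_⟫ (∨-introˡ {b = Q p} T.p∈)))
      ∷ 1 ⊠ ‵ 8 ⩽ con 1 ∵ ≤-reflexive (cong ⟪_⟫ (∨-introˡ {b = Q s} T.s∈))
      ∷ 3 ⊠ con 1 :+ ‵ 1 ⩽ ‵ 0 ∵ neg
      ∷ []))

    aI≤bI : nA (P ∩ Q) ≤ nB (P ∩ Q)
    aI≤bI = (≮⇒≥ λ neg → farkas (nA (P ∩ Q) ∷ nB (P ∩ Q) ∷ rout X̂ (P ∩ Q) ∷ rout X̂ (P ∪ Q) ∷ rout X̂ P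
        ∷ rout X̂ Q ∷ ⟪ (P ∩ Q) p ⟫ ∷ ⟪ (P ∩ Q) q ⟫ ∷ ⟪ (P ∩ Q) s ⟫ ∷ flow E (X̂ ∖ (P ∩ Q)) (P ∩ Q) ∷ [])
      ( 1 ⊠ 3 :* (‵ 0) :+ (‵ 6 :+ ‵ 7) :+ ‵ 9 ⩽ ‵ 2 :+ ‵ 8 :+ 3 :* (‵ 1) ∵ bal° (P ∩ Q) I⊆
      ∷ 1 ⊠ ‵ 2 :+ ‵ 3 ⩽ ‵ 4 :+ ‵ 5 ∵ rout-submodular P Q
      ∷ 1 ⊠ ‵ 4 ⩽ con 1 ∵ ≤-reflexive T.rout≡1
      ∷ 1 ⊠ ‵ 5 ⩽ con 1 ∵ ≤-reflexive U.rout≡1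
      ∷ 1 ⊠ con 1 ⩽ ‵ 6 ∵ ≤-reflexive (sym (cong ⟪_⟫ (∧-intro T.p∈ U.p∈)))
      ∷ 1 ⊠ ‵ 8 ⩽ con 1 ∵ ≤-reflexive (cong ⟪_⟫ (∧-intro T.s∈ U.s∈))
      ∷ 3 ⊠ con 1 :+ ‵ 1 ⩽ ‵ 0 ∵ neg
      ∷ []))

    bU≤aU : nB (P ∪ Q) ≤ nA (P ∪ Q)
    bU≤aU = (≮⇒≥ λ neg → farkas (nA (P ∩ Q) ∷ nB (P ∩ Q) ∷ nA (P ∪ Q) ∷ nB (P ∪ Q) ∷ nA P ∷ nB P ∷ nA Q ∷ nB Q ∷ [])
      ( 1 ⊠ ‵ 0 ⩽ ‵ 1 ∵ aI≤bI
      ∷ 1 ⊠ ‵ 4 :+ ‵ 6 ⩽ ‵ 0 :+ ‵ 2 ∵ ≤-reflexive (sym (modular A P Q))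
      ∷ 1 ⊠ ‵ 1 :+ ‵ 3 ⩽ ‵ 5 :+ ‵ 7 ∵ ≤-reflexive (modular B P Q)
      ∷ 1 ⊠ ‵ 5 ⩽ ‵ 4 ∵ ≤-reflexive (sym T.nA≡nB)
      ∷ 1 ⊠ ‵ 7 ⩽ ‵ 6 ∵ ≤-reflexive (sym U.nA≡nB)
      ∷ 1 ⊠ con 1 :+ ‵ 2 ⩽ ‵ 3 ∵ neg
      ∷ []))

    oU≥ : 1 ≤ rout X̂ (P ∪ Q)
    oU≥ = (≮⇒≥ λ neg → farkas (nA (P ∪ Q) ∷ nB (P ∪ Q) ∷ rout X̂ (P ∪ Q) ∷ ⟪ (P ∪ Q) s ⟫ ∷ ⟪ (P ∪ Q) p ∧ (P ∪ Q) q ⟫ ∷ [])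
      ( 1 ⊠ con 3 :+ 3 :* (‵ 0) :+ 2 :* (‵ 4) ⩽ 2 :* (‵ 2 :+ ‵ 3) :+ 3 :* (‵ 1) ∵ star° (P ∪ Q) U⊆ (∨-introˡ {b = Q s} T.s∈)
      ∷ 3 ⊠ ‵ 1 ⩽ ‵ 0 ∵ bU≤aU
      ∷ 2 ⊠ ‵ 3 ⩽ con 1 ∵ ≤-reflexive (cong ⟪_⟫ (∨-introˡ {b = Q s} T.s∈))
      ∷ 2 ⊠ con 1 :+ ‵ 2 ⩽ con 1 ∵ neg
      ∷ []))

    bI≤aI : nB (P ∩ Q) ≤ nA (P ∩ Q)
    bI≤aI = (≮⇒≥ λ neg → farkas (nA (P ∩ Q) ∷ nB (P ∩ Q) ∷ nA (P ∪ Q) ∷ nB (P ∪ Q) ∷ nA P ∷ nB P ∷ nA Q ∷ nB Q ∷ [])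
      ( 1 ⊠ ‵ 2 ⩽ ‵ 3 ∵ aU≤bU
      ∷ 1 ⊠ ‵ 4 :+ ‵ 6 ⩽ ‵ 0 :+ ‵ 2 ∵ ≤-reflexive (sym (modular A P Q))
      ∷ 1 ⊠ ‵ 1 :+ ‵ 3 ⩽ ‵ 5 :+ ‵ 7 ∵ ≤-reflexive (modular B P Q)
      ∷ 1 ⊠ ‵ 5 ⩽ ‵ 4 ∵ ≤-reflexive (sym T.nA≡nB)
      ∷ 1 ⊠ ‵ 7 ⩽ ‵ 6 ∵ ≤-reflexive (sym U.nA≡nB)
      ∷ 1 ⊠ con 1 :+ ‵ 0 ⩽ ‵ 1 ∵ neg
      ∷ []))

    oI≥ : 1 ≤ rout X̂ (P ∩ Q)
    oI≥ = (≮⇒≥ λ neg → farkas (nA (P ∩ Q) ∷ nB (P ∩ Q) ∷ rout X̂ (P ∩ Q) ∷ ⟪ (P ∩ Q) s ⟫ ∷ ⟪ (P ∩ Q) p ∧ (P ∩ Q) q ⟫ ∷ [])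
      ( 1 ⊠ con 3 :+ 3 :* (‵ 0) :+ 2 :* (‵ 4) ⩽ 2 :* (‵ 2 :+ ‵ 3) :+ 3 :* (‵ 1) ∵ star° (P ∩ Q) I⊆ (∧-intro T.s∈ U.s∈)
      ∷ 3 ⊠ ‵ 1 ⩽ ‵ 0 ∵ bI≤aI
      ∷ 2 ⊠ ‵ 3 ⩽ con 1 ∵ ≤-reflexive (cong ⟪_⟫ (∧-intro T.s∈ U.s∈))
      ∷ 2 ⊠ con 1 :+ ‵ 2 ⩽ con 1 ∵ neg
      ∷ []))

  tight? : ∀ Q → Dec (Tight S X̂ s p q Q)
  tight? Q = build (Q ⊆? X̂) (Q s Bool.≟ true) (Q p Bool.≟ true) (Q q Bool.≟ false) (nA Q Nat.≟ nB Q) (rout X̂ Q Nat.≟ 1)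
    where
    build : Dec (Q ⊆ X̂) → Dec (s ∈ Q) → Dec (p ∈ Q) → Dec (q ∉ Q) → Dec (nA Q ≡ nB Q) → Dec (rout X̂ Q ≡ 1) → Dec (Tight S X̂ s p q Q)
    build (yes a) (yes b) (yes c) (yes d) (yes e) (yes f) = yes (record { Q⊆ = a ; s∈ = b ; p∈ = c ; q∉ = d ; nA≡nB = e ; rout≡1 = f })
    build (no h) _ _ _ _ _ = no (h ∘ Tight.Q⊆)
    build _ (no h) _ _ _ _ = no (h ∘ Tight.s∈)
    build _ _ (no h) _ _ _ = no (h ∘ Tight.p∈)
    build _ _ _ (no h) _ _ = no (h ∘ Tight.q∉)
    build _ _ _ _ (no h) _ = no (h ∘ Tight.nA≡nB)
    build _ _ _ _ _ (no h) = no (h ∘ Tight.rout≡1)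

  tight-resp : ∀ {P Q} → P ≗ Q → Tight S X̂ s p q P → Tight S X̂ s p q Q
  tight-resp {P} {Q} h t = record
    { Q⊆ = λ v r → Q⊆ v (trans (h v) r) ; s∈ = trans (sym (h s)) T.s∈ ; p∈ = trans (sym (h p)) T.p∈ ; q∉ = trans (sym (h q)) q∉
    ; nA≡nB = trans (sym (cnt-cong A h)) (trans nA≡nB (cnt-cong B h))
    ; rout≡1 = trans (flow-cong E (sym ∘ h) (λ v → cong (λ b → X̂ v ∧ not b) (sym (h v)))) rout≡1 }
    where
    module T = Tight t
    open Tight t using (Q⊆; q∉; nA≡nB; rout≡1)

  -- ∅ and X̂ are adjoined to the tight sets, so that the whole of X̂ becomes an interval of the
  -- lattice even when there are no tight sets.
  data Level (F : VSet n) : Set where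
    bottom : F ≗ ∅ → Level F
    middle : Tight S X̂ s p q F → Level F
    top    : F ≗ X̂ → Level F

  level-resp : ∀ {P Q} → P ≗ Q → Level P → Level Q
  level-resp h (bottom e) = bottom λ v → trans (sym (h v)) (e v)
  level-resp h (middle t) = middle (tight-resp h t)
  level-resp h (top e) = top λ v → trans (sym (h v)) (e v)

  level? : ∀ F → Dec (Level F)
  level? F = build (all? λ v → F v Bool.≟ false) (tight? F) (all? λ v → F v Bool.≟ X̂ v)
    where
    build : Dec (∀ v → F v ≡ false) → Dec (Tight S X̂ s p q F) → Dec (∀ v → F v ≡ X̂ v) → Dec (Level F)
    build (yes a) _ _ = yes (bottom a)
    build _ (yes b) _ = yes (middle b)
    build _ _ (yes c) = yes (top c)
    build (no a) (no b) (no c) = no λ { (bottom e) → a e ; (middle t) → b t ; (top e) → c e }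

  level-⊆ : ∀ {F} → Level F → F ⊆ X̂
  level-⊆ (bottom e) v h = ⊥-elim (true≢false h (e v))
  level-⊆ (middle t) = Tight.Q⊆ t
  level-⊆ (top e) v h = trans (sym (e v)) h

  level-∩ : ∀ {P Q} → Level P → Level Q → Level (P ∩ Q)
  level-∩ {Q = Q} (bottom e) _ = bottom λ v → cong (_∧ Q v) (e v)
  level-∩ {P} _ (bottom e) = bottom λ v → trans (cong (P v ∧_) (e v)) (∧-zeroʳ (P v))
  level-∩ (middle t) (middle u) = middle (proj₁ (tight-pair t u))
  level-∩ {P} {Q} (top e) l = level-resp (λ v → ≡-by-⇔ (λ h → ∧-intro (trans (e v) (level-⊆ l v h)) h) (λ h → (∧ʳ {P v} h))) l
  level-∩ {P} {Q} l (top e) = level-resp (λ v → ≡-by-⇔ (λ h → ∧-intro h (trans (e v) (level-⊆ l v h))) (λ h → (∧ˡ {P v} h))) l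

  level-∪ : ∀ {P Q} → Level P → Level Q → Level (P ∪ Q)
  level-∪ {P} {Q} (bottom e) l = level-resp (λ v → sym (cong (_∨ Q v) (e v))) l
  level-∪ {P} l (bottom e) = level-resp (λ v → sym (trans (cong (P v ∨_) (e v)) (∨-identityʳ (P v)))) l
  level-∪ (middle t) (middle u) = middle (proj₂ (tight-pair t u))
  level-∪ {P} {Q} (top e) l = top λ v → ≡-by-⇔ (λ h → [ (λ r → trans (sym (e v)) r) , level-⊆ l v ]′ (∨-true {P v} h)) (λ h → ∨-introˡ (trans (e v) h))
  level-∪ {P} {Q} l (top e) = top λ v → ≡-by-⇔ (λ h → [ level-⊆ l v , (λ r → trans (sym (e v)) r) ]′ (∨-true {P v} h)) (λ h → ∨-introʳ {P v} (trans (e v) h))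

  -- The values that distinguish the three kinds of level, so that `Fill` can treat all intervals at
  -- once. The equation `surplus` says that F is balanced once s, p, q are left out.
  record Numbers (F : VSet n) (π κ σ ω : ℕ) : Set where
    field
      p-value : ⟪ F p ⟫ ≡ π
      q-value : ⟪ F q ⟫ ≡ κ
      s-value : ⟪ F s ⟫ ≡ σ
      r-value : rout X̂ F ≡ ω
      surplus : nA F + (π + κ) ≡ nB F + σ

  bottom-numbers : ∀ {F} → F ≗ ∅ → Numbers F 0 0 0 0
  bottom-numbers {F} e = record
    { p-value = cong ⟪_⟫ (e p) ; q-value = cong ⟪_⟫ (e q) ; s-value = cong ⟪_⟫ (e s)
    ; r-value = flow-0 E {F} {X̂ ∖ F} λ x _ _ h _ → true≢false h (e x)
    ; surplus = cong (_+ 0) (trans (cnt-0 A {F} λ x _ h → true≢false h (e x)) (sym (cnt-0 B {F} λ x _ h → true≢false h (e x)))) }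

  middle-numbers : ∀ {F} → Tight S X̂ s p q F → Numbers F 1 0 1 1
  middle-numbers t = record { p-value = cong ⟪_⟫ T.p∈ ; q-value = cong ⟪_⟫ T.q∉ ; s-value = cong ⟪_⟫ T.s∈
                            ; r-value = T.rout≡1 ; surplus = cong (_+ 1) T.nA≡nB }
    where module T = Tight t

  top-numbers : ∀ {F} → F ≗ X̂ → Numbers F 1 1 1 0
  top-numbers {F} e = record
    { p-value = cong ⟪_⟫ (trans (e p) p∈) ; q-value = cong ⟪_⟫ (trans (e q) q∈) ; s-value = cong ⟪_⟫ (trans (e s) s∈)
    ; r-value = flow-0 E {F} {X̂ ∖ F} λ x y _ _ h → true≢false (trans (e y) (∧ˡ {X̂ y} h)) (not-true (∧ʳ {X̂ y} h))
    ; surplus = trans (+-comm (nA F) 2) (trans (cong suc (trans (cong suc (cnt-cong A e)) (trans (sym excess) (sym (cnt-cong B e))))) (+-comm 1 (nB F))) }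

  module Fill {L U : VSet n} {π κ σ ω π′ κ′ σ′ ω′ : ℕ} (L⊆U : L ⊆ U) (U⊆X̂ : U ⊆ X̂)
    (l : Numbers L π κ σ ω) (u : Numbers U π′ κ′ σ′ ω′) where

    module l = Numbers l
    module u = Numbers u

    Δ : VSet n
    Δ = U ∖ L

    W : VSet n
    W = Δ ∩ PQ

    Δ-value : ∀ v → ⟪ Δ v ⟫ + ⟪ L v ⟫ ≡ ⟪ U v ⟫
    Δ-value v = ⟪⟫-split {L v} (L⊆U v)

    equal : nA (Δ ∩ K) ≡ nB (Δ ∩ K)
    equal = equate (nA (Δ ∩ K) ∷ nB (Δ ∩ K) ∷ nA Δ ∷ nB Δ ∷ nA U ∷ nB U ∷ nA L ∷ nB L ∷ nB W ∷ ⟪ Δ s ⟫ ∷ ⟪ Δ p ⟫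
        ∷ ⟪ Δ q ⟫ ∷ ⟪ L s ⟫ ∷ ⟪ L p ⟫ ∷ ⟪ L q ⟫ ∷ ⟪ U s ⟫ ∷ ⟪ U p ⟫ ∷ ⟪ U q ⟫ ∷ π ∷ κ ∷ σ ∷ π′ ∷ κ′ ∷ σ′ ∷ []) 1 (‵ 0) (‵ 1)
      ( 1 ⊠ ‵ 0 :+ ‵ 9 ≐ ‵ 2 ∵ sym (nA-K Δ)
      ∷ 1 ⊠ ‵ 3 ≐ ‵ 1 :+ ‵ 8 ∵ nB-K Δ
      ∷ 1 ⊠ ‵ 8 ≐ ‵ 10 :+ ‵ 11 ∵ nB-PQ Δ
      ∷ 1 ⊠ ‵ 6 :+ ‵ 2 ≐ ‵ 4 ∵ sym (cnt-⊆ A L⊆U)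
      ∷ 1 ⊠ ‵ 5 ≐ ‵ 7 :+ ‵ 3 ∵ cnt-⊆ B L⊆U
      ∷ 1 ⊠ ‵ 15 ≐ ‵ 9 :+ ‵ 12 ∵ sym (Δ-value s)
      ∷ 1 ⊠ ‵ 10 :+ ‵ 13 ≐ ‵ 16 ∵ Δ-value p
      ∷ 1 ⊠ ‵ 11 :+ ‵ 14 ≐ ‵ 17 ∵ Δ-value q
      ∷ 1 ⊠ ‵ 18 ≐ ‵ 13 ∵ sym l.p-value
      ∷ 1 ⊠ ‵ 19 ≐ ‵ 14 ∵ sym l.q-value
      ∷ 1 ⊠ ‵ 12 ≐ ‵ 20 ∵ l.s-value
      ∷ 1 ⊠ ‵ 16 ≐ ‵ 21 ∵ u.p-value
      ∷ 1 ⊠ ‵ 17 ≐ ‵ 22 ∵ u.q-value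
      ∷ 1 ⊠ ‵ 23 ≐ ‵ 15 ∵ sym u.s-value
      ∷ 1 ⊠ ‵ 7 :+ ‵ 20 ≐ ‵ 6 :+ (‵ 18 :+ ‵ 19) ∵ sym l.surplus
      ∷ 1 ⊠ ‵ 4 :+ (‵ 21 :+ ‵ 22) ≐ ‵ 5 :+ ‵ 23 ∵ u.surplus
      ∷ [])

    module _ (b : Blocked X̂ L U W) (X⊆K : Blocked.X b ⊆ K) where
      open Blocked b

      Y⊆X̂ : Y ⊆ X̂
      Y⊆X̂ v h = U⊆X̂ v (Y⊆U v h)

      -- The violator avoids s, which is not covered, so Y inherits s from L; it contains every
      -- excluded vertex of B in the interval, so it inherits p and q from U.
      s-Y : ⟪ Y s ⟫ ≡ σ
      s-Y = trans (cong ⟪_⟫ (≡-by-⇔ (λ h → [ id , (λ r → ⊥-elim (proj₁ (K-split {s} (X⊆K s r)) refl)) ]′ (Y∩A⊆ s s∈A h)) (L⊆Y s))) l.s-value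

      at-Y : ∀ v → v ∈ PQ → Y v ≡ U v
      at-Y v h = ≡-by-⇔ (Y⊆U v) λ r → [ L⊆Y v , (λ i → W⊆Y v (∧-intro (∧-intro r (not-intro i)) h)) ]′ (bool (L v))

      p-Y : ⟪ Y p ⟫ ≡ π′
      p-Y = trans (cong ⟪_⟫ (at-Y p (∨-introˡ (⌊≟⌋-refl p)))) u.p-value

      q-Y : ⟪ Y q ⟫ ≡ κ′
      q-Y = trans (cong ⟪_⟫ (at-Y q (∨-introʳ (⌊≟⌋-refl q)))) u.q-value

      deficit : nB Y + 1 + σ ≤ nA Y + π′ + κ′
      deficit = (≮⇒≥ λ neg → farkas (nA Y ∷ nB Y ∷ nA X ∷ nB X ∷ nA L ∷ nB L ∷ nB W ∷ ⟪ Δ p ⟫ ∷ ⟪ Δ q ⟫ ∷ ⟪ L p ⟫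
          ∷ ⟪ L q ⟫ ∷ ⟪ U p ⟫ ∷ ⟪ U q ⟫ ∷ π ∷ κ ∷ σ ∷ π′ ∷ κ′ ∷ [])
        ( 1 ⊠ ‵ 4 :+ ‵ 2 ⩽ ‵ 0 ∵ ≤-reflexive (sym nA-Y)
        ∷ 1 ⊠ ‵ 1 ⩽ ‵ 5 :+ (‵ 3 :+ ‵ 6) ∵ ≤-reflexive nB-Y
        ∷ 1 ⊠ con 1 :+ ‵ 3 ⩽ ‵ 2 ∵ nB<nA
        ∷ 1 ⊠ ‵ 6 ⩽ ‵ 7 :+ ‵ 8 ∵ ≤-reflexive (nB-PQ Δ)
        ∷ 1 ⊠ ‵ 7 :+ ‵ 9 ⩽ ‵ 11 ∵ ≤-reflexive (Δ-value p)
        ∷ 1 ⊠ ‵ 8 :+ ‵ 10 ⩽ ‵ 12 ∵ ≤-reflexive (Δ-value q)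
        ∷ 1 ⊠ ‵ 13 ⩽ ‵ 9 ∵ ≤-reflexive (sym l.p-value)
        ∷ 1 ⊠ ‵ 14 ⩽ ‵ 10 ∵ ≤-reflexive (sym l.q-value)
        ∷ 1 ⊠ ‵ 11 ⩽ ‵ 16 ∵ ≤-reflexive u.p-value
        ∷ 1 ⊠ ‵ 12 ⩽ ‵ 17 ∵ ≤-reflexive u.q-value
        ∷ 1 ⊠ ‵ 5 :+ ‵ 15 ⩽ ‵ 4 :+ (‵ 13 :+ ‵ 14) ∵ ≤-reflexive (sym l.surplus)
        ∷ 1 ⊠ con 1 :+ (‵ 0 :+ ‵ 16 :+ ‵ 17) ⩽ ‵ 1 :+ con 1 :+ ‵ 15 ∵ neg
        ∷ []))

      rout-Y : rout X̂ Y ≤ ω + ω′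
      rout-Y = subst₂ (λ a b → rout X̂ Y ≤ a + b) l.r-value u.r-value out-Y

      star-Y : 3 + 3 * nA Y + 2 * ⟪ Y p ∧ Y q ⟫ ≤ 2 * (rout X̂ Y + ⟪ Y s ⟫) + 3 * nB Y
      star-Y = star° Y Y⊆X̂ (proj₂ nonempty)

      bal-Y : 3 * nA Y + (⟪ Y p ⟫ + ⟪ Y q ⟫) + flow E (X̂ ∖ Y) Y ≤ rout X̂ Y + ⟪ Y s ⟫ + 3 * nB Y
      bal-Y = bal° Y Y⊆X̂

    matched : (∀ (b : Blocked X̂ L U W) → Blocked.X b ⊆ K → ⊥) → ∃ λ N → Matching E (A ∩ (Δ ∩ K)) (B ∩ (Δ ∩ K)) N
    matched = interval X̂ K L U W L⊆U (λ v h → (∧ˡ {Δ v} h)) (λ v h → PQ⊆B v (∧ʳ {Δ v} h))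
      (λ v v∈B v∈U v∉L v∉W → K-intro (A-≢-B s∈A v∈B ∘ sym)
        (λ { refl → true≢false (∧-intro (∧-intro v∈U (not-intro v∉L)) (∨-introˡ (⌊≟⌋-refl v))) v∉W })
        (λ { refl → true≢false (∧-intro (∧-intro v∈U (not-intro v∉L)) (∨-introʳ (⌊≟⌋-refl v))) v∉W }))
      (λ v h → PQ∉K v (∧ʳ {Δ v} h)) equal

  both-values : ∀ {a b} → ⟪ a ⟫ ≡ 1 → ⟪ b ⟫ ≡ 1 → ⟪ a ∧ b ⟫ ≡ 1
  both-values {true} {true} _ _ = refl

  -- A violator contradicts `star°` except between two tight sets: there two edges may leave it,
  -- which `star°` would tolerate, and `bal°` is used instead.
  fill : ∀ {L U v} → Level L → Level U → L ⊆ U → v ∈ U → v ∉ L →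
         ∃ λ N → Matching E (A ∩ ((U ∖ L) ∩ K)) (B ∩ ((U ∖ L) ∩ K)) N
  fill {v = v} _ (bottom e) _ v∈U _ = ⊥-elim (true≢false v∈U (e v))
  fill {v = v} (top e) l L⊆U v∈U v∉L = ⊥-elim (true≢false (trans (e v) (level-⊆ l v v∈U)) v∉L)
  fill {L} {U} (bottom e) (middle t) L⊆U _ _ = F.matched λ b k →
      (farkas (nA (Blocked.Y b) ∷ nB (Blocked.Y b) ∷ rout X̂ (Blocked.Y b) ∷ ⟪ Blocked.Y b s ⟫
          ∷ ⟪ Blocked.Y b p ∧ Blocked.Y b q ⟫ ∷ [])
        ( 1 ⊠ con 3 :+ 3 :* (‵ 0) :+ 2 :* (‵ 4) ⩽ 2 :* (‵ 2 :+ ‵ 3) :+ 3 :* (‵ 1) ∵ F.star-Y b k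
        ∷ 2 ⊠ ‵ 3 ⩽ con 0 ∵ ≤-reflexive (F.s-Y b k)
        ∷ 3 ⊠ ‵ 1 :+ con 1 :+ con 0 ⩽ ‵ 0 :+ con 1 :+ con 0 ∵ F.deficit b k
        ∷ 2 ⊠ ‵ 2 ⩽ con 0 :+ con 1 ∵ F.rout-Y b k
        ∷ []))
    where module F = Fill {L} {U} L⊆U (Tight.Q⊆ t) (bottom-numbers e) (middle-numbers t)
  fill {L} {U} (middle t) (middle u) L⊆U _ _ = F.matched λ b k →
      (farkas (nA (Blocked.Y b) ∷ nB (Blocked.Y b) ∷ rout X̂ (Blocked.Y b) ∷ ⟪ Blocked.Y b s ⟫ ∷ ⟪ Blocked.Y b p ⟫
          ∷ ⟪ Blocked.Y b q ⟫ ∷ flow E (X̂ ∖ Blocked.Y b) (Blocked.Y b) ∷ [])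
        ( 1 ⊠ 3 :* (‵ 0) :+ (‵ 4 :+ ‵ 5) :+ ‵ 6 ⩽ ‵ 2 :+ ‵ 3 :+ 3 :* (‵ 1) ∵ F.bal-Y b k
        ∷ 1 ⊠ ‵ 3 ⩽ con 1 ∵ ≤-reflexive (F.s-Y b k)
        ∷ 1 ⊠ con 1 ⩽ ‵ 4 ∵ ≤-reflexive (sym (F.p-Y b k))
        ∷ 3 ⊠ ‵ 1 :+ con 1 :+ con 1 ⩽ ‵ 0 :+ con 1 :+ con 0 ∵ F.deficit b k
        ∷ 1 ⊠ ‵ 2 ⩽ con 1 :+ con 1 ∵ F.rout-Y b k
        ∷ []))
    where module F = Fill {L} {U} L⊆U (Tight.Q⊆ u) (middle-numbers t) (middle-numbers u)
  fill {L} {U} (middle t) (top e) L⊆U _ _ = F.matched λ b k →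
      (farkas (nA (Blocked.Y b) ∷ nB (Blocked.Y b) ∷ rout X̂ (Blocked.Y b) ∷ ⟪ Blocked.Y b s ⟫
          ∷ ⟪ Blocked.Y b p ∧ Blocked.Y b q ⟫ ∷ [])
        ( 1 ⊠ con 3 :+ 3 :* (‵ 0) :+ 2 :* (‵ 4) ⩽ 2 :* (‵ 2 :+ ‵ 3) :+ 3 :* (‵ 1) ∵ F.star-Y b k
        ∷ 2 ⊠ ‵ 3 ⩽ con 1 ∵ ≤-reflexive (F.s-Y b k)
        ∷ 2 ⊠ con 1 ⩽ ‵ 4 ∵ ≤-reflexive (sym (both-values (F.p-Y b k) (F.q-Y b k)))
        ∷ 3 ⊠ ‵ 1 :+ con 1 :+ con 1 ⩽ ‵ 0 :+ con 1 :+ con 1 ∵ F.deficit b k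
        ∷ 2 ⊠ ‵ 2 ⩽ con 1 :+ con 0 ∵ F.rout-Y b k
        ∷ []))
    where module F = Fill {L} {U} L⊆U (level-⊆ (top e)) (middle-numbers t) (top-numbers e)
  fill {L} {U} (bottom e) (top e′) L⊆U _ _ = F.matched λ b k →
      (farkas (nA (Blocked.Y b) ∷ nB (Blocked.Y b) ∷ rout X̂ (Blocked.Y b) ∷ ⟪ Blocked.Y b s ⟫
          ∷ ⟪ Blocked.Y b p ∧ Blocked.Y b q ⟫ ∷ [])
        ( 1 ⊠ con 3 :+ 3 :* (‵ 0) :+ 2 :* (‵ 4) ⩽ 2 :* (‵ 2 :+ ‵ 3) :+ 3 :* (‵ 1) ∵ F.star-Y b k
        ∷ 2 ⊠ ‵ 3 ⩽ con 0 ∵ ≤-reflexive (F.s-Y b k)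
        ∷ 2 ⊠ con 1 ⩽ ‵ 4 ∵ ≤-reflexive (sym (both-values (F.p-Y b k) (F.q-Y b k)))
        ∷ 3 ⊠ ‵ 1 :+ con 1 :+ con 0 ⩽ ‵ 0 :+ con 1 :+ con 1 ∵ F.deficit b k
        ∷ 2 ⊠ ‵ 2 ⩽ con 0 :+ con 0 ∵ F.rout-Y b k
        ∷ []))
    where module F = Fill {L} {U} L⊆U (level-⊆ (top e′)) (bottom-numbers e) (top-numbers e′)

  module Chain = Lattice E A B K Level level-resp level? level-∩ level-∪ fill

  chain-matching : ∃ λ N → Matching E (A ∩ (X̂ ∩ K)) (B ∩ (X̂ ∩ K)) N × (∀ Q → Tight S X̂ s p q Q → Avoids N Q)
  chain-matching = convert (Chain.lattice-matching {∅} {X̂} {s} (bottom λ _ → refl) (top λ _ → refl) (λ _ ()) s∈ refl)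
    where
    convert : (∃ λ N → Matching E (A ∩ ((X̂ ∖ ∅) ∩ K)) (B ∩ ((X̂ ∖ ∅) ∩ K)) N × (∀ F → Level F → Avoids N F)) →
              ∃ λ N → Matching E (A ∩ (X̂ ∩ K)) (B ∩ (X̂ ∩ K)) N × (∀ Q → Tight S X̂ s p q Q → Avoids N Q)
    convert (N , m , avoid) = N , Matching-cong (same A) (same B) m , λ Q t → avoid Q (middle t)
      where
      same : ∀ C → (C ∩ ((X̂ ∖ ∅) ∩ K)) ≗ (C ∩ (X̂ ∩ K))
      same C v = cong (λ b → C v ∧ (b ∧ K v)) (∧-identityʳ (X̂ v))

  matched-A : ∀ Z → Z ⊆ X̂ → nA Z ≡ cnt (A ∩ (X̂ ∩ K)) Z + ⟪ Z s ⟫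
  matched-A Z h = trans (nA-K Z) (cong (_+ ⟪ Z s ⟫) (∑-cong λ v → cong ⟪_⟫ (rearrange (A v) (X̂ v) (K v) (Z v) (h v))))
    where
    rearrange : ∀ a x k z → (z ≡ true → x ≡ true) → a ∧ (z ∧ k) ≡ (a ∧ (x ∧ k)) ∧ z
    rearrange false x k z i = refl
    rearrange true x k true i rewrite i refl = sym (∧-identityʳ k)
    rearrange true x k false i = sym (∧-zeroʳ (x ∧ k))

  matched-B : ∀ Z → Z ⊆ X̂ → nB Z ≡ cnt (B ∩ (X̂ ∩ K)) Z + (⟪ Z p ⟫ + ⟪ Z q ⟫)
  matched-B Z h = trans (nB-K Z) (cong₂ _+_ (∑-cong λ v → cong ⟪_⟫ (rearrange (B v) (X̂ v) (K v) (Z v) (h v))) (nB-PQ Z))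
    where
    rearrange : ∀ a x k z → (z ≡ true → x ≡ true) → a ∧ (z ∧ k) ≡ (a ∧ (x ∧ k)) ∧ z
    rearrange false x k z i = refl
    rearrange true x k true i rewrite i refl = sym (∧-identityʳ k)
    rearrange true x k false i = sym (∧-zeroʳ (x ∧ k))

  -- Tight sets containing p and tight sets containing q cross as in K₄.
  module Opposite {N : Adj n} (m : Matching E (A ∩ (X̂ ∩ K)) (B ∩ (X̂ ∩ K)) N)
    {P Q : VSet n} (t : Tight S X̂ s p q P) (u : Tight S X̂ s q p Q) (avoidP : Avoids N P) where

    module t = Tight t
    module u = Tight u

    I U : VSet n
    I = P ∩ Q
    U = P ∪ Q

    I⊆ : I ⊆ X̂
    I⊆ v h = t.Q⊆ v (∧ˡ {P v} h)

    U⊆ : U ⊆ X̂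
    U⊆ v h = [ t.Q⊆ v , u.Q⊆ v ]′ (∨-true h)

    s∈I : s ∈ I
    s∈I = ∧-intro t.s∈ u.s∈

    s∈U : s ∈ U
    s∈U = ∨-introˡ t.s∈

    p∉I : p ∉ I
    p∉I = trans (cong (P p ∧_) u.q∉) (∧-zeroʳ (P p))

    q∉I : q ∉ I
    q∉I = cong (_∧ Q q) t.q∉

    p∈U : p ∈ U
    p∈U = ∨-introˡ t.p∈

    q∈U : q ∈ U
    q∈U = ∨-introʳ {P q} u.p∈

    sub : rout X̂ I + rout X̂ U ≤ 2
    sub = subst₂ (λ a b → rout X̂ I + rout X̂ U ≤ a + b) t.rout≡1 u.rout≡1 (rout-submodular P Q)

    sizes : nA I + nA U ≡ nB I + nB U
    sizes = trans (modular A P Q) (trans (cong₂ _+_ t.nA≡nB u.nA≡nB) (sym (modular B P Q)))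

    bal-I : 3 * nA I + flow E (X̂ ∖ I) I ≤ rout X̂ I + 1 + 3 * nB I
    bal-I = (≮⇒≥ λ neg → farkas (nA I ∷ nB I ∷ rout X̂ I ∷ ⟪ I p ⟫ ∷ ⟪ I q ⟫ ∷ ⟪ I s ⟫ ∷ flow E (X̂ ∖ I) I ∷ [])
      ( 1 ⊠ 3 :* (‵ 0) :+ (‵ 3 :+ ‵ 4) :+ ‵ 6 ⩽ ‵ 2 :+ ‵ 5 :+ 3 :* (‵ 1) ∵ bal° I I⊆
      ∷ 1 ⊠ ‵ 5 ⩽ con 1 ∵ ≤-reflexive (cong ⟪_⟫ s∈I)
      ∷ 1 ⊠ con 1 :+ (‵ 2 :+ con 1 :+ 3 :* (‵ 1)) ⩽ 3 :* (‵ 0) :+ ‵ 6 ∵ neg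
      ∷ []))

    bal-U : 3 * nA U + 2 ≤ rout X̂ U + 1 + 3 * nB U
    bal-U = (≮⇒≥ λ neg → farkas (nA U ∷ nB U ∷ rout X̂ U ∷ ⟪ U p ⟫ ∷ ⟪ U q ⟫ ∷ ⟪ U s ⟫ ∷ flow E (X̂ ∖ U) U ∷ [])
      ( 1 ⊠ 3 :* (‵ 0) :+ (‵ 3 :+ ‵ 4) :+ ‵ 6 ⩽ ‵ 2 :+ ‵ 5 :+ 3 :* (‵ 1) ∵ bal° U U⊆
      ∷ 1 ⊠ con 1 ⩽ ‵ 3 ∵ ≤-reflexive (sym (cong ⟪_⟫ p∈U))
      ∷ 1 ⊠ con 1 ⩽ ‵ 4 ∵ ≤-reflexive (sym (cong ⟪_⟫ q∈U))
      ∷ 1 ⊠ ‵ 5 ⩽ con 1 ∵ ≤-reflexive (cong ⟪_⟫ s∈U)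
      ∷ 1 ⊠ con 1 :+ (‵ 2 :+ con 1 :+ 3 :* (‵ 1)) ⩽ 3 :* (‵ 0) :+ con 2 ∵ neg
      ∷ []))

    star-I : 3 + 3 * nA I ≤ 2 * (rout X̂ I + 1) + 3 * nB I
    star-I = (≮⇒≥ λ neg → farkas (nA I ∷ nB I ∷ rout X̂ I ∷ ⟪ I p ∧ I q ⟫ ∷ ⟪ I s ⟫ ∷ [])
      ( 1 ⊠ con 3 :+ 3 :* (‵ 0) :+ 2 :* (‵ 3) ⩽ 2 :* (‵ 2 :+ ‵ 4) :+ 3 :* (‵ 1) ∵ star° I I⊆ s∈I
      ∷ 2 ⊠ ‵ 4 ⩽ con 1 ∵ ≤-reflexive (cong ⟪_⟫ s∈I)
      ∷ 1 ⊠ con 1 :+ (2 :* (‵ 2 :+ con 1) :+ 3 :* (‵ 1)) ⩽ con 3 :+ 3 :* (‵ 0) ∵ neg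
      ∷ []))

    star-U : 3 + 3 * nA U + 2 ≤ 2 * (rout X̂ U + 1) + 3 * nB U
    star-U = (≮⇒≥ λ neg → farkas (nA U ∷ nB U ∷ rout X̂ U ∷ ⟪ U p ∧ U q ⟫ ∷ ⟪ U s ⟫ ∷ [])
      ( 1 ⊠ con 3 :+ 3 :* (‵ 0) :+ 2 :* (‵ 3) ⩽ 2 :* (‵ 2 :+ ‵ 4) :+ 3 :* (‵ 1) ∵ star° U U⊆ s∈U
      ∷ 2 ⊠ con 1 ⩽ ‵ 3 ∵ ≤-reflexive (sym (cong ⟪_⟫ (∧-intro p∈U q∈U)))
      ∷ 2 ⊠ ‵ 4 ⩽ con 1 ∵ ≤-reflexive (cong ⟪_⟫ s∈U)
      ∷ 1 ⊠ con 1 :+ (2 :* (‵ 2 :+ con 1) :+ 3 :* (‵ 1)) ⩽ con 3 :+ 3 :* (‵ 0) :+ con 2 ∵ neg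
      ∷ []))

    -- Otherwise `star-U` assigns both leaving edges to U and none to I; `star-I` then gives I a
    -- surplus of B, hence U a surplus of A, for which `bal-U` would need at least four leaving
    -- edges.
    deficit-U : nA U < nB U
    deficit-U = ≰⇒> λ h →
      let
        two : 2 ≤ rout X̂ U
        two = (≮⇒≥ λ neg → farkas (rout X̂ U ∷ nA U ∷ nB U ∷ [])
          ( 1 ⊠ con 3 :+ 3 :* (‵ 1) :+ con 2 ⩽ 2 :* (‵ 0 :+ con 1) :+ 3 :* (‵ 2) ∵ star-U
          ∷ 3 ⊠ ‵ 2 ⩽ ‵ 1 ∵ h
          ∷ 2 ⊠ con 1 :+ ‵ 0 ⩽ con 2 ∵ neg
          ∷ []))
        deficit-I : nA I < nB I
        deficit-I = (≮⇒≥ λ neg → farkas (rout X̂ U ∷ rout X̂ I ∷ nA I ∷ nB I ∷ [])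
          ( 1 ⊠ con 3 :+ 3 :* (‵ 2) ⩽ 2 :* (‵ 1 :+ con 1) :+ 3 :* (‵ 3) ∵ star-I
          ∷ 2 ⊠ ‵ 1 :+ ‵ 0 ⩽ con 2 ∵ sub
          ∷ 2 ⊠ con 2 ⩽ ‵ 0 ∵ two
          ∷ 3 ⊠ con 1 :+ ‵ 3 ⩽ con 1 :+ ‵ 2 ∵ neg
          ∷ []))
      in (farkas (rout X̂ U ∷ rout X̂ I ∷ nA I ∷ nB I ∷ nA U ∷ nB U ∷ [])
        ( 3 ⊠ con 1 :+ ‵ 2 ⩽ ‵ 3 ∵ deficit-I
        ∷ 3 ⊠ ‵ 3 :+ ‵ 5 ⩽ ‵ 2 :+ ‵ 4 ∵ ≤-reflexive (sym sizes)
        ∷ 1 ⊠ 3 :* (‵ 4) :+ con 2 ⩽ ‵ 0 :+ con 1 :+ 3 :* (‵ 5) ∵ bal-U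
        ∷ 1 ⊠ ‵ 1 :+ ‵ 0 ⩽ con 2 ∵ sub
        ∷ []))

    -- I has a surplus of A, so `bal-I` needs two edges leaving I and tolerates none entering from
    -- X̂. Submodularity leaves nothing for U.
    rout-U : rout X̂ U ≡ 0
    rout-U = n≤0⇒n≡0 (≮⇒≥ λ neg → farkas (rout X̂ U ∷ rout X̂ I ∷ nA I ∷ nB I ∷ nA U ∷ nB U ∷ flow E (X̂ ∖ I) I ∷ [])
      ( 3 ⊠ con 1 :+ ‵ 4 ⩽ ‵ 5 ∵ deficit-U
      ∷ 3 ⊠ ‵ 3 :+ ‵ 5 ⩽ ‵ 2 :+ ‵ 4 ∵ ≤-reflexive (sym sizes)
      ∷ 1 ⊠ 3 :* (‵ 2) :+ ‵ 6 ⩽ ‵ 1 :+ con 1 :+ 3 :* (‵ 3) ∵ bal-I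
      ∷ 1 ⊠ ‵ 1 :+ ‵ 0 ⩽ con 2 ∵ sub
      ∷ 1 ⊠ con 1 :+ con 0 ⩽ ‵ 0 ∵ neg
      ∷ []))

    back-I : flow E (X̂ ∖ I) I ≡ 0
    back-I = n≤0⇒n≡0 (≮⇒≥ λ neg → farkas (rout X̂ U ∷ rout X̂ I ∷ nA I ∷ nB I ∷ nA U ∷ nB U ∷ flow E (X̂ ∖ I) I ∷ [])
      ( 3 ⊠ con 1 :+ ‵ 4 ⩽ ‵ 5 ∵ deficit-U
      ∷ 3 ⊠ ‵ 3 :+ ‵ 5 ⩽ ‵ 2 :+ ‵ 4 ∵ ≤-reflexive (sym sizes)
      ∷ 1 ⊠ 3 :* (‵ 2) :+ ‵ 6 ⩽ ‵ 1 :+ con 1 :+ 3 :* (‵ 3) ∵ bal-I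
      ∷ 1 ⊠ ‵ 1 :+ ‵ 0 ⩽ con 2 ∵ sub
      ∷ 1 ⊠ con 1 :+ con 0 ⩽ ‵ 6 ∵ neg
      ∷ []))

    excess-I : nA I ≡ 1 + nB I
    excess-I = ≤-antisym
      (≮⇒≥ λ neg → farkas (rout X̂ U ∷ rout X̂ I ∷ nA I ∷ nB I ∷ flow E (X̂ ∖ I) I ∷ [])
        ( 1 ⊠ 3 :* (‵ 2) :+ ‵ 4 ⩽ ‵ 1 :+ con 1 :+ 3 :* (‵ 3) ∵ bal-I
        ∷ 1 ⊠ ‵ 1 :+ ‵ 0 ⩽ con 2 ∵ sub
        ∷ 3 ⊠ con 1 :+ (con 1 :+ ‵ 3) ⩽ ‵ 2 ∵ neg
        ∷ []))
      (≮⇒≥ λ neg → farkas (nA I ∷ nB I ∷ nA U ∷ nB U ∷ [])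
        ( 1 ⊠ con 1 :+ ‵ 2 ⩽ ‵ 3 ∵ deficit-U
        ∷ 1 ⊠ ‵ 1 :+ ‵ 3 ⩽ ‵ 0 :+ ‵ 2 ∵ ≤-reflexive (sym sizes)
        ∷ 1 ⊠ con 1 :+ ‵ 0 ⩽ con 1 :+ ‵ 1 ∵ neg
        ∷ []))

    N-X̂ : ∀ {x y} → N x y ≡ true → x ∈ X̂ × y ∈ X̂
    N-X̂ {x} {y} h = (∧ˡ {X̂ x} (∧ʳ {A x} (Matching.left m x y h)))
                  , (∧ˡ {X̂ y} (∧ʳ {B y} (Matching.right m x y h)))

    N-back-I : flow N (∁ I) I ≡ 0
    N-back-I = flow-0 N {∁ I} {I} λ x y h i j → positive back-I (flow-term E {X̂ ∖ I} {I} (Matching.edge m x y h) (∧-intro (proj₁ (N-X̂ h)) i) j)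
      where
      positive : ∀ {k} → k ≡ 0 → 1 ≤ k → ⊥
      positive refl ()

    N-out-U : flow N U (∁ U) ≡ 0
    N-out-U = flow-0 N {U} {∁ U} λ x y h i j → positive rout-U (flow-term E {U} {X̂ ∖ U} (Matching.edge m x y h) i (∧-intro (proj₂ (N-X̂ h)) j))
      where
      positive : ∀ {k} → k ≡ 0 → 1 ≤ k → ⊥
      positive refl ()

    -- Apart from s, which N does not cover, I has as many vertices of A as of B; as N does not
    -- enter I, it cannot leave it. For U the same count leaves out s, p and q.
    N-out-I : flow N I (∁ I) ≡ 0
    N-out-I = n≤0⇒n≡0 (≮⇒≥ λ neg → farkas (flow N I (∁ I) ∷ flow N (∁ I) I ∷ nA I ∷ nB I ∷ cnt (A ∩ (X̂ ∩ K)) I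
        ∷ cnt (B ∩ (X̂ ∩ K)) I ∷ ⟪ I s ⟫ ∷ ⟪ I p ⟫ ∷ ⟪ I q ⟫ ∷ [])
      ( 1 ⊠ ‵ 5 :+ ‵ 0 ⩽ ‵ 4 :+ ‵ 1 ∵ ≤-reflexive (sym (matching-balance m I))
      ∷ 1 ⊠ ‵ 1 ⩽ con 0 ∵ ≤-reflexive N-back-I
      ∷ 1 ⊠ ‵ 4 :+ ‵ 6 ⩽ ‵ 2 ∵ ≤-reflexive (sym (matched-A I I⊆))
      ∷ 1 ⊠ ‵ 3 ⩽ ‵ 5 :+ (‵ 7 :+ ‵ 8) ∵ ≤-reflexive (matched-B I I⊆)
      ∷ 1 ⊠ con 1 ⩽ ‵ 6 ∵ ≤-reflexive (sym (cong ⟪_⟫ s∈I))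
      ∷ 1 ⊠ ‵ 7 ⩽ con 0 ∵ ≤-reflexive (cong ⟪_⟫ p∉I)
      ∷ 1 ⊠ ‵ 8 ⩽ con 0 ∵ ≤-reflexive (cong ⟪_⟫ q∉I)
      ∷ 1 ⊠ ‵ 2 ⩽ con 1 :+ ‵ 3 ∵ ≤-reflexive excess-I
      ∷ 1 ⊠ con 1 :+ con 0 ⩽ ‵ 0 ∵ neg
      ∷ []))

    N-back-U : flow N (∁ U) U ≡ 0
    N-back-U = n≤0⇒n≡0 (≮⇒≥ λ neg → farkas (flow N U (∁ U) ∷ flow N (∁ U) U ∷ nA U ∷ nB U ∷ cnt (A ∩ (X̂ ∩ K)) U
        ∷ cnt (B ∩ (X̂ ∩ K)) U ∷ ⟪ U s ⟫ ∷ ⟪ U p ⟫ ∷ ⟪ U q ⟫ ∷ nA I ∷ nB I ∷ [])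
      ( 1 ⊠ ‵ 4 :+ ‵ 1 ⩽ ‵ 5 :+ ‵ 0 ∵ ≤-reflexive (matching-balance m U)
      ∷ 1 ⊠ ‵ 0 ⩽ con 0 ∵ ≤-reflexive N-out-U
      ∷ 1 ⊠ ‵ 2 ⩽ ‵ 4 :+ ‵ 6 ∵ ≤-reflexive (matched-A U U⊆)
      ∷ 1 ⊠ ‵ 5 :+ (‵ 7 :+ ‵ 8) ⩽ ‵ 3 ∵ ≤-reflexive (sym (matched-B U U⊆))
      ∷ 1 ⊠ ‵ 6 ⩽ con 1 ∵ ≤-reflexive (cong ⟪_⟫ s∈U)
      ∷ 1 ⊠ con 1 ⩽ ‵ 7 ∵ ≤-reflexive (sym (cong ⟪_⟫ p∈U))
      ∷ 1 ⊠ con 1 ⩽ ‵ 8 ∵ ≤-reflexive (sym (cong ⟪_⟫ q∈U))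
      ∷ 1 ⊠ ‵ 10 :+ ‵ 3 ⩽ ‵ 9 :+ ‵ 2 ∵ ≤-reflexive (sym sizes)
      ∷ 1 ⊠ ‵ 9 ⩽ con 1 :+ ‵ 10 ∵ ≤-reflexive excess-I
      ∷ 1 ⊠ con 1 :+ con 0 ⩽ ‵ 1 ∵ neg
      ∷ []))

    avoidQ : Avoids N Q
    avoidQ x y h = decide (bool (P x))
      where
      avoidI : I x ≡ I y
      avoidI = avoids-if-no-flow N I N-out-I N-back-I x y h
      avoidU : U x ≡ U y
      avoidU = avoids-if-no-flow N U N-out-U N-back-U x y h
      -- Within P membership in Q is membership in I, outside P it is membership in U, and N does
      -- not change sides of P.
      decide : P x ≡ true ⊎ P x ≡ false → Q x ≡ Q y
      decide (inj₁ r) = trans (sym (cong (_∧ Q x) r)) (trans avoidI (cong (_∧ Q y) (trans (sym (avoidP x y h)) r)))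
      decide (inj₂ r) = trans (sym (cong (_∨ Q x) r)) (trans avoidU (cong (_∨ Q y) (trans (sym (avoidP x y h)) r)))

EndResult : ∀ {n} (S : Setup n) (X̂ : VSet n) (s p q : Fin n) → Set
EndResult {n} S X̂ s p q = ∃ λ (N : Adj n) →
  Matching E (A ∩ (X̂ ∩ inner-vertices s p q)) (B ∩ (X̂ ∩ inner-vertices s p q)) N ×
  (∀ Q → Tight S X̂ s p q Q → Avoids N Q) × (∀ Q → Tight S X̂ s q p Q → Avoids N Q)
  where open Basics S

-- The lattice argument serves only one of the two orientations of p and q. A single tight set of
-- that orientation suffices to transfer the property to all tight sets of the other one; if there
-- is none, the other orientation is served directly.
end-matching : ∀ {n} (S : Setup n) {X̂ s p q} → End S X̂ s p q → EndResult S X̂ s p q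
end-matching {n} S {X̂} {s} {p} {q} end = decide (∃set? F.tight-resp F.tight?)
  where
  module F = EndMatching S end
  module G = EndMatching S (End-swap end)
  open Basics S

  decide : Dec (∃ (Tight S X̂ s p q)) → EndResult S X̂ s p q
  decide (yes (P , t)) = finish F.chain-matching
    where
    finish : (∃ λ N → Matching E (A ∩ (X̂ ∩ F.K)) (B ∩ (X̂ ∩ F.K)) N × (∀ Q → Tight S X̂ s p q Q → Avoids N Q)) → EndResult S X̂ s p q
    finish (N , m , avoid) = N , m , avoid , λ Q u → F.Opposite.avoidQ m t u (avoid P t)
  decide (no none) = finish G.chain-matching
    where
    finish : (∃ λ N → Matching E (A ∩ (X̂ ∩ G.K)) (B ∩ (X̂ ∩ G.K)) N × (∀ Q → Tight S X̂ s q p Q → Avoids N Q)) → EndResult S X̂ s p q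
    finish (N , m , avoid) = N , Matching-cong (same A) (same B) m , (λ Q t → ⊥-elim (none (Q , t))) , avoid
      where
      same : ∀ C → (C ∩ (X̂ ∩ G.K)) ≗ (C ∩ (X̂ ∩ F.K))
      same C v = cong (λ b → C v ∧ (X̂ v ∧ (not (⁅ s ⁆ v) ∧ b))) (∧-comm (not (⁅ q ⁆ v)) (not (⁅ p ⁆ v)))

-- The chain of special sets

module Specials {n} (S : Setup n) where
  open Perfect S
  open Facts S
  open Basics S
  open Intervals S

  special-star : ∀ {X} → a₁ ∉ X → a₂ ∉ X → b₁ ∈ X → b₂ ∈ X → 5 + 3 * nA X ≤ 2 * out X + 3 * nB X
  special-star {X} p q r u = (≮⇒≥ λ neg → farkas (nA X ∷ nB X ∷ out X ∷ α X ∷ β X ∷ [])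
    ( 1 ⊠ con 3 :+ 3 :* (‵ 0) :+ 2 :* (‵ 4) ⩽ 2 :* (‵ 2) :+ 2 :* (‵ 3) :+ 3 :* (‵ 1) ∵ star X r p
    ∷ 2 ⊠ ‵ 3 ⩽ con 0 ∵ ≤-reflexive (α≡0 {X} p q)
    ∷ 2 ⊠ con 1 ⩽ ‵ 4 ∵ ≤-reflexive (sym (β≡1 {X} r u))
    ∷ 1 ⊠ con 1 :+ (2 :* (‵ 2) :+ 3 :* (‵ 1)) ⩽ con 5 :+ 3 :* (‵ 0) ∵ neg
    ∷ []))

  special-resp : ∀ {X Y} → X ≗ Y → Special shape X → Special shape Y
  special-resp h sp = record
    { a₁∉ = trans (sym (h a₁)) a₁∉ ; a₂∉ = trans (sym (h a₂)) a₂∉ ; b₁∈ = trans (sym (h b₁)) b₁∈ ; b₂∈ = trans (sym (h b₂)) b₂∈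
    ; excess = trans (sym (cnt-cong B h)) (trans excess (cong suc (cnt-cong A h)))
    ; out≡1 = trans (flow-cong E (sym ∘ h) (λ v → cong not (sym (h v)))) out≡1 }
    where open Special sp

  special? : ∀ X → Dec (Special shape X)
  special? X = build (X a₁ Bool.≟ false) (X a₂ Bool.≟ false) (X b₁ Bool.≟ true) (X b₂ Bool.≟ true) (nB X Nat.≟ 1 + nA X) (out X Nat.≟ 1)
    where
    build : Dec (a₁ ∉ X) → Dec (a₂ ∉ X) → Dec (b₁ ∈ X) → Dec (b₂ ∈ X) → Dec (nB X ≡ 1 + nA X) → Dec (out X ≡ 1) → Dec (Special shape X)
    build (yes a) (yes b) (yes c) (yes d) (yes e) (yes f) = yes (record { a₁∉ = a ; a₂∉ = b ; b₁∈ = c ; b₂∈ = d ; excess = e ; out≡1 = f })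
    build (no h) _ _ _ _ _ = no (h ∘ Special.a₁∉)
    build _ (no h) _ _ _ _ = no (h ∘ Special.a₂∉)
    build _ _ (no h) _ _ _ = no (h ∘ Special.b₁∈)
    build _ _ _ (no h) _ _ = no (h ∘ Special.b₂∈)
    build _ _ _ _ (no h) _ = no (h ∘ Special.excess)
    build _ _ _ _ _ (no h) = no (h ∘ Special.out≡1)

  module Two {X Y} (sx : Special shape X) (sy : Special shape Y) where
    private
      module X = Special sx
      module Y = Special sy

    I U P Q : VSet n
    I = X ∩ Y
    U = X ∪ Y
    P = X ∖ Y
    Q = Y ∖ X

    sizes : ∀ c → cnt c I + cnt c U ≡ cnt c X + cnt c Y
    sizes c = cnt-≡ {2} (λ { (x ∷ y ∷ []) → x ∧ y ∷ (x ∨ y) ∷ [] }) (λ { (x ∷ y ∷ []) → x ∷ y ∷ [] }) c (X ∷ Y ∷ [])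

    submodular : out I + out U ≤ out X + out Y
    submodular = flow-≤ {2} (λ { (x ∷ y ∷ []) → (x ∧ y , not (x ∧ y)) ∷ (x ∨ y , not (x ∨ y)) ∷ [] })
                            (λ { (x ∷ y ∷ []) → (x , not x) ∷ (y , not y) ∷ [] }) E (X ∷ Y ∷ [])

    small : out I + out U ≤ 2
    small = subst₂ (λ a b → out I + out U ≤ a + b) X.out≡1 Y.out≡1 submodular

    a₁∉U : a₁ ∉ U
    a₁∉U = ∨-false-intro X.a₁∉ Y.a₁∉

    star-I : 5 + 3 * nA I ≤ 2 * out I + 3 * nB I
    star-I = special-star (cong (_∧ Y a₁) X.a₁∉) (cong (_∧ Y a₂) X.a₂∉) (∧-intro X.b₁∈ Y.b₁∈) (∧-intro X.b₂∈ Y.b₂∈)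

    star-U : 5 + 3 * nA U ≤ 2 * out U + 3 * nB U
    star-U = special-star a₁∉U (∨-false-intro X.a₂∉ Y.a₂∉) (∨-introˡ X.b₁∈) (∨-introˡ X.b₂∈)

    -- At most two edges leave I, while `star-I` without an excess of B would need three. The same
    -- holds for U, and the excesses of X and Y add up to 2.
    large-I : 1 + nA I ≤ nB I
    large-I = (≮⇒≥ λ neg → farkas (nA I ∷ nB I ∷ out I ∷ out U ∷ [])
      ( 1 ⊠ con 5 :+ 3 :* (‵ 0) ⩽ 2 :* (‵ 2) :+ 3 :* (‵ 1) ∵ star-I
      ∷ 2 ⊠ ‵ 2 :+ ‵ 3 ⩽ con 2 ∵ small
      ∷ 3 ⊠ con 1 :+ ‵ 1 ⩽ con 1 :+ ‵ 0 ∵ neg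
      ∷ []))

    large-U : 1 + nA U ≤ nB U
    large-U = (≮⇒≥ λ neg → farkas (nA U ∷ nB U ∷ out I ∷ out U ∷ [])
      ( 1 ⊠ con 5 :+ 3 :* (‵ 0) ⩽ 2 :* (‵ 3) :+ 3 :* (‵ 1) ∵ star-U
      ∷ 2 ⊠ ‵ 2 :+ ‵ 3 ⩽ con 2 ∵ small
      ∷ 3 ⊠ con 1 :+ ‵ 1 ⩽ con 1 :+ ‵ 0 ∵ neg
      ∷ []))

    excess-I : nB I ≡ 1 + nA I
    excess-I = ≤-antisym
      (≮⇒≥ λ neg → farkas (nA I ∷ nB I ∷ nA U ∷ nB U ∷ nA X ∷ nB X ∷ nA Y ∷ nB Y ∷ [])
        ( 1 ⊠ ‵ 4 :+ ‵ 6 ⩽ ‵ 0 :+ ‵ 2 ∵ ≤-reflexive (sym (sizes A))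
        ∷ 1 ⊠ ‵ 1 :+ ‵ 3 ⩽ ‵ 5 :+ ‵ 7 ∵ ≤-reflexive (sizes B)
        ∷ 1 ⊠ ‵ 5 ⩽ con 1 :+ ‵ 4 ∵ ≤-reflexive X.excess
        ∷ 1 ⊠ ‵ 7 ⩽ con 1 :+ ‵ 6 ∵ ≤-reflexive Y.excess
        ∷ 1 ⊠ con 1 :+ ‵ 2 ⩽ ‵ 3 ∵ large-U
        ∷ 1 ⊠ con 1 :+ (con 1 :+ ‵ 0) ⩽ ‵ 1 ∵ neg
        ∷ [])) large-I

    excess-U : nB U ≡ 1 + nA U
    excess-U = ≤-antisym
      (≮⇒≥ λ neg → farkas (nA I ∷ nB I ∷ nA U ∷ nB U ∷ nA X ∷ nB X ∷ nA Y ∷ nB Y ∷ [])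
        ( 1 ⊠ ‵ 4 :+ ‵ 6 ⩽ ‵ 0 :+ ‵ 2 ∵ ≤-reflexive (sym (sizes A))
        ∷ 1 ⊠ ‵ 1 :+ ‵ 3 ⩽ ‵ 5 :+ ‵ 7 ∵ ≤-reflexive (sizes B)
        ∷ 1 ⊠ ‵ 5 ⩽ con 1 :+ ‵ 4 ∵ ≤-reflexive X.excess
        ∷ 1 ⊠ ‵ 7 ⩽ con 1 :+ ‵ 6 ∵ ≤-reflexive Y.excess
        ∷ 1 ⊠ con 1 :+ ‵ 0 ⩽ ‵ 1 ∵ large-I
        ∷ 1 ⊠ con 1 :+ (con 1 :+ ‵ 2) ⩽ ‵ 3 ∵ neg
        ∷ [])) large-U

    out-I≥1 : 1 ≤ out I
    out-I≥1 = (≮⇒≥ λ neg → farkas (nA I ∷ nB I ∷ out I ∷ [])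
      ( 1 ⊠ con 5 :+ 3 :* (‵ 0) ⩽ 2 :* (‵ 2) :+ 3 :* (‵ 1) ∵ star-I
      ∷ 3 ⊠ ‵ 1 ⩽ con 1 :+ ‵ 0 ∵ ≤-reflexive excess-I
      ∷ 2 ⊠ con 1 :+ ‵ 2 ⩽ con 1 ∵ neg
      ∷ []))

    out-U≥1 : 1 ≤ out U
    out-U≥1 = (≮⇒≥ λ neg → farkas (nA U ∷ nB U ∷ out U ∷ [])
      ( 1 ⊠ con 5 :+ 3 :* (‵ 0) ⩽ 2 :* (‵ 2) :+ 3 :* (‵ 1) ∵ star-U
      ∷ 3 ⊠ ‵ 1 ⩽ con 1 :+ ‵ 0 ∵ ≤-reflexive excess-U
      ∷ 2 ⊠ con 1 :+ ‵ 2 ⩽ con 1 ∵ neg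
      ∷ []))

    special-∩ : Special shape I
    special-∩ = record
      { a₁∉ = cong (_∧ Y a₁) X.a₁∉ ; a₂∉ = cong (_∧ Y a₂) X.a₂∉ ; b₁∈ = ∧-intro X.b₁∈ Y.b₁∈ ; b₂∈ = ∧-intro X.b₂∈ Y.b₂∈
      ; excess = excess-I
      ; out≡1 = ≤-antisym (≮⇒≥ λ neg → farkas (out I ∷ out U ∷ [])
        ( 1 ⊠ ‵ 0 :+ ‵ 1 ⩽ con 2 ∵ small
        ∷ 1 ⊠ con 1 ⩽ ‵ 1 ∵ out-U≥1
        ∷ 1 ⊠ con 1 :+ con 1 ⩽ ‵ 0 ∵ neg
        ∷ [])) out-I≥1 }

    special-∪ : Special shape U
    special-∪ = record
      { a₁∉ = a₁∉U ; a₂∉ = ∨-false-intro X.a₂∉ Y.a₂∉ ; b₁∈ = ∨-introˡ X.b₁∈ ; b₂∈ = ∨-introˡ X.b₂∈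
      ; excess = excess-U
      ; out≡1 = ≤-antisym (≮⇒≥ λ neg → farkas (out I ∷ out U ∷ [])
        ( 1 ⊠ ‵ 0 :+ ‵ 1 ⩽ con 2 ∵ small
        ∷ 1 ⊠ con 1 ⩽ ‵ 0 ∵ out-I≥1
        ∷ 1 ⊠ con 1 :+ con 1 ⩽ ‵ 1 ∵ neg
        ∷ [])) out-U≥1 }

    -- The differences P and Q would be balanced, hence have cuts of size at least 4, but the two cuts add up to at most 6.
    not-crossing : ∀ {x y} → x ∈ P → y ∈ Q → ⊥
    not-crossing {x} {y} p q = (farkas (out P ∷ out Q ∷ out I ∷ back I ∷ out X ∷ out Y ∷ nA I ∷ nB I ∷ εa I ∷ εb I ∷ [])
      ( 1 ⊠ ‵ 0 :+ (‵ 1 :+ ‵ 2) ⩽ ‵ 3 :+ (‵ 4 :+ ‵ 5) ∵ cells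
      ∷ 1 ⊠ con 2 ⩽ ‵ 0 ∵ difference-out P p (cong (_∧ not (Y a₁)) X.a₁∉) (cong (_∧ not (Y a₂)) X.a₂∉) equal-P
      ∷ 1 ⊠ con 2 ⩽ ‵ 1 ∵ difference-out Q q (cong (_∧ not (X a₁)) Y.a₁∉) (cong (_∧ not (X a₂)) Y.a₂∉) equal-Q
      ∷ 1 ⊠ ‵ 4 ⩽ con 1 ∵ ≤-reflexive X.out≡1
      ∷ 1 ⊠ ‵ 5 ⩽ con 1 ∵ ≤-reflexive Y.out≡1
      ∷ 1 ⊠ ‵ 3 :+ 3 :* (‵ 6) :+ ‵ 9 ⩽ ‵ 2 :+ 3 :* (‵ 7) :+ ‵ 8 ∵ ≤-reflexive (sym (balance I))
      ∷ 3 ⊠ ‵ 7 ⩽ con 1 :+ ‵ 6 ∵ ≤-reflexive excess-I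
      ∷ 1 ⊠ ‵ 8 ⩽ con 0 ∵ ≤-reflexive (cong₂ (λ u v → ⟪ u ⟫ + ⟪ v ⟫) (Special.a₁∉ special-∩) (Special.a₂∉ special-∩))
      ∷ 1 ⊠ con 2 ⩽ ‵ 9 ∵ ≤-reflexive (sym (cong₂ (λ u v → ⟪ u ⟫ + ⟪ v ⟫) (Special.b₁∈ special-∩) (Special.b₂∈ special-∩)))
      ∷ []))
      where
      cells : out P + (out Q + out I) ≤ back I + (out X + out Y)
      cells = flow-≤ {2}
        (λ { (x ∷ y ∷ []) → (x ∧ not y , not (x ∧ not y)) ∷ (y ∧ not x , not (y ∧ not x)) ∷ (x ∧ y , not (x ∧ y)) ∷ [] })
        (λ { (x ∷ y ∷ []) → (not (x ∧ y) , x ∧ y) ∷ (x , not x) ∷ (y , not y) ∷ [] }) E (X ∷ Y ∷ [])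

      part : ∀ c → cnt c X ≡ cnt c I + cnt c P
      part c = cnt-≡ {2} (λ { (x ∷ y ∷ []) → x ∷ [] }) (λ { (x ∷ y ∷ []) → x ∧ y ∷ x ∧ not y ∷ [] }) c (X ∷ Y ∷ [])

      part′ : ∀ c → cnt c Y ≡ cnt c I + cnt c Q
      part′ c = cnt-≡ {2} (λ { (x ∷ y ∷ []) → y ∷ [] }) (λ { (x ∷ y ∷ []) → x ∧ y ∷ y ∧ not x ∷ [] }) c (X ∷ Y ∷ [])

      equal-P : nB P ≤ nA P
      equal-P = (≮⇒≥ λ neg → farkas (nA P ∷ nB P ∷ nA I ∷ nB I ∷ nA X ∷ nB X ∷ [])
        ( 1 ⊠ ‵ 4 ⩽ ‵ 2 :+ ‵ 0 ∵ ≤-reflexive (part A)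
        ∷ 1 ⊠ ‵ 3 :+ ‵ 1 ⩽ ‵ 5 ∵ ≤-reflexive (sym (part B))
        ∷ 1 ⊠ ‵ 5 ⩽ con 1 :+ ‵ 4 ∵ ≤-reflexive X.excess
        ∷ 1 ⊠ con 1 :+ ‵ 2 ⩽ ‵ 3 ∵ ≤-reflexive (sym excess-I)
        ∷ 1 ⊠ con 1 :+ ‵ 0 ⩽ ‵ 1 ∵ neg
        ∷ []))

      equal-Q : nB Q ≤ nA Q
      equal-Q = (≮⇒≥ λ neg → farkas (nA Q ∷ nB Q ∷ nA I ∷ nB I ∷ nA Y ∷ nB Y ∷ [])
        ( 1 ⊠ ‵ 4 ⩽ ‵ 2 :+ ‵ 0 ∵ ≤-reflexive (part′ A)
        ∷ 1 ⊠ ‵ 3 :+ ‵ 1 ⩽ ‵ 5 ∵ ≤-reflexive (sym (part′ B))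
        ∷ 1 ⊠ ‵ 5 ⩽ con 1 :+ ‵ 4 ∵ ≤-reflexive Y.excess
        ∷ 1 ⊠ con 1 :+ ‵ 2 ⩽ ‵ 3 ∵ ≤-reflexive (sym excess-I)
        ∷ 1 ⊠ con 1 :+ ‵ 0 ⩽ ‵ 1 ∵ neg
        ∷ []))

      difference-out : ∀ D {x} → x ∈ D → a₁ ∉ D → a₂ ∉ D → nB D ≤ nA D → 2 ≤ out D
      difference-out D p q r h = (≮⇒≥ λ neg → farkas (nA D ∷ nB D ∷ out D ∷ α D ∷ β D ∷ [])
        ( 1 ⊠ con 3 :+ 3 :* (‵ 0) :+ 2 :* (‵ 4) ⩽ 2 :* (‵ 2) :+ 2 :* (‵ 3) :+ 3 :* (‵ 1) ∵ star D p q
        ∷ 2 ⊠ ‵ 3 ⩽ con 0 ∵ ≤-reflexive (α≡0 {D} q r)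
        ∷ 3 ⊠ ‵ 1 ⩽ ‵ 0 ∵ h
        ∷ 2 ⊠ con 1 :+ ‵ 2 ⩽ con 2 ∵ neg
        ∷ []))

  -- Special sets do not cross, so one that does not contain X lies properly inside X, and descent
  -- on the cardinality ends at a set contained in all others.
  least-special : ∃ (Special shape) → ∃ λ X → Special shape X × (∀ Y → Special shape Y → X ⊆ Y)
  least-special (X , sp) = descend (suc (cnt V X)) X ≤-refl sp
    where
    descend : ∀ k (X : VSet n) → cnt V X < k → Special shape X → ∃ λ X → Special shape X × (∀ Y → Special shape Y → X ⊆ Y)
    descend (suc k) X (s≤s l) sp = decide (∃set?
        (λ h (sq , x , p , q) → special-resp h sq , x , p , trans (sym (h x)) q)
        (λ Y → special? Y ×-dec any? (λ x → (X x Bool.≟ true) ×-dec (Y x Bool.≟ false))))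
      where
      decide : Dec (∃ λ Y → Special shape Y × ∃ λ x → x ∈ X × x ∉ Y) → ∃ λ X → Special shape X × (∀ Y → Special shape Y → X ⊆ Y)
      decide (no none) = X , sp , λ Y sq x p → [ id , (λ q → ⊥-elim (none (Y , sq , x , p , q))) ]′ (bool (Y x))
      decide (yes (Y , sq , x , p , q)) = descend k Y (≤-trans (cnt-< V {Y} {X} {x} Y⊆X refl p q) l) sq
        where
        Y⊆X : Y ⊆ X
        Y⊆X y r = [ id , (λ w → ⊥-elim (Two.not-crossing sp sq (∧-intro p (not-intro q)) (∧-intro r (not-intro w)))) ]′ (bool (X y))

  -- The enlarged violator Y contains b₁ and b₂, avoids a₁ and a₂, and has no excess of B, so
  -- `special-star` needs three leaving edges; only the two special edges of L and U are available.
  special-interval : ∀ {L U v} → Special shape L → Special shape U → L ⊆ U → v ∈ U → v ∉ L →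
                     ∃ λ N → Matching E (A ∩ ((U ∖ L) ∩ V)) (B ∩ ((U ∖ L) ∩ V)) N
  special-interval {L} {U} sl su L⊆U _ _ = interval V V L U ∅ L⊆U (λ _ ()) (λ _ ()) (λ _ _ _ _ _ → refl) (λ _ ()) equal
      λ b _ → (farkas (nA (Blocked.Y b) ∷ nB (Blocked.Y b) ∷ out (Blocked.Y b) ∷ nA L ∷ nB L ∷ nA (Blocked.X b)
          ∷ nB (Blocked.X b) ∷ nB ∅ ∷ out L ∷ out U ∷ [])
        ( 1 ⊠ con 5 :+ 3 :* (‵ 0) ⩽ 2 :* (‵ 2) :+ 3 :* (‵ 1)
              ∵ special-star (¬true (λ p → true≢false (Blocked.Y⊆U b a₁ p) U.a₁∉)) (¬true (λ p → true≢false (Blocked.Y⊆U b a₂ p) U.a₂∉)) (Blocked.L⊆Y b b₁ L.b₁∈) (Blocked.L⊆Y b b₂ L.b₂∈)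
        ∷ 3 ⊠ ‵ 3 :+ ‵ 5 ⩽ ‵ 0 ∵ ≤-reflexive (sym (Blocked.nA-Y b))
        ∷ 3 ⊠ ‵ 1 ⩽ ‵ 4 :+ (‵ 6 :+ ‵ 7) ∵ ≤-reflexive (Blocked.nB-Y b)
        ∷ 3 ⊠ ‵ 7 ⩽ con 0 ∵ ≤-reflexive (cnt-0 B {∅} (λ _ _ ()))
        ∷ 3 ⊠ con 1 :+ ‵ 6 ⩽ ‵ 5 ∵ Blocked.nB<nA b
        ∷ 3 ⊠ ‵ 4 ⩽ con 1 :+ ‵ 3 ∵ ≤-reflexive L.excess
        ∷ 2 ⊠ ‵ 2 ⩽ ‵ 8 :+ ‵ 9 ∵ Blocked.out-Y b
        ∷ 2 ⊠ ‵ 8 ⩽ con 1 ∵ ≤-reflexive L.out≡1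
        ∷ 2 ⊠ ‵ 9 ⩽ con 1 ∵ ≤-reflexive U.out≡1
        ∷ []))
    where
    module L = Special sl
    module U = Special su
    equal : nA ((U ∖ L) ∩ V) ≡ nB ((U ∖ L) ∩ V)
    equal = trans (drop A) (trans (equate (nA U ∷ nB U ∷ nA L ∷ nB L ∷ nA (U ∖ L) ∷ nB (U ∖ L) ∷ []) 1 (‵ 4) (‵ 5)
      ( 1 ⊠ ‵ 2 :+ ‵ 4 ≐ ‵ 0 ∵ sym (cnt-⊆ A L⊆U)
      ∷ 1 ⊠ ‵ 1 ≐ ‵ 3 :+ ‵ 5 ∵ cnt-⊆ B L⊆U
      ∷ 1 ⊠ con 1 :+ ‵ 0 ≐ ‵ 1 ∵ sym U.excess
      ∷ 1 ⊠ ‵ 3 ≐ con 1 :+ ‵ 2 ∵ L.excess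
      ∷ [])) (sym (drop B)))
      where
      drop : ∀ c → cnt c ((U ∖ L) ∩ V) ≡ cnt c (U ∖ L)
      drop c = cnt-cong c (λ v → ∧-identityʳ ((U ∖ L) v))

  MiddleMatching : VSet n → VSet n → Set
  MiddleMatching L U = ∃ λ N → Matching E (A ∩ (U ∖ L)) (B ∩ (U ∖ L)) N × (∀ X → Special shape X → Avoids N X)

  middle-matching : ∀ {L U} → Special shape L → Special shape U → L ⊆ U → MiddleMatching L U
  middle-matching {L} {U} sl su L⊆U = decide (any? λ v → ((U ∖ L) v Bool.≟ true))
    where
    module Chain = Lattice E A B V (Special shape) special-resp special? (λ p q → Two.special-∩ p q) (λ p q → Two.special-∪ p q) special-interval

    same : ∀ C → (C ∩ ((U ∖ L) ∩ V)) ≗ (C ∩ (U ∖ L))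
    same C v = cong (C v ∧_) (∧-identityʳ ((U ∖ L) v))

    decide : Dec (∃ λ v → v ∈ U ∖ L) → MiddleMatching L U
    decide (yes (v , p)) = convert (Chain.lattice-matching sl su L⊆U (∧ˡ {U v} p) (not-true (∧ʳ {U v} p)))
      where
      convert : (∃ λ N → Matching E (A ∩ ((U ∖ L) ∩ V)) (B ∩ ((U ∖ L) ∩ V)) N × (∀ X → Special shape X → Avoids N X)) → MiddleMatching L U
      convert (N , m , avoid) = N , Matching-cong (same A) (same B) m , avoid
    -- The lattice argument needs a nonempty interval; if the least and the greatest special set
    -- coincide, the empty matching is taken.
    decide (no none) = (λ _ _ → false) , record
        { edge = λ _ _ () ; left = λ _ _ () ; right = λ _ _ () ; row = λ v → trans (∑-0 {n}) (sym (nothing A v)) ; col = λ v → trans (∑-0 {n}) (sym (nothing B v)) }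
      , λ _ _ _ _ ()
      where
      nothing : ∀ C v → ⟪ (C ∩ (U ∖ L)) v ⟫ ≡ 0
      nothing C v = cong ⟪_⟫ (¬true λ p → none (v , (∧ʳ {C v} p)))

  -- For subsets of a special set `α` and `εa` vanish; the term `⟪ Q s ⟫` in `star°` and `bal°`
  -- stands for the single edge from s out of X. In `whole-end` the same term comes from a₁ through
  -- `α` and `εa`.
  special-end : ∀ {X} → Special shape X → ∃ λ s → End S X s b₁ b₂ × 1 ≤ flow E ⁅ s ⁆ (∁ X)
  special-end {X} sp = build (flow-witness E {X} {∁ X} (≤-reflexive (sym out≡1)))
    where
    open Special sp

    build : (∃ λ s → ∃ λ t → E s t ≡ true × s ∈ X × t ∈ ∁ X) → ∃ λ s → End S X s b₁ b₂ × 1 ≤ flow E ⁅ s ⁆ (∁ X)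
    build (s , t , st , s∈X , t∉X) = s , record
      { s∈A = E-A st ; p∈B = b₁∈B ; q∈B = b₂∈B ; p≢q = b₁≢b₂ ; s∈ = s∈X ; p∈ = b₁∈ ; q∈ = b₂∈ ; excess = excess
      ; star° = λ Q Q⊆X v∈Q → (≮⇒≥ λ neg → farkas (nA Q ∷ nB Q ∷ out Q ∷ α Q ∷ β Q ∷ rout X Q ∷ ⟪ Q s ⟫ ∷ [])
        ( 1 ⊠ con 3 :+ 3 :* (‵ 0) :+ 2 :* (‵ 4) ⩽ 2 :* (‵ 2) :+ 2 :* (‵ 3) :+ 3 :* (‵ 1) ∵ star Q v∈Q (outside Q⊆X a₁∉)
        ∷ 2 ⊠ ‵ 3 ⩽ con 0 ∵ ≤-reflexive (α≡0 {Q} (outside Q⊆X a₁∉) (outside Q⊆X a₂∉))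
        ∷ 2 ⊠ ‵ 2 ⩽ ‵ 5 :+ ‵ 6 ∵ out-split Q Q⊆X
        ∷ 1 ⊠ con 1 :+ (2 :* (‵ 5 :+ ‵ 6) :+ 3 :* (‵ 1)) ⩽ con 3 :+ 3 :* (‵ 0) :+ 2 :* (‵ 4) ∵ neg
        ∷ []))
      ; bal° = λ Q Q⊆X → (≮⇒≥ λ neg → farkas (nA Q ∷ nB Q ∷ out Q ∷ back Q ∷ εa Q ∷ εb Q ∷ rout X Q ∷ ⟪ Q s ⟫
          ∷ flow E (X ∖ Q) Q ∷ [])
        ( 1 ⊠ ‵ 3 :+ 3 :* (‵ 0) :+ ‵ 5 ⩽ ‵ 2 :+ 3 :* (‵ 1) :+ ‵ 4 ∵ ≤-reflexive (sym (balance Q))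
        ∷ 1 ⊠ ‵ 4 ⩽ con 0 ∵ ≤-reflexive (cong₂ (λ u v → ⟪ u ⟫ + ⟪ v ⟫) (outside Q⊆X a₁∉) (outside Q⊆X a₂∉))
        ∷ 1 ⊠ ‵ 8 ⩽ ‵ 3
              ∵ flow-≤ {2} (λ { (x ∷ y ∷ []) → (x ∧ not y , y) ∷ [] }) (λ { (x ∷ y ∷ []) → (not y , y) ∷ [] }) E (X ∷ Q ∷ [])
        ∷ 1 ⊠ ‵ 2 ⩽ ‵ 6 :+ ‵ 7 ∵ out-split Q Q⊆X
        ∷ 1 ⊠ con 1 :+ (‵ 6 :+ ‵ 7 :+ 3 :* (‵ 1)) ⩽ 3 :* (‵ 0) :+ ‵ 5 :+ ‵ 8 ∵ neg
        ∷ []))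
      } , flow-term E {⁅ s ⁆} {∁ X} st (⌊≟⌋-refl s) t∉X
      where
      outside : ∀ {Q v} → Q ⊆ X → v ∉ X → v ∉ Q
      outside {v = v} h p = ¬true λ q → true≢false (h v q) p

      leave : ∀ Q → Q ⊆ X → flow E Q (∁ X) ≤ ⟪ Q s ⟫
      leave Q Q⊆X with bool (Q s)
      ... | inj₁ p = subst (λ b → flow E Q (∁ X) ≤ ⟪ b ⟫) (sym p)
              (≤-trans (flow-mono {R = E} {S = E} {P = Q} {P′ = X} {Q = ∁ X} {Q′ = ∁ X} (λ _ _ e → e) Q⊆X (λ _ q → q)) (≤-reflexive out≡1))
      ... | inj₂ p = subst (_≤ ⟪ Q s ⟫) (sym (flow-0 E {Q} {∁ X} other)) z≤n
        where
        other : ∀ x y → E x y ≡ true → x ∈ Q → y ∈ ∁ X → ⊥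
        other x y e x∈Q y∉X = (farkas (flow E Q (∁ X) ∷ flow E ⁅ s ⁆ (∁ X) ∷ out X ∷ [])
          ( 1 ⊠ con 1 ⩽ ‵ 0 ∵ flow-term E {Q} {∁ X} e x∈Q y∉X
          ∷ 1 ⊠ con 1 ⩽ ‵ 1 ∵ flow-term E {⁅ s ⁆} {∁ X} st (⌊≟⌋-refl s) t∉X
          ∷ 1 ⊠ ‵ 0 :+ ‵ 1 ⩽ ‵ 2 ∵ disjoint
          ∷ 1 ⊠ ‵ 2 ⩽ con 1 ∵ ≤-reflexive out≡1
          ∷ []))
          where
          disjoint : flow E Q (∁ X) + flow E ⁅ s ⁆ (∁ X) ≤ out X
          disjoint = ≤-trans (+-mono-≤ (into Q s Q⊆X p) (single s∈X))
            (flow-≤ {3} (λ { (x ∷ q ∷ i ∷ []) → (x ∧ (q ∧ not i) , not x) ∷ (x ∧ i , not x) ∷ [] }) (λ { (x ∷ q ∷ i ∷ []) → (x , not x) ∷ [] }) E (X ∷ Q ∷ ⁅ s ⁆ ∷ []))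
            where
            into : ∀ Q s → Q ⊆ X → s ∉ Q → flow E Q (∁ X) ≤ flow E (λ v → X v ∧ (Q v ∧ not (⁅ s ⁆ v))) (∁ X)
            into Q s h p = flow-mono {R = E} {S = E} {P = Q} {P′ = λ v → X v ∧ (Q v ∧ not (⁅ s ⁆ v))} {Q = ∁ X} {Q′ = ∁ X} (λ _ _ e → e)
              (λ v q → ∧-intro (h v q) (∧-intro q (not-intro (¬true λ r → true≢false (subst (_∈ Q) (⌊≟⌋-true r) q) p)))) (λ _ q → q)
            single : s ∈ X → flow E ⁅ s ⁆ (∁ X) ≤ flow E (λ v → X v ∧ ⁅ s ⁆ v) (∁ X)
            single p = flow-mono {R = E} {S = E} {P = ⁅ s ⁆} {P′ = λ v → X v ∧ ⁅ s ⁆ v} {Q = ∁ X} {Q′ = ∁ X} (λ _ _ e → e)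
              (λ v q → ∧-intro (subst (_∈ X) (sym (⌊≟⌋-true q)) p) q) (λ _ q → q)

      out-split : ∀ Q → Q ⊆ X → out Q ≤ rout X Q + ⟪ Q s ⟫
      out-split Q Q⊆X = ≤-trans
        (flow-≤ {2} (λ { (x ∷ q ∷ []) → (q , not q) ∷ [] }) (λ { (x ∷ q ∷ []) → (q , x ∧ not q) ∷ (q , not x) ∷ [] }) E (X ∷ Q ∷ []))
        (+-monoʳ-≤ (rout X Q) (leave Q Q⊆X))

  -- If there is no special set, a₁ plays the role of the exit.
  whole-end : End S (V ⊖ a₂) a₁ b₁ b₂
  whole-end = record
    { s∈A = a₁∈A ; p∈B = b₁∈B ; q∈B = b₂∈B ; p≢q = b₁≢b₂
    ; s∈ = ∈-⊖ {X = V} {x = a₁} refl a₁≢a₂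
    ; p∈ = ∈-⊖ {X = V} {x = b₁} refl (A-≢-B a₂∈A b₁∈B ∘ sym) ; q∈ = ∈-⊖ {X = V} {x = b₂} refl (A-≢-B a₂∈A b₂∈B ∘ sym)
    ; excess = trans (sym (nB-⊖a {V} a₂∈A refl)) (trans (sym balanced) (nA-⊖a {V} a₂∈A refl))
    ; star° = λ Q Q⊆ v∈Q → (≮⇒≥ λ neg → farkas (nA Q ∷ nB Q ∷ out Q ∷ α Q ∷ β Q ∷ rout (V ⊖ a₂) Q ∷ ⟪ Q a₁ ⟫ ∷ [])
      ( 1 ⊠ con 3 :+ 3 :* (‵ 0) :+ 2 :* (‵ 4) ⩽ 2 :* (‵ 2) :+ 2 :* (‵ 3) :+ 3 :* (‵ 1) ∵ star Q v∈Q (a₂∉ Q⊆)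
      ∷ 2 ⊠ ‵ 3 ⩽ ‵ 6 ∵ ≤-reflexive (cong ⟪_⟫ (trans (cong (Q a₁ ∨_) (a₂∉ Q⊆)) (∨-identityʳ (Q a₁))))
      ∷ 2 ⊠ ‵ 2 ⩽ ‵ 5 ∵ out-rout Q
      ∷ 1 ⊠ con 1 :+ (2 :* (‵ 5 :+ ‵ 6) :+ 3 :* (‵ 1)) ⩽ con 3 :+ 3 :* (‵ 0) :+ 2 :* (‵ 4) ∵ neg
      ∷ []))
    ; bal° = λ Q Q⊆ → (≮⇒≥ λ neg → farkas (nA Q ∷ nB Q ∷ out Q ∷ back Q ∷ εa Q ∷ εb Q ∷ rout (V ⊖ a₂) Q ∷ ⟪ Q a₁ ⟫
        ∷ flow E ((V ⊖ a₂) ∖ Q) Q ∷ [])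
      ( 1 ⊠ ‵ 3 :+ 3 :* (‵ 0) :+ ‵ 5 ⩽ ‵ 2 :+ 3 :* (‵ 1) :+ ‵ 4 ∵ ≤-reflexive (sym (balance Q))
      ∷ 1 ⊠ ‵ 4 ⩽ ‵ 7 ∵ ≤-reflexive (trans (cong (λ b → ⟪ Q a₁ ⟫ + ⟪ b ⟫) (a₂∉ Q⊆)) (+-identityʳ ⟪ Q a₁ ⟫))
      ∷ 1 ⊠ ‵ 8 ⩽ ‵ 3
            ∵ flow-≤ {2} (λ { (x ∷ y ∷ []) → (x ∧ not y , y) ∷ [] }) (λ { (x ∷ y ∷ []) → (not y , y) ∷ [] }) E ((V ⊖ a₂) ∷ Q ∷ [])
      ∷ 1 ⊠ ‵ 2 ⩽ ‵ 6 ∵ out-rout Q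
      ∷ 1 ⊠ con 1 :+ (‵ 6 :+ ‵ 7 :+ 3 :* (‵ 1)) ⩽ 3 :* (‵ 0) :+ ‵ 5 :+ ‵ 8 ∵ neg
      ∷ [])) }
    where
    a₂∉ : ∀ {Q} → Q ⊆ V ⊖ a₂ → a₂ ∉ Q
    a₂∉ h = ¬true λ p → ⊖-≢ {X = V} {a = a₂} {x = a₂} (h a₂ p) refl

    -- The vertex a₂ lies in A and receives no edge of `E`, so nothing is lost by leaving it out of
    -- the ambient set.
    out-rout : ∀ Q → out Q ≤ rout (V ⊖ a₂) Q
    out-rout Q = ∑-mono λ x → ∑-mono λ y → ⟪⟫-mono (imply x y)
      where
      imply : ∀ x y → E x y ∧ (Q x ∧ not (Q y)) ≡ true → E x y ∧ (Q x ∧ ((V ⊖ a₂) y ∧ not (Q y))) ≡ true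
      imply x y h with ∧-true {E x y} h
      ... | e , r with ∧-true {Q x} r
      ...   | u , v = ∧-intro e (∧-intro u (∧-intro (∈-⊖ {X = V} {x = y} refl (A-≢-B a₂∈A (E-B e) ∘ sym)) v))

-- No obstruction survives

flow-⊆ : ∀ {n} {R R′ : Adj n} {P P′ Q Q′ : VSet n} →
         (∀ x y → R x y ≡ true → x ∈ P → y ∈ Q → R′ x y ≡ true × x ∈ P′ × y ∈ Q′) → flow R P Q ≤ flow R′ P′ Q′
flow-⊆ {R = R} {R′} {P} {P′} {Q} {Q′} h = ∑-mono λ x → ∑-mono λ y → ⟪⟫-mono (imply x y)
  where
  imply : ∀ x y → R x y ∧ (P x ∧ Q y) ≡ true → R′ x y ∧ (P′ x ∧ Q′ y) ≡ true
  imply x y r with ∧-true {R x y} r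
  ... | e , pq with h x y e (∧ˡ {P x} pq) (∧ʳ {P x} pq)
  ...   | e′ , p′ , q′ = ∧-intro e′ (∧-intro p′ q′)

Matching-transpose : ∀ {n} {R R′ : Adj n} {A B : VSet n} {N : Adj n} → (∀ x y → R x y ≡ R′ y x) →
                     Matching R A B N → Matching R′ B A (transpose N)
Matching-transpose h m = record
  { edge = λ x y p → trans (sym (h y x)) (edge y x p) ; left = λ x y p → right y x p ; right = λ x y p → left y x p
  ; row = col ; col = row }
  where open Matching m

exactly-one : ∀ p q → p ∨ q ≡ true → p ∧ q ≡ false → ⟪ p ⟫ + ⟪ q ⟫ ≡ 1
exactly-one true false _ _ = refl
exactly-one false true _ _ = refl

module Refute {n} (S : Setup n) {N : Adj n} (N⊆E : Within S N) (noncrossing : NonCrossing (Setup.shape S) N)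
  {s′ t′ : Fin n} {Z : VSet n} (ob : Obstruction (Setup.shape S) s′ t′ Z)
  (dep : Dependence (Setup.shape S) N Z) where

  open Basics S
  open Perfect S
  open Facts S
  open Intervals S
  open Specials S
  open Obstruction ob
  open Dependence dep
  open Dependent S N⊆E noncrossing ob using (back-count; N≤E)

  -- Uncrossing Z with a special set X that contains both ends of st, when some vertex lies outside
  -- Z and X. The outcome is that the single edge leaving X starts in Z, and that at least `εa Z` of
  -- the edges entering Z come from outside X and end outside X.
  module High {X} (sp : Special shape X) (s′∈X : s′ ∈ X) (t′∈X : t′ ∈ X) {v} (v∉X : v ∉ X) (v∉Z : v ∉ Z) where
    private
      module X = Special sp

    J U D : VSet n
    J = Z ∩ X
    U = Z ∪ X
    D = Z ∖ X

    sizes : ∀ c → cnt c J + cnt c U ≡ cnt c Z + cnt c X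
    sizes c = cnt-≡ {2} (λ { (x ∷ y ∷ []) → x ∧ y ∷ (x ∨ y) ∷ [] }) (λ { (x ∷ y ∷ []) → x ∷ y ∷ [] }) c (Z ∷ X ∷ [])

    submodular : out J + out U ≤ out Z + out X
    submodular = flow-≤ {2} (λ { (x ∷ y ∷ []) → (x ∧ y , not (x ∧ y)) ∷ (x ∨ y , not (x ∨ y)) ∷ [] })
                            (λ { (x ∷ y ∷ []) → (x , not x) ∷ (y , not y) ∷ [] }) E (Z ∷ X ∷ [])

    out-J≤ : out J ≤ out Z + flow E J (∁ X)
    out-J≤ = flow-≤ {2} (λ { (z ∷ x ∷ []) → (z ∧ x , not (z ∧ x)) ∷ [] })
                        (λ { (z ∷ x ∷ []) → (z , not z) ∷ (z ∧ x , not x) ∷ [] }) E (Z ∷ X ∷ [])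

    s′∈J : s′ ∈ J
    s′∈J = ∧-intro s∈ s′∈X

    star-J : 3 + 3 * nA J ≤ 2 * out J + 3 * nB J
    star-J = (≮⇒≥ λ neg → farkas (nA J ∷ nB J ∷ out J ∷ α J ∷ β J ∷ [])
      ( 1 ⊠ con 3 :+ 3 :* (‵ 0) :+ 2 :* (‵ 4) ⩽ 2 :* (‵ 2) :+ 2 :* (‵ 3) :+ 3 :* (‵ 1) ∵ star J s′∈J (cong (_∧ X v) v∉Z)
      ∷ 2 ⊠ ‵ 3 ⩽ con 0
            ∵ ≤-reflexive (α≡0 {J} (trans (cong (Z a₁ ∧_) X.a₁∉) (∧-zeroʳ (Z a₁))) (trans (cong (Z a₂ ∧_) X.a₂∉) (∧-zeroʳ (Z a₂))))
      ∷ 1 ⊠ con 1 :+ (2 :* (‵ 2) :+ 3 :* (‵ 1)) ⩽ con 3 :+ 3 :* (‵ 0) ∵ neg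
      ∷ []))

    out-U≤1 : out U ≤ 1
    out-U≤1 = (≮⇒≥ λ neg → farkas (out U ∷ flow E Z (∁ U) ∷ out X ∷ [])
      ( 1 ⊠ ‵ 0 ⩽ ‵ 1 :+ ‵ 2
            ∵ flow-≤ {2} (λ { (z ∷ x ∷ []) → (z ∨ x , not (z ∨ x)) ∷ [] }) (λ { (z ∷ x ∷ []) → (z , not (z ∨ x)) ∷ (x , not x) ∷ [] }) E (Z ∷ X ∷ [])
      ∷ 1 ⊠ ‵ 1 ⩽ con 0
            ∵ ≤-reflexive (flow-0 E {Z} {∁ U} (λ x y e p q → true≢false t′∈X (subst (λ w → X w ≡ false) (proj₂ (only x y e p (proj₁ (∨-false {Z y} (not-true q))))) (proj₂ (∨-false {Z y} (not-true q))))))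
      ∷ 1 ⊠ ‵ 2 ⩽ con 1 ∵ ≤-reflexive X.out≡1
      ∷ 1 ⊠ con 1 :+ con 1 ⩽ ‵ 0 ∵ neg
      ∷ []))

    deficit-U : 1 + nA U ≤ nB U
    deficit-U = (≮⇒≥ λ neg → farkas (nA U ∷ nB U ∷ out U ∷ α U ∷ β U ∷ [])
      ( 1 ⊠ con 3 :+ 3 :* (‵ 0) :+ 2 :* (‵ 4) ⩽ 2 :* (‵ 2) :+ 2 :* (‵ 3) :+ 3 :* (‵ 1)
            ∵ star U (∨-introˡ s∈) (∨-false-intro v∉Z v∉X)
      ∷ 2 ⊠ ‵ 3 ⩽ con 1 ∵ ⟪⟫≤1 (U a₁ ∨ U a₂)
      ∷ 2 ⊠ con 1 ⩽ ‵ 4 ∵ ≤-reflexive (sym (β≡1 {U} (∨-introʳ X.b₁∈) (∨-introʳ X.b₂∈)))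
      ∷ 2 ⊠ ‵ 2 ⩽ con 1 ∵ out-U≤1
      ∷ 3 ⊠ con 1 :+ ‵ 1 ⩽ con 1 :+ ‵ 0 ∵ neg
      ∷ []))

    -- Two edges for J and U together are too few for `star` if J has a surplus of A, and the excess
    -- of U, at least one, takes up the whole excess of Z and X.
    equal : nA J ≡ nB J
    equal = ≤-antisym
      (≮⇒≥ λ neg → farkas (nA J ∷ nB J ∷ out J ∷ out U ∷ out Z ∷ out X ∷ [])
        ( 1 ⊠ con 3 :+ 3 :* (‵ 0) ⩽ 2 :* (‵ 2) :+ 3 :* (‵ 1) ∵ star-J
        ∷ 2 ⊠ ‵ 2 :+ ‵ 3 ⩽ ‵ 4 :+ ‵ 5 ∵ submodular
        ∷ 2 ⊠ ‵ 4 ⩽ con 1 ∵ ≤-reflexive out≡1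
        ∷ 2 ⊠ ‵ 5 ⩽ con 1 ∵ ≤-reflexive X.out≡1
        ∷ 3 ⊠ con 1 :+ ‵ 1 ⩽ ‵ 0 ∵ neg
        ∷ []))
      (≮⇒≥ λ neg → farkas (nA J ∷ nB J ∷ nA U ∷ nB U ∷ nA Z ∷ nB Z ∷ nA X ∷ nB X ∷ [])
        ( 1 ⊠ ‵ 4 :+ ‵ 6 ⩽ ‵ 0 :+ ‵ 2 ∵ ≤-reflexive (sym (sizes A))
        ∷ 1 ⊠ ‵ 1 :+ ‵ 3 ⩽ ‵ 5 :+ ‵ 7 ∵ ≤-reflexive (sizes B)
        ∷ 1 ⊠ ‵ 5 ⩽ ‵ 4 ∵ ≤-reflexive (sym nA≡nB)
        ∷ 1 ⊠ ‵ 7 ⩽ con 1 :+ ‵ 6 ∵ ≤-reflexive X.excess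
        ∷ 1 ⊠ con 1 :+ ‵ 2 ⩽ ‵ 3 ∵ deficit-U
        ∷ 1 ⊠ con 1 :+ ‵ 0 ⩽ ‵ 1 ∵ neg
        ∷ []))

    out-J≥2 : 2 ≤ out J
    out-J≥2 = (≮⇒≥ λ neg → farkas (nA J ∷ nB J ∷ out J ∷ [])
      ( 1 ⊠ con 3 :+ 3 :* (‵ 0) ⩽ 2 :* (‵ 2) :+ 3 :* (‵ 1) ∵ star-J
      ∷ 3 ⊠ ‵ 1 ⩽ ‵ 0 ∵ ≤-reflexive (sym equal)
      ∷ 2 ⊠ con 1 :+ ‵ 2 ⩽ con 2 ∵ neg
      ∷ []))

    exits-in-J : 1 ≤ flow E J (∁ X)
    exits-in-J = (≮⇒≥ λ neg → farkas (flow E J (∁ X) ∷ out J ∷ out Z ∷ [])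
      ( 1 ⊠ con 2 ⩽ ‵ 1 ∵ out-J≥2
      ∷ 1 ⊠ ‵ 1 ⩽ ‵ 2 :+ ‵ 0 ∵ out-J≤
      ∷ 1 ⊠ ‵ 2 ⩽ con 1 ∵ ≤-reflexive out≡1
      ∷ 1 ⊠ con 1 :+ ‵ 0 ⩽ con 1 ∵ neg
      ∷ []))

    D-split : ∀ c → cnt c Z ≡ cnt c J + cnt c D
    D-split c = cnt-≡ {2} (λ { (z ∷ x ∷ []) → z ∷ [] }) (λ { (z ∷ x ∷ []) → z ∧ x ∷ z ∧ not x ∷ [] }) c (Z ∷ X ∷ [])

    a-D : ∀ {a} → a ∉ X → D a ≡ Z a
    a-D {a} p = trans (cong (λ b → Z a ∧ not b) p) (∧-identityʳ (Z a))

    b-D : ∀ {b} → b ∈ X → b ∉ D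
    b-D {b} p = trans (cong (λ x → Z b ∧ not x) p) (∧-zeroʳ (Z b))

    D-element : ∃ λ a → a ∈ D
    D-element = [ (λ p → a₁ , trans (a-D X.a₁∉) p) , (λ p → a₂ , trans (a-D X.a₂∉) p) ]′ (∨-true meets-a)

    -- D is balanced and contains neither b₁ nor b₂. Even with the help of `α`, `star` requires an
    -- edge leaving D, and `balance` converts it into entering edges.
    back-D : 1 + εa Z ≤ back D
    back-D = (≮⇒≥ λ neg → farkas (nA D ∷ nB D ∷ out D ∷ back D ∷ εa D ∷ εb D ∷ εa Z ∷ nA Z ∷ nB Z ∷ nA J ∷ nB J ∷ [])
      ( 1 ⊠ con 1 ⩽ ‵ 2 ∵ out-D
      ∷ 1 ⊠ ‵ 2 :+ 3 :* (‵ 1) :+ ‵ 4 ⩽ ‵ 3 :+ 3 :* (‵ 0) :+ ‵ 5 ∵ ≤-reflexive (balance D)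
      ∷ 1 ⊠ ‵ 6 ⩽ ‵ 4 ∵ ≤-reflexive (sym (cong₂ (λ x y → ⟪ x ⟫ + ⟪ y ⟫) (a-D X.a₁∉) (a-D X.a₂∉)))
      ∷ 1 ⊠ ‵ 5 ⩽ con 0 ∵ ≤-reflexive (cong₂ (λ x y → ⟪ x ⟫ + ⟪ y ⟫) (b-D X.b₁∈) (b-D X.b₂∈))
      ∷ 3 ⊠ ‵ 9 :+ ‵ 0 ⩽ ‵ 7 ∵ ≤-reflexive (sym (D-split A))
      ∷ 3 ⊠ ‵ 8 ⩽ ‵ 10 :+ ‵ 1 ∵ ≤-reflexive (D-split B)
      ∷ 3 ⊠ ‵ 7 ⩽ ‵ 8 ∵ ≤-reflexive nA≡nB
      ∷ 3 ⊠ ‵ 10 ⩽ ‵ 9 ∵ ≤-reflexive (sym equal)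
      ∷ 1 ⊠ con 1 :+ ‵ 3 ⩽ con 1 :+ ‵ 6 ∵ neg
      ∷ []))
      where
      out-D : 1 ≤ out D
      out-D = (≮⇒≥ λ neg → farkas (nA D ∷ nB D ∷ out D ∷ α D ∷ β D ∷ nA Z ∷ nB Z ∷ nA J ∷ nB J ∷ [])
        ( 1 ⊠ con 3 :+ 3 :* (‵ 0) :+ 2 :* (‵ 4) ⩽ 2 :* (‵ 2) :+ 2 :* (‵ 3) :+ 3 :* (‵ 1)
              ∵ star D (proj₂ D-element) (b-D s′∈X)
        ∷ 2 ⊠ ‵ 3 ⩽ con 1 ∵ ⟪⟫≤1 (D a₁ ∨ D a₂)
        ∷ 3 ⊠ ‵ 5 ⩽ ‵ 7 :+ ‵ 0 ∵ ≤-reflexive (D-split A)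
        ∷ 3 ⊠ ‵ 8 :+ ‵ 1 ⩽ ‵ 6 ∵ ≤-reflexive (sym (D-split B))
        ∷ 3 ⊠ ‵ 6 ⩽ ‵ 5 ∵ ≤-reflexive (sym nA≡nB)
        ∷ 3 ⊠ ‵ 7 ⩽ ‵ 8 ∵ ≤-reflexive equal
        ∷ 2 ⊠ con 1 :+ ‵ 2 ⩽ con 1 ∵ neg
        ∷ []))

    -- Of the edges entering D at most one comes from X, since only one edge leaves X.
    outer-back : εa Z ≤ flow E (∁ U) D
    outer-back = (≮⇒≥ λ neg → farkas (εa Z ∷ flow E (∁ U) D ∷ back D ∷ out X ∷ [])
      ( 1 ⊠ con 1 :+ ‵ 0 ⩽ ‵ 2 ∵ back-D
      ∷ 1 ⊠ ‵ 2 ⩽ ‵ 1 :+ ‵ 3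
            ∵ flow-≤ {2} (λ { (z ∷ x ∷ []) → (not (z ∧ not x) , z ∧ not x) ∷ [] }) (λ { (z ∷ x ∷ []) → (not (z ∨ x) , z ∧ not x) ∷ (x , not x) ∷ [] }) E (Z ∷ X ∷ [])
      ∷ 1 ⊠ ‵ 3 ⩽ con 1 ∵ ≤-reflexive X.out≡1
      ∷ 1 ⊠ con 1 :+ ‵ 1 ⩽ ‵ 0 ∵ neg
      ∷ []))

  -- Otherwise `special-below` supplies a special set disjoint from Z, but x lies in Z and in every
  -- special set.
  meets-b : ∀ {x} → x ∈ Z → (∀ C → Special shape C → x ∈ C) → Z b₁ ∨ Z b₂ ≡ true
  meets-b {x} p h = [ id , (λ q → ⊥-elim (absurd (special-below q))) ]′ (bool (Z b₁ ∨ Z b₂))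
    where
    absurd : (∃ λ C → Special shape C × (∀ v → v ∈ C → v ∉ Z) × 1 ≤ flow E C Z) → ⊥
    absurd (C , sp , apart , _) = true≢false p (apart x (h C sp))

  covering-excess : ∀ {X} → Special shape X → (∀ v → v ∉ X → v ∈ Z) → nB (Z ∩ X) ≡ 1 + nA (Z ∩ X)
  covering-excess {X} sp cover = equate (nA (Z ∩ X) ∷ nB (Z ∩ X) ∷ nA (Z ∪ X) ∷ nB (Z ∪ X) ∷ nA Z ∷ nB Z ∷ nA X
      ∷ nB X ∷ []) 1 (‵ 1) (con 1 :+ ‵ 0)
    ( 1 ⊠ ‵ 4 :+ ‵ 6 ≐ ‵ 0 :+ ‵ 2 ∵ sym (sizes A)
    ∷ 1 ⊠ ‵ 1 :+ ‵ 3 ≐ ‵ 5 :+ ‵ 7 ∵ sizes B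
    ∷ 1 ⊠ ‵ 2 ≐ ‵ 3 ∵ whole
    ∷ 1 ⊠ ‵ 5 ≐ ‵ 4 ∵ sym nA≡nB
    ∷ 1 ⊠ ‵ 7 ≐ con 1 :+ ‵ 6 ∵ Special.excess sp
    ∷ [])
    where
    sizes : ∀ c → cnt c (Z ∩ X) + cnt c (Z ∪ X) ≡ cnt c Z + cnt c X
    sizes c = cnt-≡ {2} (λ { (x ∷ y ∷ []) → x ∧ y ∷ (x ∨ y) ∷ [] }) (λ { (x ∷ y ∷ []) → x ∷ y ∷ [] }) c (Z ∷ X ∷ [])
    all-in : (Z ∪ X) ≗ V
    all-in v = [ (λ p → ∨-introʳ {Z v} p) , (λ p → ∨-introˡ (cover v p)) ]′ (bool (X v))
    whole : nA (Z ∪ X) ≡ nB (Z ∪ X)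
    whole = trans (cnt-cong A all-in) (trans balanced (sym (cnt-cong B all-in)))

  module EndCase {X s M} (sp : Special shape X) (least : ∀ Y → Special shape Y → X ⊆ Y)
    (end : End S X s b₁ b₂) (exit : 1 ≤ flow E ⁅ s ⁆ (∁ X))
    (m : Matching E (A ∩ (X ∩ inner-vertices s b₁ b₂)) (B ∩ (X ∩ inner-vertices s b₁ b₂)) M)
    (avoid₁ : ∀ Q → Tight S X s b₁ b₂ Q → Avoids M Q) (avoid₂ : ∀ Q → Tight S X s b₂ b₁ Q → Avoids M Q)
    (M⊆N : ∀ x y → M x y ≡ true → N x y ≡ true) (st∈M : M s′ t′ ≡ true) where

    private
      module X = Special sp
      module F = EndMatching S end

    M-X : ∀ {x y} → M x y ≡ true → x ∈ X × y ∈ X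
    M-X {x} {y} h = (∧ˡ {X x} (∧ʳ {A x} (Matching.left m x y h)))
                  , (∧ˡ {X y} (∧ʳ {B y} (Matching.right m x y h)))

    s′∈X : s′ ∈ X
    s′∈X = proj₁ (M-X st∈M)

    t′∈X : t′ ∈ X
    t′∈X = proj₂ (M-X st∈M)

    J : VSet n
    J = Z ∩ X

    A′ B′ : VSet n
    A′ = A ∩ (X ∩ F.K)
    B′ = B ∩ (X ∩ F.K)

    touches-b : Z b₁ ∨ Z b₂ ≡ true
    touches-b = meets-b s∈ (λ C sc → least C sc s′ s′∈X)

    εb≡1 : εb Z ≡ 1
    εb≡1 = exactly-one (Z b₁) (Z b₂) touches-b misses-b

    in-X : ∀ {v} → v ∈ X → J v ≡ Z v
    in-X {v} p = trans (cong (Z v ∧_) p) (∧-identityʳ (Z v))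

    M-out : flow M J (∁ J) ≡ 1
    M-out = ≤-antisym
      (flow-≤1 M s′ t′ λ x y e p q → only x y (Matching.edge m x y e) (∧ˡ {Z x} p)
        (trans (sym (in-X (proj₂ (M-X e)))) (not-true q)))
      (flow-term M {J} {∁ J} st∈M (∧-intro s∈ s′∈X) (not-intro (trans (in-X t′∈X) t∉)))

    M-back : flow M (∁ J) J ≤ 1
    M-back = ≤-trans (flow-⊆ {R = M} {N} {∁ J} {∁ Z} {J} {Z} λ x y e p q →
      M⊆N x y e , not-intro (trans (sym (in-X (proj₁ (M-X e)))) (not-true p)) , (∧ˡ {Z y} q)) N-back

    -- `matching-balance` for the part of Z inside X: M leaves it once, through st, and the
    -- uncovered vertices in it are s, if s lies in Z, and exactly one of b₁, b₂.
    J-count : nA J + flow M (∁ J) J ≡ nB J + ⟪ Z s ⟫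
    J-count = equate (nA J ∷ nB J ∷ flow M (∁ J) J ∷ flow M J (∁ J) ∷ ⟪ Z s ⟫ ∷ ⟪ J s ⟫ ∷ ⟪ J b₁ ⟫ ∷ ⟪ J b₂ ⟫
        ∷ ⟪ Z b₁ ⟫ ∷ ⟪ Z b₂ ⟫ ∷ cnt A′ J ∷ cnt B′ J ∷ []) 1 (‵ 0 :+ ‵ 2) (‵ 1 :+ ‵ 4)
      ( 1 ⊠ ‵ 0 ≐ ‵ 10 :+ ‵ 5 ∵ F.matched-A J J⊆
      ∷ 1 ⊠ ‵ 11 :+ (‵ 6 :+ ‵ 7) ≐ ‵ 1 ∵ sym (F.matched-B J J⊆)
      ∷ 1 ⊠ ‵ 10 :+ ‵ 2 ≐ ‵ 11 :+ ‵ 3 ∵ matching-balance m J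
      ∷ 1 ⊠ ‵ 3 ≐ con 1 ∵ M-out
      ∷ 1 ⊠ ‵ 5 ≐ ‵ 4 ∵ cong ⟪_⟫ (in-X (End.s∈ end))
      ∷ 1 ⊠ ‵ 8 ≐ ‵ 6 ∵ sym (cong ⟪_⟫ (in-X X.b₁∈))
      ∷ 1 ⊠ ‵ 9 ≐ ‵ 7 ∵ sym (cong ⟪_⟫ (in-X X.b₂∈))
      ∷ 1 ⊠ con 1 ≐ ‵ 8 :+ ‵ 9 ∵ sym εb≡1
      ∷ [])
      where
      J⊆ : J ⊆ X
      J⊆ v h = (∧ʳ {Z v} h)

    module Covering (cover : ∀ v → v ∉ X → v ∈ Z) where

      -- If Z covers the complement of X, then J has excess 1; with s in Z the matching would have
      -- to enter J twice.
      s∉Z : s ∉ Z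
      s∉Z = ¬true λ p → (farkas (nA J ∷ nB J ∷ flow M (∁ J) J ∷ ⟪ Z s ⟫ ∷ [])
        ( 1 ⊠ ‵ 1 :+ ‵ 3 ⩽ ‵ 0 :+ ‵ 2 ∵ ≤-reflexive (sym J-count)
        ∷ 1 ⊠ ‵ 2 ⩽ con 1 ∵ M-back
        ∷ 1 ⊠ con 1 ⩽ ‵ 3 ∵ ≤-reflexive (sym (cong ⟪_⟫ p))
        ∷ 1 ⊠ con 1 :+ ‵ 0 ⩽ ‵ 1 ∵ ≤-reflexive (sym (covering-excess sp cover))
        ∷ []))

      W : VSet n
      W = ∁ Z

      W⊆X : W ⊆ X
      W⊆X v p = [ id , (λ q → ⊥-elim (true≢false (cover v q) (not-true p))) ]′ (bool (X v))

      back-Z : back Z ≡ 2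
      back-Z = equate (back Z ∷ εa Z ∷ εb Z ∷ []) 1 (‵ 0) (con 2)
        ( 1 ⊠ ‵ 0 :+ ‵ 2 ≐ con 1 :+ ‵ 1 ∵ sym back-count
        ∷ 1 ⊠ con 1 ≐ ‵ 2 ∵ sym εb≡1
        ∷ 1 ⊠ ‵ 1 ≐ con 2 ∵ cong₂ (λ x y → ⟪ x ⟫ + ⟪ y ⟫) (cover a₁ X.a₁∉) (cover a₂ X.a₂∉)
        ∷ [])

      leaving : flow E W (Z ∖ X) ≡ 1
      leaving = ≤-antisym
        (≤-trans (flow-⊆ {R = E} {E} {W} {X} {Z ∖ X} {∁ X} λ x y e p q → e , W⊆X x p , (∧ʳ {Z y} q)) (≤-reflexive X.out≡1))
        (≤-trans exit (flow-⊆ {R = E} {E} {⁅ s ⁆} {W} {∁ X} {Z ∖ X} λ x y e p q →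
          e , subst (_∈ W) (sym (⌊≟⌋-true p)) (not-intro s∉Z) , ∧-intro (cover y (not-true q)) q))

      -- Exactly two edges enter Z, and one of them is the edge from s out of X. The other stays
      -- inside X, which makes the complement of Z tight; but st crosses it.
      rout-W : rout X W ≡ 1
      rout-W = ≤-antisym
        (≮⇒≥ λ neg → farkas (rout X W ∷ flow E W (Z ∖ X) ∷ back Z ∷ [])
          ( 1 ⊠ ‵ 0 :+ ‵ 1 ⩽ ‵ 2
                ∵ flow-≤ {2} (λ { (z ∷ x ∷ []) → (not z , x ∧ not (not z)) ∷ (not z , z ∧ not x) ∷ [] }) (λ { (z ∷ x ∷ []) → (not z , z) ∷ [] }) E (Z ∷ X ∷ [])
          ∷ 1 ⊠ con 1 ⩽ ‵ 1 ∵ ≤-reflexive (sym leaving)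
          ∷ 1 ⊠ ‵ 2 ⩽ con 2 ∵ ≤-reflexive back-Z
          ∷ 1 ⊠ con 1 :+ con 1 ⩽ ‵ 0 ∵ neg
          ∷ []))
        (≮⇒≥ λ neg → farkas (rout X W ∷ flow E W (Z ∖ X) ∷ back Z ∷ [])
          ( 1 ⊠ ‵ 2 ⩽ ‵ 0 :+ ‵ 1
                ∵ flow-≤ {2} (λ { (z ∷ x ∷ []) → (not z , z) ∷ [] }) (λ { (z ∷ x ∷ []) → (not z , x ∧ not (not z)) ∷ (not z , z ∧ not x) ∷ [] }) E (Z ∷ X ∷ [])
          ∷ 1 ⊠ ‵ 1 ⩽ con 1 ∵ ≤-reflexive leaving
          ∷ 1 ⊠ con 2 ⩽ ‵ 2 ∵ ≤-reflexive (sym back-Z)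
          ∷ 1 ⊠ con 1 :+ ‵ 0 ⩽ con 1 ∵ neg
          ∷ []))

      tight : ∀ {p q} → p ∉ Z → q ∈ Z → Tight S X s p q W
      tight p∉Z q∈Z = record { Q⊆ = W⊆X ; s∈ = not-intro s∉Z ; p∈ = not-intro p∉Z ; q∉ = cong not q∈Z
                             ; nA≡nB = Mirror.∁-excess S {Z} {0} (sym nA≡nB) ; rout≡1 = rout-W }

      crossed : Avoids M W → ⊥
      crossed avoid = true≢false (trans (avoid s′ t′ st∈M) (not-intro t∉)) (cong not s∈)

      covering : ⊥
      covering = [ (λ p → crossed (avoid₂ W (tight (∧-false misses-b p) p)))
                 , (λ p → crossed (avoid₁ W (tight p (∨-case touches-b p)))) ]′ (bool (Z b₁))

    module Missing {v} (v∉X : v ∉ X) (v∉Z : v ∉ Z) where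
      open High sp s′∈X t′∈X v∉X v∉Z hiding (J)

      s∈Z : s ∈ Z
      s∈Z = [ id , (λ p → ⊥-elim (outside p)) ]′ (bool (Z s))
        where
        outside : s ∉ Z → ⊥
        outside p = (farkas (flow E J (∁ X) ∷ flow E ⁅ s ⁆ (∁ X) ∷ out X
            ∷ flow E (λ v → X v ∧ (Z v ∧ not (⁅ s ⁆ v))) (∁ X) ∷ flow E (λ v → X v ∧ ⁅ s ⁆ v) (∁ X) ∷ [])
          ( 1 ⊠ con 1 ⩽ ‵ 0 ∵ exits-in-J
          ∷ 1 ⊠ con 1 ⩽ ‵ 1 ∵ exit
          ∷ 1 ⊠ ‵ 0 ⩽ ‵ 3
                ∵ flow-⊆ {R = E} {E} {J} {λ v → X v ∧ (Z v ∧ not (⁅ s ⁆ v))} {∁ X} {∁ X} (λ x y e i k → e , ∧-intro (∧ʳ {Z x} i) (∧-intro (∧ˡ {Z x} i) (not-intro (¬true λ w → true≢false (subst (_∈ Z) (⌊≟⌋-true w) (∧ˡ {Z x} i)) p))) , k)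
          ∷ 1 ⊠ ‵ 1 ⩽ ‵ 4
                ∵ flow-⊆ {R = E} {E} {⁅ s ⁆} {λ v → X v ∧ ⁅ s ⁆ v} {∁ X} {∁ X} (λ x y e i k → e , ∧-intro (subst (_∈ X) (sym (⌊≟⌋-true i)) (End.s∈ end)) i , k)
          ∷ 1 ⊠ ‵ 3 :+ ‵ 4 ⩽ ‵ 2
                ∵ flow-≤ {3} (λ { (x ∷ z ∷ i ∷ []) → (x ∧ (z ∧ not i) , not x) ∷ (x ∧ i , not x) ∷ [] }) (λ { (x ∷ z ∷ i ∷ []) → (x , not x) ∷ [] }) E (X ∷ Z ∷ ⁅ s ⁆ ∷ [])
          ∷ 1 ⊠ ‵ 2 ⩽ con 1 ∵ ≤-reflexive X.out≡1
          ∷ []))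

      inner-back : 1 ≤ flow E (X ∖ Z) J
      inner-back = ≤-trans
        (≮⇒≥ λ neg → farkas (nA J ∷ nB J ∷ flow M (∁ J) J ∷ ⟪ Z s ⟫ ∷ [])
          ( 1 ⊠ ‵ 1 :+ ‵ 3 ⩽ ‵ 0 :+ ‵ 2 ∵ ≤-reflexive (sym J-count)
          ∷ 1 ⊠ con 1 ⩽ ‵ 3 ∵ ≤-reflexive (sym (cong ⟪_⟫ s∈Z))
          ∷ 1 ⊠ ‵ 0 ⩽ ‵ 1 ∵ ≤-reflexive equal
          ∷ 1 ⊠ con 1 :+ ‵ 2 ⩽ con 1 ∵ neg
          ∷ []))
        (flow-⊆ {R = M} {E} {∁ J} {X ∖ Z} {J} {J} λ x y e p q → Matching.edge m x y e ,
          ∧-intro (proj₁ (M-X e)) (not-intro (trans (sym (in-X (proj₁ (M-X e)))) (not-true p))) , q)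

      -- At least one entering edge ends inside X and at least `εa Z` enter outside X, but
      -- `back-count` with `εb Z` = 1 permits only `εa Z`.
      missing : ⊥
      missing = (farkas (εa Z ∷ εb Z ∷ back Z ∷ flow E (X ∖ Z) J ∷ flow E (∁ U) D ∷ [])
        ( 1 ⊠ ‵ 2 :+ ‵ 1 ⩽ con 1 :+ ‵ 0 ∵ ≤-reflexive (sym back-count)
        ∷ 1 ⊠ con 1 ⩽ ‵ 1 ∵ ≤-reflexive (sym εb≡1)
        ∷ 1 ⊠ con 1 ⩽ ‵ 3 ∵ inner-back
        ∷ 1 ⊠ ‵ 0 ⩽ ‵ 4 ∵ outer-back
        ∷ 1 ⊠ ‵ 3 :+ ‵ 4 ⩽ ‵ 2
              ∵ flow-≤ {2} (λ { (z ∷ x ∷ []) → (x ∧ not z , z ∧ x) ∷ (not (z ∨ x) , z ∧ not x) ∷ [] }) (λ { (z ∷ x ∷ []) → (not z , z) ∷ [] }) E (Z ∷ X ∷ [])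
        ∷ []))

    refuted-end : ⊥
    refuted-end = decide (any? λ v → (X v Bool.≟ false) ×-dec (Z v Bool.≟ false))
      where
      decide : Dec (∃ λ v → v ∉ X × v ∉ Z) → ⊥
      decide (yes (v , p , q)) = Missing.missing p q
      decide (no none) = Covering.covering λ v p → [ id , (λ q → ⊥-elim (none (v , p , q))) ]′ (bool (Z v))

  module WholeCase {M} (none : ∀ X → Special shape X → ⊥)
    (avoid₁ : ∀ Q → Tight S (V ⊖ a₂) a₁ b₁ b₂ Q → Avoids M Q) (avoid₂ : ∀ Q → Tight S (V ⊖ a₂) a₁ b₂ b₁ Q → Avoids M Q)
    (st∈M : M s′ t′ ≡ true) where

    touches-b : Z b₁ ∨ Z b₂ ≡ true
    touches-b = meets-b s∈ (λ C sc → ⊥-elim (none C sc))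

    not-both-a : Z a₁ ∧ Z a₂ ≡ false
    not-both-a = ¬true λ p → none (proj₁ (special-above p)) (proj₁ (proj₂ (special-above p)))

    -- Without special sets Z must separate b₁ from b₂ and a₁ from a₂. So one edge enters and one
    -- leaves, and whichever of Z and its complement contains a₁ is tight.
    back-Z : back Z ≡ 1
    back-Z = +-cancelʳ-≡ 1 (back Z) 1 (trans (cong (back Z +_) (sym (exactly-one (Z b₁) (Z b₂) touches-b misses-b)))
      (trans (sym back-count) (cong suc (exactly-one (Z a₁) (Z a₂) meets-a not-both-a))))

    rout≡out : ∀ Q → rout (V ⊖ a₂) Q ≡ out Q
    rout≡out Q = ≤-antisym
      (flow-⊆ {R = E} {E} {Q} {Q} {(V ⊖ a₂) ∖ Q} {∁ Q} λ x y e p q → e , p , (∧ʳ {(V ⊖ a₂) y} q))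
      (flow-⊆ {R = E} {E} {Q} {Q} {∁ Q} {(V ⊖ a₂) ∖ Q} λ x y e p q → e , p ,
        ∧-intro (∈-⊖ {X = V} {x = y} refl (A-≢-B a₂∈A (E-B e) ∘ sym)) q)

    without-a₂ : ∀ {Q} → a₂ ∉ Q → Q ⊆ V ⊖ a₂
    without-a₂ {Q} h v p = ∈-⊖ {X = V} {x = v} refl λ e → true≢false (subst (_∈ Q) e p) h

    tight-Z : ∀ {p q} → a₁ ∈ Z → p ∈ Z → q ∉ Z → Tight S (V ⊖ a₂) a₁ p q Z
    tight-Z a₁∈Z p∈Z q∉Z = record { Q⊆ = without-a₂ (∧-false not-both-a a₁∈Z) ; s∈ = a₁∈Z ; p∈ = p∈Z ; q∉ = q∉Z
                                  ; nA≡nB = nA≡nB ; rout≡1 = trans (rout≡out Z) out≡1 }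

    tight-∁Z : ∀ {p q} → a₁ ∉ Z → p ∉ Z → q ∈ Z → Tight S (V ⊖ a₂) a₁ p q (∁ Z)
    tight-∁Z a₁∉Z p∉Z q∈Z = record
      { Q⊆ = without-a₂ (cong not (∨-case meets-a a₁∉Z)) ; s∈ = not-intro a₁∉Z ; p∈ = not-intro p∉Z ; q∉ = cong not q∈Z
      ; nA≡nB = Mirror.∁-excess S {Z} {0} (sym nA≡nB)
      ; rout≡1 = trans (rout≡out (∁ Z)) (trans (flow-cong E {∁ Z} (λ _ → refl) (sym ∘ not² Z)) back-Z) }

    crossed-Z : Avoids M Z → ⊥
    crossed-Z avoid = true≢false s∈ (trans (avoid s′ t′ st∈M) t∉)

    crossed-∁Z : Avoids M (∁ Z) → ⊥
    crossed-∁Z avoid = true≢false (not-intro t∉) (trans (sym (avoid s′ t′ st∈M)) (cong not s∈))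

    refuted-whole : ⊥
    refuted-whole = cases (bool (Z a₁)) (bool (Z b₁))
      where
      cases : a₁ ∈ Z ⊎ a₁ ∉ Z → b₁ ∈ Z ⊎ b₁ ∉ Z → ⊥
      cases (inj₁ p) (inj₁ q) = crossed-Z (avoid₁ Z (tight-Z p q (∧-false misses-b q)))
      cases (inj₁ p) (inj₂ q) = crossed-Z (avoid₂ Z (tight-Z p (∨-case touches-b q) q))
      cases (inj₂ p) (inj₁ q) = crossed-∁Z (avoid₂ (∁ Z) (tight-∁Z p (∧-false misses-b q) q))
      cases (inj₂ p) (inj₂ q) = crossed-∁Z (avoid₁ (∁ Z) (tight-∁Z p q (∨-case touches-b q)))

  module MiddleCase {L H M} (sl : Special shape L) (sh : Special shape H) (L⊆H : L ⊆ H)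
    (greatest : ∀ Y → Special shape Y → Y ⊆ H)
    (m : Matching E (A ∩ (H ∖ L)) (B ∩ (H ∖ L)) M)
    (M⊆N : ∀ x y → M x y ≡ true → N x y ≡ true) (st∈M : M s′ t′ ≡ true) where

    private
      module L = Special sl
      module H = Special sh

    M-T : ∀ {x y} → M x y ≡ true → (x ∈ H × x ∉ L) × (y ∈ H × y ∉ L)
    M-T {x} {y} h with ∧-true {H x} (∧ʳ {A x} (Matching.left m x y h)) | ∧-true {H y} (∧ʳ {B y} (Matching.right m x y h))
    ... | p , q | r , u = (p , not-true q) , (r , not-true u)

    s′∈H : s′ ∈ H
    s′∈H = proj₁ (proj₁ (M-T st∈M))

    t′∈H : t′ ∈ H
    t′∈H = proj₁ (proj₂ (M-T st∈M))

    module LowerEmpty (empty : ∀ v → v ∈ L → v ∉ Z) where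

      J : VSet n
      J = Z ∩ H

      M-out : flow M J (∁ J) ≡ 1
      M-out = ≤-antisym
        (flow-≤1 M s′ t′ λ x y e p q → only x y (Matching.edge m x y e) (∧ˡ {Z x} p)
          (trans (sym (in-H (proj₁ (proj₂ (M-T e))))) (not-true q)))
        (flow-term M {J} {∁ J} st∈M (∧-intro s∈ s′∈H) (not-intro (trans (in-H t′∈H) t∉)))
        where
        in-H : ∀ {v} → v ∈ H → J v ≡ Z v
        in-H {v} p = trans (cong (Z v ∧_) p) (∧-identityʳ (Z v))

      in-T : ∀ {x} → x ∈ H → x ∈ ∁ J → x ∉ Z
      in-T {x} p q = trans (sym (trans (cong (Z x ∧_) p) (∧-identityʳ (Z x)))) (not-true q)

      M-back : flow M (∁ J) J ≤ 1
      M-back = ≤-trans (flow-⊆ {R = M} {N} {∁ J} {∁ Z} {J} {Z} λ x y e p q →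
        M⊆N x y e , not-intro (in-T (proj₁ (proj₁ (M-T e))) p) , (∧ˡ {Z y} q)) N-back

      whole : ∀ c → cnt (c ∩ (H ∖ L)) J ≡ cnt c J
      whole c = ∑-cong λ v → cong ⟪_⟫ (≡-by-⇔ (λ p → ∧-intro (∧ˡ {c v} (∧ˡ {c v ∧ (H ∖ L) v} p)) (∧ʳ {c v ∧ (H ∖ L) v} p))
        (λ p → ∧-intro (∧-intro (∧ˡ {c v} p) (∧-intro (∧ʳ {Z v} (∧ʳ {c v} p))
          (not-intro (¬true λ q → true≢false (∧ˡ {Z v} (∧ʳ {c v} p)) (empty v q))))) (∧ʳ {c v} p)))

      J-count : nA J + flow M (∁ J) J ≡ nB J + 1
      J-count = trans (cong (_+ flow M (∁ J) J) (sym (whole A))) (trans (matching-balance m J) (cong₂ _+_ (whole B) M-out))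

      εb≡0 : Z b₁ ∨ Z b₂ ≡ false
      εb≡0 = ∨-false-intro (empty b₁ L.b₁∈) (empty b₂ L.b₂∈)

      -- If Z covers the complement of H, then J has excess 1 and M would have to enter it twice.
      upper-covered : (∀ v → v ∉ H → v ∈ Z) → ⊥
      upper-covered cover = (farkas (nA J ∷ nB J ∷ flow M (∁ J) J ∷ [])
        ( 1 ⊠ ‵ 1 :+ con 1 ⩽ ‵ 0 :+ ‵ 2 ∵ ≤-reflexive (sym J-count)
        ∷ 1 ⊠ ‵ 2 ⩽ con 1 ∵ M-back
        ∷ 1 ⊠ con 1 :+ ‵ 0 ⩽ ‵ 1 ∵ ≤-reflexive (sym (covering-excess sh cover))
        ∷ []))

      upper-missed : ∀ {v} → v ∉ H → v ∉ Z → ⊥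
      upper-missed v∉H v∉Z = clash (special-below εb≡0)
        where
        open High sh s′∈H t′∈H v∉H v∉Z hiding (J)

        M-back≥1 : 1 ≤ flow M (∁ J) J
        M-back≥1 = (≮⇒≥ λ neg → farkas (nA J ∷ nB J ∷ flow M (∁ J) J ∷ [])
          ( 1 ⊠ ‵ 1 :+ con 1 ⩽ ‵ 0 :+ ‵ 2 ∵ ≤-reflexive (sym J-count)
          ∷ 1 ⊠ ‵ 0 ⩽ ‵ 1 ∵ ≤-reflexive equal
          ∷ 1 ⊠ con 1 :+ ‵ 2 ⩽ con 1 ∵ neg
          ∷ []))

        -- Three disjoint kinds of edges enter Z: one from C, at least one of M inside H, which does
        -- not come from C because N does not cross C, and at least `εa Z` from outside H. As Z
        -- misses b₁ and b₂, only 1 + `εa Z` edges enter it.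
        clash : (∃ λ C → Special shape C × (∀ x → x ∈ C → x ∉ Z) × 1 ≤ flow E C Z) → ⊥
        clash (C , sc , apart , entering) = (farkas (back Z ∷ εa Z ∷ εb Z ∷ flow M (∁ J) J
            ∷ flow E (λ v → H v ∧ (not (Z v) ∧ not (C v))) Z ∷ flow E C Z
            ∷ flow E (λ v → H v ∧ (not (Z v) ∧ C v)) Z ∷ flow E (∁ U) D ∷ [])
          ( 1 ⊠ ‵ 0 :+ ‵ 2 ⩽ con 1 :+ ‵ 1 ∵ ≤-reflexive (sym back-count)
          ∷ 1 ⊠ con 1 ⩽ ‵ 3 ∵ M-back≥1
          ∷ 1 ⊠ ‵ 3 ⩽ ‵ 4
                ∵ flow-⊆ {R = M} {E} {∁ J} {λ v → H v ∧ (not (Z v) ∧ not (C v))} {J} {Z} (λ x y e p q → Matching.edge m x y e , ∧-intro (proj₁ (proj₁ (M-T e))) (∧-intro (not-intro (in-T (proj₁ (proj₁ (M-T e))) p)) (not-intro (trans (noncrossing C sc x y (M⊆N x y e)) (¬true λ r → true≢false (∧ˡ {Z y} q) (apart y r))))) , (∧ˡ {Z y} q))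
          ∷ 1 ⊠ con 1 ⩽ ‵ 5 ∵ entering
          ∷ 1 ⊠ ‵ 5 ⩽ ‵ 6
                ∵ flow-⊆ {R = E} {E} {C} {λ v → H v ∧ (not (Z v) ∧ C v)} {Z} {Z} (λ x y e p q → e , ∧-intro (greatest C sc x p) (∧-intro (not-intro (apart x p)) p) , q)
          ∷ 1 ⊠ ‵ 1 ⩽ ‵ 7 ∵ outer-back
          ∷ 1 ⊠ ‵ 4 :+ (‵ 6 :+ ‵ 7) ⩽ ‵ 0
                ∵ flow-≤ {3} (λ { (z ∷ h ∷ c ∷ []) → (h ∧ (not z ∧ not c) , z) ∷ (h ∧ (not z ∧ c) , z) ∷ (not (z ∨ h) , z ∧ not h) ∷ [] }) (λ { (z ∷ h ∷ c ∷ []) → (not z , z) ∷ [] }) E (Z ∷ H ∷ C ∷ [])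
          ∷ []))

module MiddleRefuted {n} (S : Setup n) {N : Adj n} (N⊆E : Within S N) (noncrossing : NonCrossing (Setup.shape S) N)
  {s′ t′ : Fin n} {Z : VSet n} (ob : Obstruction (Setup.shape S) s′ t′ Z) (dep : Dependence (Setup.shape S) N Z)
  {L H : VSet n} {M : Adj n} (sl : Special (Setup.shape S) L) (sh : Special (Setup.shape S) H) (L⊆H : L ⊆ H)
  (least : ∀ Y → Special (Setup.shape S) Y → L ⊆ Y) (greatest : ∀ Y → Special (Setup.shape S) Y → Y ⊆ H)
  (m : Matching (Counts.E (Setup.shape S)) (Setup.A S ∩ (H ∖ L)) (Setup.B S ∩ (H ∖ L)) M)
  (M⊆N : ∀ x y → M x y ≡ true → N x y ≡ true) (st∈M : M s′ t′ ≡ true) where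

  open Basics S

  private
    module M = Counts (flip shape)
    module Here = Refute S N⊆E noncrossing ob dep
    module There = Refute (mirror S) {transpose N} (λ x y p → trans (Mirror.mirror-E S x y) (N⊆E y x p))
      (Mirror.mirror-noncrossing (mirror S) {transpose N} noncrossing)
      (Mirror.mirror-obstruction S ob) (mirror-dependence S dep)
    module Below = Here.MiddleCase sl sh L⊆H greatest m M⊆N st∈M

    mirrored : Matching M.E (B ∩ (∁ L ∖ ∁ H)) (A ∩ (∁ L ∖ ∁ H)) (transpose M)
    mirrored = Matching-cong (same B) (same A) (Matching-transpose (λ x y → sym (Mirror.mirror-E S y x)) m)
      where
      same : ∀ C → (C ∩ (H ∖ L)) ≗ (C ∩ (∁ L ∖ ∁ H))
      same C v = cong (C v ∧_) (trans (∧-comm (H v) (not (L v))) (cong (not (L v) ∧_) (sym (not-involutive (H v)))))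

    module Above = There.MiddleCase (Mirror.mirror-special S sh) (Mirror.mirror-special S sl)
      (λ v p → not-intro (¬true λ q → true≢false (L⊆H v q) (not-true p)))
      (λ Y sy v p → not-intro (¬true λ q → true≢false (least (∁ Y) (Mirror.mirror-special (mirror S) sy) v q) (cong not p)))
      mirrored (λ x y p → M⊆N y x p) st∈M

    complement-count : ∀ p q → (⟪ not p ⟫ + ⟪ not q ⟫) + (⟪ p ⟫ + ⟪ q ⟫) ≡ 2
    complement-count true true = refl
    complement-count true false = refl
    complement-count false true = refl
    complement-count false false = refl

    -- `outer-back` is applied to H and, with the classes exchanged, to L. This yields `εa Z`
    -- entering edges outside H and 2 - `εb Z` inside L, one more in total than `back-count`
    -- permits.
    both : ∀ {u v} → u ∈ L → u ∈ Z → v ∉ H → v ∉ Z → ⊥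
    both {u} {v} u∈L u∈Z v∉H v∉Z = (farkas (back Z ∷ εa Z ∷ εb Z ∷ M.εa (∁ Z) ∷ flow E (∁ (Z ∪ H)) (Z ∖ H)
        ∷ flow E (λ v → not (Z v ∨ H v) ∧ not (L v)) (Z ∖ H) ∷ flow M.E (∁ (∁ Z ∪ ∁ L)) (∁ Z ∖ ∁ L)
        ∷ flow E (∁ Z ∖ ∁ L) (∁ (∁ Z ∪ ∁ L)) ∷ [])
      ( 1 ⊠ ‵ 0 :+ ‵ 2 ⩽ con 1 :+ ‵ 1 ∵ ≤-reflexive (sym (Dependent.back-count S N⊆E noncrossing ob))
      ∷ 1 ⊠ con 2 ⩽ ‵ 3 :+ ‵ 2 ∵ ≤-reflexive (sym (complement-count (Z b₁) (Z b₂)))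
      ∷ 1 ⊠ ‵ 1 ⩽ ‵ 4 ∵ Here.High.outer-back sh Below.s′∈H Below.t′∈H v∉H v∉Z
      ∷ 1 ⊠ ‵ 3 ⩽ ‵ 6
            ∵ There.High.outer-back (Mirror.mirror-special S sl) Above.s′∈H Above.t′∈H {u} (cong not u∈L) (cong not u∈Z)
      ∷ 1 ⊠ ‵ 6 ⩽ ‵ 7 ∵ ≤-reflexive (Mirror.mirror-flow S (∁ (∁ Z ∪ ∁ L)) (∁ Z ∖ ∁ L))
      ∷ 1 ⊠ ‵ 4 ⩽ ‵ 5
            ∵ flow-⊆ {R = E} {E} {∁ (Z ∪ H)} {λ v → not (Z v ∨ H v) ∧ not (L v)} {Z ∖ H} {Z ∖ H} (λ x y e p q → e , ∧-intro p (not-intro (¬true λ r → true≢false (L⊆H x r) (proj₂ (∨-false {Z x} (not-true p))))) , q)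
      ∷ 1 ⊠ ‵ 7 :+ ‵ 5 ⩽ ‵ 0
            ∵ flow-≤ {3} (λ { (z ∷ h ∷ l ∷ []) → (not z ∧ not (not l) , not (not z ∨ not l)) ∷ (not (z ∨ h) ∧ not l , z ∧ not h) ∷ [] }) (λ { (z ∷ h ∷ l ∷ []) → (not z , z) ∷ [] }) E (Z ∷ H ∷ L ∷ [])
      ∷ []))

  middle-refuted : ⊥
  middle-refuted = decide (any? λ u → (L u Bool.≟ true) ×-dec (Z u Bool.≟ true)) (any? λ v → (H v Bool.≟ false) ×-dec (Z v Bool.≟ false))
    where
    decide : Dec (∃ λ u → u ∈ L × u ∈ Z) → Dec (∃ λ v → v ∉ H × v ∉ Z) → ⊥
    decide (yes (u , p , q)) (yes (v , r , w)) = both p q r w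
    -- If Z meets L but contains everything outside H, its complement avoids the lower end for the
    -- exchanged classes.
    decide (yes (u , p , q)) (no none) = Above.LowerEmpty.upper-missed
      (λ v r → ¬true λ w → none (v , not-true r , not-true w)) {u} (cong not p) (cong not q)
    decide (no none) (yes (v , r , w)) = Below.LowerEmpty.upper-missed (λ u p → ¬true λ q → none (u , p , q)) r w
    decide (no none) (no all) = Below.LowerEmpty.upper-covered (λ u p → ¬true λ q → none (u , p , q))
      (λ v r → [ id , (λ w → ⊥-elim (all (v , r , w))) ]′ (bool (Z v)))

-- Assembling the matching

record Solution {n} (S : Setup n) : Set where
  open Basics S
  field
    {N}       : Adj n
    {A′ B′}   : VSet n
    A′⊆A      : A′ ⊆ A
    B′⊆B      : B′ ⊆ B
    matching  : Matching E A′ B′ N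
    large     : cnt A V + cnt B V ≤ cnt V A′ + cnt V B′ + 6
    removable : ∀ s t → N s t ≡ true → ∀ u v → deleteEdge edge s t u v ≡ true →
                Σ (Adj n) λ M → IsPerfectMatching (deleteEdge edge s t) M × M u v ≡ true

module Solve {n} (S : Setup n) where
  open Perfect S
  open Facts S
  open Basics S
  open Specials S

  solve-whole : (∀ X → Special shape X → ⊥) → Solution S
  solve-whole none = assemble (end-matching S whole-end)
    where
    module F = EndMatching S whole-end

    assemble : EndResult S (V ⊖ a₂) a₁ b₁ b₂ → Solution S
    assemble (N , m , avoid₁ , avoid₂) = record
      { A′⊆A = λ v p → (∧ˡ {A v} p) ; B′⊆B = λ v p → (∧ˡ {B v} p) ; matching = m ; large = large
      ; removable = λ s t st → Removal.every-edge S (Matching.edge m) (λ X sp → ⊥-elim (none X sp)) st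
          λ Z ob dep → Refute.WholeCase.refuted-whole S (Matching.edge m) (λ X sp → ⊥-elim (none X sp)) ob dep none avoid₁ avoid₂ st }
      where
      -- Without special sets only a₁, a₂, b₁ and b₂ remain uncovered, so the bound holds with room
      -- to spare.
      large : cnt A V + cnt B V ≤ nA ((V ⊖ a₂) ∩ F.K) + nB ((V ⊖ a₂) ∩ F.K) + 6
      large = (≮⇒≥ λ neg → farkas (cnt A V ∷ cnt B V ∷ nA (V ⊖ a₂) ∷ nB (V ⊖ a₂) ∷ nA ((V ⊖ a₂) ∩ F.K)
          ∷ nB ((V ⊖ a₂) ∩ F.K) ∷ ⟪ (V ⊖ a₂) a₁ ⟫ ∷ ⟪ (V ⊖ a₂) b₁ ⟫ ∷ ⟪ (V ⊖ a₂) b₂ ⟫ ∷ nB ((V ⊖ a₂) ∩ F.PQ) ∷ [])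
        ( 1 ⊠ ‵ 0 ⩽ con 1 :+ ‵ 2 ∵ ≤-reflexive (nA-⊖a {V} a₂∈A refl)
        ∷ 1 ⊠ ‵ 1 ⩽ ‵ 3 ∵ ≤-reflexive (nB-⊖a {V} a₂∈A refl)
        ∷ 1 ⊠ ‵ 2 ⩽ ‵ 4 :+ ‵ 6 ∵ ≤-reflexive (F.nA-K (V ⊖ a₂))
        ∷ 1 ⊠ ‵ 3 ⩽ ‵ 5 :+ ‵ 9 ∵ ≤-reflexive (F.nB-K (V ⊖ a₂))
        ∷ 1 ⊠ ‵ 9 ⩽ ‵ 7 :+ ‵ 8 ∵ ≤-reflexive (F.nB-PQ (V ⊖ a₂))
        ∷ 1 ⊠ ‵ 6 ⩽ con 1 ∵ ⟪⟫≤1 ((V ⊖ a₂) a₁)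
        ∷ 1 ⊠ ‵ 7 ⩽ con 1 ∵ ⟪⟫≤1 ((V ⊖ a₂) b₁)
        ∷ 1 ⊠ ‵ 8 ⩽ con 1 ∵ ⟪⟫≤1 ((V ⊖ a₂) b₂)
        ∷ 1 ⊠ con 1 :+ (‵ 4 :+ ‵ 5 :+ con 6) ⩽ ‵ 0 :+ ‵ 1 ∵ neg
        ∷ []))

  module Pieces {L X° : VSet n} (sl : Special shape L) (least : ∀ Y → Special shape Y → L ⊆ Y)
    (s° : Special (flip shape) X°) (least° : ∀ Y → Special (flip shape) Y → X° ⊆ Y)
    {s t : Fin n} (end : End S L s b₁ b₂) (exit : 1 ≤ flow E ⁅ s ⁆ (∁ L))
    (end° : End (mirror S) X° t a₁ a₂) (exit° : 1 ≤ flow (Basics.E (mirror S)) ⁅ t ⁆ (∁ X°))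
    (lower : EndResult S L s b₁ b₂) (middle : MiddleMatching L (∁ X°)) (upper : EndResult (mirror S) X° t a₁ a₂) where

    private
      module M = Counts (flip shape)
      module F = EndMatching S end
      module G = EndMatching (mirror S) end°

      H : VSet n
      H = ∁ X°

      sh : Special shape H
      sh = Mirror.mirror-special (mirror S) s°

      greatest : ∀ Y → Special shape Y → Y ⊆ H
      greatest Y sy v p = not-intro (¬true λ q → true≢false p (not-true (least° (∁ Y) (Mirror.mirror-special S sy) v q)))

      L⊆H : L ⊆ H
      L⊆H = least H sh

      N₁ N₂ N₃ N : Adj n
      N₁ = proj₁ lower
      N₂ = proj₁ middle
      N₃ = proj₁ upper
      N x y = N₁ x y ∨ (N₂ x y ∨ N₃ y x)

      m₁ = proj₁ (proj₂ lower)
      m₂ = proj₁ (proj₂ middle)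
      m₃ = proj₁ (proj₂ upper)

      m₃ᵀ : Matching E (A ∩ (X° ∩ G.K)) (B ∩ (X° ∩ G.K)) (transpose N₃)
      m₃ᵀ = Matching-transpose (λ x y → Mirror.mirror-E S x y) m₃

      A₁ A₂₃ B₁ B₂₃ : VSet n
      A₁ = A ∩ (L ∩ F.K)
      A₂₃ = (A ∩ (H ∖ L)) ∪ (A ∩ (X° ∩ G.K))
      B₁ = B ∩ (L ∩ F.K)
      B₂₃ = (B ∩ (H ∖ L)) ∪ (B ∩ (X° ∩ G.K))

      in-L : ∀ C {v} → v ∈ C ∩ (L ∩ F.K) → v ∈ L
      in-L C {v} p = (∧ˡ {L v} (∧ʳ {C v} p))

      in-mid : ∀ C {v} → v ∈ C ∩ (H ∖ L) → v ∈ H × v ∉ L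
      in-mid C {v} p with ∧-true {H v} (∧ʳ {C v} p)
      ... | q , r = q , not-true r

      in-X° : ∀ C {v} → v ∈ C ∩ (X° ∩ G.K) → v ∈ X°
      in-X° C {v} p = (∧ˡ {X° v} (∧ʳ {C v} p))

      apart₂₃ : ∀ C v → v ∈ C ∩ (H ∖ L) → v ∈ C ∩ (X° ∩ G.K) → ⊥
      apart₂₃ C v p q = true≢false (in-X° C {v} q) (not-true (proj₁ (in-mid C {v} p)))

      apart₁ : ∀ C v → v ∈ C ∩ (L ∩ F.K) → v ∈ (C ∩ (H ∖ L)) ∪ (C ∩ (X° ∩ G.K)) → ⊥
      apart₁ C v p q = [ (λ r → true≢false (in-L C {v} p) (proj₂ (in-mid C {v} r)))
                       , (λ r → true≢false (in-X° C {v} r) (not-true (L⊆H v (in-L C {v} p)))) ]′ (∨-true {(C ∩ (H ∖ L)) v} q)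

      m : Matching E (A₁ ∪ A₂₃) (B₁ ∪ B₂₃) N
      m = Matching-join (λ _ → refl) (λ _ → refl) (apart₁ A) (apart₁ B) m₁
            (Matching-join {A = A₂₃} {B = B₂₃} (λ _ → refl) (λ _ → refl) (apart₂₃ A) (apart₂₃ B) m₂ m₃ᵀ)

      N⊆E : ∀ x y → N x y ≡ true → E x y ≡ true
      N⊆E = Matching.edge m

      -- Every special set contains L and lies inside H, so the matchings at the two ends cannot
      -- cross it; the middle matching was chosen accordingly.
      noncrossing : NonCrossing shape N
      noncrossing X sp x y p = cases (∨-true {N₁ x y} p)
        where
        cases : N₁ x y ≡ true ⊎ N₂ x y ∨ N₃ y x ≡ true → X x ≡ X y
        cases (inj₁ q) = trans (least X sp x (in-L A (Matching.left m₁ x y q))) (sym (least X sp y (in-L B (Matching.right m₁ x y q))))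
        cases (inj₂ q) = [ proj₂ (proj₂ middle) X sp x y
                         , (λ r → trans (outside x (in-X° A (Matching.left m₃ᵀ x y r))) (sym (outside y (in-X° B (Matching.right m₃ᵀ x y r))))) ]′ (∨-true {N₂ x y} q)
          where
          outside : ∀ v → v ∈ X° → v ∉ X
          outside v h = ¬true λ w → true≢false h (not-true (greatest X sp v w))

      refute : ∀ {s′ t′} → N s′ t′ ≡ true → ∀ Z → Obstruction shape s′ t′ Z → Dependence shape N Z → ⊥
      refute {s′} {t′} p Z ob dep = cases (∨-true {N₁ s′ t′} p)
        where
        cases : N₁ s′ t′ ≡ true ⊎ N₂ s′ t′ ∨ N₃ t′ s′ ≡ true → ⊥
        cases (inj₁ q) = Refute.EndCase.refuted-end S N⊆E noncrossing ob dep sl least end exit m₁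
          (proj₁ (proj₂ (proj₂ lower))) (proj₂ (proj₂ (proj₂ lower))) (λ x y r → ∨-introˡ r) q
        cases (inj₂ q) = [ (λ r → MiddleRefuted.middle-refuted S N⊆E noncrossing ob dep sl sh L⊆H least greatest m₂
                              (λ x y w → ∨-introʳ {N₁ x y} (∨-introˡ w)) r)
                         , (λ r → Refute.EndCase.refuted-end (mirror S) {transpose N}
                              (λ x y w → trans (Mirror.mirror-E S x y) (N⊆E y x w))
                              (Mirror.mirror-noncrossing (mirror S) {transpose N} noncrossing)
                              (Mirror.mirror-obstruction S ob) (mirror-dependence S dep) s° least° end° exit° m₃
                              (proj₁ (proj₂ (proj₂ upper))) (proj₂ (proj₂ (proj₂ upper)))
                              (λ x y w → ∨-introʳ {N₁ y x} (∨-introʳ {N₂ y x} w)) r) ]′ (∨-true {N₂ s′ t′} q)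

      size : ∀ C → cnt V ((C ∩ (L ∩ F.K)) ∪ ((C ∩ (H ∖ L)) ∪ (C ∩ (X° ∩ G.K)))) ≡ cnt C (L ∩ F.K) + (cnt C (H ∖ L) + cnt C (X° ∩ G.K))
      size C = trans (cnt-⊎ V {C ∩ (L ∩ F.K)} (apart₁ C)) (cong (cnt C (L ∩ F.K) +_) (cnt-⊎ V {C ∩ (H ∖ L)} (apart₂₃ C)))

      -- L loses s, b₁ and b₂, the complement of H loses t, a₁ and a₂, and nothing is lost in
      -- between.
      large : cnt A V + cnt B V ≤ cnt V (A₁ ∪ A₂₃) + cnt V (B₁ ∪ B₂₃) + 6
      large = (≮⇒≥ λ neg → farkas (cnt A V ∷ cnt B V ∷ cnt V (A₁ ∪ A₂₃) ∷ cnt V (B₁ ∪ B₂₃) ∷ nA (L ∩ F.K)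
          ∷ nA (H ∖ L) ∷ nA (X° ∩ G.K) ∷ nB (L ∩ F.K) ∷ nB (H ∖ L) ∷ nB (X° ∩ G.K) ∷ nA L ∷ nB L ∷ nA H ∷ nB H
          ∷ nA X° ∷ nB X° ∷ ⟪ L s ⟫ ∷ ⟪ L b₁ ⟫ ∷ ⟪ L b₂ ⟫ ∷ nB (L ∩ F.PQ) ∷ ⟪ X° t ⟫ ∷ ⟪ X° a₁ ⟫ ∷ ⟪ X° a₂ ⟫
          ∷ nA (X° ∩ G.PQ) ∷ [])
        ( 1 ⊠ ‵ 4 :+ (‵ 5 :+ ‵ 6) ⩽ ‵ 2 ∵ ≤-reflexive (sym (size A))
        ∷ 1 ⊠ ‵ 7 :+ (‵ 8 :+ ‵ 9) ⩽ ‵ 3 ∵ ≤-reflexive (sym (size B))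
        ∷ 1 ⊠ ‵ 10 ⩽ ‵ 4 :+ ‵ 16 ∵ ≤-reflexive (F.nA-K L)
        ∷ 1 ⊠ ‵ 11 ⩽ ‵ 7 :+ ‵ 19 ∵ ≤-reflexive (F.nB-K L)
        ∷ 1 ⊠ ‵ 19 ⩽ ‵ 17 :+ ‵ 18 ∵ ≤-reflexive (F.nB-PQ L)
        ∷ 1 ⊠ ‵ 12 ⩽ ‵ 10 :+ ‵ 5 ∵ ≤-reflexive (cnt-⊆ A L⊆H)
        ∷ 1 ⊠ ‵ 13 ⩽ ‵ 11 :+ ‵ 8 ∵ ≤-reflexive (cnt-⊆ B L⊆H)
        ∷ 1 ⊠ ‵ 0 ⩽ ‵ 12 :+ ‵ 14 ∵ ≤-reflexive (sym (cnt-∁ A X°))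
        ∷ 1 ⊠ ‵ 1 ⩽ ‵ 13 :+ ‵ 15 ∵ ≤-reflexive (sym (cnt-∁ B X°))
        ∷ 1 ⊠ ‵ 15 ⩽ ‵ 9 :+ ‵ 20 ∵ ≤-reflexive (G.nA-K X°)
        ∷ 1 ⊠ ‵ 14 ⩽ ‵ 6 :+ ‵ 23 ∵ ≤-reflexive (G.nB-K X°)
        ∷ 1 ⊠ ‵ 23 ⩽ ‵ 21 :+ ‵ 22 ∵ ≤-reflexive (G.nB-PQ X°)
        ∷ 1 ⊠ ‵ 16 ⩽ con 1 ∵ ⟪⟫≤1 (L s)
        ∷ 1 ⊠ ‵ 17 ⩽ con 1 ∵ ⟪⟫≤1 (L b₁)
        ∷ 1 ⊠ ‵ 18 ⩽ con 1 ∵ ⟪⟫≤1 (L b₂)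
        ∷ 1 ⊠ ‵ 20 ⩽ con 1 ∵ ⟪⟫≤1 (X° t)
        ∷ 1 ⊠ ‵ 21 ⩽ con 1 ∵ ⟪⟫≤1 (X° a₁)
        ∷ 1 ⊠ ‵ 22 ⩽ con 1 ∵ ⟪⟫≤1 (X° a₂)
        ∷ 1 ⊠ con 1 :+ (‵ 2 :+ ‵ 3 :+ con 6) ⩽ ‵ 0 :+ ‵ 1 ∵ neg
        ∷ []))

      only-C : ∀ C → ((C ∩ (L ∩ F.K)) ∪ ((C ∩ (H ∖ L)) ∪ (C ∩ (X° ∩ G.K)))) ⊆ C
      only-C C v p = [ (λ q → (∧ˡ {C v} q)) , (λ q → [ (λ r → (∧ˡ {C v} r)) , (λ r → (∧ˡ {C v} r)) ]′ (∨-true {(C ∩ (H ∖ L)) v} q)) ]′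
                         (∨-true {(C ∩ (L ∩ F.K)) v} p)

    solution : Solution S
    solution = record
      { A′⊆A = only-C A ; B′⊆B = only-C B ; matching = m ; large = large
      ; removable = λ s t st → Removal.every-edge S N⊆E noncrossing st (refute st) }

  solve : Solution S
  solve = decide (∃set? special-resp special?)
    where
    module S° = Specials (mirror S)

    decide : Dec (∃ (Special shape)) → Solution S
    decide (no none) = solve-whole λ X sp → none (X , sp)
    decide (yes (X , sp)) = pieces (least-special (X , sp)) (S°.least-special (∁ X , Mirror.mirror-special S sp))
      where
      pieces : (∃ λ L → Special shape L × (∀ Y → Special shape Y → L ⊆ Y)) →
               (∃ λ X° → Special (flip shape) X° × (∀ Y → Special (flip shape) Y → X° ⊆ Y)) → Solution S
      pieces (L , sl , least) (X° , s° , least°) = ends (special-end sl) (S°.special-end s°)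
        where
        ends : (∃ λ s → End S L s b₁ b₂ × 1 ≤ flow E ⁅ s ⁆ (∁ L)) →
               (∃ λ t → End (mirror S) X° t a₁ a₂ × 1 ≤ flow (Basics.E (mirror S)) ⁅ t ⁆ (∁ X°)) → Solution S
        ends (s , end , exit) (t , end° , exit°) = Pieces.solution sl least s° least° end exit end° exit°
          (end-matching S end) (middle-matching sl (Mirror.mirror-special (mirror S) s°) (least (∁ X°) (Mirror.mirror-special (mirror S) s°)))
          (end-matching (mirror S) end°)

-- From the given graph to the setup

flow-remove : ∀ {n} (R : Adj n) {P Q : VSet n} {a b} → R a b ≡ true → a ∈ P → b ∈ Q →
              1 + flow (remove R a b) P Q ≤ flow R P Q
flow-remove R {P} {Q} {a} {b} r p q =
  ∑-mono-< (λ x → ∑-mono (bound x)) a (∑-mono-< (bound a) b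
    (subst₂ _<_ (sym (cong (λ e → ⟪ e ∧ (P a ∧ Q b) ⟫) (remove-gone R a b))) (sym (cong ⟪_⟫ (∧-intro r (∧-intro p q)))) (s≤s z≤n)))
  where
  bound : ∀ x y → ⟪ remove R a b x y ∧ (P x ∧ Q y) ⟫ ≤ ⟪ R x y ∧ (P x ∧ Q y) ⟫
  bound x y = ⟪⟫-mono λ h → ∧-intro (remove-⊆ R (∧ˡ {remove R a b x y} h)) (∧ʳ {remove R a b x y} h)

Reach-crossing : ∀ {n} {R : Adj n} (X : VSet n) {x y} → Reach R x y → x ∈ X → y ∉ X →
                 ∃ λ u → ∃ λ v → R u v ≡ true × u ∈ X × v ∉ X
Reach-crossing X here p q = ⊥-elim (true≢false p q)
Reach-crossing X (step {u} {v} r path) p q with bool (X v)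
... | inj₁ i = Reach-crossing X path i q
... | inj₂ o = u , v , r , p , o

Reach-mono : ∀ {n} {R R′ : Adj n} → (∀ x y → R x y ≡ true → R′ x y ≡ true) → ∀ {x y} → Reach R x y → Reach R′ x y
Reach-mono h here = here
Reach-mono h (step r path) = step (h _ _ r) (Reach-mono h path)

deleteEdge-⊆ : ∀ {n} (R : Adj n) {u v} x y → deleteEdge R u v x y ≡ true → R x y ≡ true
deleteEdge-⊆ R x y p = (∧ˡ p)

deleteEdge-≢ : ∀ {n} (R : Adj n) {u v x y} → deleteEdge R u v x y ≡ true → x ≡ u → y ≡ v → ⊥
deleteEdge-≢ R {x = x} {y} p refl refl =
  true≢false (∨-introˡ (∧-intro (⌊≟⌋-refl x) (⌊≟⌋-refl y))) (not-true (∧ʳ {R x y} p))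

cut-size : ∀ {n} (R : Adj n) → ThreeEdgeConnected R → ∀ X x y → x ∈ X → y ∉ X → 3 ≤ flow R X (∁ X)
cut-size R (connected , robust) X x y x∈X y∉X = first (Reach-crossing X (connected x y) x∈X y∉X)
  where
  Crossing : Adj _ → Set
  Crossing R = ∃ λ u → ∃ λ v → R u v ≡ true × u ∈ X × v ∉ X

  first : Crossing R → 3 ≤ flow R X (∁ X)
  -- Naming the first edge twice deletes just this edge; the second crossing edge found is therefore
  -- different from it, and deleting both yields a third.
  first (u₁ , v₁ , e₁ , p₁ , q₁) = second (Reach-crossing X (robust u₁ v₁ u₁ v₁ e₁ e₁ x y) x∈X y∉X)
    where
    second : Crossing (deleteEdge (deleteEdge R u₁ v₁) u₁ v₁) → 3 ≤ flow R X (∁ X)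
    second (u₂ , v₂ , e₂ , p₂ , q₂) = third (Reach-crossing X (robust u₁ v₁ u₂ v₂ e₁ R-e₂ x y) x∈X y∉X)
      where
      once : deleteEdge R u₁ v₁ u₂ v₂ ≡ true
      once = deleteEdge-⊆ (deleteEdge R u₁ v₁) u₂ v₂ e₂

      R-e₂ : R u₂ v₂ ≡ true
      R-e₂ = deleteEdge-⊆ R u₂ v₂ once

      third : Crossing (deleteEdge (deleteEdge R u₁ v₁) u₂ v₂) → 3 ≤ flow R X (∁ X)
      third (u₃ , v₃ , e₃ , p₃ , q₃) =
        ≤-trans (s≤s (≤-trans (s≤s (flow-term (remove (remove R u₁ v₁) u₂ v₂) {X} {∁ X} kept p₃ (not-intro q₃)))
                              (flow-remove (remove R u₁ v₁) {X} {∁ X} (remove-keep R R-e₂ (deleteEdge-≢ R once)) p₂ (not-intro q₂))))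
                (flow-remove R {X} {∁ X} e₁ p₁ (not-intro q₁))
        where
        once′ : deleteEdge R u₁ v₁ u₃ v₃ ≡ true
        once′ = deleteEdge-⊆ (deleteEdge R u₁ v₁) u₃ v₃ e₃

        kept : remove (remove R u₁ v₁) u₂ v₂ u₃ v₃ ≡ true
        kept = remove-keep (remove R u₁ v₁)
          (remove-keep R (deleteEdge-⊆ R u₃ v₃ once′) (deleteEdge-≢ R once′)) (deleteEdge-≢ (deleteEdge R u₁ v₁) e₃)

samePair-cases : ∀ {n} (x y u v : Fin n) → samePair x y u v ≡ true → (x ≡ u × y ≡ v) ⊎ (x ≡ v × y ≡ u)
samePair-cases x y u v p with ∨-true {⁅ u ⁆ x ∧ ⁅ v ⁆ y} p
... | inj₁ q = inj₁ (⌊≟⌋-true (∧ˡ {⁅ u ⁆ x} q) , ⌊≟⌋-true (∧ʳ {⁅ u ⁆ x} q))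
... | inj₂ q = inj₂ (⌊≟⌋-true (∧ˡ {⁅ v ⁆ x} q) , ⌊≟⌋-true (∧ʳ {⁅ v ⁆ x} q))

samePair-refl : ∀ {n} (u v : Fin n) → samePair u v u v ≡ true
samePair-refl u v = ∨-introˡ (∧-intro (⌊≟⌋-refl u) (⌊≟⌋-refl v))

samePair-swap : ∀ {n} (u v : Fin n) → samePair u v v u ≡ true
samePair-swap u v = ∨-introʳ {⁅ v ⁆ u ∧ ⁅ u ⁆ v} (∧-intro (⌊≟⌋-refl u) (⌊≟⌋-refl v))

module Colouring {n} (G : SimpleGraph n) (connected : ThreeEdgeConnected (adj G)) (cubic : Cubic (adj G)) (c : VSet n) where

  record Exceptions (u₁ v₁ u₂ v₂ : Fin n) : Set where
    field
      e₁       : adj G u₁ v₁ ≡ true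
      e₂       : adj G u₂ v₂ ≡ true
      distinct : samePair u₁ v₁ u₂ v₂ ≡ false
      mono     : ∀ x y → adj G x y ≡ true → c x ≡ c y → samePair x y u₁ v₁ ≡ true ⊎ samePair x y u₂ v₂ ≡ true

  Exceptions-swap : ∀ {u₁ v₁ u₂ v₂} → Exceptions u₁ v₁ u₂ v₂ → Exceptions u₂ v₂ u₁ v₁
  Exceptions-swap {u₁} {v₁} {u₂} {v₂} ex = record
    { e₁ = e₂ ; e₂ = e₁
    ; distinct = ¬true λ p → [ (λ { (refl , refl) → true≢false (samePair-refl u₁ v₁) distinct })
                             , (λ { (refl , refl) → true≢false (samePair-swap u₁ v₁) distinct }) ]′ (samePair-cases u₂ v₂ u₁ v₁ p)
    ; mono = λ x y e h → [ inj₂ , inj₁ ]′ (mono x y e h) }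
    where open Exceptions ex

  ends-≢ : ∀ {u v} → adj G u v ≡ true → u ≢ v
  ends-≢ {u} e refl = true≢false e (irrfl G u)

  module Count {u₁ v₁ u₂ v₂} (ex : Exceptions u₁ v₁ u₂ v₂) where
    open Exceptions ex

    monochromatic : ∀ (C : VSet n) → (∀ x y → x ∈ C → y ∈ C → c x ≡ c y) →
                    flow (adj G) C C ≡ 2 * ⟪ C u₁ ∧ C v₁ ⟫ + 2 * ⟪ C u₂ ∧ C v₂ ⟫
    monochromatic C same = begin
      flow (adj G) C C
        ≡⟨ ∑-cong (λ x → ∑-cong (λ y → pointwise x y)) ⟩
      ∑ (λ x → ∑ (λ y → ⟪ samePair x y u₁ v₁ ∧ (C x ∧ C y) ⟫ + ⟪ samePair x y u₂ v₂ ∧ (C x ∧ C y) ⟫))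
        ≡⟨ ∑-cong (λ x → ∑-+ (λ y → ⟪ samePair x y u₁ v₁ ∧ (C x ∧ C y) ⟫) (λ y → ⟪ samePair x y u₂ v₂ ∧ (C x ∧ C y) ⟫)) ⟩
      ∑ (λ x → ∑ (λ y → ⟪ samePair x y u₁ v₁ ∧ (C x ∧ C y) ⟫) + ∑ (λ y → ⟪ samePair x y u₂ v₂ ∧ (C x ∧ C y) ⟫))
        ≡⟨ ∑-+ (λ x → ∑ (λ y → ⟪ samePair x y u₁ v₁ ∧ (C x ∧ C y) ⟫)) (λ x → ∑ (λ y → ⟪ samePair x y u₂ v₂ ∧ (C x ∧ C y) ⟫)) ⟩
      flow (λ x y → samePair x y u₁ v₁) C C + flow (λ x y → samePair x y u₂ v₂) C C
        ≡⟨ cong₂ _+_ (value u₁ v₁ e₁) (value u₂ v₂ e₂) ⟩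
      2 * ⟪ C u₁ ∧ C v₁ ⟫ + 2 * ⟪ C u₂ ∧ C v₂ ⟫ ∎
      where
      open ≡-Reasoning

      value : ∀ u v → adj G u v ≡ true → flow (λ x y → samePair x y u v) C C ≡ 2 * ⟪ C u ∧ C v ⟫
      value u v e = trans (flow-single (λ x y → samePair x y u v) (ends-≢ e) (λ _ _ → refl) C C)
        (cong (⟪ C u ∧ C v ⟫ +_) (trans (cong ⟪_⟫ (∧-comm (C v) (C u))) (sym (+-identityʳ _))))

      edge-of : ∀ u v x y → adj G u v ≡ true → samePair x y u v ≡ true → adj G x y ≡ true
      edge-of u v x y e p = [ (λ { (refl , refl) → e }) , (λ { (refl , refl) → trans (SimpleGraph.sym G x y) e }) ]′ (samePair-cases x y u v p)

      exclusive : ∀ x y → samePair x y u₁ v₁ ≡ true → samePair x y u₂ v₂ ≡ true → ⊥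
      exclusive x y p q with samePair-cases x y u₁ v₁ p
      ... | inj₁ (refl , refl) = true≢false q distinct
      ... | inj₂ (refl , refl) with samePair-cases x y u₂ v₂ q
      ...   | inj₁ (refl , refl) = true≢false (samePair-swap y x) distinct
      ...   | inj₂ (refl , refl) = true≢false (samePair-refl y x) distinct

      pointwise : ∀ x y → ⟪ adj G x y ∧ (C x ∧ C y) ⟫ ≡ ⟪ samePair x y u₁ v₁ ∧ (C x ∧ C y) ⟫ + ⟪ samePair x y u₂ v₂ ∧ (C x ∧ C y) ⟫
      pointwise x y = trans (cong ⟪_⟫ (≡-by-⇔ to from))
        (⟪⟫-∨ _ _ λ p q → exclusive x y (∧ˡ {samePair x y u₁ v₁} p) (∧ˡ {samePair x y u₂ v₂} q))
        where
        to : adj G x y ∧ (C x ∧ C y) ≡ true → (samePair x y u₁ v₁ ∧ (C x ∧ C y)) ∨ (samePair x y u₂ v₂ ∧ (C x ∧ C y)) ≡ true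
        to p with ∧-true {adj G x y} p
        ... | e , q = [ (λ r → ∨-introˡ (∧-intro r q)) , (λ r → ∨-introʳ {samePair x y u₁ v₁ ∧ (C x ∧ C y)} (∧-intro r q)) ]′
                        (mono x y e (same x y (∧ˡ {C x} q) (∧ʳ {C x} q)))
        from : (samePair x y u₁ v₁ ∧ (C x ∧ C y)) ∨ (samePair x y u₂ v₂ ∧ (C x ∧ C y)) ≡ true → adj G x y ∧ (C x ∧ C y) ≡ true
        from p = [ (λ q → ∧-intro (edge-of u₁ v₁ x y e₁ (∧ˡ {samePair x y u₁ v₁} q)) (∧ʳ {samePair x y u₁ v₁} q))
                 , (λ q → ∧-intro (edge-of u₂ v₂ x y e₂ (∧ˡ {samePair x y u₂ v₂} q)) (∧ʳ {samePair x y u₂ v₂} q)) ]′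
                 (∨-true {samePair x y u₁ v₁ ∧ (C x ∧ C y)} p)

    half : ∀ (C : VSet n) → 3 * cnt C V ≡ flow (adj G) C C + flow (adj G) C (∁ C)
    half C = trans (sym (degree-sum (adj G) cubic C V)) (trans (flow-cong (adj G) (λ x → ∧-identityʳ (C x)) (λ _ → refl)) (≤-antisym
      (flow-≤ {1} (λ { (x ∷ []) → (x , true) ∷ [] }) (λ { (x ∷ []) → (x , x) ∷ (x , not x) ∷ [] }) (adj G) (C ∷ []))
      (flow-≤ {1} (λ { (x ∷ []) → (x , x) ∷ (x , not x) ∷ [] }) (λ { (x ∷ []) → (x , true) ∷ [] }) (adj G) (C ∷ []))))

    opposite : flow (adj G) (∁ c) (∁ (∁ c)) ≡ flow (adj G) c (∁ c)
    opposite = trans (flow-cong (adj G) (λ _ → refl) (sym ∘ not² c)) (flow-transpose (SimpleGraph.sym G) (∁ c) c)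

    -- Both colour classes meet the same bichromatic edges. The factors 2 arise because `flow`
    -- counts a monochromatic edge once from each end.
    double-count : 3 * cnt c V + (2 * ⟪ not (c u₁) ∧ not (c v₁) ⟫ + 2 * ⟪ not (c u₂) ∧ not (c v₂) ⟫)
                 ≡ 3 * cnt (∁ c) V + (2 * ⟪ c u₁ ∧ c v₁ ⟫ + 2 * ⟪ c u₂ ∧ c v₂ ⟫)
    double-count = equate (cnt c V ∷ cnt (∁ c) V ∷ ⟪ not (c u₁) ∧ not (c v₁) ⟫ ∷ ⟪ not (c u₂) ∧ not (c v₂) ⟫
        ∷ ⟪ c u₁ ∧ c v₁ ⟫ ∷ ⟪ c u₂ ∧ c v₂ ⟫ ∷ flow (adj G) c c ∷ flow (adj G) (∁ c) (∁ c) ∷ flow (adj G) c (∁ c)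
        ∷ flow (adj G) (∁ c) (∁ (∁ c))
        ∷ []) 1 (3 :* (‵ 0) :+ (2 :* (‵ 2) :+ 2 :* (‵ 3))) (3 :* (‵ 1) :+ (2 :* (‵ 4) :+ 2 :* (‵ 5)))
      ( 1 ⊠ 3 :* (‵ 0) ≐ ‵ 6 :+ ‵ 8 ∵ half c
      ∷ 1 ⊠ ‵ 7 :+ ‵ 9 ≐ 3 :* (‵ 1) ∵ sym (half (∁ c))
      ∷ 1 ⊠ ‵ 8 ≐ ‵ 9 ∵ sym opposite
      ∷ 1 ⊠ ‵ 6 ≐ 2 :* (‵ 4) :+ 2 :* (‵ 5) ∵ monochromatic c (λ x y i j → trans i (sym j))
      ∷ 1 ⊠ 2 :* (‵ 2) :+ 2 :* (‵ 3) ≐ ‵ 7 ∵ sym (monochromatic (∁ c) (λ x y i j → trans (not-true i) (sym (not-true j))))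
      ∷ [])

  build : ∀ {u₁ v₁ u₂ v₂} → Exceptions u₁ v₁ u₂ v₂ → u₁ ∈ c → v₁ ∈ c → u₂ ∉ c → v₂ ∉ c →
          Σ (Setup n) λ S → Setup.edge S ≡ adj G
  build {u₁} {v₁} {u₂} {v₂} ex p q r s = record
    { shape = record { edge = adj G ; A = c ; B = ∁ c ; a₁ = u₁ ; a₂ = v₁ ; b₁ = u₂ ; b₂ = v₂ }
    ; edge-sym = SimpleGraph.sym G ; cubic = cubic ; B≡∁A = λ _ → refl
    ; a₁∈A = p ; a₂∈A = q ; b₁∈B = not-intro r ; b₂∈B = not-intro s ; a₁≢a₂ = ends-≢ e₁ ; b₁≢b₂ = ends-≢ e₂
    ; a₁a₂ = e₁ ; b₁b₂ = e₂
    ; A-edges = λ x y e i j → [ samePair-cases x y u₁ v₁ , (λ h → ⊥-elim (true≢false i (∉-pair x y r s h))) ]′ (mono x y e (trans i (sym j)))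
    ; B-edges = λ x y e i j → [ (λ h → ⊥-elim (true≢false (∈-pair x y p q h) (not-true i))) , samePair-cases x y u₂ v₂ ]′ (mono x y e (trans (not-true i) (sym (not-true j))))
    ; balanced = equal
    ; cut≥3 = cut-size (adj G) connected } , refl
    where
    open Exceptions ex

    ∉-pair : ∀ {u v} x y → u ∉ c → v ∉ c → samePair x y u v ≡ true → x ∉ c
    ∉-pair {u} {v} x y h k i = [ (λ { (refl , _) → h }) , (λ { (refl , _) → k }) ]′ (samePair-cases x y u v i)

    ∈-pair : ∀ {u v} x y → u ∈ c → v ∈ c → samePair x y u v ≡ true → x ∈ c
    ∈-pair {u} {v} x y h k i = [ (λ { (refl , _) → h }) , (λ { (refl , _) → k }) ]′ (samePair-cases x y u v i)

    balance-of : ∀ a b {p q r s : Bool} → p ≡ true → q ≡ true → r ≡ false → s ≡ false →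
                 3 * a + (2 * ⟪ not p ∧ not q ⟫ + 2 * ⟪ not r ∧ not s ⟫) ≡ 3 * b + (2 * ⟪ p ∧ q ⟫ + 2 * ⟪ r ∧ s ⟫) → a ≡ b
    balance-of a b refl refl refl refl h = *-cancelˡ-≡ a b 3 (+-cancelʳ-≡ 2 (3 * a) (3 * b) h)

    equal : cnt c V ≡ cnt (∁ c) V
    equal = balance-of (cnt c V) (cnt (∁ c) V) p q r s (Count.double-count ex)

  private
    -- Two certificates are needed, as the argument is integral: the equation first gives b < a,
    -- hence 3 a ≥ 3 b + 3.
    unbalanced₁ : ∀ {a b} → 3 * a ≡ 3 * b + 2 → ⊥
    unbalanced₁ {a} {b} h = (farkas (a ∷ b ∷ [])
      ( 1 ⊠ 3 :* (‵ 0) ⩽ 3 :* (‵ 1) :+ con 2 ∵ ≤-reflexive h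
      ∷ 3 ⊠ con 1 :+ ‵ 1 ⩽ ‵ 0 ∵ above
      ∷ []))
      where
      above : 1 + b ≤ a
      above = (≮⇒≥ λ neg → farkas (a ∷ b ∷ [])
        ( 1 ⊠ 3 :* (‵ 1) :+ con 2 ⩽ 3 :* (‵ 0) ∵ ≤-reflexive (sym h)
        ∷ 3 ⊠ con 1 :+ ‵ 0 ⩽ con 1 :+ ‵ 1 ∵ neg
        ∷ []))

    unbalanced₂ : ∀ {a b} → 3 * a ≡ 3 * b + 4 → ⊥
    unbalanced₂ {a} {b} h = (farkas (a ∷ b ∷ [])
      ( 1 ⊠ 3 :* (‵ 0) ⩽ 3 :* (‵ 1) :+ con 4 ∵ ≤-reflexive h
      ∷ 3 ⊠ con 2 :+ ‵ 1 ⩽ ‵ 0 ∵ above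
      ∷ []))
      where
      above : 2 + b ≤ a
      above = (≮⇒≥ λ neg → farkas (a ∷ b ∷ [])
        ( 1 ⊠ 3 :* (‵ 1) :+ con 4 ⩽ 3 :* (‵ 0) ∵ ≤-reflexive (sym h)
        ∷ 3 ⊠ con 1 :+ ‵ 0 ⩽ con 2 :+ ‵ 1 ∵ neg
        ∷ []))

    Mono : Bool → Bool → Bool → Bool → Set
    Mono p q r s = (p ≢ q × r ≢ s) ⊎ ((p ≡ true × q ≡ true × r ≡ false × s ≡ false) ⊎ (p ≡ false × q ≡ false × r ≡ true × s ≡ true))

    -- Modulo 3, the two exceptional edges must both be bichromatic or lie in different colour classes.
    classify : ∀ a b p q r s →
               3 * a + (2 * ⟪ not p ∧ not q ⟫ + 2 * ⟪ not r ∧ not s ⟫) ≡ 3 * b + (2 * ⟪ p ∧ q ⟫ + 2 * ⟪ r ∧ s ⟫) → Mono p q r s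
    classify a b true false true false h = inj₁ ((λ ()) , (λ ()))
    classify a b true false false true h = inj₁ ((λ ()) , (λ ()))
    classify a b false true true false h = inj₁ ((λ ()) , (λ ()))
    classify a b false true false true h = inj₁ ((λ ()) , (λ ()))
    classify a b true true false false h = inj₂ (inj₁ (refl , refl , refl , refl))
    classify a b false false true true h = inj₂ (inj₂ (refl , refl , refl , refl))
    classify a b true true true false h = ⊥-elim (unbalanced₁ {a} {b} (trans (sym (+-identityʳ _)) h))
    classify a b true true false true h = ⊥-elim (unbalanced₁ {a} {b} (trans (sym (+-identityʳ _)) h))
    classify a b true false true true h = ⊥-elim (unbalanced₁ {a} {b} (trans (sym (+-identityʳ _)) h))
    classify a b false true true true h = ⊥-elim (unbalanced₁ {a} {b} (trans (sym (+-identityʳ _)) h))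
    classify a b true true true true h = ⊥-elim (unbalanced₂ {a} {b} (trans (sym (+-identityʳ _)) h))
    classify a b false false true false h = ⊥-elim (unbalanced₁ {b} {a} (trans (sym (+-identityʳ _)) (sym h)))
    classify a b false false false true h = ⊥-elim (unbalanced₁ {b} {a} (trans (sym (+-identityʳ _)) (sym h)))
    classify a b true false false false h = ⊥-elim (unbalanced₁ {b} {a} (trans (sym (+-identityʳ _)) (sym h)))
    classify a b false true false false h = ⊥-elim (unbalanced₁ {b} {a} (trans (sym (+-identityʳ _)) (sym h)))
    classify a b false false false false h = ⊥-elim (unbalanced₂ {b} {a} (trans (sym (+-identityʳ _)) (sym h)))

  setup : ¬ Bipartite (adj G) → ∀ {u₁ v₁ u₂ v₂} → Exceptions u₁ v₁ u₂ v₂ → Σ (Setup n) λ S → Setup.edge S ≡ adj G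
  setup odd {u₁} {v₁} {u₂} {v₂} ex = cases (classify (cnt c V) (cnt (∁ c) V) (c u₁) (c v₁) (c u₂) (c v₂) (Count.double-count ex))
    where
    open Exceptions ex

    proper : c u₁ ≢ c v₁ → c u₂ ≢ c v₂ → ∀ x y → adj G x y ≡ true → c x ≢ c y
    proper h k x y e same = [ clash u₁ v₁ h , clash u₂ v₂ k ]′ (mono x y e same)
      where
      clash : ∀ u v → c u ≢ c v → samePair x y u v ≡ true → ⊥
      clash u v h p = [ (λ { (refl , refl) → h same }) , (λ { (refl , refl) → h (sym same) }) ]′ (samePair-cases x y u v p)

    cases : Mono (c u₁) (c v₁) (c u₂) (c v₂) → Σ (Setup n) λ S → Setup.edge S ≡ adj G
    -- If both exceptional edges are bichromatic, c is a proper colouring of the whole graph.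
    cases (inj₁ (h , k)) = ⊥-elim (odd (c , proper h k))
    cases (inj₂ (inj₁ (p , q , r , s))) = build ex p q r s
    cases (inj₂ (inj₂ (p , q , r , s))) = build (Exceptions-swap ex) r s p q

-- Counting the edges of the matching

∑-1 : ∀ n → ∑ {n} (λ _ → 1) ≡ n
∑-1 zero = refl
∑-1 (suc n) = trans (∑-suc {n} (λ _ → 1)) (cong suc (∑-1 n))

<ᵇ-total : ∀ i j → i ≢ j → ⟪ i <ᵇ j ⟫ + ⟪ j <ᵇ i ⟫ ≡ 1
<ᵇ-total zero zero h = ⊥-elim (h refl)
<ᵇ-total zero (suc j) h = refl
<ᵇ-total (suc i) zero h = refl
<ᵇ-total (suc i) (suc j) h = <ᵇ-total i j (h ∘ cong suc)

handshake : ∀ {n} (M : Adj n) → (∀ x y → M x y ≡ M y x) → (∀ x → M x x ≡ false) → ∑ (deg M) ≡ 2 * edgeCount M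
handshake {n} M symmetric irreflexive = begin
  ∑ (λ x → ∑ λ y → ⟪ M x y ⟫)
    ≡⟨ ∑-cong (λ x → ∑-cong (pointwise x)) ⟩
  ∑ (λ x → ∑ λ y → ⟪ M x y ∧ (x <ᵇF y) ⟫ + ⟪ M y x ∧ (y <ᵇF x) ⟫)
    ≡⟨ ∑-cong (λ x → ∑-+ (λ y → ⟪ M x y ∧ (x <ᵇF y) ⟫) (λ y → ⟪ M y x ∧ (y <ᵇF x) ⟫)) ⟩
  ∑ (λ x → ∑ (λ y → ⟪ M x y ∧ (x <ᵇF y) ⟫) + ∑ (λ y → ⟪ M y x ∧ (y <ᵇF x) ⟫))
    ≡⟨ ∑-+ (λ x → ∑ (λ y → ⟪ M x y ∧ (x <ᵇF y) ⟫)) (λ x → ∑ (λ y → ⟪ M y x ∧ (y <ᵇF x) ⟫)) ⟩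
  edgeCount M + ∑ (λ x → ∑ (λ y → ⟪ M y x ∧ (y <ᵇF x) ⟫))
    ≡⟨ cong (edgeCount M +_) (trans (∑-swap (λ x y → ⟪ M y x ∧ (y <ᵇF x) ⟫)) (sym (+-identityʳ _))) ⟩
  2 * edgeCount M ∎
  where
  open ≡-Reasoning
  pointwise : ∀ x y → ⟪ M x y ⟫ ≡ ⟪ M x y ∧ (x <ᵇF y) ⟫ + ⟪ M y x ∧ (y <ᵇF x) ⟫
  pointwise x y rewrite symmetric y x with bool (M x y)
  ... | inj₂ p rewrite p = refl
  ... | inj₁ p rewrite p = sym (<ᵇ-total (toℕ x) (toℕ y) λ e → true≢false (subst (λ z → M x z ≡ true) (sym (toℕ-injective e)) p) (irreflexive x))

module Conclusion {n} (G : SimpleGraph n) (connected : ThreeEdgeConnected (adj G)) (S : Setup n)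
  (edge≡ : Setup.edge S ≡ adj G) (sol : Solution S) where

  open Perfect S
  open Basics S
  open Solution sol

  private
    E-adj : ∀ {x y} → E x y ≡ true → adj G x y ≡ true
    E-adj {x} {y} p = subst (λ R → R x y ≡ true) edge≡ (E-edge p)

    M : Adj n
    M = symmetrise N

    M-sym : ∀ x y → M x y ≡ M y x
    M-sym x y = ∨-comm (N x y) (N y x)

    M-adj : ∀ x y → M x y ≡ true → adj G x y ≡ true
    M-adj x y p = [ (λ q → E-adj (Matching.edge matching x y q))
                  , (λ q → trans (SimpleGraph.sym G x y) (E-adj (Matching.edge matching y x q))) ]′ (∨-true {N x y} p)

    disjoint : ∀ v → v ∈ A′ → v ∈ B′ → ⊥
    disjoint v p q = A-B (A′⊆A v p) (B′⊆B v q)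

    degree : ∀ v → deg M v ≡ ⟪ A′ v ⟫ + ⟪ B′ v ⟫
    degree = deg-symmetrise disjoint matching

    degree≤1 : ∀ v → deg M v ≤ 1
    degree≤1 v = subst (_≤ 1) (sym (trans (degree v) (sym (⟪⟫-∨ (A′ v) (B′ v) (disjoint v))))) (⟪⟫≤1 (A′ v ∨ B′ v))

    M-irreflexive : ∀ x → M x x ≡ false
    M-irreflexive x = ¬true λ p → true≢false (M-adj x x p) (irrfl G x)

    vertices : cnt A V + cnt B V ≡ n
    vertices = trans (sym (∑-+ (λ x → ⟪ A x ∧ true ⟫) (λ x → ⟪ B x ∧ true ⟫))) (trans (∑-cong one) (∑-1 n))
      where
      one : ∀ x → ⟪ A x ∧ true ⟫ + ⟪ B x ∧ true ⟫ ≡ 1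
      one x rewrite B≡∁A x with A x
      ... | true = refl
      ... | false = refl

    edges : cnt V A′ + cnt V B′ ≡ 2 * edgeCount M
    edges = trans (sym (∑-+ (λ x → ⟪ A′ x ⟫) (λ x → ⟪ B′ x ⟫))) (trans (∑-cong (sym ∘ degree)) (handshake M M-sym M-irreflexive))

    still-connected : ∀ u v → adj G u v ≡ true → Connected (deleteEdge (adj G) u v)
    still-connected u v e x y = Reach-mono (deleteEdge-⊆ (deleteEdge (adj G) u v)) (proj₂ connected u v u v e e x y)

    unordered : ∀ u v x y → deleteEdge (adj G) u v x y ≡ deleteEdge (adj G) v u x y
    unordered u v x y = cong (λ b → adj G x y ∧ not b) (∨-comm (⁅ u ⁆ x ∧ ⁅ v ⁆ y) (⁅ v ⁆ x ∧ ⁅ u ⁆ y))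

    covered : ∀ s t → N s t ≡ true → ∀ x y → deleteEdge (adj G) s t x y ≡ true →
              Σ (Adj n) λ M → IsPerfectMatching (deleteEdge (adj G) s t) M × M x y ≡ true
    covered s t p = subst (λ R → ∀ x y → deleteEdge R s t x y ≡ true →
      Σ (Adj n) λ M → IsPerfectMatching (deleteEdge R s t) M × M x y ≡ true) edge≡ (removable s t p)

    -- N is directed from A to B whereas M is symmetric, so for one of the two orientations the
    -- perfect matchings are those obtained for the reversed edge.
    M-removable : ∀ u v → M u v ≡ true → Removable (adj G) u v
    M-removable u v p = still-connected u v (M-adj u v p) , λ x y q → [ (λ r → covered u v r x y q) , (λ r → reverse (covered v u r x y (trans (sym (unordered u v x y)) q))) ]′ (∨-true {N u v} p)
      where
      reverse : ∀ {x y} → (Σ (Adj n) λ M → IsPerfectMatching (deleteEdge (adj G) v u) M × M x y ≡ true) →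
                Σ (Adj n) λ M → IsPerfectMatching (deleteEdge (adj G) u v) M × M x y ≡ true
      reverse (M , ((symm , sub) , d) , r) = M , ((symm , λ x y i → trans (unordered u v x y) (sub x y i)) , d) , r

  conclusion : Σ (Adj n) λ M → IsMatching (adj G) M × (n ≤ 2 * edgeCount M + 6) × (∀ u v → M u v ≡ true → Removable (adj G) u v)
  conclusion = M , ((M-sym , M-adj) , degree≤1) , subst₂ (λ k l → k ≤ l + 6) vertices edges large , M-removable

theorem1p3 : ∀ {n} (G : SimpleGraph n) →
    ThreeEdgeConnected (adj G) → NearBipartite (adj G) → Cubic (adj G) →
    ¬ Isomorphic (adj G) K4 →
    Σ (Adj n) λ M → IsMatching (adj G) M ×
    (n ≤ 2 * edgeCount M + 6) ×
    (∀ u v → M u v ≡ true → Removable (adj G) u v)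
theorem1p3 {n} G connected (_ , odd , u₁ , v₁ , u₂ , v₂ , e₁ , e₂ , distinct , (c , proper) , _) cubic _ =
  finish (Colouring.setup G connected cubic c odd ex)
  where
  ex : Colouring.Exceptions G connected cubic c u₁ v₁ u₂ v₂
  ex = record { e₁ = e₁ ; e₂ = e₂ ; distinct = distinct ; mono = mono }
    where
    mono : ∀ x y → adj G x y ≡ true → c x ≡ c y → samePair x y u₁ v₁ ≡ true ⊎ samePair x y u₂ v₂ ≡ true
    mono x y e same with bool (samePair x y u₁ v₁) | bool (samePair x y u₂ v₂)
    ... | inj₁ p | _ = inj₁ p
    ... | _ | inj₁ q = inj₂ q
    ... | inj₂ p | inj₂ q = ⊥-elim (proper x y (∧-intro (∧-intro e (not-intro p)) (not-intro q)) same)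

  finish : (Σ (Setup n) λ S → Setup.edge S ≡ adj G) →
           Σ (Adj n) λ M → IsMatching (adj G) M × (n ≤ 2 * edgeCount M + 6) × (∀ u v → M u v ≡ true → Removable (adj G) u v)
  finish (S , edge≡) = Conclusion.conclusion G connected S edge≡ (Solve.solve S)
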